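{- Let $a=(a_i)_{i\in\mathbb Z}$ be any sequence of complex numbers, $n\ge1$, and $\mu$ a Young diagram with $d=d(\mu)\le n$. Then $$s_{\mu;a}(x_1,\dots,x_n;y_1,\dots,y_n)=\frac{\sum_{w\in\mathfrak S_n\times\mathfrak S_n}\epsilon(w)\,w[g_{\mu;a}(x_1,\dots,x_n;y_1,\dots,y_n)]}{V(x_1,\dots,x_n)V(y_1,\dots,y_n)},$$ where $$g_{\mu;a}=\prod_{i=1}^d(x_i\mid a)^{\mu_i-i}x_i^{(n-\mu_i)_+}(y_i\mid\widehat a)^{\mu'_i-i}y_i^{(n-\mu'_i)_+}\cdot\prod_{i=d+1}^nx_i^{n-i}y_i^{n-i}\cdot\prod_{\substack{i,j\le n\\(i,j)\in\mu}}(x_i+y_j).$$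
   Context: $\Lambda$ is the algebra of symmetric functions over $\mathbb C$ with complete homogeneous $h_k$, elementary $e_k$, power sums $\mathbf p_k$. For a sequence $a$ define $h_{k;a}=\sum_{i=1}^k(-1)^{k-i}e_{k-i}(a_1,\dots,a_{k-1})h_i$ ($k\ge1$), $h_{0;a}=1$, $h_{k;a}=0$ ($k<0$); $(\tau^ra)_i=a_{i+r}$; $s_{\mu;a}=\det[h_{\mu_i-i+j;\,\tau^{1-j}a}]_{i,j=1}^N$ for any $N\ge\ell(\mu)$. Dual sequence: $\widehat a_i=-a_{1-i}$. Each $f\in\Lambda$ is evaluated at $(x_1,\dots,x_n;y_1,\dots,y_n)$ via $\mathbf p_k\mapsto\sum_ix_i^k+(-1)^{k-1}\sum_jy_j^k$. $d(\mu)$ is the number of diagonal boxes of $\mu$, $\mu'$ the transposed diagram, $(i,j)$ a box in row $i$, column $j$. $\mathfrak S_n\times\mathfrak S_n$ acts on polynomials in $x_1,\dots,x_n,y_1,\dots,y_n$, the first factor permuting the $x$'s and the second the $y$'s; for $w=(w_1,w_2)$, $\epsilon(w)=\operatorname{sgn}(w_1)\operatorname{sgn}(w_2)$. $V(z_1,\dots,z_m)=\prod_{1\le i<k\le m}(z_i-z_k)$. $(x\mid a)^m=(x-a_1)\cdots(x-a_m)$ for $m\ge1$ and $=1$ for $m=0$. $(k)_+=\max(k,0)$. -}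

module Defs where

open import Algebra.Bundles using (AbelianGroup; CommutativeRing)
import Algebra.Construct.DirectProduct as DirectProduct
import Algebra.Properties.CommutativeMonoid.Mult as CommutativeMonoidMult
import Algebra.Properties.CommutativeMonoid.Sum as CommutativeMonoidSum
import Algebra.Properties.Semiring.Exp as SemiringExp
import Algebra.Properties.Semiring.Mult as SemiringMult
import Algebra.Properties.Semiring.Sum as SemiringSum
open import Algebra.Structures using (IsCommutativeRing)
open import Data.Bool.Base using (if_then_else_; _∧_)
open import Data.Fin.Base as Fin using (Fin; zero; suc; toℕ)
open import Data.Fin.Permutation
  using (Permutation′; _⟨$⟩ʳ_; insert; remove; insert-remove; insert-punchIn)
  renaming (_≈_ to _≈ₚ_; id to idₚ)
import Data.Fin.Properties as Fin
open import Data.Integer.Base as ℤ using (ℤ; +_; -[1+_])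
open import Data.List.Base as List
  using (List; []; _∷_; length; filter; allFin; cartesianProductWith; upTo)
open import Data.List.Membership.Propositional.Properties using (∈-allFin)
open import Data.List.Properties using (length-tabulate; length-map; length-++)
open import Data.List.Relation.Unary.All using (All)
open import Data.List.Relation.Unary.Any using (Any; here)
import Data.List.Relation.Unary.Any.Properties as Any
open import Data.List.Relation.Unary.Linked using (Linked)
open import Data.Nat.Base as ℕ using (ℕ; zero; suc; _∸_; _≤_; _≥_)
import Data.Nat.Properties as ℕ
open import Data.Product.Base using (Σ-syntax; ∃; _×_; _,_)
open import Data.Rational.Base as ℚ using (ℚ; 0ℚ; 1ℚ; ½)
import Data.Rational.Properties as ℚ
open import Data.Sum.Base as Sum using (_⊎_; inj₁; inj₂)
open import Data.Vec.Base using (Vec; []; _∷_; head; lookup)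
open import Data.Vec.Functional as Vector using (Vector)
open import Function.Base using (_∘_)
open import Level using (_⊔_; 0ℓ)
import Relation.Binary.PropositionalEquality as ≡
open ≡ using (_≡_)
open import Relation.Binary.Structures using (IsEquivalence)
open import Relation.Nullary.Decidable using (does)

module Differences {c ℓ} (R : CommutativeRing c ℓ) where
  open CommutativeRing R
  open import Algebra.Properties.Ring ring using (-‿+-comm; -‿distribʳ-*; -‿involutive)
  open import Algebra.Properties.CommutativeSemigroup +-commutativeSemigroup using (interchange)
  open import Relation.Binary.Reasoning.Setoid setoid

  split : ∀ p q → p + (q - p) ≈ q
  split p q = begin
    p + (q - p)    ≈⟨ +-comm p (q - p) ⟩
    (q - p) + p    ≈⟨ +-assoc q (- p) p ⟩
    q + (- p + p)  ≈⟨ +-congˡ (-‿inverseˡ p) ⟩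
    q + 0#         ≈⟨ +-identityʳ q ⟩
    q              ∎

  diff-neg : ∀ a b → - (a - b) ≈ - a - - b
  diff-neg a b = sym (-‿+-comm a (- b))

  diff-swap : ∀ a b → - (a - b) ≈ b - a
  diff-swap a b = begin
    - (a - b)   ≈⟨ diff-neg a b ⟩
    - a - - b   ≈⟨ +-congˡ (-‿involutive b) ⟩
    - a + b     ≈⟨ +-comm (- a) b ⟩
    b - a       ∎

  diff-trans : ∀ a b c → (a - b) + (b - c) ≈ a - c
  diff-trans a b c = begin
    (a - b) + (b - c)      ≈⟨ +-assoc a (- b) (b - c) ⟩
    a + (- b + (b - c))    ≈⟨ +-congˡ (sym (+-assoc (- b) b (- c))) ⟩
    a + ((- b + b) - c)    ≈⟨ +-congˡ (+-congʳ (-‿inverseˡ b)) ⟩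
    a + (0# - c)           ≈⟨ +-congˡ (+-identityˡ (- c)) ⟩
    a - c                  ∎

  diff-+ : ∀ a b c d → (a - b) + (c - d) ≈ (a + c) - (b + d)
  diff-+ a b c d = trans (interchange a (- b) c (- d)) (+-congˡ (-‿+-comm b d))

  *-diff : ∀ a b c → a * (b - c) ≈ a * b - a * c
  *-diff a b c = trans (distribˡ a b (- c)) (+-congˡ (sym (-‿distribʳ-* a c)))

  diff-* : ∀ a b c d → a * (c - d) + d * (a - b) ≈ a * c - b * d
  diff-* a b c d = begin
    a * (c - d) + d * (a - b)            ≈⟨ +-cong (*-diff a c d) (*-diff d a b) ⟩
    (a * c - a * d) + (d * a - d * b)    ≈⟨ +-congˡ (+-cong (*-comm d a) (-‿cong (*-comm d b))) ⟩
    (a * c - a * d) + (a * d - b * d)    ≈⟨ diff-trans (a * c) (a * d) (b * d) ⟩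
    a * c - b * d                        ∎

module Reals where
  open Differences ℚ.+-*-commutativeRing

  -- Sequences (I = ℕ) and double sequences (I = ℕ × ℕ) that tend to 0.
  module Null {I : Set} (_⊑_ : ℕ → I → Set) (weaken : ∀ {M N i} → M ℕ.≤ N → N ⊑ i → M ⊑ i) where

    Eventually : (I → Set) → Set
    Eventually P = ∃ λ N → ∀ i → N ⊑ i → P i

    Null : (I → ℚ) → Set
    Null f = ∀ ε → 0ℚ ℚ.< ε → Eventually (λ i → ℚ.∣ f i ∣ ℚ.< ε)

    Bounded : (I → ℚ) → Set
    Bounded f = Σ[ B ∈ ℚ ] 0ℚ ℚ.< B × Eventually (λ i → ℚ.∣ f i ∣ ℚ.≤ B)

    both : ∀ {P Q R : I → Set} → Eventually P → Eventually Q →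
           (∀ i → P i → Q i → R i) → Eventually R
    both (M , p) (N , q) f = M ℕ.⊔ N , λ i le →
      f i (p i (weaken (ℕ.m≤m⊔n M N) le)) (q i (weaken (ℕ.m≤n⊔m M N) le))

    null-≗ : ∀ f g → (∀ i → f i ≡ g i) → Null f → Null g
    null-≗ f g f≗g nf ε ε>0 with nf ε ε>0
    ... | N , lt = N , λ i le → ≡.subst (λ q → ℚ.∣ q ∣ ℚ.< ε) (f≗g i) (lt i le)

    null-0 : Null (λ _ → 0ℚ)
    null-0 ε ε>0 = 0 , λ _ _ → ε>0

    null-neg : ∀ f → Null f → Null (λ i → ℚ.- f i)
    null-neg f nf ε ε>0 with nf ε ε>0
    ... | N , lt = N , λ i le → ≡.subst (ℚ._< ε) (≡.sym (ℚ.∣-p∣≡∣p∣ (f i))) (lt i le)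

    null-+ : ∀ f g → Null f → Null g → Null (λ i → f i ℚ.+ g i)
    null-+ f g nf ng ε ε>0 = both (nf _ half>0) (ng _ half>0) λ i p q →
        ≡.subst (ℚ.∣ f i ℚ.+ g i ∣ ℚ.<_) halves
          (ℚ.≤-<-trans (ℚ.∣p+q∣≤∣p∣+∣q∣ (f i) (g i)) (ℚ.+-mono-< p q))
      where
      half>0 : 0ℚ ℚ.< ½ ℚ.* ε
      half>0 = ℚ.*-monoʳ-<-pos ½ ε>0
      halves : ½ ℚ.* ε ℚ.+ ½ ℚ.* ε ≡ ε
      halves = ≡.trans (≡.sym (ℚ.*-distribʳ-+ ε ½ ½)) (ℚ.*-identityˡ ε)

    null-* : ∀ b f → Bounded b → Null f → Null (λ i → b i ℚ.* f i)
    null-* b f (B , B>0 , bb) nf ε ε>0 = both bb (nf δ δ>0) λ i b≤B f<δ →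
        ≡.subst₂ ℚ._<_ (≡.sym (ℚ.∣p*q∣≡∣p∣*∣q∣ (b i) (f i))) Bδ≡ε
          (ℚ.≤-<-trans
            (ℚ.*-monoʳ-≤-nonNeg ℚ.∣ f i ∣ {{ℚ.nonNegative (ℚ.0≤∣p∣ (f i))}} b≤B)
            (ℚ.*-monoʳ-<-pos B f<δ))
      where
      instance
        B-nonZero = ℚ.>-nonZero B>0
        B-pos = ℚ.positive B>0
        1/B-pos = ℚ.1/pos⇒pos B
      δ : ℚ
      δ = (ℚ.1/ B) ℚ.* ε
      δ>0 : 0ℚ ℚ.< δ
      δ>0 = ≡.subst (ℚ._< δ) (ℚ.*-zeroʳ (ℚ.1/ B)) (ℚ.*-monoʳ-<-pos (ℚ.1/ B) ε>0)
      Bδ≡ε : B ℚ.* δ ≡ ε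
      Bδ≡ε = ≡.trans (≡.sym (ℚ.*-assoc B (ℚ.1/ B) ε))
               (≡.trans (≡.cong (ℚ._* ε) (ℚ.*-inverseʳ B)) (ℚ.*-identityˡ ε))

  open Null {ℕ} ℕ._≤_ ℕ.≤-trans
  module Null² = Null {ℕ × ℕ} (λ N (m , n) → N ℕ.≤ m × N ℕ.≤ n)
    (λ le (p , q) → ℕ.≤-trans le p , ℕ.≤-trans le q)

  Cauchy : (ℕ → ℚ) → Set
  Cauchy x = ∀ ε → 0ℚ ℚ.< ε → ∃ λ N → ∀ m n → N ℕ.≤ m → N ℕ.≤ n → ℚ.∣ x m ℚ.- x n ∣ ℚ.< ε

  record ℝ : Set where
    constructor real
    field
      seq    : ℕ → ℚ
      cauchy : Cauchy seq

  open ℝ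

  infix 4 _≈ℝ_

  record _≈ℝ_ (x y : ℝ) : Set where
    constructor equal
    field
      null-difference : ∀ ε → 0ℚ ℚ.< ε →
        ∃ λ N → ∀ n → N ℕ.≤ n → ℚ.∣ seq x n ℚ.- seq y n ∣ ℚ.< ε

  private
    Δ : (ℕ → ℚ) → ℕ × ℕ → ℚ
    Δ x (m , n) = x m ℚ.- x n

    toCauchy : ∀ x → Null².Null (Δ x) → Cauchy x
    toCauchy x nx ε ε>0 with nx ε ε>0
    ... | N , lt = N , λ m n p q → lt (m , n) (p , q)

    fromCauchy : ∀ x → Cauchy x → Null².Null (Δ x)
    fromCauchy x cx ε ε>0 with cx ε ε>0
    ... | N , lt = N , λ (m , n) (p , q) → lt m n p q

    bound : ∀ x → Cauchy x → Bounded x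
    bound x cx with cx 1ℚ (ℚ.positive⁻¹ 1ℚ)
    ... | N , lt = ℚ.∣ x N ∣ ℚ.+ 1ℚ
                 , ℚ.+-mono-≤-< (ℚ.0≤∣p∣ (x N)) (ℚ.positive⁻¹ 1ℚ)
                 , N , λ n le → ℚ.≤-trans
                     (≡.subst (λ q → ℚ.∣ q ∣ ℚ.≤ ℚ.∣ x N ∣ ℚ.+ ℚ.∣ x n ℚ.- x N ∣) (split (x N) (x n))
                       (ℚ.∣p+q∣≤∣p∣+∣q∣ (x N) (x n ℚ.- x N)))
                     (ℚ.+-monoʳ-≤ ℚ.∣ x N ∣ (ℚ.<⇒≤ (lt n N le ℕ.≤-refl)))

    bound₁ : ∀ x → Cauchy x → Null².Bounded (λ (m , n) → x m)
    bound₁ x cx with bound x cx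
    ... | B , B>0 , N , le = B , B>0 , N , λ (m , n) (p , q) → le m p

    bound₂ : ∀ x → Cauchy x → Null².Bounded (λ (m , n) → x n)
    bound₂ x cx with bound x cx
    ... | B , B>0 , N , le = B , B>0 , N , λ (m , n) (p , q) → le n q

    cauchy-+ : ∀ x y → Cauchy x → Cauchy y → Cauchy (λ n → x n ℚ.+ y n)
    cauchy-+ x y cx cy = toCauchy (λ n → x n ℚ.+ y n) (Null².null-≗ (λ i → Δ x i ℚ.+ Δ y i) _
      (λ (m , n) → diff-+ (x m) (x n) (y m) (y n))
      (Null².null-+ (Δ x) (Δ y) (fromCauchy x cx) (fromCauchy y cy)))

    cauchy-neg : ∀ x → Cauchy x → Cauchy (λ n → ℚ.- x n)
    cauchy-neg x cx = toCauchy (λ n → ℚ.- x n) (Null².null-≗ (λ i → ℚ.- Δ x i) _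
      (λ (m , n) → diff-neg (x m) (x n))
      (Null².null-neg (Δ x) (fromCauchy x cx)))

    cauchy-* : ∀ x y → Cauchy x → Cauchy y → Cauchy (λ n → x n ℚ.* y n)
    cauchy-* x y cx cy = toCauchy (λ n → x n ℚ.* y n) (Null².null-≗
      (λ (m , n) → x m ℚ.* Δ y (m , n) ℚ.+ y n ℚ.* Δ x (m , n)) _
      (λ (m , n) → diff-* (x m) (x n) (y m) (y n))
      (Null².null-+ (λ (m , n) → x m ℚ.* Δ y (m , n)) (λ (m , n) → y n ℚ.* Δ x (m , n))
        (Null².null-* (λ (m , n) → x m) (Δ y) (bound₁ x cx) (fromCauchy y cy))
        (Null².null-* (λ (m , n) → y n) (Δ x) (bound₂ y cy) (fromCauchy x cx))))

    cauchy-const : ∀ q → Cauchy (λ _ → q)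
    cauchy-const q = toCauchy (λ _ → q)
      (Null².null-≗ (λ _ → 0ℚ) _ (λ _ → ≡.sym (ℚ.+-inverseʳ q)) Null².null-0)

  fromℚ : ℚ → ℝ
  fromℚ q = real (λ _ → q) (cauchy-const q)

  infixl 6 _+ℝ_
  infixl 7 _*ℝ_
  infix  8 -ℝ_

  _+ℝ_ _*ℝ_ : ℝ → ℝ → ℝ
  x +ℝ y = real (λ n → seq x n ℚ.+ seq y n) (cauchy-+ (seq x) (seq y) (cauchy x) (cauchy y))
  x *ℝ y = real (λ n → seq x n ℚ.* seq y n) (cauchy-* (seq x) (seq y) (cauchy x) (cauchy y))

  -ℝ_ : ℝ → ℝ
  -ℝ x = real (λ n → ℚ.- seq x n) (cauchy-neg (seq x) (cauchy x))

  private
    δ : ℝ → ℝ → ℕ → ℚ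
    δ x y n = seq x n ℚ.- seq y n

  pointwise : ∀ {x y} → (∀ n → seq x n ≡ seq y n) → x ≈ℝ y
  pointwise {x} {y} x≗y = equal (null-≗ (λ _ → 0ℚ) (δ x y)
    (λ n → ≡.sym (≡.trans (≡.cong (ℚ._- seq y n) (x≗y n)) (ℚ.+-inverseʳ (seq y n)))) null-0)

  private
    ≈ℝ-isEquivalence : IsEquivalence _≈ℝ_
    ≈ℝ-isEquivalence = record
      { refl  = pointwise (λ _ → ≡.refl)
      ; sym   = λ {x} {y} (equal x≈y) → equal (null-≗ (λ n → ℚ.- δ x y n) (δ y x)
          (λ n → diff-swap (seq x n) (seq y n)) (null-neg (δ x y) x≈y))
      ; trans = λ {x} {y} {z} (equal x≈y) (equal y≈z) → equal
          (null-≗ (λ n → δ x y n ℚ.+ δ y z n) (δ x z)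
            (λ n → diff-trans (seq x n) (seq y n) (seq z n)) (null-+ (δ x y) (δ y z) x≈y y≈z))
      }

    +ℝ-cong : ∀ {x y u v} → x ≈ℝ y → u ≈ℝ v → (x +ℝ u) ≈ℝ (y +ℝ v)
    +ℝ-cong {x} {y} {u} {v} (equal x≈y) (equal u≈v) = equal (null-≗
      (λ n → δ x y n ℚ.+ δ u v n) (δ (x +ℝ u) (y +ℝ v))
      (λ n → diff-+ (seq x n) (seq y n) (seq u n) (seq v n))
      (null-+ (δ x y) (δ u v) x≈y u≈v))

    -ℝ-cong : ∀ {x y} → x ≈ℝ y → (-ℝ x) ≈ℝ (-ℝ y)
    -ℝ-cong {x} {y} (equal x≈y) = equal (null-≗ (λ n → ℚ.- δ x y n) (δ (-ℝ x) (-ℝ y))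
      (λ n → diff-neg (seq x n) (seq y n)) (null-neg (δ x y) x≈y))

    *ℝ-cong : ∀ {x y u v} → x ≈ℝ y → u ≈ℝ v → (x *ℝ u) ≈ℝ (y *ℝ v)
    *ℝ-cong {x} {y} {u} {v} (equal x≈y) (equal u≈v) = equal (null-≗
      (λ n → seq x n ℚ.* δ u v n ℚ.+ seq v n ℚ.* δ x y n) (δ (x *ℝ u) (y *ℝ v))
      (λ n → diff-* (seq x n) (seq y n) (seq u n) (seq v n))
      (null-+ (λ n → seq x n ℚ.* δ u v n) (λ n → seq v n ℚ.* δ x y n)
        (null-* (seq x) (δ u v) (bound (seq x) (cauchy x)) u≈v)
        (null-* (seq v) (δ x y) (bound (seq v) (cauchy v)) x≈y)))

    ℝ-isCommutativeRing : IsCommutativeRing _≈ℝ_ _+ℝ_ _*ℝ_ -ℝ_ (fromℚ 0ℚ) (fromℚ 1ℚ)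
    ℝ-isCommutativeRing = record
      { isRing = record
        { +-isAbelianGroup = record
          { isGroup = record
            { isMonoid = record
              { isSemigroup = record
                { isMagma = record
                  { isEquivalence = ≈ℝ-isEquivalence
                  ; ∙-cong = +ℝ-cong
                  }
                ; assoc = λ x y z → pointwise (λ n → ℚ.+-assoc (seq x n) (seq y n) (seq z n))
                }
              ; identity = (λ x → pointwise (λ n → ℚ.+-identityˡ (seq x n)))
                         , (λ x → pointwise (λ n → ℚ.+-identityʳ (seq x n)))
              }
            ; inverse = (λ x → pointwise (λ n → ℚ.+-inverseˡ (seq x n)))
                      , (λ x → pointwise (λ n → ℚ.+-inverseʳ (seq x n)))
            ; ⁻¹-cong = -ℝ-cong
            }
          ; comm = λ x y → pointwise (λ n → ℚ.+-comm (seq x n) (seq y n))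
          }
        ; *-cong = *ℝ-cong
        ; *-assoc = λ x y z → pointwise (λ n → ℚ.*-assoc (seq x n) (seq y n) (seq z n))
        ; *-identity = (λ x → pointwise (λ n → ℚ.*-identityˡ (seq x n)))
                     , (λ x → pointwise (λ n → ℚ.*-identityʳ (seq x n)))
        ; distrib = (λ x y z → pointwise (λ n → ℚ.*-distribˡ-+ (seq x n) (seq y n) (seq z n)))
                  , (λ x y z → pointwise (λ n → ℚ.*-distribʳ-+ (seq x n) (seq y n) (seq z n)))
        }
      ; *-comm = λ x y → pointwise (λ n → ℚ.*-comm (seq x n) (seq y n))
      }

  ℝ-commutativeRing : CommutativeRing 0ℓ 0ℓ
  ℝ-commutativeRing = record { isCommutativeRing = ℝ-isCommutativeRing }

open Reals public using (ℝ; _≈ℝ_; fromℚ; ℝ-commutativeRing)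

-- R[i] = R[t]/(t² + 1)
module AdjoinI {c ℓ} (R : CommutativeRing c ℓ) where
  open CommutativeRing R
  open Differences R
  open import Algebra.Properties.Ring ring using (-‿distribˡ-*; -‿distribʳ-*; -‿+-comm; -0#≈0#)
  open import Algebra.Solver.CommutativeMonoid +-commutativeMonoid using (solve; _⊕_; _⊜_)
  open import Relation.Binary.Reasoning.Setoid setoid
  private
    module Pair = AbelianGroup (DirectProduct.abelianGroup +-abelianGroup +-abelianGroup)

  infixl 7 _⊛_

  _⊛_ : Carrier × Carrier → Carrier × Carrier → Carrier × Carrier
  (a , b) ⊛ (c , d) = a * c - b * d , a * d + b * c

  private
    diff-*ʳ : ∀ a b c → (a - b) * c ≈ a * c - b * c
    diff-*ʳ a b c = trans (distribʳ c a (- b)) (+-congˡ (sym (-‿distribˡ-* b c)))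

    assoc-re : ∀ a b c d e f →
      (a * c - b * d) * e - (a * d + b * c) * f ≈ a * (c * e - d * f) - b * (c * f + d * e)
    assoc-re a b c d e f = begin
      (a * c - b * d) * e - (a * d + b * c) * f
        ≈⟨ +-cong (diff-*ʳ _ _ e) (-‿cong (distribʳ f _ _)) ⟩
      (a * c * e - b * d * e) - (a * d * f + b * c * f)
        ≈⟨ +-congˡ (-‿+-comm _ _) ⟨
      (a * c * e - b * d * e) + (- (a * d * f) - b * c * f)
        ≈⟨ solve 4 (λ p q r s → (p ⊕ q) ⊕ (r ⊕ s) ⊜ (p ⊕ r) ⊕ (s ⊕ q)) refl _ _ _ _ ⟩
      (a * c * e - a * d * f) + (- (b * c * f) - b * d * e)
        ≈⟨ +-congˡ (-‿+-comm _ _) ⟩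
      (a * c * e - a * d * f) - (b * c * f + b * d * e)
        ≈⟨ +-cong (+-cong (*-assoc a c e) (-‿cong (*-assoc a d f)))
                  (-‿cong (+-cong (*-assoc b c f) (*-assoc b d e))) ⟩
      (a * (c * e) - a * (d * f)) - (b * (c * f) + b * (d * e))
        ≈⟨ +-cong (*-diff a _ _) (-‿cong (distribˡ b _ _)) ⟨
      a * (c * e - d * f) - b * (c * f + d * e) ∎

    assoc-im : ∀ a b c d e f →
      (a * c - b * d) * f + (a * d + b * c) * e ≈ a * (c * f + d * e) + b * (c * e - d * f)
    assoc-im a b c d e f = begin
      (a * c - b * d) * f + (a * d + b * c) * e
        ≈⟨ +-cong (diff-*ʳ _ _ f) (distribʳ e _ _) ⟩
      (a * c * f - b * d * f) + (a * d * e + b * c * e)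
        ≈⟨ solve 4 (λ p q r s → (p ⊕ q) ⊕ (r ⊕ s) ⊜ (p ⊕ r) ⊕ (s ⊕ q)) refl _ _ _ _ ⟩
      (a * c * f + a * d * e) + (b * c * e - b * d * f)
        ≈⟨ +-cong (+-cong (*-assoc a c f) (*-assoc a d e))
                  (+-cong (*-assoc b c e) (-‿cong (*-assoc b d f))) ⟩
      (a * (c * f) + a * (d * e)) + (b * (c * e) - b * (d * f))
        ≈⟨ +-cong (distribˡ a _ _) (*-diff b _ _) ⟨
      a * (c * f + d * e) + b * (c * e - d * f) ∎

    distrib-re : ∀ a b c d e f →
      a * (c + e) - b * (d + f) ≈ (a * c - b * d) + (a * e - b * f)
    distrib-re a b c d e f =
      trans (+-cong (distribˡ a c e) (-‿cong (distribˡ b d f))) (sym (diff-+ _ _ _ _))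

    distrib-im : ∀ a b c d e f →
      a * (d + f) + b * (c + e) ≈ (a * d + b * c) + (a * f + b * e)
    distrib-im a b c d e f = trans (+-cong (distribˡ a d f) (distribˡ b c e))
      (solve 4 (λ p q r s → (p ⊕ q) ⊕ (r ⊕ s) ⊜ (p ⊕ r) ⊕ (q ⊕ s)) refl _ _ _ _)

    identity-re : ∀ a b → 1# * a - 0# * b ≈ a
    identity-re a b = begin
      1# * a - 0# * b  ≈⟨ +-cong (*-identityˡ a) (-‿cong (zeroˡ b)) ⟩
      a - 0#           ≈⟨ +-congˡ -0#≈0# ⟩
      a + 0#           ≈⟨ +-identityʳ a ⟩
      a                ∎

    identity-im : ∀ a b → 1# * b + 0# * a ≈ b
    identity-im a b = begin
      1# * b + 0# * a  ≈⟨ +-cong (*-identityˡ b) (zeroˡ a) ⟩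
      b + 0#           ≈⟨ +-identityʳ b ⟩
      b                ∎

    ⊛-comm : ∀ z w → z ⊛ w Pair.≈ w ⊛ z
    ⊛-comm (a , b) (c , d) =
        +-cong (*-comm a c) (-‿cong (*-comm b d))
      , trans (+-comm _ _) (+-cong (*-comm b c) (*-comm a d))

    open import Algebra.Consequences.Setoid Pair.setoid
      using (comm∧idˡ⇒id; comm∧distrˡ⇒distr)

    ⊛-cong : ∀ {z z′ w w′} → z Pair.≈ z′ → w Pair.≈ w′ → z ⊛ w Pair.≈ z′ ⊛ w′
    ⊛-cong (a , b) (c , d) =
        +-cong (*-cong a c) (-‿cong (*-cong b d)) , +-cong (*-cong a d) (*-cong b c)

  commutativeRing : CommutativeRing c ℓ
  commutativeRing = record
    { _*_ = _⊛_
    ; 1#  = 1# , 0#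
    ; isCommutativeRing = record
      { isRing = record
        { +-isAbelianGroup = Pair.isAbelianGroup
        ; *-cong     = ⊛-cong
        ; *-assoc    = λ (a , b) (c , d) (e , f) → assoc-re a b c d e f , assoc-im a b c d e f
        ; *-identity = comm∧idˡ⇒id ⊛-comm (λ (a , b) → identity-re a b , identity-im a b)
        ; distrib    = comm∧distrˡ⇒distr Pair.∙-cong ⊛-comm
            (λ (a , b) (c , d) (e , f) → distrib-re a b c d e f , distrib-im a b c d e f)
        }
      ; *-comm = ⊛-comm
      }
    }

module Complex where
  open Reals using (pointwise)

  ℂ-commutativeRing : CommutativeRing 0ℓ 0ℓ
  ℂ-commutativeRing = AdjoinI.commutativeRing ℝ-commutativeRing

  ℂ : Set
  ℂ = CommutativeRing.Carrier ℂ-commutativeRing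

  private
    module ℂ-Ring = CommutativeRing ℂ-commutativeRing
    module ℚ× = SemiringMult (CommutativeRing.semiring ℚ.+-*-commutativeRing)
    module ℂ× = SemiringMult ℂ-Ring.semiring
    open ℚ× using () renaming (_×_ to _·_)

    ·1-pos : ∀ k → ℚ.Positive (suc k · 1ℚ)
    ·1-pos zero    = ℚ.positive (ℚ.positive⁻¹ 1ℚ)
    ·1-pos (suc k) = ℚ.pos+pos⇒pos 1ℚ (suc k · 1ℚ) {{·1-pos k}}

  ℚ⇒ℂ : ℚ → ℂ
  ℚ⇒ℂ q = fromℚ q , fromℚ 0ℚ

  1/1+ℚ : ℕ → ℚ
  1/1+ℚ k = (ℚ.1/ (suc k · 1ℚ)) {{ℚ.pos⇒nonZero (suc k · 1ℚ) {{·1-pos k}}}}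

  1/1+_ : ℕ → ℂ
  1/1+ k = ℚ⇒ℂ (1/1+ℚ k)

  private
    ·-inverse : ∀ k → suc k · 1/1+ℚ k ≡ 1ℚ
    ·-inverse k = begin
      suc k · q                 ≡⟨ ≡.cong (suc k ·_) (ℚ.*-identityˡ q) ⟨
      suc k · (1ℚ ℚ.* q)        ≡⟨ ℚ×.×-assoc-* (suc k) 1ℚ q ⟨
      (suc k · 1ℚ) ℚ.* q        ≡⟨ ℚ.*-inverseʳ (suc k · 1ℚ) {{ℚ.pos⇒nonZero (suc k · 1ℚ) {{·1-pos k}}}} ⟩
      1ℚ                        ∎
      where
      open ≡.≡-Reasoning
      q : ℚ
      q = 1/1+ℚ k

    ·-ℚ⇒ℂ : ∀ n q → n ℂ×.× ℚ⇒ℂ q ℂ-Ring.≈ ℚ⇒ℂ (n · q)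
    ·-ℚ⇒ℂ zero    q = ℂ-Ring.refl
    ·-ℚ⇒ℂ (suc n) q = ℂ-Ring.trans (ℂ-Ring.+-congˡ {ℚ⇒ℂ q} (·-ℚ⇒ℂ n q))
      (pointwise (λ _ → ≡.refl) , pointwise (λ _ → ≡.refl))

  1/1+-inverse : ∀ k → suc k ℂ×.× (1/1+ k) ℂ-Ring.≈ ℂ-Ring.1#
  1/1+-inverse k = ℂ-Ring.trans (·-ℚ⇒ℂ (suc k) (1/1+ℚ k))
    (ℂ-Ring.reflexive (≡.cong ℚ⇒ℂ (·-inverse k)))

open Complex public

𝔖 : ∀ n → List (Permutation′ n)
𝔖 zero    = idₚ ∷ []
𝔖 (suc n) = cartesianProductWith (insert zero) (allFin (suc n)) (𝔖 n)

-- 𝔖 n lists each permutation exactly once: it has n ! entries and misses none.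
length-𝔖 : ∀ n → length (𝔖 n) ≡ n ℕ.!
length-𝔖 zero    = ≡.refl
length-𝔖 (suc n) = ≡.trans (length-product (allFin (suc n)))
    (≡.cong₂ ℕ._*_ (length-tabulate {n = suc n} (λ j → j)) (length-𝔖 n))
  where
  length-product : ∀ js → length (cartesianProductWith (insert zero) js (𝔖 n)) ≡ length js ℕ.* length (𝔖 n)
  length-product []       = ≡.refl
  length-product (j ∷ js) = ≡.trans (length-++ (List.map (insert zero j) (𝔖 n)))
    (≡.cong₂ ℕ._+_ (length-map (insert zero j) (𝔖 n)) (length-product js))

𝔖-complete : ∀ {n} (π : Permutation′ n) → Any (π ≈ₚ_) (𝔖 n)
𝔖-complete {zero}  π = here λ ()
𝔖-complete {suc n} π = Any.cartesianProductWith⁺ _ step (∈-allFin (π ⟨$⟩ʳ zero)) (𝔖-complete (remove zero π))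
  where
  step : ∀ {j ρ} → π ⟨$⟩ʳ zero ≡ j → remove zero π ≈ₚ ρ → π ≈ₚ insert zero j ρ
  step {_} {ρ} ≡.refl eq k = ≡.trans (≡.sym (insert-remove zero π k)) (agree k)
    where
    agree : ∀ k → insert zero (π ⟨$⟩ʳ zero) (remove zero π) ⟨$⟩ʳ k ≡ insert zero (π ⟨$⟩ʳ zero) ρ ⟨$⟩ʳ k
    agree zero    = ≡.refl
    agree (suc k) = ≡.trans (insert-punchIn zero (π ⟨$⟩ʳ zero) (remove zero π) k)
      (≡.trans (≡.cong (Fin.punchIn (π ⟨$⟩ʳ zero)) (eq k)) (≡.sym (insert-punchIn zero (π ⟨$⟩ʳ zero) ρ k)))

module RingOperations {c r} (R : CommutativeRing c r) where
  open CommutativeRing R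
  open SemiringExp semiring public using (_^_)
  open SemiringSum semiring public using (sum; sum-syntax)
  open CommutativeMonoidSum *-commutativeMonoid public using () renaming (sum to product)

  infixl 10 product-syntax

  product-syntax : ∀ n → Vector Carrier n → Carrier
  product-syntax _ = product

  syntax product-syntax n (λ i → x) = ∏[ i < n ] x

  ∑-list : ∀ {A : Set} → List A → (A → Carrier) → Carrier
  ∑-list as f = List.foldr (λ a s → f a + s) 0# as

  sgn : ∀ {n} → Permutation′ n → Carrier
  sgn {n} π = ∏[ i < n ] ∏[ j < n ]
    (if does (i Fin.<? j) ∧ does ((π ⟨$⟩ʳ j) Fin.<? (π ⟨$⟩ʳ i)) then - 1# else 1#)

  det : ∀ {n} → (Fin n → Fin n → Carrier) → Carrier
  det {n} A = ∑-list (𝔖 n) λ π → sgn π * (∏[ i < n ] A i (π ⟨$⟩ʳ i))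

  V : ∀ {n} → Vector Carrier n → Carrier
  V {n} z = ∏[ i < n ] ∏[ k < n ] (if does (i Fin.<? k) then z i - z k else 1#)

  e : ∀ {n} → ℕ → Vector Carrier n → Carrier
  e         zero    z = 1#
  e {zero}  (suc k) z = 0#
  e {suc n} (suc k) z = e (suc k) (Vector.tail z) + Vector.head z * e k (Vector.tail z)

  -- The second summand keeps the head variable available, so exponents are unbounded.
  h : ∀ {n} → ℕ → Vector Carrier n → Carrier
  h         zero    z = 1#
  h {zero}  (suc k) z = 0#
  h {suc n} (suc k) z = h (suc k) (Vector.tail z) + Vector.head z * h k z

  p : ∀ {n} → ℕ → Vector Carrier n → Carrier
  p {n} k z = ∑[ i < n ] (z i ^ k)

-- The polynomial ring K[W], as the free commutative K-algebra on the set W.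
module Polynomials {c r} (K : CommutativeRing c r) where
  private module K = CommutativeRing K

  infixl 6 _+_
  infixl 7 _*_
  infix  8 -_
  infix  4 _≈_

  data Poly (W : Set) : Set c where
    con     : K.Carrier → Poly W
    var     : W → Poly W
    _+_ _*_ : Poly W → Poly W → Poly W
    -_      : Poly W → Poly W

  data _≈_ {W : Set} : Poly W → Poly W → Set (c ⊔ r) where
    refl  : ∀ {f} → f ≈ f
    sym   : ∀ {f g} → f ≈ g → g ≈ f
    trans : ∀ {f g h} → f ≈ g → g ≈ h → f ≈ h

    +-cong : ∀ {f f′ g g′} → f ≈ f′ → g ≈ g′ → f + g ≈ f′ + g′
    *-cong : ∀ {f f′ g g′} → f ≈ f′ → g ≈ g′ → f * g ≈ f′ * g′
    neg-cong : ∀ {f f′} → f ≈ f′ → - f ≈ - f′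

    +-assoc     : ∀ f g h → (f + g) + h ≈ f + (g + h)
    +-comm      : ∀ f g → f + g ≈ g + f
    +-identityˡ : ∀ f → con K.0# + f ≈ f
    +-inverseˡ  : ∀ f → (- f) + f ≈ con K.0#
    *-assoc     : ∀ f g h → (f * g) * h ≈ f * (g * h)
    *-comm      : ∀ f g → f * g ≈ g * f
    *-identityˡ : ∀ f → con K.1# * f ≈ f
    distribˡ    : ∀ f g h → f * (g + h) ≈ (f * g) + (f * h)

    con-cong : ∀ {a b} → a K.≈ b → con a ≈ con b
    con-+    : ∀ a b → con (a K.+ b) ≈ con a + con b
    con-*    : ∀ a b → con (a K.* b) ≈ con a * con b

  polynomialRing : Set → CommutativeRing c (c ⊔ r)
  polynomialRing W = record
    { Carrier = Poly W
    ; _≈_ = _≈_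
    ; _+_ = _+_
    ; _*_ = _*_
    ; -_  = -_
    ; 0#  = con K.0#
    ; 1#  = con K.1#
    ; isCommutativeRing = record
      { isRing = record
        { +-isAbelianGroup = record
          { isGroup = record
            { isMonoid = record
              { isSemigroup = record
                { isMagma = record
                  { isEquivalence = record { refl = refl ; sym = sym ; trans = trans }
                  ; ∙-cong = +-cong
                  }
                ; assoc = +-assoc
                }
              ; identity = +-identityˡ , λ f → trans (+-comm _ _) (+-identityˡ f)
              }
            ; inverse = +-inverseˡ , λ f → trans (+-comm _ _) (+-inverseˡ f)
            ; ⁻¹-cong = neg-cong
            }
          ; comm = +-comm
          }
        ; *-cong = *-cong
        ; *-assoc = *-assoc
        ; *-identity = *-identityˡ , λ f → trans (*-comm _ _) (*-identityˡ f)
        ; distrib = distribˡ , λ f g h → trans (*-comm _ _)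
            (trans (distribˡ f g h) (+-cong (*-comm _ _) (*-comm _ _)))
        }
      ; *-comm = *-comm
      }
    }

  -- The K-algebra homomorphism K[U] → K[W] with var u ↦ σ u.
  substitute : ∀ {U W} → (U → Poly W) → Poly U → Poly W
  substitute σ (con a) = con a
  substitute σ (var u) = σ u
  substitute σ (f + g) = substitute σ f + substitute σ g
  substitute σ (f * g) = substitute σ f * substitute σ g
  substitute σ (- f)   = - substitute σ f

  substitute-cong : ∀ {U W} (σ : U → Poly W) {f g} → f ≈ g → substitute σ f ≈ substitute σ g
  substitute-cong σ refl              = refl
  substitute-cong σ (sym eq)          = sym (substitute-cong σ eq)
  substitute-cong σ (trans eq₁ eq₂)   = trans (substitute-cong σ eq₁) (substitute-cong σ eq₂)
  substitute-cong σ (+-cong eq₁ eq₂)  = +-cong (substitute-cong σ eq₁) (substitute-cong σ eq₂)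
  substitute-cong σ (*-cong eq₁ eq₂)  = *-cong (substitute-cong σ eq₁) (substitute-cong σ eq₂)
  substitute-cong σ (neg-cong eq)     = neg-cong (substitute-cong σ eq)
  substitute-cong σ (+-assoc _ _ _)   = +-assoc _ _ _
  substitute-cong σ (+-comm _ _)      = +-comm _ _
  substitute-cong σ (+-identityˡ _)   = +-identityˡ _
  substitute-cong σ (+-inverseˡ _)    = +-inverseˡ _
  substitute-cong σ (*-assoc _ _ _)   = *-assoc _ _ _
  substitute-cong σ (*-comm _ _)      = *-comm _ _
  substitute-cong σ (*-identityˡ _)   = *-identityˡ _
  substitute-cong σ (distribˡ _ _ _)  = distribˡ _ _ _
  substitute-cong σ (con-cong eq)     = con-cong eq
  substitute-cong σ (con-+ a b)       = con-+ a b
  substitute-cong σ (con-* a b)       = con-* a b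

-- nth entry, counting from 0 and padding with zeros
entry : List ℕ → ℕ → ℕ
entry []       _       = 0
entry (m ∷ ms) zero    = m
entry (m ∷ ms) (suc i) = entry ms i

record YoungDiagram : Set where
  field
    rows       : List ℕ
    decreasing : Linked _≥_ rows
    positive   : All (1 ≤_) rows

  ℓ : ℕ
  ℓ = length rows

  -- row i = μ_i and col j = μ′_j; rows and columns are numbered from 1.
  row : ℕ → ℕ
  row zero    = 0
  row (suc i) = entry rows i

  col : ℕ → ℕ
  col j = length (filter (j ℕ.≤?_) rows)

  d : ℕ
  d = length (filter (λ i → i ℕ.≤? row i) (List.map suc (upTo ℓ)))

open YoungDiagram using (ℓ; row; col; d) public

-- Symmetric functions over a commutative ℚ-algebra K; 1/1+ k is the inverse of k + 1.
module SymmetricFunctions {c r} (K : CommutativeRing c r)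
  (1/1+_ : ℕ → CommutativeRing.Carrier K)
  (1/1+-inverse : ∀ k → CommutativeRing._≈_ K
    (SemiringMult._×_ (CommutativeRing.semiring K) (suc k) (1/1+ k)) (CommutativeRing.1# K)) where
  private
    module K where
      open CommutativeRing K public
      open RingOperations K public

  open Polynomials K public

  private
    module Ops {W : Set} = RingOperations (polynomialRing W)
  open Ops public

  τ : ℤ → (ℤ → K.Carrier) → ℤ → K.Carrier
  τ r a i = a (i ℤ.+ r)

  dual : (ℤ → K.Carrier) → ℤ → K.Carrier
  dual a i = K.- a (+ 1 ℤ.- i)

  -- Λ = K[𝐩₁, 𝐩₂, …]; the variable k stands for 𝐩ₖ₊₁.
  Λ : Set c
  Λ = Poly ℕ

  -- 𝐡s k = 𝐡ₖ ∷ … ∷ 𝐡₀, from Newton's identity (k+1) 𝐡ₖ₊₁ = Σ_{i=0}^k 𝐩ᵢ₊₁ 𝐡ₖ₋ᵢ.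
  𝐡s : ∀ k → Vec Λ (suc k)
  𝐡s zero    = con K.1# ∷ []
  𝐡s (suc k) = con (1/1+ k) * (∑[ i < suc k ] (var (toℕ i) * lookup (𝐡s k) i)) ∷ 𝐡s k

  𝐡 : ℕ → Λ
  𝐡 k = head (𝐡s k)

  h⟨_,_⟩ : ℤ → (ℤ → K.Carrier) → Λ
  h⟨ + zero   , a ⟩ = con K.1#
  h⟨ + suc k  , a ⟩ = ∑[ i < suc k ]
    (con (((K.- K.1#) K.^ (k ∸ toℕ i)) K.* K.e (k ∸ toℕ i) (λ (j : Fin k) → a (+ suc (toℕ j)))) * 𝐡 (suc (toℕ i)))
  h⟨ -[1+ k ] , a ⟩ = con K.0#

  s : ℕ → YoungDiagram → (ℤ → K.Carrier) → Λ
  s N μ a = det {n = N} λ i j →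
    let i′ = suc (toℕ i) ; j′ = suc (toℕ j) in
    h⟨ + row μ i′ ℤ.- + i′ ℤ.+ + j′ , τ (+ 1 ℤ.- + j′) a ⟩

  K[x,y] : ℕ → Set c
  K[x,y] n = Poly (Fin n ⊎ Fin n)

  x y : ∀ {n} → Vector (K[x,y] n) n
  x i = var (inj₁ i)
  y i = var (inj₂ i)

  evaluate : ∀ n → Λ → K[x,y] n
  evaluate n = substitute λ k → p (suc k) (x {n}) + (- con K.1#) ^ k * p (suc k) (y {n})

  _∙_ : ∀ {n} → Permutation′ n × Permutation′ n → K[x,y] n → K[x,y] n
  (w₁ , w₂) ∙ f = substitute (var ∘ Sum.map (w₁ ⟨$⟩ʳ_) (w₂ ⟨$⟩ʳ_)) f

  ε : ∀ {n} → Permutation′ n × Permutation′ n → K[x,y] n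
  ε (w₁ , w₂) = sgn w₁ * sgn w₂

  -- f ∣ a ^∣ m = (f ∣ a)ᵐ = (f - a₁) ⋯ (f - aₘ)
  _∣_^∣_ : ∀ {W} → Poly W → (ℤ → K.Carrier) → ℕ → Poly W
  f ∣ a ^∣ m = ∏[ j < m ] (f + (- con (a (+ suc (toℕ j)))))

  g : ∀ n → YoungDiagram → (ℤ → K.Carrier) → K[x,y] n
  g n μ a =
      (∏[ k < n ] (let i = suc (toℕ k) in
        if does (i ℕ.≤? d μ)
        then (x k ∣ a ^∣ (row μ i ∸ i)) * x k ^ (n ∸ row μ i)
           * ((y k ∣ dual a ^∣ (col μ i ∸ i)) * y k ^ (n ∸ col μ i))
        else x k ^ (n ∸ i) * y k ^ (n ∸ i)))
    * (∏[ k < n ] ∏[ l < n ]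
        (if does (suc (toℕ l) ℕ.≤? row μ (suc (toℕ k))) then x k + y l else con K.1#))

  -- Newton's recursion does define the complete homogeneous functions: 𝐡ₖ becomes
  -- the k-th complete homogeneous polynomial in z under 𝐩ₖ ↦ Σᵢ zᵢᵏ.
  module _ {W : Set} where
    private
      R = polynomialRing W
      module R = CommutativeRing R
      module Σ = SemiringSum R.semiring
      module Mult = SemiringMult R.semiring
      open Mult using () renaming (_×_ to _·_)
      module KMult = SemiringMult K.semiring

      conv : (ℕ → Poly W) → (ℕ → Poly W) → ℕ → Poly W
      conv f g k = ∑[ i < suc k ] (f (toℕ i) * g (k ∸ toℕ i))

      shift : (ℕ → Poly W) → ℕ → Poly W
      shift g zero    = R.0#
      shift g (suc k) = g k

      open import Relation.Binary.Reasoning.Setoid R.setoid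

      conv-cong : ∀ {f f′ g g′} k → (∀ i → f i ≈ f′ i) → (∀ i → g i ≈ g′ i) → conv f g k ≈ conv f′ g′ k
      conv-cong k f≈ g≈ = Σ.sum-cong-≋ {suc k} (λ i → *-cong (f≈ (toℕ i)) (g≈ (k ∸ toℕ i)))

      conv-+ˡ : ∀ f f′ g k → conv (λ i → f i + f′ i) g k ≈ conv f g k + conv f′ g k
      conv-+ˡ f f′ g k = trans
        (Σ.sum-cong-≋ {suc k} (λ i → R.distribʳ (g (k ∸ toℕ i)) (f (toℕ i)) (f′ (toℕ i))))
        (Σ.∑-distrib-+ {suc k} (λ i → f (toℕ i) * g (k ∸ toℕ i)) (λ i → f′ (toℕ i) * g (k ∸ toℕ i)))

      conv-+ʳ : ∀ f g g′ k → conv f (λ i → g i + g′ i) k ≈ conv f g k + conv f g′ k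
      conv-+ʳ f g g′ k = trans
        (Σ.sum-cong-≋ {suc k} (λ i → distribˡ (f (toℕ i)) (g (k ∸ toℕ i)) (g′ (k ∸ toℕ i))))
        (Σ.∑-distrib-+ {suc k} (λ i → f (toℕ i) * g (k ∸ toℕ i)) (λ i → f (toℕ i) * g′ (k ∸ toℕ i)))

      conv-*ˡ : ∀ t f g k → conv (λ i → t * f i) g k ≈ t * conv f g k
      conv-*ˡ t f g k = trans
        (Σ.sum-cong-≋ {suc k} (λ i → *-assoc t (f (toℕ i)) (g (k ∸ toℕ i))))
        (sym (Σ.*-distribˡ-sum {suc k} t (λ i → f (toℕ i) * g (k ∸ toℕ i))))

      conv-*ʳ : ∀ t f g k → conv f (λ i → t * g i) k ≈ t * conv f g k
      conv-*ʳ t f g k = trans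
        (Σ.sum-cong-≋ {suc k} (λ i → swap (f (toℕ i)) (g (k ∸ toℕ i))))
        (sym (Σ.*-distribˡ-sum {suc k} t (λ i → f (toℕ i) * g (k ∸ toℕ i))))
        where
        swap : ∀ u v → u * (t * v) ≈ t * (u * v)
        swap u v = trans (sym (*-assoc u t v)) (trans (R.*-congʳ (*-comm u t)) (*-assoc t u v))

      conv-shift-zero : ∀ f g → conv f (shift g) 0 ≈ R.0#
      conv-shift-zero f g = trans (R.+-identityʳ _) (R.zeroʳ (f 0))

      conv-shift-suc : ∀ f g k → conv f (shift g) (suc k) ≈ conv f g k
      conv-shift-suc f g zero    = R.+-congˡ (conv-shift-zero (f ∘ suc) g)
      conv-shift-suc f g (suc k) = R.+-congˡ (conv-shift-suc (f ∘ suc) g k)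

      P : ∀ {n} → Vector (Poly W) n → ℕ → Poly W
      P z i = p (suc i) z

      H : ∀ {n} → Vector (Poly W) n → ℕ → Poly W
      H z k = h k z

      conv-P : ∀ {n} (z : Vector (Poly W) (suc n)) k →
        conv (P z) (H z) k ≈ conv (λ i → z zero ^ suc i) (H z) k + conv (P (Vector.tail z)) (H z) k
      conv-P z k = conv-+ˡ (λ i → z zero ^ suc i) (P (Vector.tail z)) (H z) k

      H-suc : ∀ {n} (z : Vector (Poly W) (suc n)) k →
        H z k ≈ H (Vector.tail z) k + z zero * shift (H z) k
      H-suc z zero    = sym (trans (R.+-congˡ (R.zeroʳ (z zero))) (R.+-identityʳ _))
      H-suc z (suc k) = refl

      conv-tail : ∀ {n} (z : Vector (Poly W) (suc n)) k →
        conv (P (Vector.tail z)) (H z) k ≈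
        conv (P (Vector.tail z)) (H (Vector.tail z)) k + z zero * conv (P (Vector.tail z)) (shift (H z)) k
      conv-tail z k = begin
        conv q (H z) k
          ≈⟨ conv-cong {q} {q} k (λ _ → refl) (H-suc z) ⟩
        conv q (λ i → H (Vector.tail z) i + z zero * shift (H z) i) k
          ≈⟨ conv-+ʳ q (H (Vector.tail z)) (λ i → z zero * shift (H z) i) k ⟩
        conv q (H (Vector.tail z)) k + conv q (λ i → z zero * shift (H z) i) k
          ≈⟨ R.+-congˡ (conv-*ʳ (z zero) q (shift (H z)) k) ⟩
        conv q (H (Vector.tail z)) k + z zero * conv q (shift (H z)) k ∎
        where
        q : ℕ → Poly W
        q = P (Vector.tail z)

      combine : ∀ u v w a → (u + v) + (w + a) ≈ w + (u + (v + a))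
      combine u v w a = solve 4 (λ u v w a → (u ⊕ v) ⊕ (w ⊕ a) ⊜ w ⊕ (u ⊕ (v ⊕ a))) refl u v w a
        where open import Algebra.Solver.CommutativeMonoid R.+-commutativeMonoid

      newton : ∀ {n} (z : Vector (Poly W) n) k → suc k · H z (suc k) ≈ conv (P z) (H z) k
      newton {zero} z k = trans (Mult.×-congʳ (suc k) refl) (trans (zeros (suc k)) (sym (trans
          (Σ.sum-cong-≋ {suc k} (λ i → R.zeroˡ (H z (k ∸ toℕ i)))) (Σ.sum-replicate-zero (suc k)))))
        where
        zeros : ∀ m → m · R.0# ≈ R.0#
        zeros zero    = refl
        zeros (suc m) = trans (R.+-identityˡ _) (zeros m)
      newton {suc n} z zero = begin
        1 · (H t 1 + z₀ * R.1#)                              ≈⟨ R.+-identityʳ _ ⟩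
        H t 1 + z₀ * R.1#                                    ≈⟨ R.+-cong (sym (R.+-identityʳ (H t 1))) (R.*-congʳ (sym (R.*-identityʳ z₀))) ⟩
        1 · H t 1 + (z₀ ^ 1) * R.1#                          ≈⟨ R.+-cong (newton t zero) (sym (R.+-identityʳ _)) ⟩
        conv (P t) (H t) 0 + conv (λ i → z₀ ^ suc i) (H z) 0 ≈⟨ +-comm _ _ ⟩
        conv (λ i → z₀ ^ suc i) (H z) 0 + conv (P t) (H z) 0 ≈⟨ conv-P z 0 ⟨
        conv (P z) (H z) 0                                   ∎
        where
        t = Vector.tail z
        z₀ = z zero
      newton {suc n} z (suc k) = begin
        suc (suc k) · (H t (2 ℕ.+ k) + z₀ * H z (suc k))
          ≈⟨ Mult′.×-distrib-+ _ _ (suc (suc k)) ⟩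
        suc (suc k) · H t (2 ℕ.+ k) + suc (suc k) · (z₀ * H z (suc k))
          ≈⟨ R.+-cong (newton t (suc k)) (R.+-congˡ {z₀ * H z (suc k)} (sym (*-× (suc k)))) ⟩
        C + (z₀ * H z (suc k) + z₀ * (suc k · H z (suc k)))
          ≈⟨ R.+-congˡ (R.+-congˡ {z₀ * H z (suc k)} (R.*-congˡ {z₀} (trans (newton z k) (conv-P z k)))) ⟩
        C + (z₀ * H z (suc k) + z₀ * (A + B))
          ≈⟨ R.+-congˡ {C} (R.+-congˡ {z₀ * H z (suc k)} (distribˡ z₀ A B)) ⟩
        C + (z₀ * H z (suc k) + (z₀ * A + z₀ * B))
          ≈⟨ combine (z₀ * H z (suc k)) (z₀ * A) C (z₀ * B) ⟨
        (z₀ * H z (suc k) + z₀ * A) + (C + z₀ * B)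
          ≈⟨ R.+-cong (R.+-cong (R.*-congʳ (R.*-identityʳ z₀)) (conv-*ˡ z₀ (λ i → z₀ ^ suc i) (H z) k))
                      (R.+-congˡ {C} (R.*-congˡ {z₀} (conv-shift-suc (P t) (H z) k))) ⟨
        conv (λ i → z₀ ^ suc i) (H z) (suc k) + (C + z₀ * conv (P t) (shift (H z)) (suc k))
          ≈⟨ R.+-congˡ (conv-tail z (suc k)) ⟨
        conv (λ i → z₀ ^ suc i) (H z) (suc k) + conv (P t) (H z) (suc k)
          ≈⟨ conv-P z (suc k) ⟨
        conv (P z) (H z) (suc k) ∎
        where
        t = Vector.tail z
        z₀ = z zero
        A = conv (λ i → z₀ ^ suc i) (H z) k
        B = conv (P t) (H z) k
        C = conv (P t) (H t) (suc k)
        module Mult′ = CommutativeMonoidMult R.+-commutativeMonoid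
        *-× : ∀ m → z₀ * (m · H z (suc k)) ≈ m · (z₀ * H z (suc k))
        *-× m = Mult.×-comm-* m z₀ (H z (suc k))

      divide : ∀ k u → con (1/1+ k) * (suc k · u) ≈ u
      divide k u = begin
        con (1/1+ k) * (suc k · u)        ≈⟨ Mult.×-comm-* (suc k) (con (1/1+ k)) u ⟩
        suc k · (con (1/1+ k) * u)        ≈⟨ Mult.×-assoc-* (suc k) (con (1/1+ k)) u ⟨
        (suc k · con (1/1+ k)) * u        ≈⟨ R.*-congʳ (con-· (suc k) (1/1+ k)) ⟩
        con (suc k KMult.× (1/1+ k)) * u  ≈⟨ R.*-congʳ (con-cong (1/1+-inverse k)) ⟩
        R.1# * u                          ≈⟨ *-identityˡ u ⟩
        u                                 ∎
        where
        con-· : ∀ m a → m · con a ≈ con (m KMult.× a)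
        con-· zero    a = refl
        con-· (suc m) a = trans (R.+-congˡ (con-· m a)) (sym (con-+ a (m KMult.× a)))

    specialize : ∀ {n} → Vector (Poly W) n → Λ → Poly W
    specialize z = substitute λ k → p (suc k) z

    private
      specialize-sum : ∀ {n m} (z : Vector (Poly W) n) (f : Vector Λ m) →
        specialize z (∑[ i < m ] f i) ≡ ∑[ i < m ] specialize z (f i)
      specialize-sum {m = zero}  z f = ≡.refl
      specialize-sum {m = suc m} z f = ≡.cong (λ u → specialize z (f zero) + u) (specialize-sum z (f ∘ suc))

      specialize-𝐡s : ∀ {n} (z : Vector (Poly W) n) k (i : Fin (suc k)) →
        specialize z (lookup (𝐡s k) i) ≈ h (k ∸ toℕ i) z
      specialize-𝐡s z zero    zero    = refl
      specialize-𝐡s z (suc k) (suc i) = specialize-𝐡s z k i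
      specialize-𝐡s z (suc k) zero    = begin
        con (1/1+ k) * specialize z (∑[ i < suc k ] (var (toℕ i) * lookup (𝐡s k) i))
          ≡⟨ ≡.cong (con (1/1+ k) *_) (specialize-sum z (λ i → var (toℕ i) * lookup (𝐡s k) i)) ⟩
        con (1/1+ k) * (∑[ i < suc k ] (P z (toℕ i) * specialize z (lookup (𝐡s k) i)))
          ≈⟨ R.*-congˡ (Σ.sum-cong-≋ {suc k} (λ i → R.*-congˡ {P z (toℕ i)} (specialize-𝐡s z k i))) ⟩
        con (1/1+ k) * conv (P z) (H z) k
          ≈⟨ R.*-congˡ (newton z k) ⟨
        con (1/1+ k) * (suc k · H z (suc k))
          ≈⟨ divide k (H z (suc k)) ⟩
        H z (suc k) ∎

    specialize-𝐡 : ∀ {n} (z : Vector (Poly W) n) k → specialize z (𝐡 k) ≈ h k z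
    specialize-𝐡 z zero    = refl
    specialize-𝐡 z (suc k) = specialize-𝐡s z (suc k) zero

{-# OPTIONS --safe #-}
module Submission where

-- Let F = Π (u + yⱼ) / Π (u - xᵢ), expanded at u = ∞. The entries of the Jacobi–Trudi matrix
-- are residues of F (u | a)^(μᵢ - i) times polynomials in u, where (u | a)^(-r) denotes
-- 1 / ((u - a₀) ⋯ (u - a₁₋ᵣ)). Adjoining, for every leg μ′ⱼ - j of μ, the missing row of
-- negative degree and a polynomial column dual to it turns the determinant into the Gram
-- determinant, under the residue pairing, of the rows (u | a)^(μᵢ - i), i ≤ d, and
-- (u | a)^(-r), r ≥ 1, with the columns given by the legs and F, F u, F u², ….
--
-- If μ₁ ≥ n, then the first row is a sum of evaluations at the poles xₖ, and evaluation at xₖ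
-- leaves the determinant without that row and for F (u - xₖ): the factor of x₁ in g appears.
-- The first column is treated likewise if μ′₁ ≥ n. If neither holds, the determinant for
-- F u / (u + t) is a polynomial in t of degree less than the number of y's, and its Lagrange
-- interpolation at 0 through the yₖ removes the last y, with weight the product of the others;
-- dually for x. Multiplied by the Vandermonde products, every step is free of divisions, and
-- together the steps build up the alternating sum of g.

open import Algebra.Bundles using (CommutativeRing; RawRing)
import Algebra.Consequences.Setoid as Consequences
import Algebra.Properties.CommutativeMonoid.Mult as CommutativeMonoidMult
import Algebra.Properties.CommutativeMonoid.Sum as CommutativeMonoidSum
import Algebra.Properties.Ring as RingProperties
import Algebra.Properties.Semiring.Mult as SemiringMult
import Algebra.Properties.Semiring.Mult.TCOptimised as SemiringMultTC
import Algebra.Solver.Ring as RingSolver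
import Algebra.Solver.Ring.AlmostCommutativeRing as ACR
open import Data.Bool.Base using (Bool; _∧_; false; if_then_else_; true)
open import Data.Fin.Base as Fin using (Fin; punchIn; suc; toℕ; zero)
open import Data.Fin.Permutation using (Permutation′; _⟨$⟩ʳ_; insert; insert-punchIn)
import Data.Fin.Properties as Fin
open import Data.Integer.Base as ℤ using (+_; _⊖_; ℤ)
import Data.Integer.Properties as ℤ
import Data.Integer.Tactic.RingSolver as ℤSolver
open import Data.List.Base as List
  using (List; []; _∷_; allFin; applyUpTo; cartesianProduct; cartesianProductWith; filter; length)
import Data.List.Properties as List
open import Data.List.Relation.Unary.Linked using (Linked; [-]; []; _∷_)
open import Data.Maybe.Base using (Maybe; just; nothing)
open import Data.Nat.Base as ℕ using (_∸_; _≤_; suc; s≤s; zero; z≤n; ℕ)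
import Data.Nat.Properties as ℕ
open import Data.Nat.Tactic.RingSolver using (solve-∀)
open import Data.Product.Base using (_,_; _×_; proj₁; proj₂; Σ-syntax)
open import Data.Sum.Base as Sum using (_⊎_; inj₁; inj₂)
open import Data.Vec.Base using (lookup)
open import Function.Base using (_∘_)
open import Level using (0ℓ)
open import Relation.Binary.Bundles using (Setoid)
open import Relation.Binary.Definitions using (tri<; tri>; tri≈)
open import Relation.Binary.PropositionalEquality as ≡ using (_≡_; _≢_)
open import Relation.Nullary.Decidable using (dec-false; dec-true; does; no; yes)
open import Relation.Nullary.Negation using (contradiction)
open import Relation.Unary using (Decidable; Pred)
open import Defs

-- For i > d the degrees μᵢ - i are the negative integers other than -1 - (μ′ⱼ - j), j ≤ d, so the
-- rows of negative degree that are missing from the Jacobi-Trudi matrix correspond exactly to the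
-- legs. Once legs are columns in their own right, nothing ties them to the arms: rows and columns
-- can be removed one at a time, and the intermediate determinants need not belong to any diagram.
-- What survives is a balance. With p polynomial rows and q legs left there are p + e variables x
-- and q + e variables y, so F has degree q - p in u whatever e is, and all exponents can be
-- normalised by p and q alone. The removal of a point rests on a degree bound that holds only when
-- every remaining arm and leg is short compared with the number of variables; this forces long rows
-- and columns to go first. Polynomials are given by generators and relations, where a Vandermonde
-- product is not known to be cancellable. Interpolation coefficients therefore occur only as V / Π
-- (xₖ - xᵢ), which is a signed Vandermonde product of the other variables.

-- Normalisation of ring expressions with integer coefficients

module RingTactic {c ℓ} (R : CommutativeRing c ℓ) where
  open CommutativeRing R
  open RingProperties ring using (-0#≈0#; -‿distribˡ-*; -‿distribʳ-*; -‿+-comm; -‿involutive)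
  open SemiringMult semiring using (×-homo-+; ×1-homo-*) renaming (_×_ to _·_)
  open SemiringMultTC semiring using (×ᵤ≈×) renaming (_×_ to _·′_)
  open import Relation.Binary.Reasoning.Setoid setoid
  open import Algebra.Properties.CommutativeSemigroup +-commutativeSemigroup using (interchange)

  private
    -- (a , b) stands for the integer a - b.
    Coefficient : Set
    Coefficient = ℕ × ℕ

    coefficients : RawRing 0ℓ 0ℓ
    coefficients = record
      { Carrier = Coefficient
      ; _≈_ = _≡_
      ; _+_ = λ (a , b) (c , d) → a ℕ.+ c , b ℕ.+ d
      ; _*_ = λ (a , b) (c , d) → a ℕ.* c ℕ.+ b ℕ.* d , a ℕ.* d ℕ.+ b ℕ.* c
      ; -_  = λ (a , b) → b , a
      ; 0#  = 0 , 0
      ; 1#  = 1 , 0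
      }

    module C = RawRing coefficients

    ⟪_⟫ : Coefficient → Carrier
    ⟪ a , b ⟫ = a · 1# - b · 1#

    -- Evaluates the constants 0 and 1 definitionally to 0# and 1#.
    ⟦_⟧ : Coefficient → Carrier
    ⟦ a , zero ⟧    = a ·′ 1#
    ⟦ a , b@(suc _) ⟧ = ⟪ a , b ⟫

    ⟦⟧≈⟪⟫ : ∀ u → ⟦ u ⟧ ≈ ⟪ u ⟫
    ⟦⟧≈⟪⟫ (a , zero)  = trans (sym (×ᵤ≈× a 1#)) (sym (trans (+-congˡ -0#≈0#) (+-identityʳ _)))
    ⟦⟧≈⟪⟫ (a , suc b) = refl

    +-homo : ∀ u v → ⟪ u C.+ v ⟫ ≈ ⟪ u ⟫ + ⟪ v ⟫
    +-homo (a , b) (c , d) = begin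
      (a ℕ.+ c) · 1# - (b ℕ.+ d) · 1#
        ≈⟨ +-cong (×-homo-+ 1# a c) (-‿cong (×-homo-+ 1# b d)) ⟩
      (a · 1# + c · 1#) - (b · 1# + d · 1#)
        ≈⟨ +-congˡ (-‿+-comm _ _) ⟨
      (a · 1# + c · 1#) + (- (b · 1#) + - (d · 1#))
        ≈⟨ interchange _ _ _ _ ⟩
      ⟪ a , b ⟫ + ⟪ c , d ⟫ ∎

    -‿homo : ∀ u → ⟪ C.- u ⟫ ≈ - ⟪ u ⟫
    -‿homo (a , b) = begin
      b · 1# - a · 1#         ≈⟨ +-comm _ _ ⟩
      - (a · 1#) + b · 1#     ≈⟨ +-congˡ (-‿involutive _) ⟨
      - (a · 1#) - - (b · 1#) ≈⟨ -‿+-comm _ _ ⟩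
      - ⟪ a , b ⟫             ∎

    *-homo : ∀ u v → ⟪ u C.* v ⟫ ≈ ⟪ u ⟫ * ⟪ v ⟫
    *-homo (a , b) (c , d) = begin
      (a ℕ.* c ℕ.+ b ℕ.* d) · 1# - (a ℕ.* d ℕ.+ b ℕ.* c) · 1#
        ≈⟨ +-cong (trans (×-homo-+ 1# (a ℕ.* c) (b ℕ.* d)) (+-cong (×1-homo-* a c) (×1-homo-* b d)))
            (-‿cong (trans (×-homo-+ 1# (a ℕ.* d) (b ℕ.* c)) (+-cong (×1-homo-* a d) (×1-homo-* b c)))) ⟩
      (A * C + B * D) - (A * D + B * C)
        ≈⟨ +-congˡ (-‿+-comm _ _) ⟨
      (A * C + B * D) + (- (A * D) + - (B * C))
        ≈⟨ +-congˡ (+-comm _ _) ⟩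
      (A * C + B * D) + (- (B * C) + - (A * D))
        ≈⟨ interchange _ _ _ _ ⟩
      (A * C + - (B * C)) + (B * D + - (A * D))
        ≈⟨ +-cong (+-congˡ (-‿distribˡ-* B C))
             (trans (+-comm _ _) (+-cong (-‿distribʳ-* A D)
               (trans (sym (-‿involutive _)) (trans (-‿cong (-‿distribʳ-* B D)) (-‿distribˡ-* B (- D)))))) ⟩
      (A * C + - B * C) + (A * - D + - B * - D)
        ≈⟨ +-cong (distribʳ C A (- B)) (distribʳ (- D) A (- B)) ⟨
      (A - B) * C + (A - B) * - D
        ≈⟨ distribˡ (A - B) C (- D) ⟨
      (A - B) * (C - D) ∎
      where
      A = a · 1#
      B = b · 1#
      C = c · 1#
      D = d · 1#

    almost : ACR.AlmostCommutativeRing c ℓ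
    almost = ACR.fromCommutativeRing R

    morphism : coefficients ACR.-Raw-AlmostCommutative⟶ almost
    morphism = record
      { ⟦_⟧    = ⟦_⟧
      ; +-homo = λ u v → trans (⟦⟧≈⟪⟫ (u C.+ v)) (trans (+-homo u v) (+-cong (sym (⟦⟧≈⟪⟫ u)) (sym (⟦⟧≈⟪⟫ v))))
      ; *-homo = λ u v → trans (⟦⟧≈⟪⟫ (u C.* v)) (trans (*-homo u v) (*-cong (sym (⟦⟧≈⟪⟫ u)) (sym (⟦⟧≈⟪⟫ v))))
      ; -‿homo = λ u → trans (⟦⟧≈⟪⟫ (C.- u)) (trans (-‿homo u) (-‿cong (sym (⟦⟧≈⟪⟫ u))))
      ; 0-homo = refl
      ; 1-homo = refl
      }

    ⟪⟫-cong : ∀ {a b c d} → a ℕ.+ d ≡ c ℕ.+ b → ⟪ a , b ⟫ ≈ ⟪ c , d ⟫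
    ⟪⟫-cong {a} {b} {c} {d} eq = begin
      A - B                        ≈⟨ +-identityʳ _ ⟨
      (A - B) + 0#                 ≈⟨ +-congˡ (-‿inverseʳ D) ⟨
      (A - B) + (D - D)            ≈⟨ interchange _ _ _ _ ⟩
      (A + D) + (- B - D)          ≈⟨ +-cong (trans (sym (×-homo-+ 1# a d))
          (trans (reflexive (≡.cong (_· 1#) eq)) (×-homo-+ 1# c b))) (+-comm _ _) ⟩
      (C + B) + (- D - B)          ≈⟨ interchange _ _ _ _ ⟩
      (C - D) + (B - B)            ≈⟨ +-congˡ (-‿inverseʳ B) ⟩
      (C - D) + 0#                 ≈⟨ +-identityʳ _ ⟩
      C - D                        ∎
      where
      A = a · 1#
      B = b · 1#
      C = c · 1#
      D = d · 1#

    -- A pair of naturals is not a normal form of an integer; comparing cross sums also identifies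
    -- different pairs with the same difference.
    decide : ∀ u v → Maybe (⟦ u ⟧ ≈ ⟦ v ⟧)
    decide (a , b) (c , d) with a ℕ.+ d ℕ.≟ c ℕ.+ b
    ... | yes eq = just (trans (⟦⟧≈⟪⟫ (a , b)) (trans (⟪⟫-cong {a} {b} {c} {d} eq) (sym (⟦⟧≈⟪⟫ (c , d)))))
    ... | no _   = nothing

  private module Solver = RingSolver coefficients almost morphism decide
  open Solver public using (solve; _:=_; _:+_; _:*_; _:-_; :-_)

  :0 :1 : ∀ {n} → Solver.Polynomial n
  :0 = Solver.con (0 , 0)
  :1 = Solver.con (1 , 0)

-- Deletion and concatenation of index sequences

-- skip j enumerates ℕ ∖ {j}. For k ≠ l as positions, (k , skip k l) ↦ (skip k l , k)
-- exchanges the two entries of an ordered pair, and k = skip (skip k l) (pre k l).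
skip pre : ℕ → ℕ → ℕ
skip zero    k       = suc k
skip (suc j) zero    = zero
skip (suc j) (suc k) = suc (skip j k)

pre zero    l       = zero
pre (suc k) zero    = k
pre (suc k) (suc l) = suc (pre k l)

skip-pre : ∀ k l → skip (skip k l) (pre k l) ≡ k
skip-pre zero    l       = ≡.refl
skip-pre (suc k) zero    = ≡.refl
skip-pre (suc k) (suc l) = ≡.cong suc (skip-pre k l)

-- Both sides enumerate, in increasing order, the naturals other than `k` and `skip k l`.
skip-skip : ∀ k l i → skip (skip k l) (skip (pre k l) i) ≡ skip k (skip l i)
skip-skip zero    l       i       = ≡.refl
skip-skip (suc k) zero    i       = ≡.refl
skip-skip (suc k) (suc l) zero    = ≡.refl
skip-skip (suc k) (suc l) (suc i) = ≡.cong suc (skip-skip k l i)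

skip-< : ∀ j k → k ℕ.< j → skip j k ≡ k
skip-< (suc j) zero    _         = ≡.refl
skip-< (suc j) (suc k) (s≤s k<j) = ≡.cong suc (skip-< j k k<j)

skip-≥ : ∀ j k → j ℕ.≤ k → skip j k ≡ suc k
skip-≥ zero    k       _         = ≡.refl
skip-≥ (suc j) (suc k) (s≤s j≤k) = ≡.cong suc (skip-≥ j k j≤k)

skip-bound : ∀ {n} j k → k ℕ.< n → skip j k ℕ.< suc n
skip-bound zero    k       k<n       = s≤s k<n
skip-bound (suc j) zero    k<n       = s≤s z≤n
skip-bound {suc n} (suc j) (suc k) (s≤s k<n) = s≤s (skip-bound j k k<n)

infixr 5 _◂_

_◂_ : ∀ {a} {A : Set a} → A → (ℕ → A) → ℕ → A
(u ◂ v) zero    = u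
(u ◂ v) (suc i) = v i

-- f 0, …, f (q - 1), g 0, g 1, …
glue : ∀ {a} {A : Set a} → ℕ → (ℕ → A) → (ℕ → A) → ℕ → A
glue zero    f g = g
glue (suc q) f g = f 0 ◂ glue q (f ∘ suc) g

module _ {a} {A : Set a} where

  glue-at : ∀ q (f g : ℕ → A) → glue q f g q ≡ g 0
  glue-at zero    f g = ≡.refl
  glue-at (suc q) f g = glue-at q (f ∘ suc) g

  glue-+ : ∀ q (f g : ℕ → A) l → glue q f g (q ℕ.+ l) ≡ g l
  glue-+ zero    f g l = ≡.refl
  glue-+ (suc q) f g l = glue-+ q (f ∘ suc) g l

  glue-< : ∀ q (f g : ℕ → A) j → j ℕ.< q → glue q f g j ≡ f j
  glue-< (suc q) f g zero    _         = ≡.refl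
  glue-< (suc q) f g (suc j) (s≤s j<q) = glue-< q (f ∘ suc) g j j<q

  glue-suc-at : ∀ q (f g : ℕ → A) → glue (suc q) f g q ≡ f q
  glue-suc-at zero    f g = ≡.refl
  glue-suc-at (suc q) f g = glue-suc-at q (f ∘ suc) g

  glue-skip : ∀ q (f g : ℕ → A) j → glue q f g (skip q j) ≡ glue q f (g ∘ suc) j
  glue-skip zero    f g j       = ≡.refl
  glue-skip (suc q) f g zero    = ≡.refl
  glue-skip (suc q) f g (suc j) = glue-skip q (f ∘ suc) g j

  glue-suc-skip : ∀ q (f g : ℕ → A) j → glue (suc q) f g (skip q j) ≡ glue q f g j
  glue-suc-skip zero    f g j       = ≡.refl
  glue-suc-skip (suc q) f g zero    = ≡.refl
  glue-suc-skip (suc q) f g (suc j) = glue-suc-skip q (f ∘ suc) g j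

  glue-elim : ∀ {p} (P : ℕ → A → Set p) q f g → (∀ j → j ℕ.< q → P j (f j)) →
    (∀ l → P (q ℕ.+ l) (g l)) → ∀ j → P j (glue q f g j)
  glue-elim P zero    f g P-f P-g j       = P-g j
  glue-elim P (suc q) f g P-f P-g zero    = P-f 0 (s≤s z≤n)
  glue-elim P (suc q) f g P-f P-g (suc j) =
    glue-elim (P ∘ suc) q (f ∘ suc) g (λ i i<q → P-f (suc i) (s≤s i<q)) P-g j

glue-map : ∀ {a b} {A : Set a} {B : Set b} (h : A → B) q f g j → h (glue q f g j) ≡ glue q (h ∘ f) (h ∘ g) j
glue-map h zero    f g j       = ≡.refl
glue-map h (suc q) f g zero    = ≡.refl
glue-map h (suc q) f g (suc j) = glue-map h q (f ∘ suc) g j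

position : ∀ q j → j ℕ.< q ⊎ (Σ[ l ∈ ℕ ] j ≡ q ℕ.+ l)
position zero    j       = inj₂ (j , ≡.refl)
position (suc q) zero    = inj₁ (s≤s z≤n)
position (suc q) (suc j) with position q j
... | inj₁ j<q        = inj₁ (s≤s j<q)
... | inj₂ (l , j≡ql) = inj₂ (l , ≡.cong suc j≡ql)

-- Finite sums, products and signs

module FiniteSums {c ℓ} (R : CommutativeRing c ℓ) where
  open CommutativeRing R
  open RingTactic R
  open import Algebra.Properties.CommutativeSemigroup +-commutativeSemigroup using (interchange)
  open import Relation.Binary.Reasoning.Setoid setoid

  sg : ℕ → Carrier
  sg zero    = 1#
  sg (suc n) = - sg n

  sg-+ : ∀ m n → sg (m ℕ.+ n) ≈ sg m * sg n
  sg-+ zero    n = sym (*-identityˡ _)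
  sg-+ (suc m) n = trans (-‿cong (sg-+ m n)) (solve 2 (λ a b → :- (a :* b) := (:- a) :* b) refl (sg m) (sg n))

  sg-square : ∀ n → sg n * sg n ≈ 1#
  sg-square zero    = *-identityˡ _
  sg-square (suc n) = trans (solve 1 (λ a → (:- a) :* (:- a) := a :* a) refl (sg n)) (sg-square n)

  -- The sum of the positions `skip k l` and `pre k l` is k + l + 1 or k + l - 1.
  sg-skip-pre : ∀ k l → sg (skip k l) * sg (pre k l) ≈ - (sg k * sg l)
  sg-skip-pre zero    l       = solve 1 (λ a → (:- a) :* :1 := :- (:1 :* a)) refl (sg l)
  sg-skip-pre (suc k) zero    = solve 1 (λ a → :1 :* a := :- ((:- a) :* :1)) refl (sg k)
  sg-skip-pre (suc k) (suc l) = begin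
    (- sg (skip k l)) * (- sg (pre k l)) ≈⟨ neg² (sg (skip k l)) (sg (pre k l)) ⟩
    sg (skip k l) * sg (pre k l)         ≈⟨ sg-skip-pre k l ⟩
    - (sg k * sg l)                      ≈⟨ -‿cong (neg² (sg k) (sg l)) ⟨
    - (sg (suc k) * sg (suc l))          ∎
    where
    neg² : ∀ a b → (- a) * (- b) ≈ a * b
    neg² = solve 2 (λ a b → (:- a) :* (:- b) := a :* b) refl

  opaque
    ∑ ∏ : ℕ → (ℕ → Carrier) → Carrier
    ∑ zero    f = 0#
    ∑ (suc n) f = f 0 + ∑ n (f ∘ suc)
    ∏ zero    f = 1#
    ∏ (suc n) f = f 0 * ∏ n (f ∘ suc)

    ∑-empty : ∀ f → ∑ 0 f ≈ 0#
    ∑-empty f = refl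

    ∏-empty : ∀ f → ∏ 0 f ≈ 1#
    ∏-empty f = refl

    ∑-suc : ∀ n f → ∑ (suc n) f ≈ f 0 + ∑ n (f ∘ suc)
    ∑-suc n f = refl

    ∏-suc : ∀ n f → ∏ (suc n) f ≈ f 0 * ∏ n (f ∘ suc)
    ∏-suc n f = refl

  opaque
    unfolding ∑ ∏

    ∑-cong< : ∀ n {f g : ℕ → Carrier} → (∀ i → i ℕ.< n → f i ≈ g i) → ∑ n f ≈ ∑ n g
    ∑-cong< zero    f≈g = refl
    ∑-cong< (suc n) f≈g = +-cong (f≈g 0 (s≤s z≤n)) (∑-cong< n (λ i i<n → f≈g (suc i) (s≤s i<n)))

    ∑-cong : ∀ n {f g : ℕ → Carrier} → (∀ i → f i ≈ g i) → ∑ n f ≈ ∑ n g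
    ∑-cong n f≈g = ∑-cong< n (λ i _ → f≈g i)

    ∑-zero : ∀ n {f : ℕ → Carrier} → (∀ i → i ℕ.< n → f i ≈ 0#) → ∑ n f ≈ 0#
    ∑-zero zero    f≈0 = refl
    ∑-zero (suc n) f≈0 = trans (+-cong (f≈0 0 (s≤s z≤n)) (∑-zero n (λ i i<n → f≈0 (suc i) (s≤s i<n))))
        (+-identityˡ _)

    ∑-+ : ∀ n (f g : ℕ → Carrier) → ∑ n (λ i → f i + g i) ≈ ∑ n f + ∑ n g
    ∑-+ zero    f g = sym (+-identityˡ _)
    ∑-+ (suc n) f g = trans (+-congˡ (∑-+ n (f ∘ suc) (g ∘ suc))) (interchange _ _ _ _)

    *-∑ : ∀ n a (f : ℕ → Carrier) → a * ∑ n f ≈ ∑ n (λ i → a * f i)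
    *-∑ zero    a f = zeroʳ a
    *-∑ (suc n) a f = trans (distribˡ _ _ _) (+-congˡ (*-∑ n a (f ∘ suc)))

    ∑-swap : ∀ m n (f : ℕ → ℕ → Carrier) → ∑ m (λ i → ∑ n (f i)) ≈ ∑ n (λ j → ∑ m (λ i → f i j))
    ∑-swap zero    n f = sym (∑-zero n (λ _ _ → refl))
    ∑-swap (suc m) n f = trans (+-congˡ (∑-swap m n (f ∘ suc))) (sym (∑-+ n (f 0) _))

    ∑-single : ∀ n r {f : ℕ → Carrier} → r ℕ.< n → (∀ i → i ≢ r → f i ≈ 0#) → ∑ n f ≈ f r
    ∑-single (suc n) zero    _         f≈0 =
      trans (+-congˡ (∑-zero n (λ i _ → f≈0 (suc i) (λ ())))) (+-identityʳ _)
    ∑-single (suc n) (suc r) (s≤s r<n) f≈0 =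
      trans (+-cong (f≈0 0 (λ ())) (∑-single n r r<n (λ i i≢r → f≈0 (suc i) (i≢r ∘ ℕ.suc-injective))))
          (+-identityˡ _)

    -- The indices (k , l) stand for the ordered pairs (k , skip k l) of distinct positions, and
    -- exchanging the two entries merely permutes these pairs.
    ∑-pairs : ∀ n (T : ℕ → ℕ → Carrier) →
      ∑ (suc n) (λ k → ∑ n (λ l → T (skip k l) (pre k l))) ≈ ∑ (suc n) (λ k → ∑ n (T k))
    ∑-pairs zero    T = refl
    ∑-pairs (suc n) T = begin
      ∑ (suc n) (λ l → T (suc l) 0) + ∑ (suc n) (λ k → T 0 k + ∑ n (λ l → T′ (skip k l) (pre k l)))
        ≈⟨ +-congˡ (trans (∑-+ (suc n) (T 0) (λ k → ∑ n (λ l → T′ (skip k l) (pre k l))))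
             (+-congˡ (∑-pairs n T′))) ⟩
      ∑ (suc n) (λ l → T (suc l) 0) + (∑ (suc n) (T 0) + ∑ (suc n) (λ k → ∑ n (T′ k)))
        ≈⟨ solve 3 (λ a b c → a :+ (b :+ c) := b :+ (a :+ c)) refl _ _ _ ⟩
      ∑ (suc n) (T 0) + (∑ (suc n) (λ l → T (suc l) 0) + ∑ (suc n) (λ k → ∑ n (T′ k)))
        ≈⟨ +-congˡ (∑-+ (suc n) (λ l → T (suc l) 0) (λ k → ∑ n (T′ k))) ⟨
      ∑ (suc n) (T 0) + ∑ (suc n) (λ k → ∑ (suc n) (T (suc k))) ∎
      where
      T′ : ℕ → ℕ → Carrier
      T′ k l = T (suc k) (suc l)

    -- Reindexing by the exchange would only show that twice the sum vanishes. Cancelling the pairs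
    -- that contain position 0 and recursing on the others works in every characteristic.
    ∑-alternating : ∀ n (T : ℕ → ℕ → Carrier) → (∀ k l → T (skip k l) (pre k l) ≈ - T k l) →
      ∑ (suc n) (λ k → ∑ n (T k)) ≈ 0#
    ∑-alternating zero    T alt = +-identityˡ _
    ∑-alternating (suc n) T alt = begin
      ∑ (suc n) (T 0) + ∑ (suc n) (λ k → T (suc k) 0 + ∑ n (T′ k))
        ≈⟨ +-congˡ (∑-+ (suc n) (λ k → T (suc k) 0) (λ k → ∑ n (T′ k))) ⟩
      ∑ (suc n) (T 0) + (∑ (suc n) (λ k → T (suc k) 0) + ∑ (suc n) (λ k → ∑ n (T′ k)))
        ≈⟨ +-congˡ (+-cong (trans (∑-cong (suc n) (λ k → trans (alt 0 k) (minus (T 0 k))))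
             (sym (*-∑ (suc n) (- 1#) (T 0))))
             (∑-alternating n T′ (λ k l → alt (suc k) (suc l)))) ⟩
      ∑ (suc n) (T 0) + ((- 1#) * ∑ (suc n) (T 0) + 0#)
        ≈⟨ solve 1 (λ a → a :+ ((:- :1) :* a :+ :0) := :0) refl _ ⟩
      0# ∎
      where
      T′ : ℕ → ℕ → Carrier
      T′ k l = T (suc k) (suc l)
      minus : ∀ a → - a ≈ (- 1#) * a
      minus = solve 1 (λ a → :- a := (:- :1) :* a) refl

    ∏-cong< : ∀ n {f g : ℕ → Carrier} → (∀ i → i ℕ.< n → f i ≈ g i) → ∏ n f ≈ ∏ n g
    ∏-cong< zero    f≈g = refl
    ∏-cong< (suc n) f≈g = *-cong (f≈g 0 (s≤s z≤n)) (∏-cong< n (λ i i<n → f≈g (suc i) (s≤s i<n)))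

    ∏-cong : ∀ n {f g : ℕ → Carrier} → (∀ i → f i ≈ g i) → ∏ n f ≈ ∏ n g
    ∏-cong n f≈g = ∏-cong< n (λ i _ → f≈g i)

    ∏-* : ∀ n (f g : ℕ → Carrier) → ∏ n (λ i → f i * g i) ≈ ∏ n f * ∏ n g
    ∏-* zero    f g = sym (*-identityˡ _)
    ∏-* (suc n) f g = trans (*-congˡ (∏-* n (f ∘ suc) (g ∘ suc)))
      (solve 4 (λ a b c d → (a :* b) :* (c :* d) := (a :* c) :* (b :* d)) refl _ _ _ _)

    ∏-1 : ∀ n {f : ℕ → Carrier} → (∀ i → i ℕ.< n → f i ≈ 1#) → ∏ n f ≈ 1#
    ∏-1 zero    f≈1 = refl
    ∏-1 (suc n) f≈1 = trans (*-cong (f≈1 0 (s≤s z≤n)) (∏-1 n (λ i i<n → f≈1 (suc i) (s≤s i<n)))) (*-identityˡ _)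

    ∏-skip : ∀ n k (f : ℕ → Carrier) → k ℕ.≤ n → ∏ (suc n) f ≈ f k * ∏ n (f ∘ skip k)
    ∏-skip n       zero    f _         = refl
    ∏-skip (suc n) (suc k) f (s≤s k≤n) = trans (*-congˡ (∏-skip n k (f ∘ suc) k≤n))
      (solve 3 (λ a b c → a :* (b :* c) := b :* (a :* c)) refl _ _ _)

    ∏-last : ∀ n (f : ℕ → Carrier) → ∏ (suc n) f ≈ ∏ n f * f n
    ∏-last zero    f = *-comm _ _
    ∏-last (suc n) f = trans (*-congˡ (∏-last n (f ∘ suc))) (sym (*-assoc _ _ _))

    ∏-glue : ∀ m n (f g : ℕ → Carrier) → ∏ (m ℕ.+ n) (glue m f g) ≈ ∏ m f * ∏ n g
    ∏-glue zero    n f g = sym (*-identityˡ _)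
    ∏-glue (suc m) n f g = trans (*-congˡ (∏-glue m n (f ∘ suc) g)) (sym (*-assoc _ _ _))

    ∏-+ : ∀ m n (f : ℕ → Carrier) → ∏ (m ℕ.+ n) f ≈ ∏ m f * ∏ n (λ i → f (m ℕ.+ i))
    ∏-+ zero    n f = sym (*-identityˡ _)
    ∏-+ (suc m) n f = trans (*-congˡ (∏-+ m n (f ∘ suc))) (sym (*-assoc _ _ _))

-- Determinants by expansion along the first column

module Determinants {c ℓ} (R : CommutativeRing c ℓ) where
  open CommutativeRing R
  open RingTactic R
  open FiniteSums R
  open import Relation.Binary.Reasoning.Setoid setoid

  -- A j i is the entry in column j and row i.
  Det : ℕ → (ℕ → ℕ → Carrier) → Carrier
  Det zero    A = 1#
  Det (suc n) A = ∑ (suc n) (λ i → sg i * (A 0 i * Det n (λ j k → A (suc j) (skip i k))))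

  Det-cong : ∀ n {A B} → (∀ j → j ℕ.< n → ∀ i → A j i ≈ B j i) → Det n A ≈ Det n B
  Det-cong zero    A≈B = refl
  Det-cong (suc n) A≈B = ∑-cong (suc n) (λ i → *-congˡ (*-cong (A≈B 0 (s≤s z≤n) i)
    (Det-cong n (λ j j<n k → A≈B (suc j) (s≤s j<n) (skip i k)))))

  -- A family `v ◂ A` computes only at an index `zero` or `suc j`, so it is convenient to compare
  -- first columns and minors separately.
  Det-minors : ∀ n A B → (∀ i → A 0 i ≈ B 0 i) →
    (∀ i → Det n (λ j k → A (suc j) (skip i k)) ≈ Det n (λ j k → B (suc j) (skip i k))) →
    Det (suc n) A ≈ Det (suc n) B
  Det-minors n A B A≈B m = ∑-cong (suc n) (λ i → *-congˡ (*-cong (A≈B i) (m i)))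

  Det-linear : ∀ n a v w A →
    Det (suc n) ((λ i → a * v i + w i) ◂ A) ≈ a * Det (suc n) (v ◂ A) + Det (suc n) (w ◂ A)
  Det-linear n a v w A = begin
    ∑ (suc n) (λ i → sg i * ((a * v i + w i) * M i))
      ≈⟨ ∑-cong (suc n) (λ i → solve 5 (λ s a v w m → s :* ((a :* v :+ w) :* m) := a :* (s :* (v :* m)) :+ s :*
           (w :* m))
           refl (sg i) a (v i) (w i) (M i)) ⟩
    ∑ (suc n) (λ i → a * (sg i * (v i * M i)) + sg i * (w i * M i))
      ≈⟨ ∑-+ (suc n) _ _ ⟩
    ∑ (suc n) (λ i → a * (sg i * (v i * M i))) + Det (suc n) (w ◂ A)
      ≈⟨ +-congʳ (*-∑ (suc n) a _) ⟨
    a * Det (suc n) (v ◂ A) + Det (suc n) (w ◂ A) ∎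
    where
    M : ℕ → Carrier
    M i = Det n (λ j k → A j (skip i k))

  Det-linear₁ : ∀ n a u v w A →
    Det (2 ℕ.+ n) (u ◂ (λ i → a * v i + w i) ◂ A) ≈ a * Det (2 ℕ.+ n) (u ◂ v ◂ A) + Det (2 ℕ.+ n) (u ◂ w ◂ A)
  Det-linear₁ n a u v w A = begin
    ∑ (2 ℕ.+ n) (λ i → sg i * (u i * D i (λ i → a * v i + w i)))
      ≈⟨ ∑-cong (2 ℕ.+ n) (λ i → trans (*-congˡ (*-congˡ
           (Det-linear n a (v ∘ skip i) (w ∘ skip i) (λ j k → A j (skip i k)))))
           (solve 5 (λ s a u x y → s :* (u :* (a :* x :+ y)) := a :* (s :* (u :* x)) :+ s :* (u :* y)) refl
               (sg i) a (u i) (D i v) (D i w))) ⟩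
    ∑ (2 ℕ.+ n) (λ i → a * (sg i * (u i * D i v)) + sg i * (u i * D i w))
      ≈⟨ ∑-+ (2 ℕ.+ n) _ _ ⟩
    ∑ (2 ℕ.+ n) (λ i → a * (sg i * (u i * D i v))) + Det (2 ℕ.+ n) (u ◂ w ◂ A)
      ≈⟨ +-congʳ (*-∑ (2 ℕ.+ n) a _) ⟨
    a * Det (2 ℕ.+ n) (u ◂ v ◂ A) + Det (2 ℕ.+ n) (u ◂ w ◂ A) ∎
    where
    D : ℕ → (ℕ → Carrier) → Carrier
    D i v = Det (suc n) ((v ∘ skip i) ◂ (λ j k → A j (skip i k)))

  -- Expanding along both columns gives a sum over ordered pairs of distinct rows, whose terms
  -- change sign when the two rows are exchanged.
  Det-repeated₀₁ : ∀ n v A → Det (2 ℕ.+ n) (v ◂ v ◂ A) ≈ 0#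
  Det-repeated₀₁ n v A = trans
      (∑-cong (2 ℕ.+ n) (λ i → trans (sym (*-assoc _ _ _)) (*-∑ (suc n) (sg i * v i) _)))
      (∑-alternating (suc n) T alternating)
    where
    D : ℕ → ℕ → Carrier
    D i k = Det n (λ j l → A j (skip i (skip k l)))
    T : ℕ → ℕ → Carrier
    T i k = (sg i * v i) * (sg k * (v (skip i k) * D i k))
    alternating : ∀ k l → T (skip k l) (pre k l) ≈ - T k l
    alternating k l = begin
      (sg (skip k l) * v (skip k l)) * (sg (pre k l) * (v (skip (skip k l) (pre k l)) * D (skip k l) (pre k l)))
        ≈⟨ *-congˡ (*-congˡ (*-cong (reflexive (≡.cong v (skip-pre k l)))
             (Det-cong n (λ j _ m → reflexive (≡.cong (A j) (skip-skip k l m)))))) ⟩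
      (sg (skip k l) * v (skip k l)) * (sg (pre k l) * (v k * D k l))
        ≈⟨ solve 5 (λ s v t w d → (s :* v) :* (t :* (w :* d)) := (s :* t) :* (v :* (w :* d))) refl _ _ _ _ _ ⟩
      (sg (skip k l) * sg (pre k l)) * (v (skip k l) * (v k * D k l))
        ≈⟨ *-congʳ (sg-skip-pre k l) ⟩
      (- (sg k * sg l)) * (v (skip k l) * (v k * D k l))
        ≈⟨ solve 5 (λ s t v w d → (:- (s :* t)) :* (v :* (w :* d)) := :- ((s :* w) :* (t :* (v :* d)))) refl _ _
             _ _ _ ⟩
      - T k l ∎

  -- Polarisation: the determinant with the column v + w repeated vanishes, as do those with v or w
  -- repeated.
  Det-swap₀₁ : ∀ n v w A → Det (2 ℕ.+ n) (v ◂ w ◂ A) ≈ - Det (2 ℕ.+ n) (w ◂ v ◂ A)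
  Det-swap₀₁ n v w A = begin
    D v w                                            ≈⟨ solve 2 (λ a b → a := (:0 :+ (a :+ (b :+ :0))) :- b)
        refl _ _ ⟩
    (0# + (D v w + (D w v + 0#))) - D w v
      ≈⟨ +-congʳ (+-cong (Det-repeated₀₁ n v A) (+-congˡ (+-congˡ (Det-repeated₀₁ n w A)))) ⟨
    (D v v + (D v w + (D w v + D w w))) - D w v
      ≈⟨ +-congʳ (solve 4 (λ a b c d → a :+ (b :+ (c :+ d)) := :1 :* (:1 :* a :+ b) :+ (:1 :* c :+ d)) refl _ _
           _ _) ⟩
    (1# * (1# * D v v + D v w) + (1# * D w v + D w w)) - D w v
      ≈⟨ +-congʳ (+-cong (*-congˡ (Det-linear₁ n 1# v v w A)) (Det-linear₁ n 1# w v w A)) ⟨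
    (1# * D v u + D w u) - D w v                     ≈⟨ +-congʳ (Det-linear (suc n) 1# v w (u ◂ A)) ⟨
    D u u - D w v                                    ≈⟨ +-congʳ (Det-repeated₀₁ n u A) ⟩
    0# - D w v                                       ≈⟨ +-identityˡ _ ⟩
    - D w v                                          ∎
    where
    u : ℕ → Carrier
    u i = 1# * v i + w i
    D : (ℕ → Carrier) → (ℕ → Carrier) → Carrier
    D x y = Det (2 ℕ.+ n) (x ◂ y ◂ A)

  Det-repeated : ∀ n j v A → j ℕ.< n → (∀ i → A j i ≈ v i) → Det (suc n) (v ◂ A) ≈ 0#
  Det-repeated (suc n) zero    v A _ A≈v = trans
    (Det-minors (suc n) (v ◂ A) (v ◂ v ◂ (A ∘ suc)) (λ _ → refl)
        (λ i → Det-minors n (λ j k → A j (skip i k)) (λ j k → (v ◂ (A ∘ suc)) j (skip i k))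
        (λ k → A≈v (skip i k)) (λ _ → refl)))
    (Det-repeated₀₁ n v (A ∘ suc))
  Det-repeated (suc n) (suc j) v A (s≤s j<n) A≈v = begin
    Det (2 ℕ.+ n) (v ◂ A 0 ◂ (A ∘ suc))       ≈⟨ Det-swap₀₁ n v (A 0) (A ∘ suc) ⟩
    - Det (2 ℕ.+ n) (A 0 ◂ v ◂ (A ∘ suc))     ≈⟨ -‿cong (∑-zero (2 ℕ.+ n) (λ i _ → trans (*-congˡ (trans
      (*-congˡ (Det-repeated n j (v ∘ skip i) (λ j k → A (suc j) (skip i k)) j<n (λ k → A≈v (skip i k))))
          (zeroʳ _))) (zeroʳ _))) ⟩
    - 0#                                      ≈⟨ solve 0 (:- :0 := :0) refl ⟩
    0#                                        ∎

  Det-move : ∀ n c A → c ℕ.≤ n → Det (suc n) A ≈ sg c * Det (suc n) (A c ◂ (A ∘ skip c))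
  Det-move n       zero    A _         = sym (*-identityˡ _)
  Det-move (suc n) (suc c) A (s≤s c≤n) = begin
    ∑ (2 ℕ.+ n) (λ i → sg i * (A 0 i * Det (suc n) (λ j k → A (suc j) (skip i k))))
      ≈⟨ ∑-cong (2 ℕ.+ n) (λ i → trans (*-congˡ (*-congˡ (Det-move n c (λ j k → A (suc j) (skip i k)) c≤n)))
           (solve 4 (λ s a t d → s :* (a :* (t :* d)) := t :* (s :* (a :* d))) refl _ _ _ _)) ⟩
    ∑ (2 ℕ.+ n) (λ i → sg c * (sg i * (A 0 i * Det (suc n)
        ((A (suc c) ∘ skip i) ◂ (λ j k → A (suc (skip c j)) (skip i k))))))
      ≈⟨ *-∑ (2 ℕ.+ n) (sg c) _ ⟨
    sg c * Det (2 ℕ.+ n) (A 0 ◂ A (suc c) ◂ (λ j → A (suc (skip c j))))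
      ≈⟨ *-congˡ (Det-swap₀₁ n (A 0) (A (suc c)) (λ j → A (suc (skip c j)))) ⟩
    sg c * - Det (2 ℕ.+ n) (A (suc c) ◂ A 0 ◂ (λ j → A (suc (skip c j))))
      ≈⟨ solve 2 (λ a b → a :* (:- b) := (:- a) :* b) refl _ _ ⟩
    sg (suc c) * Det (2 ℕ.+ n) (A (suc c) ◂ (A ∘ skip (suc c))) ∎

  -- Subtracting a multiple of each column from s on from its right neighbour.
  Det-chain : ∀ n s a {A A′ : ℕ → ℕ → Carrier} → (∀ j → j ℕ.≤ s → ∀ i → A′ j i ≈ A j i) →
    (∀ j → s ℕ.≤ j → ∀ i → A′ (suc j) i ≈ A (suc j) i - a * A j i) → Det n A′ ≈ Det n A
  Det-chain zero s a same step = refl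
  Det-chain (suc zero) s a {A} {A′} same step = Det-minors 0 A′ A (same 0 z≤n) (λ _ → refl)
  Det-chain (suc n) (suc s) a {A} {A′} same step = Det-minors n A′ A (same 0 z≤n) (λ i →
    Det-chain n s a (λ j j≤s k → same (suc j) (s≤s j≤s) (skip i k)) (λ j s≤j k → step (suc j) (s≤s s≤j) (skip i k)))
  Det-chain (suc (suc n)) zero a {A} {A′} same step = begin
    Det (2 ℕ.+ n) A′
      ≈⟨ Det-minors (suc n) A′ (A 0 ◂ (λ i → - a * A 0 i + A 1 i) ◂ A″) (same 0 z≤n) (λ i → Det-minors n
           (λ j k → A′ (suc j) (skip i k)) (λ j k → ((λ i → - a * A 0 i + A 1 i) ◂ A″) j (skip i k))
               (λ k → trans (step 0 z≤n (skip i k))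
           (solve 3 (λ x a y → x :- a :* y := (:- a) :* y :+ x) refl _ _ _)) (λ _ → refl)) ⟩
    Det (2 ℕ.+ n) (A 0 ◂ (λ i → - a * A 0 i + A 1 i) ◂ A″)
      ≈⟨ Det-linear₁ n (- a) (A 0) (A 0) (A 1) A″ ⟩
    - a * Det (2 ℕ.+ n) (A 0 ◂ A 0 ◂ A″) + Det (2 ℕ.+ n) (A 0 ◂ A 1 ◂ A″)
      ≈⟨ +-congʳ (trans (*-congˡ (Det-repeated₀₁ n (A 0) A″)) (zeroʳ _)) ⟩
    0# + Det (2 ℕ.+ n) (A 0 ◂ A 1 ◂ A″)
      ≈⟨ +-identityˡ _ ⟩
    Det (2 ℕ.+ n) (A 0 ◂ A 1 ◂ A″)
      ≈⟨ Det-minors (suc n) (A 0 ◂ A 1 ◂ A″) A (λ _ → refl) (λ i → Det-chain (suc n) 0 a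
           {λ j k → A (suc j) (skip i k)} {λ j k → (A 1 ◂ A″) j (skip i k)}
           (λ { zero _ k → refl }) (λ j _ k → shifted j (skip i k))) ⟩
    Det (2 ℕ.+ n) A ∎
    where
    A″ : ℕ → ℕ → Carrier
    A″ j = A′ (2 ℕ.+ j)
    shifted : ∀ j k → A″ j k ≈ A (2 ℕ.+ j) k - a * A (1 ℕ.+ j) k
    shifted j k = step (suc j) z≤n k

  -- Apart from the corner term, expand along the first column and then, after transposing the
  -- minors, along the first row. The resulting double sum is symmetric once the minors of size m
  -- are transposed too, hence the recursion on two sizes.
  Det-transpose : ∀ n A → Det n A ≈ Det n (λ j i → A i j)
  Det-transpose zero          A = refl
  Det-transpose (suc zero)    A = ∑-cong< 1 (λ { zero _ → refl ; (suc _) (s≤s ()) })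
  Det-transpose (suc (suc m)) A = trans (∑-suc (suc m) _)
      (trans (+-cong (*-congˡ (*-congˡ (Det-transpose (suc m) (λ j k → A (suc j) (suc k))))) (begin
    ∑ (suc m) (λ i → sg (suc i) * (A 0 (suc i) * Det (suc m) (λ j k → A (suc j) (skip (suc i) k))))
      ≈⟨ expand (Det-transpose (suc m)) A ⟩
    ∑ (suc m) (λ i → ∑ (suc m) (λ l → (sg (suc i) * A 0 (suc i)) *
        (sg l * (A (suc l) 0 * Det m (λ j k → A (suc (skip l k)) (suc (skip i j)))))))
      ≈⟨ ∑-swap (suc m) (suc m) _ ⟩
    ∑ (suc m) (λ l → ∑ (suc m) (λ i → (sg (suc i) * A 0 (suc i)) *
        (sg l * (A (suc l) 0 * Det m (λ j k → A (suc (skip l k)) (suc (skip i j)))))))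
      ≈⟨ ∑-cong (suc m) (λ l → ∑-cong (suc m) (λ i → trans
           (*-congˡ (*-congˡ (*-congˡ (Det-transpose m (λ j k → A (suc (skip l k)) (suc (skip i j)))))))
           (solve 5 (λ s a t b d → ((:- s) :* a) :* (t :* (b :* d)) := ((:- t) :* b) :* (s :* (a :* d))) refl
               (sg i) _ (sg l) _ _))) ⟩
    ∑ (suc m) (λ l → ∑ (suc m) (λ i → (sg (suc l) * A (suc l) 0) *
        (sg i * (A 0 (suc i) * Det m (λ j k → A (suc (skip l j)) (suc (skip i k)))))))
      ≈⟨ expand (Det-transpose (suc m)) (λ j i → A i j) ⟨
    ∑ (suc m) (λ l → sg (suc l) * (A (suc l) 0 * Det (suc m) (λ j k → A (skip (suc l) k) (suc j)))) ∎))
        (sym (∑-suc (suc m) _)))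
    where
    expand : (∀ B → Det (suc m) B ≈ Det (suc m) (λ j i → B i j)) → ∀ A → ∑ (suc m)
        (λ i → sg (suc i) * (A 0 (suc i) * Det (suc m) (λ j k → A (suc j) (skip (suc i) k)))) ≈
      ∑ (suc m) (λ i → ∑ (suc m) (λ l → (sg (suc i) * A 0 (suc i)) *
          (sg l * (A (suc l) 0 * Det m (λ j k → A (suc (skip l k)) (suc (skip i j)))))))
    expand transpose A = ∑-cong (suc m) (λ i → begin
      sg (suc i) * (A 0 (suc i) * Det (suc m) (λ j k → A (suc j) (skip (suc i) k)))
        ≈⟨ *-assoc _ _ _ ⟨
      (sg (suc i) * A 0 (suc i)) * Det (suc m) (λ j k → A (suc j) (skip (suc i) k))
        ≈⟨ *-congˡ (transpose (λ j k → A (suc j) (skip (suc i) k))) ⟩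
      (sg (suc i) * A 0 (suc i)) * Det (suc m) (λ k j → A (suc j) (skip (suc i) k))
        ≈⟨ *-∑ (suc m) _ _ ⟩
      ∑ (suc m) (λ l → (sg (suc i) * A 0 (suc i)) * (sg l *
          (A (suc l) 0 * Det m (λ j k → A (suc (skip l k)) (suc (skip i j)))))) ∎)

  Det-unit : ∀ n r v A → r ℕ.≤ n → v r ≈ 1# → (∀ i → i ≢ r → v i ≈ 0#) →
    Det (suc n) (v ◂ A) ≈ sg r * Det n (λ j k → A j (skip r k))
  Det-unit n r v A r≤n v≈1 v≈0 = trans
    (∑-single (suc n) r (s≤s r≤n) (λ i i≢r → trans (*-congˡ (trans (*-congʳ (v≈0 i i≢r)) (zeroˡ _))) (zeroʳ _)))
    (*-congˡ (trans (*-congʳ v≈1) (*-identityˡ _)))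

  Det-∑ : ∀ n m (w : ℕ → Carrier) (v : ℕ → ℕ → Carrier) A →
    Det (suc n) ((λ i → ∑ m (λ k → w k * v k i)) ◂ A) ≈ ∑ m (λ k → w k * Det (suc n) (v k ◂ A))
  Det-∑ n zero    w v A = trans (∑-zero (suc n) (λ i _ → trans (*-congˡ (trans (*-congʳ (∑-empty _)) (zeroˡ _)))
      (zeroʳ _))) (sym (∑-empty _))
  Det-∑ n (suc m) w v A = begin
    Det (suc n) ((λ i → ∑ (suc m) (λ k → w k * v k i)) ◂ A)
      ≈⟨ Det-minors n ((λ i → ∑ (suc m) (λ k → w k * v k i)) ◂ A)
           ((λ i → w 0 * v 0 i + ∑ m (λ k → w (suc k) * v (suc k) i)) ◂ A)
          (λ i → ∑-suc m (λ k → w k * v k i)) (λ _ → refl) ⟩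
    Det (suc n) ((λ i → w 0 * v 0 i + ∑ m (λ k → w (suc k) * v (suc k) i)) ◂ A)
      ≈⟨ Det-linear n (w 0) (v 0) _ A ⟩
    w 0 * Det (suc n) (v 0 ◂ A) + Det (suc n) ((λ i → ∑ m (λ k → w (suc k) * v (suc k) i)) ◂ A)
      ≈⟨ +-congˡ (Det-∑ n m (w ∘ suc) (v ∘ suc) A) ⟩
    w 0 * Det (suc n) (v 0 ◂ A) + ∑ m (λ k → w (suc k) * Det (suc n) (v (suc k) ◂ A))
      ≈⟨ ∑-suc m _ ⟨
    ∑ (suc m) (λ k → w k * Det (suc n) (v k ◂ A)) ∎

  Det-*ˡ : ∀ n x v A → Det (suc n) ((λ i → x * v i) ◂ A) ≈ x * Det (suc n) (v ◂ A)
  Det-*ˡ n x v A = trans (∑-cong (suc n) (λ i → solve 4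
      (λ s x v d → s :* ((x :* v) :* d) := x :* (s :* (v :* d))) refl _ _ _ _))
    (sym (*-∑ (suc n) x _))

-- Formal power series in z = 1 / u

module PowerSeries {c ℓ} (R : CommutativeRing c ℓ) where
  open CommutativeRing R
  open RingTactic R

  Series : Set c
  Series = ℕ → Carrier

  infix 4 _≋_

  record _≋_ (f g : Series) : Set ℓ where
    constructor coefficientwise
    field
      coef-≈ : ∀ n → f n ≈ g n

  open _≋_ public

  infixl 7 _⊛_
  infixl 6 _⊕_

  _⊕_ _⊛_ : Series → Series → Series
  (f ⊕ g) n = f n + g n
  (f ⊛ g) zero    = f 0 * g 0
  (f ⊛ g) (suc n) = f 0 * g (suc n) + ((f ∘ suc) ⊛ g) n

  neg : Series → Series
  neg f n = - f n

  C : Carrier → Series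
  C a zero    = a
  C a (suc n) = 0#

  private
    0s : Series
    0s _ = 0#

    ⊛-cong : ∀ {f f′ g g′} → (∀ n → f n ≈ f′ n) → (∀ n → g n ≈ g′ n) → ∀ n → (f ⊛ g) n ≈ (f′ ⊛ g′) n
    ⊛-cong f≈ g≈ zero    = *-cong (f≈ 0) (g≈ 0)
    ⊛-cong f≈ g≈ (suc n) = +-cong (*-cong (f≈ 0) (g≈ (suc n))) (⊛-cong (f≈ ∘ suc) g≈ n)

    ⊛-zeroˡ : ∀ g n → (0s ⊛ g) n ≈ 0#
    ⊛-zeroˡ g zero    = zeroˡ _
    ⊛-zeroˡ g (suc n) = trans (+-cong (zeroˡ _) (⊛-zeroˡ g n)) (+-identityˡ _)

    ⊛-scale : ∀ a f g n → ((λ i → a * f i) ⊛ g) n ≈ a * (f ⊛ g) n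
    ⊛-scale a f g zero    = *-assoc _ _ _
    ⊛-scale a f g (suc n) = trans (+-cong (*-assoc _ _ _) (⊛-scale a (f ∘ suc) g n)) (sym (distribˡ _ _ _))

    ⊛-distribʳ : ∀ h f g n → ((f ⊕ g) ⊛ h) n ≈ (f ⊛ h) n + (g ⊛ h) n
    ⊛-distribʳ h f g zero    = distribʳ _ _ _
    ⊛-distribʳ h f g (suc n) = trans (+-cong (distribʳ _ _ _) (⊛-distribʳ h (f ∘ suc) (g ∘ suc) n))
      (solve 4 (λ a b c d → (a :+ b) :+ (c :+ d) := (a :+ c) :+ (b :+ d)) refl _ _ _ _)

    ⊛-sucʳ : ∀ f g n → (f ⊛ g) (suc n) ≈ (f ⊛ (g ∘ suc)) n + f (suc n) * g 0
    ⊛-sucʳ f g zero    = refl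
    ⊛-sucʳ f g (suc n) = trans (+-congˡ (⊛-sucʳ (f ∘ suc) g n)) (sym (+-assoc _ _ _))

    ⊛-comm : ∀ f g n → (f ⊛ g) n ≈ (g ⊛ f) n
    ⊛-comm f g zero    = *-comm _ _
    ⊛-comm f g (suc n) = trans (+-comm _ _)
      (trans (+-cong (⊛-comm (f ∘ suc) g n) (*-comm _ _)) (sym (⊛-sucʳ g f n)))

    ⊛-assoc : ∀ f g h n → ((f ⊛ g) ⊛ h) n ≈ (f ⊛ (g ⊛ h)) n
    ⊛-assoc f g h zero    = *-assoc _ _ _
    ⊛-assoc f g h (suc n) = trans
      (+-congˡ (trans (⊛-distribʳ h (λ i → f 0 * g (suc i)) ((f ∘ suc) ⊛ g) n)
        (+-cong (⊛-scale (f 0) (g ∘ suc) h n) (⊛-assoc (f ∘ suc) g h n))))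
      (solve 5 (λ a b c d e → (a :* b) :* c :+ (a :* d :+ e) := a :* (b :* c :+ d) :+ e) refl _ _ _ _ _)

    ⊛-C : ∀ a f n → (C a ⊛ f) n ≈ a * f n
    ⊛-C a f zero    = refl
    ⊛-C a f (suc n) = trans (+-congˡ (⊛-zeroˡ f n)) (+-identityʳ _)

    ⊛-identityˡ : ∀ f n → (C 1# ⊛ f) n ≈ f n
    ⊛-identityˡ f n = trans (⊛-C 1# f n) (*-identityˡ _)

    series-setoid : Setoid c ℓ
    series-setoid = record
      { Carrier = Series
      ; _≈_ = _≋_
      ; isEquivalence = record
        { refl  = coefficientwise (λ _ → refl)
        ; sym   = λ p → coefficientwise (λ n → sym (coef-≈ p n))
        ; trans = λ p q → coefficientwise (λ n → trans (coef-≈ p n) (coef-≈ q n))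
        }
      }

  seriesRing : CommutativeRing c ℓ
  seriesRing = record
    { Carrier = Series
    ; _≈_ = _≋_
    ; _+_ = _⊕_
    ; _*_ = _⊛_
    ; -_  = neg
    ; 0#  = λ _ → 0#
    ; 1#  = C 1#
    ; isCommutativeRing = record
      { isRing = record
        { +-isAbelianGroup = record
          { isGroup = record
            { isMonoid = record
              { isSemigroup = record
                { isMagma = record
                  { isEquivalence = Setoid.isEquivalence series-setoid
                  ; ∙-cong = λ p q → coefficientwise (λ n → +-cong (coef-≈ p n) (coef-≈ q n))
                  }
                ; assoc = λ f g h → coefficientwise (λ n → +-assoc _ _ _)
                }
              ; identity = (λ f → coefficientwise (λ n → +-identityˡ _)) ,
                  (λ f → coefficientwise (λ n → +-identityʳ _))
              }
            ; inverse = (λ f → coefficientwise (λ n → -‿inverseˡ _)) , (λ f → coefficientwise (λ n → -‿inverseʳ _))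
            ; ⁻¹-cong = λ p → coefficientwise (λ n → -‿cong (coef-≈ p n))
            }
          ; comm = λ f g → coefficientwise (λ n → +-comm _ _)
          }
        ; *-cong = λ p q → coefficientwise (⊛-cong (coef-≈ p) (coef-≈ q))
        ; *-assoc = λ f g h → coefficientwise (⊛-assoc f g h)
        ; *-identity = Consequences.comm∧idˡ⇒id series-setoid {_⊛_} (λ f g → coefficientwise (⊛-comm f g))
            (λ f → coefficientwise (⊛-identityˡ f))
        ; distrib = Consequences.comm∧distrʳ⇒distr series-setoid {_⊛_} {_⊕_}
            (λ p q → coefficientwise (λ n → +-cong (coef-≈ p n) (coef-≈ q n)))
            (λ f g → coefficientwise (⊛-comm f g)) (λ h f g → coefficientwise (⊛-distribʳ h f g))
        }
      ; *-comm = λ f g → coefficientwise (⊛-comm f g)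
      }
    }

  module S where
    open CommutativeRing seriesRing public
    open FiniteSums seriesRing public using (∑; ∏)

  coef-C : ∀ a f n → (C a ⊛ f) n ≈ a * f n
  coef-C = ⊛-C

  C-cong : ∀ {a b} → a ≈ b → C a ≋ C b
  C-cong a≈b = coefficientwise λ { zero → a≈b ; (suc n) → refl }

  C-+ : ∀ a b → C (a + b) ≋ C a ⊕ C b
  C-+ a b = coefficientwise λ { zero → refl ; (suc n) → sym (+-identityˡ _) }

  C-* : ∀ a b → C (a * b) ≋ C a ⊛ C b
  C-* a b = coefficientwise λ { zero → refl ; (suc n) → sym (trans (coef-C a (C b) (suc n)) (zeroʳ _)) }

  C-neg : ∀ a → C (- a) ≋ neg (C a)
  C-neg a = coefficientwise λ { zero → refl ; (suc n) → solve 0 (:0 := :- :0) refl }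

  C-0 : C 0# ≋ S.0#
  C-0 = coefficientwise λ { zero → refl ; (suc n) → refl }

  z : Series
  z = 0# ◂ C 1#

  coef-z-zero : ∀ f → (z ⊛ f) 0 ≈ 0#
  coef-z-zero f = zeroˡ _

  coef-z-suc : ∀ f n → (z ⊛ f) (suc n) ≈ f n
  coef-z-suc f n = trans (+-cong (zeroˡ _) (⊛-identityˡ f n)) (+-identityˡ _)

  -- In terms of u these are (u - a) / u and its inverse, so a product of n of them differs from the
  -- polynomial, or from its inverse, by the n-th power of u.
  lin geo : Carrier → Series
  lin a = S._-_ S.1# (C a ⊛ z)
  geo a zero    = 1#
  geo a (suc n) = a * geo a n

  coef-lin-zero : ∀ a f → (lin a ⊛ f) 0 ≈ f 0
  coef-lin-zero a f = solve 2 (λ a f → (:1 :- a :* :0) :* f := f) refl a (f 0)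

  private
    lin-⊛ : ∀ a f → lin a ⊛ f ≋ S._-_ f (C a ⊛ (z ⊛ f))
    lin-⊛ a f = RingTactic.solve seriesRing 3 (λ a z f → (:1′ :-′ a :*′ z) :*′ f :=′ f :-′ a :*′ (z :*′ f))
        S.refl (C a) z f
      where open RingTactic seriesRing using () renaming (:1 to :1′; _:-_ to _:-′_; _:*_ to _:*′_; _:=_ to _:=′_)

  coef-lin-suc : ∀ a f n → (lin a ⊛ f) (suc n) ≈ f (suc n) - a * f n
  coef-lin-suc a f n = trans (coef-≈ (lin-⊛ a f) (suc n))
    (+-congˡ (-‿cong (trans (coef-C a (z ⊛ f) (suc n)) (*-congˡ (coef-z-suc f n)))))

  lin-geo : ∀ a → lin a ⊛ geo a ≋ S.1#
  lin-geo a = coefficientwise λ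
    { zero    → coef-lin-zero a (geo a)
    ; (suc n) → trans (coef-lin-suc a (geo a) n) (-‿inverseʳ _)
    }

  geo-cong : ∀ {a b} → a ≈ b → ∀ n → geo a n ≈ geo b n
  geo-cong a≈b zero    = refl
  geo-cong a≈b (suc n) = *-cong a≈b (geo-cong a≈b n)

  geo-neg : ∀ x k → geo (- x) k ≈ FiniteSums.sg R k * geo x k
  geo-neg x zero    = sym (*-identityˡ _)
  geo-neg x (suc k) = trans (*-congˡ (geo-neg x k)) (solve 3
      (λ x s g → (:- x) :* (s :* g) := (:- s) :* (x :* g)) refl _ _ _)

  coef-∑ : ∀ n f i → S.∑ n f i ≈ FiniteSums.∑ R n (λ k → f k i)
  coef-∑ zero    f i = trans (coef-≈ (FiniteSums.∑-empty seriesRing f) i) (sym (FiniteSums.∑-empty R _))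
  coef-∑ (suc n) f i = trans (coef-≈ (FiniteSums.∑-suc seriesRing n f) i)
      (trans (+-congˡ (coef-∑ n (f ∘ suc) i)) (sym (FiniteSums.∑-suc R n _)))

  -- at f a b is the coefficient of z^(a - b) in f.
  at : Series → ℕ → ℕ → Carrier
  at f a       zero    = f a
  at f zero    (suc b) = 0#
  at f (suc a) (suc b) = at f a b

  at-cong : ∀ {f g} → f ≋ g → ∀ a b → at f a b ≈ at g a b
  at-cong f≋g a       zero    = coef-≈ f≋g a
  at-cong f≋g zero    (suc b) = refl
  at-cong f≋g (suc a) (suc b) = at-cong f≋g a b

  at-⊕ : ∀ f g a b → at (f ⊕ g) a b ≈ at f a b + at g a b
  at-⊕ f g a       zero    = refl
  at-⊕ f g zero    (suc b) = sym (+-identityˡ _)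
  at-⊕ f g (suc a) (suc b) = at-⊕ f g a b

  at-0 : ∀ a b → at S.0# a b ≈ 0#
  at-0 a       zero    = refl
  at-0 zero    (suc b) = refl
  at-0 (suc a) (suc b) = at-0 a b

  at-C : ∀ x f a b → at (C x ⊛ f) a b ≈ x * at f a b
  at-C x f a       zero    = coef-C x f a
  at-C x f zero    (suc b) = sym (zeroʳ _)
  at-C x f (suc a) (suc b) = at-C x f a b

  at-< : ∀ f {a b} → a ℕ.< b → at f a b ≈ 0#
  at-< f {zero}  {suc b} _         = refl
  at-< f {suc a} {suc b} (s≤s a<b) = at-< f a<b

  at-+ : ∀ f k a b → at f (k ℕ.+ a) (k ℕ.+ b) ≡ at f a b
  at-+ f zero    a b = ≡.refl
  at-+ f (suc k) a b = at-+ f k a b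

  at-diagonal : ∀ f a → at f a a ≡ f 0
  at-diagonal f zero    = ≡.refl
  at-diagonal f (suc a) = at-diagonal f a

  at-z : ∀ f a b → at (z ⊛ f) (suc a) b ≈ at f a b
  at-z f a       zero          = coef-z-suc f a
  at-z f zero    (suc zero)    = coef-z-zero f
  at-z f zero    (suc (suc b)) = refl
  at-z f (suc a) (suc b)       = at-z f a b

  at-lin : ∀ x f a b → at (lin x ⊛ f) (suc a) b ≈ at f (suc a) b - x * at f a b
  at-lin x f a b = begin
    at (lin x ⊛ f) (suc a) b
      ≈⟨ at-cong (lin-⊛ x f) (suc a) b ⟩
    at (f ⊕ neg (C x ⊛ (z ⊛ f))) (suc a) b
      ≈⟨ at-cong (S.+-congˡ (S.trans (RingTactic.solve seriesRing 2 (λ a b → :-′ (a :*′ b) :=′ (:-′ a) :*′ b)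
           S.refl (C x) (z ⊛ f))
           (S.*-congʳ (S.sym (C-neg x))))) (suc a) b ⟩
    at (f ⊕ (C (- x) ⊛ (z ⊛ f))) (suc a) b
      ≈⟨ at-⊕ f (C (- x) ⊛ (z ⊛ f)) (suc a) b ⟩
    at f (suc a) b + at (C (- x) ⊛ (z ⊛ f)) (suc a) b
      ≈⟨ +-congˡ (trans (at-C (- x) (z ⊛ f) (suc a) b) (*-congˡ (at-z f a b))) ⟩
    at f (suc a) b + - x * at f a b
      ≈⟨ solve 3 (λ f x g → f :+ (:- x) :* g := f :- x :* g) refl _ _ _ ⟩
    at f (suc a) b - x * at f a b ∎
    where
    open import Relation.Binary.Reasoning.Setoid setoid
    open RingTactic seriesRing using () renaming (:-_ to :-′_; _:*_ to _:*′_; _:=_ to _:=′_)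

  infixr 8 z^_⊛_

  z^_⊛_ : ℕ → Series → Series
  z^ zero  ⊛ f = f
  z^ suc k ⊛ f = z ⊛ (z^ k ⊛ f)

  z^-cong : ∀ k {f g} → f ≋ g → z^ k ⊛ f ≋ z^ k ⊛ g
  z^-cong zero    f≋g = f≋g
  z^-cong (suc k) f≋g = S.*-congˡ (z^-cong k f≋g)

  z^-*ʳ : ∀ k f g → (z^ k ⊛ f) ⊛ g ≋ z^ k ⊛ (f ⊛ g)
  z^-*ʳ zero    f g = S.refl
  z^-*ʳ (suc k) f g = S.trans (S.*-assoc _ _ _) (S.*-congˡ (z^-*ʳ k f g))

  at-z-suc : ∀ f a b → at (z ⊛ f) a b ≈ at f a (suc b)
  at-z-suc f (suc a) b       = at-z f a b
  at-z-suc f zero    zero    = coef-z-zero f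
  at-z-suc f zero    (suc b) = refl

  at-z^ : ∀ k f a b → at (z^ k ⊛ f) (k ℕ.+ a) b ≈ at f a b
  at-z^ zero    f a b = refl
  at-z^ (suc k) f a b = trans (at-z (z^ k ⊛ f) (k ℕ.+ a) b) (at-z^ k f a b)

  at-z^-< : ∀ k f {a b} → a ℕ.< k ℕ.+ b → at (z^ k ⊛ f) a b ≈ 0#
  at-z^-< zero    f a<b = at-< f a<b
  at-z^-< (suc k) f {zero}  {zero}  _ = coef-z-zero (z^ k ⊛ f)
  at-z^-< (suc k) f {zero}  {suc b} _ = refl
  at-z^-< (suc k) f {suc a} {b} (s≤s a<kb) = trans (at-z (z^ k ⊛ f) a b) (at-z^-< k f a<kb)

  lins : ℕ → (ℕ → Carrier) → Series
  lins n x = S.∏ n (λ i → lin (x i))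

  geos : ℕ → (ℕ → Carrier) → Series
  geos n x = S.∏ n (λ i → geo (x i))

  open FiniteSums seriesRing public using () renaming (∏-suc to S-∏-suc; ∏-empty to S-∏-empty; ∏-cong to
      S-∏-cong; ∏-cong< to S-∏-cong<; ∏-* to S-∏-*; ∏-1 to S-∏-1; ∏-skip to S-∏-skip; ∏-last to S-∏-last)

  lins-geos : ∀ n x → lins n x ⊛ geos n x ≋ S.1#
  lins-geos n x = S.trans (S.sym (S-∏-* n (λ i → lin (x i)) (λ i → geo (x i)))) (S-∏-1 n (λ i _ → lin-geo (x i)))

  lins-zero : ∀ n x → lins n x 0 ≈ 1#
  lins-zero zero    x = coef-≈ (S-∏-empty _) 0
  lins-zero (suc n) x = trans (coef-≈ (S-∏-suc n _) 0) (trans (coef-lin-zero (x 0) (lins n (x ∘ suc)))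
      (lins-zero n (x ∘ suc)))

  geos-zero : ∀ n x → geos n x 0 ≈ 1#
  geos-zero zero    x = coef-≈ (S-∏-empty _) 0
  geos-zero (suc n) x = trans (coef-≈ (S-∏-suc n _) 0) (trans (*-identityˡ _) (geos-zero n (x ∘ suc)))

  -- Multiplication by a polynomial of degree k keeps coefficients in geometric progression.
  coef-lins : ∀ k (f : ℕ → Carrier) G l x g → (∀ t → G (l ℕ.+ t) ≈ g * geo x t) →
    ∀ t → (lins k f ⊛ G) (k ℕ.+ (l ℕ.+ t)) ≈ FiniteSums.∏ R k (λ i → x - f i) * g * geo x t
  coef-lins zero    f G l x g G≈ t = trans (coef-≈ (S.trans (S.*-congʳ (S-∏-empty _)) (S.*-identityˡ _)) (l ℕ.+ t))
    (trans (G≈ t) (*-congʳ (sym (trans (*-congʳ (FiniteSums.∏-empty R _)) (*-identityˡ _)))))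
  coef-lins (suc k) f G l x g G≈ t = begin
    (lins (suc k) f ⊛ G) (suc k ℕ.+ (l ℕ.+ t))
      ≈⟨ coef-≈ (S.trans (S.*-congʳ (S-∏-suc k _)) (S.*-assoc _ _ _)) (suc k ℕ.+ (l ℕ.+ t)) ⟩
    (lin (f 0) ⊛ (lins k (f ∘ suc) ⊛ G)) (suc (k ℕ.+ (l ℕ.+ t)))
      ≈⟨ coef-lin-suc (f 0) _ (k ℕ.+ (l ℕ.+ t)) ⟩
    (lins k (f ∘ suc) ⊛ G) (suc (k ℕ.+ (l ℕ.+ t))) - f 0 * (lins k (f ∘ suc) ⊛ G) (k ℕ.+ (l ℕ.+ t))
      ≈⟨ +-cong (trans (reflexive (≡.cong (lins k (f ∘ suc) ⊛ G)
           (≡.sym (≡.trans (≡.cong (k ℕ.+_) (ℕ.+-suc l t)) (ℕ.+-suc k (l ℕ.+ t))))))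
             (coef-lins k (f ∘ suc) G l x g G≈ (suc t)))
           (-‿cong (*-congˡ (coef-lins k (f ∘ suc) G l x g G≈ t))) ⟩
    Π * g * (x * geo x t) - f 0 * (Π * g * geo x t)
      ≈⟨ solve 5 (λ p q x g f → p :* q :* (x :* g) :- f :* (p :* q :* g) := (x :- f) :* p :* q :* g) refl Π g x
           (geo x t) (f 0) ⟩
    (x - f 0) * Π * g * geo x t
      ≈⟨ *-congʳ (*-congʳ (FiniteSums.∏-suc R k _)) ⟨
    FiniteSums.∏ R (suc k) (λ i → x - f i) * g * geo x t ∎
    where
    open import Relation.Binary.Reasoning.Setoid setoid
    Π = FiniteSums.∏ R k (λ i → x - f (suc i))

  -- A tail of zeros is a geometric progression with g = 0; a polynomial factor of degree k delays
  -- it by k places.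
  coef-lins-0 : ∀ k f G l → (∀ t → G (l ℕ.+ t) ≈ 0#) → ∀ t → (lins k f ⊛ G) (k ℕ.+ (l ℕ.+ t)) ≈ 0#
  coef-lins-0 k f G l G≈ t = trans (coef-lins k f G l 0# 0# (λ t → trans (G≈ t) (sym (zeroˡ _))) t)
    (trans (*-congʳ (zeroʳ _)) (zeroˡ _))

  private
    geo-0 : ∀ t → C 1# t ≈ 1# * geo 0# t
    geo-0 zero    = sym (*-identityˡ _)
    geo-0 (suc t) = sym (trans (*-identityˡ _) (zeroˡ _))

  -- The coefficients 1, 0, 0, ... of the series 1 form a geometric progression of ratio 0, so
  -- `coef-lins` applies with x = 0.
  coef-lins-top : ∀ k f → lins k f k ≈ FiniteSums.∏ R k (λ i → - f i)
  coef-lins-top k f = begin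
    lins k f k                                        ≈⟨ coef-≈ (S.*-identityʳ _) k ⟨
    (lins k f ⊛ S.1#) k                               ≡⟨ ≡.cong (lins k f ⊛ S.1#) (ℕ.+-identityʳ k) ⟨
    (lins k f ⊛ S.1#) (k ℕ.+ 0)                       ≈⟨ coef-lins k f S.1# 0 0# 1# geo-0 0 ⟩
    FiniteSums.∏ R k (λ i → 0# - f i) * 1# * 1#       ≈⟨ trans (*-identityʳ _) (*-identityʳ _) ⟩
    FiniteSums.∏ R k (λ i → 0# - f i)                 ≈⟨ FiniteSums.∏-cong R k (λ i → +-identityˡ _) ⟩
    FiniteSums.∏ R k (λ i → - f i)                    ∎
    where open import Relation.Binary.Reasoning.Setoid setoid

  coef-lins-> : ∀ k f t → lins k f (k ℕ.+ suc t) ≈ 0#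
  coef-lins-> k f t = trans (sym (coef-≈ (S.*-identityʳ _) (k ℕ.+ suc t))) (coef-lins-0 k f S.1# 1 (λ _ → refl) t)

-- Vandermonde products and Lagrange interpolation

module Vandermonde {c ℓ} (R : CommutativeRing c ℓ) where
  open CommutativeRing R
  open RingTactic R
  open FiniteSums R
  open Determinants R
  open PowerSeries R
  private module Σ = FiniteSums seriesRing

  V : ℕ → (ℕ → Carrier) → Carrier
  V zero    X = 1#
  V (suc n) X = ∏ n (λ i → X 0 - X (suc i)) * V n (X ∘ suc)

  V-cong : ∀ n {X Y} → (∀ i → i ℕ.< n → X i ≈ Y i) → V n X ≈ V n Y
  V-cong zero    X≈Y = refl
  V-cong (suc n) X≈Y = *-cong
    (∏-cong< n (λ i i<n → +-cong (X≈Y 0 (s≤s z≤n)) (-‿cong (X≈Y (suc i) (s≤s i<n)))))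
    (V-cong n (λ i i<n → X≈Y (suc i) (s≤s i<n)))

  -- This is V(x) / Π (xₖ - xᵢ) over i ≠ k, the interpolation coefficient cleared of denominators;
  -- the sign comes from moving xₖ to the front of V.
  weight : ℕ → (ℕ → Carrier) → ℕ → Carrier
  weight n X k = sg k * V n (X ∘ skip k)

  private
    open import Relation.Binary.Reasoning.Setoid setoid

    Det-scale : ∀ n d A → Det n (λ j i → d i * A j i) ≈ ∏ n d * Det n A
    Det-scale zero    d A = sym (trans (*-congʳ (∏-empty d)) (*-identityˡ _))
    Det-scale (suc n) d A = trans (∑-cong< (suc n) (λ { i (s≤s i≤n) → begin
      sg i * ((d i * A 0 i) * Det n (λ j k → d (skip i k) * A (suc j) (skip i k)))
        ≈⟨ *-congˡ (*-congˡ (Det-scale n (d ∘ skip i) (λ j k → A (suc j) (skip i k)))) ⟩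
      sg i * ((d i * A 0 i) * (∏ n (d ∘ skip i) * Det n (λ j k → A (suc j) (skip i k))))
        ≈⟨ solve 5 (λ s d a p m → s :* ((d :* a) :* (p :* m)) := (d :* p) :* (s :* (a :* m))) refl _ _ _ _ _ ⟩
      (d i * ∏ n (d ∘ skip i)) * (sg i * (A 0 i * Det n (λ j k → A (suc j) (skip i k))))
        ≈⟨ *-congʳ (∏-skip n i d i≤n) ⟨
      ∏ (suc n) d * (sg i * (A 0 i * Det n (λ j k → A (suc j) (skip i k)))) ∎ }))
      (sym (*-∑ (suc n) (∏ (suc n) d) _))

    -- σ n is (-1) to the power n (n - 1) / 2: the determinant of powers has the factors xⱼ - xᵢ
    -- with i < j, which `V` has reversed.
    σ : ℕ → Carrier
    σ zero    = 1#
    σ (suc n) = sg n * σ n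

    σ-square : ∀ n → σ n * σ n ≈ 1#
    σ-square zero    = *-identityˡ _
    σ-square (suc n) = trans (solve 2 (λ a b → (a :* b) :* (a :* b) := (a :* a) :* (b :* b)) refl _ _)
      (trans (*-cong (sg-square n) (σ-square n)) (*-identityˡ _))

    ∏-flip : ∀ n x (y : ℕ → Carrier) → ∏ n (λ i → y i - x) ≈ sg n * ∏ n (λ i → x - y i)
    ∏-flip zero    x y = trans (∏-empty _) (sym (trans (*-identityˡ _) (∏-empty _)))
    ∏-flip (suc n) x y = trans (∏-suc n _) (trans (*-congˡ (∏-flip n x (y ∘ suc)))
      (trans (solve 4 (λ x y s p → (y :- x) :* (s :* p) := (:- s) :* ((x :- y) :* p)) refl x (y 0) (sg n) _)
          (*-congˡ (sym (∏-suc n _)))))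

    powers : (ℕ → Carrier) → ℕ → ℕ → Carrier
    powers X j i = geo (X i) j

    -- Subtracting x₀ times each column from its right neighbour turns row 0 into a unit vector and
    -- gives the rest of row i the factor xᵢ - x₀.
    Det-powers : ∀ n X → Det n (powers X) ≈ σ n * V n X
    Det-powers zero    X = sym (*-identityˡ _)
    Det-powers (suc n) X = begin
      Det (suc n) (powers X)
        ≈⟨ Det-chain (suc n) 0 (X 0) {powers X} {A} (λ { zero _ i → refl })
             (λ j _ i → solve 3 (λ x y g → (y :- x) :* g := y :* g :- x :* g) refl (X 0) (X i) (geo (X i) j)) ⟨
      Det (suc n) A
        ≈⟨ Det-transpose (suc n) A ⟩
      Det (suc n) (λ j i → A i j)
        ≈⟨ Det-unit n 0 (λ i → A i 0) (λ j i → A i (suc j)) z≤n refl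
             (λ { zero 0≢0 → contradiction ≡.refl 0≢0 ; (suc i) _ → trans (*-congʳ (-‿inverseʳ (X 0))) (zeroˡ _)
                 }) ⟩
      1# * Det n (λ j i → A (suc i) (suc j))
        ≈⟨ trans (*-identityˡ _) (Det-transpose n (λ j i → A (suc i) (suc j))) ⟩
      Det n (λ j i → (X (suc i) - X 0) * powers (X ∘ suc) j i)
        ≈⟨ Det-scale n (λ i → X (suc i) - X 0) (powers (X ∘ suc)) ⟩
      ∏ n (λ i → X (suc i) - X 0) * Det n (powers (X ∘ suc))
        ≈⟨ *-cong (∏-flip n (X 0) (X ∘ suc)) (Det-powers n (X ∘ suc)) ⟩
      (sg n * ∏ n (λ i → X 0 - X (suc i))) * (σ n * V n (X ∘ suc))
        ≈⟨ solve 4 (λ a b c d → (a :* b) :* (c :* d) := (a :* c) :* (b :* d)) refl _ _ _ _ ⟩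
      σ (suc n) * V (suc n) X ∎
      where
      A : ℕ → ℕ → Carrier
      A zero    i = 1#
      A (suc j) i = (X i - X 0) * geo (X i) j

  -- Up to sign, the sum expands a determinant with two columns of ones.
  ∑-weights : ∀ n X → ∑ (2 ℕ.+ n) (weight (suc n) X) ≈ 0#
  ∑-weights n X = begin
    ∑ (2 ℕ.+ n) (weight (suc n) X)
      ≈⟨ trans (sym (*-identityˡ _)) (trans (*-congʳ (sym (σ-square (suc n)))) (*-assoc _ _ _)) ⟩
    σ (suc n) * (σ (suc n) * ∑ (2 ℕ.+ n) (weight (suc n) X))
      ≈⟨ *-congˡ (*-∑ (2 ℕ.+ n) (σ (suc n)) _) ⟩
    σ (suc n) * ∑ (2 ℕ.+ n) (λ k → σ (suc n) * weight (suc n) X k)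
      ≈⟨ *-congˡ (∑-cong (2 ℕ.+ n) (λ k → trans (solve 3 (λ a s v → a :* (s :* v) := s :* (:1 :* (a :* v))) refl
           _ _ _)
           (*-congˡ (*-congˡ (sym (Det-powers (suc n) (X ∘ skip k))))))) ⟩
    σ (suc n) * Det (2 ℕ.+ n) ((λ _ → 1#) ◂ powers X)
      ≈⟨ *-congˡ (Det-repeated (suc n) 0 (λ _ → 1#) (powers X) (s≤s z≤n) (λ _ → refl)) ⟩
    σ (suc n) * 0#
      ≈⟨ zeroʳ _ ⟩
    0# ∎

  -- The difference on the left is, up to sign, the one factor of Π (x₀ - xᵢ) that is missing once
  -- x₍ₖ₊₁₎ is deleted.
  weight-suc : ∀ n X k → k ℕ.≤ n →
    weight (suc n) X (suc k) * (X (suc k) - X 0) ≈ ∏ (suc n) (λ i → X 0 - X (suc i)) * weight n (X ∘ suc) k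
  weight-suc n X k k≤n = begin
    (- sg k * (∏ n (λ i → X 0 - X (suc (skip k i))) * V n (X ∘ suc ∘ skip k))) * (X (suc k) - X 0)
      ≈⟨ solve 5 (λ s p v x y → ((:- s) :* (p :* v)) :* (x :- y) := ((y :- x) :* p) :* (s :* v)) refl _ _ _ _ _ ⟩
    ((X 0 - X (suc k)) * ∏ n (λ i → X 0 - X (suc (skip k i)))) * weight n (X ∘ suc) k
      ≈⟨ *-congʳ (∏-skip n k (λ i → X 0 - X (suc i)) k≤n) ⟨
    ∏ (suc n) (λ i → X 0 - X (suc i)) * weight n (X ∘ suc) k ∎

  C-∑ : ∀ n f → S.∑ n (λ k → C (f k)) ≋ C (∑ n f)
  C-∑ zero    f = S.trans (Σ.∑-empty _) (S.trans (S.sym C-0) (C-cong (sym (∑-empty f))))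
  C-∑ (suc n) f = S.trans (Σ.∑-suc n _) (S.trans (S.+-congˡ (C-∑ n (f ∘ suc)))
    (S.trans (S.sym (C-+ _ _)) (C-cong (sym (∑-suc n f)))))

  -- Lagrange interpolation: partial fractions of Π 1 / (1 - c xᵢ z).
  lagrange : ∀ n a X → S.∑ (suc n) (λ k → C (weight n X k) ⊛ geo (a * X k)) ≋
    C (V (suc n) X * geo a n) ⊛ (z^ n ⊛ geos (suc n) (λ k → a * X k))
  lagrange zero    a X = S.trans (Σ.∑-suc 0 _) (S.trans (S.+-cong
      (S.*-cong (C-cong (trans (*-identityˡ _) (sym (trans (*-identityʳ _) (trans (*-identityʳ _) (∏-empty _))))))
        (S.sym (S.trans (Σ.∏-suc 0 _) (S.trans (S.*-congˡ (Σ.∏-empty _)) (S.*-identityʳ _)))))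
      (Σ.∑-empty _)) (S.+-identityʳ _))
  lagrange (suc n) a X = SR.begin
    S.∑ (2 ℕ.+ n) (λ k → C (w k) ⊛ geo (a * X k))
      -- Multiplication by 1 - a x₀ z reduces the term k = 0 to a constant and splits a constant off
      -- every other term. The constants add up to 0 by `∑-weights`, and what remains is the
      -- identity without x₀.
      SR.≈⟨ S.trans (S.sym (S.*-identityˡ _)) (S.trans (S.*-congʳ
           (S.trans (S.sym (lin-geo (a * X 0))) (S.*-comm _ _))) (S.*-assoc _ _ _)) ⟩
    geo (a * X 0) ⊛ (lin (a * X 0) ⊛ S.∑ (2 ℕ.+ n) (λ k → C (w k) ⊛ geo (a * X k)))
      SR.≈⟨ S.*-congˡ (Σ.*-∑ (2 ℕ.+ n) (lin (a * X 0)) _) ⟩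
    geo (a * X 0) ⊛ S.∑ (2 ℕ.+ n) (λ k → lin (a * X 0) ⊛ (C (w k) ⊛ geo (a * X k)))
      SR.≈⟨ S.*-congˡ (Σ.∑-cong (2 ℕ.+ n) reduce) ⟩
    geo (a * X 0) ⊛ S.∑ (2 ℕ.+ n) (λ k → C (w k) ⊕ (C (a * (w k * (X k - X 0))) ⊛ (z ⊛ geo (a * X k))))
      SR.≈⟨ S.*-congˡ (S.trans (Σ.∑-+ (2 ℕ.+ n) (λ k → C (w k)) _) (S.+-cong
           (S.trans (C-∑ (2 ℕ.+ n) w) (S.trans (C-cong (∑-weights n X)) C-0)) (Σ.∑-suc (suc n) _))) ⟩
    geo (a * X 0) ⊛ (S.0# ⊕ ((C (a * (w 0 * (X 0 - X 0))) ⊛ (z ⊛ geo (a * X 0))) ⊕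
      S.∑ (suc n) (λ k → C (a * (w (suc k) * (X (suc k) - X 0))) ⊛ (z ⊛ geo (a * X (suc k))))))
      SR.≈⟨ S.*-congˡ (S.trans (S.+-identityˡ _) (S.trans (S.+-congʳ (S.trans (S.*-congʳ (S.trans
           (C-cong (solve 3 (λ a w x → a :* (w :* (x :- x)) := :0) refl a (w 0) (X 0))) C-0)) (S.zeroˡ _)))
               (S.+-identityˡ _))) ⟩
    geo (a * X 0) ⊛ S.∑ (suc n) (λ k → C (a * (w (suc k) * (X (suc k) - X 0))) ⊛ (z ⊛ geo (a * X (suc k))))
      SR.≈⟨ S.*-congˡ (Σ.∑-cong< (suc n) (λ { k (s≤s k≤n) → S.trans
           (S.*-congʳ (S.trans (C-cong (trans (*-congˡ (weight-suc n X k k≤n)) (sym (*-assoc _ _ _)))) (C-* _ _)))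
           (Sol.solve 4 (λ p w z g → (p Sol.:* w) Sol.:* (z Sol.:* g) Sol.:= (p Sol.:* z) Sol.:* (w Sol.:* g))
               S.refl _ _ _ _) })) ⟩
    geo (a * X 0) ⊛ S.∑ (suc n) (λ k → (C (a * Π) ⊛ z) ⊛ (C (weight n (X ∘ suc) k) ⊛ geo (a * X (suc k))))
      SR.≈⟨ S.*-congˡ (S.trans (S.sym (Σ.*-∑ (suc n) (C (a * Π) ⊛ z) _)) (S.*-congˡ (lagrange n a (X ∘ suc)))) ⟩
    geo (a * X 0) ⊛ ((C (a * Π) ⊛ z) ⊛ (C (V (suc n) (X ∘ suc) * geo a n) ⊛
        (z^ n ⊛ geos (suc n) (λ k → a * X (suc k)))))
      SR.≈⟨ Sol.solve 5 (λ g p z v y → g Sol.:* ((p Sol.:* z) Sol.:* (v Sol.:* y)) Sol.:= (p Sol.:* v) Sol.:*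
           (z Sol.:* (y Sol.:* g))) S.refl _ _ _ _ _ ⟩
    (C (a * Π) ⊛ C (V (suc n) (X ∘ suc) * geo a n)) ⊛ (z ⊛
        ((z^ n ⊛ geos (suc n) (λ k → a * X (suc k))) ⊛ geo (a * X 0)))
      SR.≈⟨ S.*-cong (S.trans (S.sym (C-* _ _)) (C-cong
           (solve 4 (λ a p v g → (a :* p) :* (v :* g) := (p :* v) :* (a :* g)) refl a Π _ _)))
           (S.*-congˡ (S.trans (z^-*ʳ n _ _) (z^-cong n (S.trans (S.*-comm _ _) (S.sym (Σ.∏-suc (suc n) _)))))) ⟩
    C (V (2 ℕ.+ n) X * geo a (suc n)) ⊛ (z ⊛ (z^ n ⊛ geos (2 ℕ.+ n) (λ k → a * X k))) SR.∎
    where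
    import Relation.Binary.Reasoning.Setoid S.setoid as SR
    module Sol = RingTactic seriesRing
    w = weight (suc n) X
    Π = ∏ (suc n) (λ i → X 0 - X (suc i))
    reduce : ∀ k → lin (a * X 0) ⊛ (C (w k) ⊛ geo (a * X k)) ≋ C (w k) ⊕
        (C (a * (w k * (X k - X 0))) ⊛ (z ⊛ geo (a * X k)))
    reduce k = SR.begin
      lin (a * X 0) ⊛ (C (w k) ⊛ geo (a * X k))
        SR.≈⟨ Sol.solve 5 (λ x y z w g → (Sol.:1 Sol.:- x Sol.:* z) Sol.:* (w Sol.:* g) Sol.:=
             w Sol.:* ((Sol.:1 Sol.:- y Sol.:* z) Sol.:* g) Sol.:+ (w Sol.:* (y Sol.:- x)) Sol.:* (z Sol.:* g))
                 S.refl (C (a * X 0)) (C (a * X k)) z (C (w k)) (geo (a * X k)) ⟩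
      (C (w k) ⊛ (lin (a * X k) ⊛ geo (a * X k))) ⊕ ((C (w k) ⊛ (C (a * X k) ⊕ neg (C (a * X 0)))) ⊛
          (z ⊛ geo (a * X k)))
        SR.≈⟨ S.+-cong (S.trans (S.*-congˡ (lin-geo (a * X k))) (S.*-identityʳ _)) (S.*-congʳ (S.trans
             (S.*-congˡ (S.trans (S.+-congˡ (S.sym (C-neg (a * X 0)))) (S.sym (C-+ _ _))))
             (S.trans (S.sym (C-* _ _)) (C-cong (solve 4
                 (λ w a x y → w :* (a :* x :+ :- (a :* y)) := a :* (w :* (x :- y))) refl (w k) a (X k) (X 0)))))) ⟩
      C (w k) ⊕ (C (a * (w k * (X k - X 0))) ⊛ (z ⊛ geo (a * X k))) SR.∎

-- Partial fractions of the generating function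

module GeneratingFunctions {c ℓ} (R : CommutativeRing c ℓ) where
  open CommutativeRing R
  open RingTactic R
  open FiniteSums R
  open PowerSeries R
  open Vandermonde R
  private
    module Σ = FiniteSums seriesRing
    module Sol = RingTactic seriesRing
    open import Relation.Binary.Reasoning.Setoid setoid
    import Relation.Binary.Reasoning.Setoid S.setoid as SR

  -- Π (u + yⱼ) / Π (u - xᵢ) up to a power of u, in terms of z = 1 / u.
  generating : ℕ → ℕ → (ℕ → Carrier) → (ℕ → Carrier) → Series
  generating nx ny X Y = lins ny (λ j → - Y j) ⊛ geos nx X

  generating-dropˣ : ∀ n ny X Y k → k ℕ.≤ n → generating n ny (X ∘ skip k) Y ≋ lin (X k) ⊛ generating (suc n) ny X Y
  generating-dropˣ n ny X Y k k≤n = S.sym (SR.begin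
    lin (X k) ⊛ (lins ny (λ j → - Y j) ⊛ geos (suc n) X)
      SR.≈⟨ S.*-congˡ (S.*-congˡ (Σ.∏-skip n k (λ i → geo (X i)) k≤n)) ⟩
    lin (X k) ⊛ (lins ny (λ j → - Y j) ⊛ (geo (X k) ⊛ geos n (X ∘ skip k)))
      SR.≈⟨ Sol.solve 4 (λ a b c d → a Sol.:* (b Sol.:* (c Sol.:* d)) Sol.:= (a Sol.:* c) Sol.:* (b Sol.:* d))
           S.refl _ _ _ _ ⟩
    (lin (X k) ⊛ geo (X k)) ⊛ generating n ny (X ∘ skip k) Y
      SR.≈⟨ S.trans (S.*-congʳ (lin-geo (X k))) (S.*-identityˡ _) ⟩
    generating n ny (X ∘ skip k) Y SR.∎)

  generating-dropʸ : ∀ nx n X Y k → k ℕ.≤ n → generating nx (suc n) X Y ≋ lin (- Y k) ⊛ generating nx n X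
      (Y ∘ skip k)
  generating-dropʸ nx n X Y k k≤n = S.trans (S.*-congʳ (Σ.∏-skip n k (λ j → lin (- Y j)) k≤n)) (S.*-assoc _ _ _)

  geo-1 : ∀ n → geo 1# n ≈ 1#
  geo-1 zero    = refl
  geo-1 (suc n) = trans (*-identityˡ _) (geo-1 n)

  lagrange₁ : ∀ n X → S.∑ (suc n) (λ k → C (weight n X k) ⊛ geo (X k)) ≋ C (V (suc n) X) ⊛ (z^ n ⊛ geos (suc n) X)
  lagrange₁ n X = SR.begin
    S.∑ (suc n) (λ k → C (weight n X k) ⊛ geo (X k))
      SR.≈⟨ Σ.∑-cong (suc n) (λ k → S.*-congˡ (scaled k)) ⟩
    S.∑ (suc n) (λ k → C (weight n X k) ⊛ geo (1# * X k))
      SR.≈⟨ lagrange n 1# X ⟩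
    C (V (suc n) X * geo 1# n) ⊛ (z^ n ⊛ geos (suc n) (λ k → 1# * X k))
      SR.≈⟨ S.*-cong (C-cong (trans (*-congˡ (geo-1 n)) (*-identityʳ _)))
           (z^-cong n (Σ.∏-cong (suc n) (λ k → S.sym (scaled k)))) ⟩
    C (V (suc n) X) ⊛ (z^ n ⊛ geos (suc n) X) SR.∎
    where
    scaled : ∀ k → geo (X k) ≋ geo (1# * X k)
    scaled k = coefficientwise (geo-cong (sym (*-identityˡ _)))

  -- The sum of f(xₖ) / Π (xₖ - xᵢ) over n + 1 points vanishes for f of degree below n. For
  -- monomials this is the factor zⁿ in `lagrange₁`; the linear factors are expanded one at a time.
  ∑-weights-small : ∀ n X τ (cs : ℕ → Carrier) t → τ ℕ.+ t ℕ.< n →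
    ∑ (suc n) (λ k → weight n X k * (∏ τ (λ i → X k + cs i) * geo (X k) t)) ≈ 0#
  ∑-weights-small n X zero cs t t<n = begin
    ∑ (suc n) (λ k → weight n X k * (∏ 0 (λ i → X k + cs i) * geo (X k) t))
      ≈⟨ ∑-cong (suc n) (λ k → trans (*-congˡ (trans (*-congʳ (∏-empty _)) (*-identityˡ _)))
           (sym (coef-C (weight n X k) (geo (X k)) t))) ⟩
    ∑ (suc n) (λ k → (C (weight n X k) ⊛ geo (X k)) t)
      ≈⟨ coef-∑ (suc n) _ t ⟨
    S.∑ (suc n) (λ k → C (weight n X k) ⊛ geo (X k)) t
      ≈⟨ coef-≈ (lagrange₁ n X) t ⟩
    (C (V (suc n) X) ⊛ (z^ n ⊛ geos (suc n) X)) t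
      ≈⟨ coef-C (V (suc n) X) _ t ⟩
    V (suc n) X * (z^ n ⊛ geos (suc n) X) t
      ≈⟨ trans (*-congˡ (at-z^-< n (geos (suc n) X) (≡.subst (t ℕ.<_) (≡.sym (ℕ.+-identityʳ n)) t<n))) (zeroʳ _) ⟩
    0# ∎
  ∑-weights-small n X (suc τ) cs t τt<n = begin
    ∑ (suc n) (λ k → weight n X k * (∏ (suc τ) (λ i → X k + cs i) * geo (X k) t))
      ≈⟨ ∑-cong (suc n) (λ k → trans (*-congˡ (*-congʳ (∏-suc τ _)))
           (solve 5 (λ w x c p g → w :* (((x :+ c) :* p) :* g) := w :* (p :* (x :* g)) :+ c :* (w :* (p :* g)))
               refl _ _ _ _ _)) ⟩
    ∑ (suc n) (λ k → weight n X k * (∏ τ (λ i → X k + cs (suc i)) * geo (X k) (suc t)) +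
      cs 0 * (weight n X k * (∏ τ (λ i → X k + cs (suc i)) * geo (X k) t)))
      ≈⟨ trans (∑-+ (suc n) _ _) (+-congˡ (sym (*-∑ (suc n) (cs 0) _))) ⟩
    ∑ (suc n) (λ k → weight n X k * (∏ τ (λ i → X k + cs (suc i)) * geo (X k) (suc t))) +
      cs 0 * ∑ (suc n) (λ k → weight n X k * (∏ τ (λ i → X k + cs (suc i)) * geo (X k) t))
      ≈⟨ +-cong (∑-weights-small n X τ (cs ∘ suc) (suc t) (≡.subst (ℕ._< n) (≡.sym (ℕ.+-suc τ t)) τt<n))
           (*-congˡ (∑-weights-small n X τ (cs ∘ suc) t (ℕ.<⇒≤ τt<n))) ⟩
    0# + cs 0 * 0#
      ≈⟨ solve 1 (λ c → :0 :+ c :* :0 := :0) refl (cs 0) ⟩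
    0# ∎

  generating-lagrangeˣ : ∀ n ny X Y →
    S.∑ (suc n) (λ k → C (weight n X k) ⊛ (lins ny (λ j → - Y j) ⊛ geo (X k))) ≋
    C (V (suc n) X) ⊛ (z^ n ⊛ generating (suc n) ny X Y)
  generating-lagrangeˣ n ny X Y = SR.begin
    S.∑ (suc n) (λ k → C (weight n X k) ⊛ (L ⊛ geo (X k)))
      SR.≈⟨ Σ.∑-cong (suc n) (λ k → Sol.solve 3 (λ w l g → w Sol.:* (l Sol.:* g) Sol.:= l Sol.:* (w Sol.:* g))
           S.refl _ _ _) ⟩
    S.∑ (suc n) (λ k → L ⊛ (C (weight n X k) ⊛ geo (X k)))
      SR.≈⟨ S.trans (S.sym (Σ.*-∑ (suc n) L _)) (S.*-congˡ (lagrange₁ n X)) ⟩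
    L ⊛ (C (V (suc n) X) ⊛ (z^ n ⊛ geos (suc n) X))
      SR.≈⟨ Sol.solve 3 (λ l v g → l Sol.:* (v Sol.:* g) Sol.:= v Sol.:* (g Sol.:* l)) S.refl _ _ _ ⟩
    C (V (suc n) X) ⊛ ((z^ n ⊛ geos (suc n) X) ⊛ L)
      SR.≈⟨ S.*-congˡ (S.trans (z^-*ʳ n _ L) (z^-cong n (S.*-comm _ L))) ⟩
    C (V (suc n) X) ⊛ (z^ n ⊛ generating (suc n) ny X Y) SR.∎
    where L = lins ny (λ j → - Y j)

  -- Omitting yₖ divides F by 1 + yₖ z, so this is F times the partial fractions of Π 1 / (1 + yₖ
  -- z), whose product with F has no numerator left. The poles are at -yₖ, so `lagrange` is used
  -- with scale -1, and (-1)ⁿ is the origin of `sg n`.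
  generating-lagrangeʸ : ∀ nx n X Y →
    S.∑ (suc n) (λ k → C (weight n Y k) ⊛ generating nx n X (Y ∘ skip k)) ≋ C (V (suc n) Y * sg n) ⊛
        (z^ n ⊛ geos nx X)
  generating-lagrangeʸ nx n X Y = SR.begin
    S.∑ (suc n) (λ k → C (weight n Y k) ⊛ generating nx n X (Y ∘ skip k))
      SR.≈⟨ Σ.∑-cong< (suc n) (λ { k (s≤s k≤n) → S.trans (S.*-congˡ (dropped k k≤n))
           (Sol.solve 3 (λ w f g → w Sol.:* (f Sol.:* g) Sol.:= f Sol.:* (w Sol.:* g)) S.refl _ _ _) }) ⟩
    S.∑ (suc n) (λ k → F ⊛ (C (weight n Y k) ⊛ geo (- 1# * Y k)))
      SR.≈⟨ S.trans (S.sym (Σ.*-∑ (suc n) F _)) (S.*-congˡ (lagrange n (- 1#) Y)) ⟩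
    F ⊛ (C (V (suc n) Y * geo (- 1#) n) ⊛ (z^ n ⊛ G))
      SR.≈⟨ Sol.solve 3 (λ f v g → f Sol.:* (v Sol.:* g) Sol.:= v Sol.:* (g Sol.:* f)) S.refl _ _ _ ⟩
    C (V (suc n) Y * geo (- 1#) n) ⊛ ((z^ n ⊛ G) ⊛ F)
      SR.≈⟨ S.*-cong (C-cong (*-congˡ (trans (geo-neg 1# n) (trans (*-congˡ (geo-1 n)) (*-identityʳ _)))))
           (S.trans (z^-*ʳ n G F) (z^-cong n cancel)) ⟩
    C (V (suc n) Y * sg n) ⊛ (z^ n ⊛ geos nx X) SR.∎
    where
    F = generating nx (suc n) X Y
    G = geos (suc n) (λ k → - 1# * Y k)
    minus : ∀ y → geo (- 1# * y) ≋ geo (- y)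
    minus y = coefficientwise (geo-cong (solve 1 (λ y → (:- :1) :* y := :- y) refl y))
    dropped : ∀ k → k ℕ.≤ n → generating nx n X (Y ∘ skip k) ≋ F ⊛ geo (- 1# * Y k)
    dropped k k≤n = S.sym (SR.begin
      F ⊛ geo (- 1# * Y k)
        SR.≈⟨ S.*-cong (generating-dropʸ nx n X Y k k≤n) (minus (Y k)) ⟩
      (lin (- Y k) ⊛ generating nx n X (Y ∘ skip k)) ⊛ geo (- Y k)
        SR.≈⟨ Sol.solve 3 (λ l f g → (l Sol.:* f) Sol.:* g Sol.:= (l Sol.:* g) Sol.:* f) S.refl _ _ _ ⟩
      (lin (- Y k) ⊛ geo (- Y k)) ⊛ generating nx n X (Y ∘ skip k)
        SR.≈⟨ S.trans (S.*-congʳ (lin-geo (- Y k))) (S.*-identityˡ _) ⟩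
      generating nx n X (Y ∘ skip k) SR.∎)
    cancel : G ⊛ F ≋ geos nx X
    cancel = SR.begin
      G ⊛ (lins (suc n) (λ j → - Y j) ⊛ geos nx X)
        SR.≈⟨ S.*-congʳ (Σ.∏-cong (suc n) (λ k → minus (Y k))) ⟩
      geos (suc n) (λ j → - Y j) ⊛ (lins (suc n) (λ j → - Y j) ⊛ geos nx X)
        SR.≈⟨ Sol.solve 3 (λ g l x → g Sol.:* (l Sol.:* x) Sol.:= (l Sol.:* g) Sol.:* x) S.refl _ _ _ ⟩
      (lins (suc n) (λ j → - Y j) ⊛ geos (suc n) (λ j → - Y j)) ⊛ geos nx X
        SR.≈⟨ S.trans (S.*-congʳ (lins-geos (suc n) _)) (S.*-identityˡ _) ⟩
      geos nx X SR.∎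

  -- The Lagrange polynomials at 0 sum to 1. Here this is read off from the coefficient of zⁿ in
  -- `generating-lagrangeʸ` without x's, the top coefficient of each Π (1 + xᵢ z), i ≠ k.
  ∑-weights-top : ∀ n X → ∑ (suc n) (λ k → weight n X k * ∏ n (X ∘ skip k)) ≈ sg n * V (suc n) X
  ∑-weights-top n X = begin
    ∑ (suc n) (λ k → weight n X k * ∏ n (X ∘ skip k))
      ≈⟨ ∑-cong (suc n) (λ k → *-congˡ (sym (top k))) ⟩
    ∑ (suc n) (λ k → weight n X k * generating 0 n X (X ∘ skip k) n)
      ≈⟨ trans (coef-∑ (suc n) _ n) (∑-cong (suc n) (λ k → coef-C _ _ n)) ⟨
    S.∑ (suc n) (λ k → C (weight n X k) ⊛ generating 0 n X (X ∘ skip k)) n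
      ≈⟨ coef-≈ (generating-lagrangeʸ 0 n X X) n ⟩
    (C (V (suc n) X * sg n) ⊛ (z^ n ⊛ geos 0 X)) n
      ≈⟨ coef-C _ _ n ⟩
    (V (suc n) X * sg n) * (z^ n ⊛ geos 0 X) n
      ≈⟨ *-congˡ (trans (reflexive (≡.cong (z^ n ⊛ geos 0 X) (≡.sym (ℕ.+-identityʳ n))))
           (trans (at-z^ n (geos 0 X) 0 0) (geos-zero 0 X))) ⟩
    (V (suc n) X * sg n) * 1#
      ≈⟨ solve 2 (λ v s → (v :* s) :* :1 := s :* v) refl _ _ ⟩
    sg n * V (suc n) X ∎
    where
    top : ∀ k → generating 0 n X (X ∘ skip k) n ≈ ∏ n (X ∘ skip k)
    top k = trans (coef-≈ (S.trans (S.*-congˡ (Σ.∏-empty _)) (S.*-identityʳ _)) n) (trans (coef-lins-top n _)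
      (∏-cong n (λ i → solve 1 (λ x → :- (:- x) := x) refl (X (skip k i)))))

-- The Gram matrix of the residue pairing

module GramMatrix {c ℓ} (R : CommutativeRing c ℓ) (a b : ℕ → CommutativeRing.Carrier R) where
  open CommutativeRing R
  open FiniteSums R
  open Determinants R
  open PowerSeries R
  private
    module Σ = FiniteSums seriesRing
    module Sol = RingTactic seriesRing
    open import Relation.Binary.Reasoning.Setoid setoid

  glue-cong : ∀ q {f f′ g g′ : ℕ → ℕ → Carrier} → (∀ j i → f j i ≈ f′ j i) → (∀ l i → g l i ≈ g′ l i) →
    ∀ j i → glue q f g j i ≈ glue q f′ g′ j i
  glue-cong zero    f≈ g≈ j       i = g≈ j i
  glue-cong (suc q) f≈ g≈ zero    i = f≈ 0 i
  glue-cong (suc q) f≈ g≈ (suc j) i = glue-cong q (f≈ ∘ suc) g≈ j i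

  glue-same : ∀ q (f g g′ : ℕ → ℕ → Carrier) → (∀ i → g′ 0 i ≈ g 0 i) →
    ∀ j → j ℕ.≤ q → ∀ i → glue q f g′ j i ≈ glue q f g j i
  glue-same zero    f g g′ g≈ zero    _         i = g≈ i
  glue-same (suc q) f g g′ g≈ zero    _         i = refl
  glue-same (suc q) f g g′ g≈ (suc j) (s≤s j≤q) i = glue-same q (f ∘ suc) g g′ g≈ j j≤q i

  glue-step : ∀ q x (f g g′ : ℕ → ℕ → Carrier) → (∀ l i → g′ (suc l) i ≈ g (suc l) i - x * g l i) →
    ∀ j → q ℕ.≤ j → ∀ i → glue q f g′ (suc j) i ≈ glue q f g (suc j) i - x * glue q f g j i
  glue-step zero    x f g g′ g≈ j       _         i = g≈ j i
  glue-step (suc q) x f g g′ g≈ (suc j) (s≤s q≤j) i = glue-step q x (f ∘ suc) g g′ g≈ j q≤j i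

  Det-chain-glue : ∀ n q x (f g g′ : ℕ → ℕ → Carrier) → (∀ i → g′ 0 i ≈ g 0 i) →
    (∀ l i → g′ (suc l) i ≈ g (suc l) i - x * g l i) → Det n (glue q f g′) ≈ Det n (glue q f g)
  Det-chain-glue n q x f g g′ g≈ g-step =
    Det-chain n q x (glue-same q f g g′ g≈) (glue-step q x f g g′ g-step)

  -- The functional that kills the q legs and sends the column F times the l-th power of u to the
  -- l-th power of x.
  evaluation : ℕ → Carrier → ℕ → Carrier
  evaluation q x = glue q (λ _ → 0#) (geo x)

  unit : ℕ → ℕ → Carrier
  unit q = glue q (λ _ → 0#) (1# ◂ (λ _ → 0#))

  unit-at : ∀ q → unit q q ≈ 1#
  unit-at q = reflexive (glue-at q _ _)

  unit-≢ : ∀ q j → j ≢ q → unit q j ≈ 0#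
  unit-≢ zero    zero    j≢q = contradiction ≡.refl j≢q
  unit-≢ zero    (suc j) j≢q = refl
  unit-≢ (suc q) zero    j≢q = refl
  unit-≢ (suc q) (suc j) j≢q = unit-≢ q j (j≢q ∘ ≡.cong suc)

  Det-unit-row : ∀ m q (A : ℕ → ℕ → Carrier) → q ℕ.≤ m →
    Det (suc m) (unit q ◂ (λ i j → A j i)) ≈ sg q * Det m (A ∘ skip q)
  Det-unit-row m q A q≤m = trans (Det-unit m q (unit q) (λ i j → A j i) q≤m (unit-at q) (unit-≢ q))
    (*-congˡ (Det-transpose m (λ i j → A (skip q j) i)))

  glue-◂ : ∀ q (u v : ℕ → Carrier) (f g : ℕ → ℕ → Carrier) j i →
    glue q (λ j → u j ◂ f j) (λ l → v l ◂ g l) j i ≈ (glue q u v j ◂ glue q f g j) i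
  glue-◂ zero    u v f g j       i = refl
  glue-◂ (suc q) u v f g zero    i = refl
  glue-◂ (suc q) u v f g (suc j) i = glue-◂ q (u ∘ suc) v (f ∘ suc) g j i

  Det-rows : ∀ m (r : ℕ → Carrier) (A : ℕ → ℕ → Carrier) →
    Det (suc m) (r ◂ (λ i j → A j i)) ≈ Det (suc m) (λ j → r j ◂ A j)
  Det-rows m r A = trans (Det-transpose (suc m) (r ◂ (λ i j → A j i)))
    (Det-cong (suc m) {λ j i → (r ◂ (λ i j → A j i)) i j} {λ j → r j ◂ A j}
        (λ { j _ zero → refl ; j _ (suc i) → refl }))

  -- The row of evaluations at x of 1, u, u², … restricts the columns to multiples of u - x.
  Det-evaluation : ∀ m q x f g → q ℕ.≤ m →
    Det (suc m) (evaluation q x ◂ (λ i j → glue q f g j i)) ≈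
    sg q * Det m (glue q f (λ l i → g (suc l) i - x * g l i))
  Det-evaluation m q x f g q≤m = begin
    Det (suc m) (evaluation q x ◂ (λ i j → glue q f g j i))
      ≈⟨ Det-rows m (evaluation q x) (glue q f g) ⟩
    Det (suc m) (λ j → evaluation q x j ◂ glue q f g j)
      ≈⟨ Det-cong (suc m) (λ j _ i → glue-◂ q (λ _ → 0#) (geo x) f g j i) ⟨
    Det (suc m) (glue q (λ j → 0# ◂ f j) (λ l → geo x l ◂ g l))
      ≈⟨ Det-chain-glue (suc m) q x (λ j → 0# ◂ f j) (λ l → geo x l ◂ g l) (λ l → (1# ◂ (λ _ → 0#)) l ◂ g′ l)
           (λ { zero → refl ; (suc i) → refl }) (λ { l zero → sym (-‿inverseʳ _) ; l (suc i) → refl }) ⟨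
    Det (suc m) (glue q (λ j → 0# ◂ f j) (λ l → (1# ◂ (λ _ → 0#)) l ◂ g′ l))
      ≈⟨ Det-cong (suc m) (λ j _ i → glue-◂ q (λ _ → 0#) (1# ◂ (λ _ → 0#)) f g′ j i) ⟩
    Det (suc m) (λ j → unit q j ◂ glue q f g′ j)
      ≈⟨ Det-rows m (unit q) (glue q f g′) ⟨
    Det (suc m) (unit q ◂ (λ i j → glue q f g′ j i))
      ≈⟨ Det-unit-row m q (glue q f g′) q≤m ⟩
    sg q * Det m (glue q f g′ ∘ skip q)
      ≈⟨ *-congˡ (Det-cong m (λ j _ i → reflexive (≡.cong (λ u → u i) (glue-skip q f g′ j)))) ⟩
    sg q * Det m (glue q f (g′ ∘ suc)) ∎
    where
    g′ : ℕ → ℕ → Carrier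
    g′ zero      = g 0
    g′ (suc l) i = g (suc l) i - x * g l i

  -- (Q , A , B) is the row Q times u to the power A - B, and a series P at exponent k is the column
  -- P times u to the power k - 1. The pairing is the coefficient of 1 / u in their product; two
  -- naturals and `at` take the place of an integer exponent.
  Row : Set c
  Row = Series × ℕ × ℕ

  pairing : Row → Series → ℕ → Carrier
  pairing (Q , A , B) P k = at (Q ⊛ P) (A ℕ.+ k) B

  pairing-cong : ∀ ρ {P P′} k → P ≋ P′ → pairing ρ P k ≈ pairing ρ P′ k
  pairing-cong (Q , A , B) k P≋ = at-cong (S.*-congˡ P≋) (A ℕ.+ k) B

  pairing-⊕ : ∀ ρ P P′ k → pairing ρ (P ⊕ P′) k ≈ pairing ρ P k + pairing ρ P′ k
  pairing-⊕ (Q , A , B) P P′ k = trans (at-cong (S.distribˡ Q P P′) (A ℕ.+ k) B) (at-⊕ _ _ (A ℕ.+ k) B)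

  pairing-C : ∀ ρ x P k → pairing ρ (C x ⊛ P) k ≈ x * pairing ρ P k
  pairing-C (Q , A , B) x P k = trans
    (at-cong (Sol.solve 3 (λ q x p → q Sol.:* (x Sol.:* p) Sol.:= x Sol.:* (q Sol.:* p)) S.refl Q (C x) P)
        (A ℕ.+ k) B)
    (at-C x (Q ⊛ P) (A ℕ.+ k) B)

  pairing-∑ : ∀ ρ n f k → pairing ρ (S.∑ n f) k ≈ ∑ n (λ i → pairing ρ (f i) k)
  pairing-∑ ρ@(Q , A , B) zero    f k = trans (trans (at-cong (S.trans (S.*-congˡ (Σ.∑-empty f)) (S.zeroʳ Q))
      (A ℕ.+ k) B)
    (at-0 (A ℕ.+ k) B)) (sym (∑-empty _))
  pairing-∑ ρ (suc n) f k = trans (pairing-cong ρ k (Σ.∑-suc n f)) (trans (pairing-⊕ ρ (f 0) _ k)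
    (trans (+-congˡ (pairing-∑ ρ n (f ∘ suc) k)) (sym (∑-suc n _))))

  pairing-z : ∀ ρ P k → pairing ρ (z ⊛ P) (suc k) ≈ pairing ρ P k
  pairing-z (Q , A , B) P k = begin
    at (Q ⊛ (z ⊛ P)) (A ℕ.+ suc k) B
      ≈⟨ at-cong (Sol.solve 3 (λ q x p → q Sol.:* (x Sol.:* p) Sol.:= x Sol.:* (q Sol.:* p)) S.refl Q z P)
           (A ℕ.+ suc k) B ⟩
    at (z ⊛ (Q ⊛ P)) (A ℕ.+ suc k) B   ≡⟨ ≡.cong (λ i → at (z ⊛ (Q ⊛ P)) i B) (ℕ.+-suc A k) ⟩
    at (z ⊛ (Q ⊛ P)) (suc (A ℕ.+ k)) B ≈⟨ at-z (Q ⊛ P) (A ℕ.+ k) B ⟩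
    at (Q ⊛ P) (A ℕ.+ k) B             ∎

  pairing-z^ : ∀ ρ n P k → pairing ρ (z^ n ⊛ P) (n ℕ.+ k) ≈ pairing ρ P k
  pairing-z^ ρ zero    P k = refl
  pairing-z^ ρ (suc n) P k = trans (pairing-z ρ (z^ n ⊛ P) (n ℕ.+ k)) (pairing-z^ ρ n P k)

  pairing-lin : ∀ ρ x P k → pairing ρ (lin x ⊛ P) (suc k) ≈ pairing ρ P (suc k) - x * pairing ρ P k
  pairing-lin (Q , A , B) x P k = begin
    at (Q ⊛ (lin x ⊛ P)) (A ℕ.+ suc k) B
      ≈⟨ at-cong (Sol.solve 3 (λ q x p → q Sol.:* (x Sol.:* p) Sol.:= x Sol.:* (q Sol.:* p)) S.refl Q (lin x) P)
           (A ℕ.+ suc k) B ⟩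
    at (lin x ⊛ (Q ⊛ P)) (A ℕ.+ suc k) B   ≡⟨ ≡.cong (λ i → at (lin x ⊛ (Q ⊛ P)) i B) (ℕ.+-suc A k) ⟩
    at (lin x ⊛ (Q ⊛ P)) (suc (A ℕ.+ k)) B ≈⟨ at-lin x (Q ⊛ P) (A ℕ.+ k) B ⟩
    at (Q ⊛ P) (suc (A ℕ.+ k)) B - x * at (Q ⊛ P) (A ℕ.+ k) B
      ≡⟨ ≡.cong (λ i → at (Q ⊛ P) i B - x * at (Q ⊛ P) (A ℕ.+ k) B) (ℕ.+-suc A k) ⟨
    at (Q ⊛ P) (A ℕ.+ suc k) B - x * at (Q ⊛ P) (A ℕ.+ k) B ∎

  -- Exponents of rows are counted relative to p, so a change of p by one shifts them all;
  -- `pairing-bump` moves the shift into the column exponent.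
  bump : Row → Row
  bump (Q , A , B) = Q , A , suc B

  pairing-bump : ∀ ρ P k → pairing (bump ρ) P (suc k) ≈ pairing ρ P k
  pairing-bump (Q , A , B) P k = reflexive (≡.cong (λ i → at (Q ⊛ P) i (suc B)) (ℕ.+-suc A k))

  -- The row 1 / ((u - b₀) ⋯ (u - bᵣ)) of the Gram matrix, up to a power of z = 1 / u.
  H : ℕ → Series
  H r = geos (suc r) b

  -- Row i < p is the polynomial (u - a₀) ⋯ (u - a_(α i - 1)).
  rows : ℕ → (ℕ → ℕ) → ℕ → Row
  rows p α = glue p (λ i → lins (α i) a , α i , p) (λ r → H r , 0 , suc (p ℕ.+ r))

  rows-suc : ∀ p α i → rows (suc p) α (suc i) ≡ bump (rows p (α ∘ suc) i)
  rows-suc p α i = ≡.sym (glue-map bump p _ _ i)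

  column : ℕ → (ℕ → ℕ) → Series → ℕ → ℕ → Carrier
  column p α P k i = pairing (rows p α i) P k

  χ-columns : ℕ → (ℕ → ℕ) → (ℕ → ℕ) → ℕ → ℕ → Carrier
  χ-columns p α β j = column p α (lins (β j) b) (suc (β j ℕ.+ p))

  F-columns : ℕ → (ℕ → ℕ) → Series → ℕ → ℕ → ℕ → Carrier
  F-columns p α F k l = column p α F (k ℕ.+ l)

  -- The actual F has degree q - p while its series starts at z⁰. Relative to rows shifted by p,
  -- this places F times the l-th power of u at exponent q + 1 + l, and χⱼ at exponent β j + p + 1.
  columns : ℕ → ℕ → (ℕ → ℕ) → (ℕ → ℕ) → Series → ℕ → ℕ → Carrier
  columns p q α β F = glue q (χ-columns p α β) (F-columns p α F (suc q))

  -- The Gram matrix, under the residue pairing, of the rows and of the columns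
  -- χ₀, …, χ_(q-1), F, F u, F u², …, where χⱼ = (u - b₀) ⋯ (u - b_(β j - 1)).
  Gram : ℕ → ℕ → ℕ → (ℕ → ℕ) → (ℕ → ℕ) → Series → Carrier
  Gram m p q α β F = Det m (columns p q α β F)

  -- `χ n y` is (-1)ⁿ times the value of (u - b₀) ⋯ (u - b₍ₙ₋₁₎) at u = -y. With bₜ = a₍₋ₜ₎ it is
  -- the power of y with respect to the dual sequence.
  φ χ : ℕ → Carrier → Carrier
  φ n x = ∏ n (λ t → x - a t)
  χ n y = ∏ n (λ t → y + b t)

-- Removal of a polynomial row

module RowRemoval {c ℓ} (R : CommutativeRing c ℓ) (a b : ℕ → CommutativeRing.Carrier R) where
  open CommutativeRing R
  open RingTactic R
  open FiniteSums R
  open Determinants R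
  open PowerSeries R
  open Vandermonde R
  open GeneratingFunctions R
  open GramMatrix R a b
  private
    module Σ = FiniteSums seriesRing
    module Sol = RingTactic seriesRing
    open import Relation.Binary.Reasoning.Setoid setoid

  private
    -- The product of two polynomials in u has no term 1 / u.
    first-row-χ : ∀ p α β → column (suc p) α (lins β b) (suc (β ℕ.+ suc p)) 0 ≈ 0#
    first-row-χ p α β = begin
      at (lins (α 0) a ⊛ lins β b) (α 0 ℕ.+ suc (β ℕ.+ suc p)) (suc p)
        ≡⟨ ≡.cong₂ (at (lins (α 0) a ⊛ lins β b)) (index (α 0) β p) (≡.sym (ℕ.+-identityʳ (suc p))) ⟩
      at (lins (α 0) a ⊛ lins β b) (suc p ℕ.+ (α 0 ℕ.+ (β ℕ.+ 1 ℕ.+ 0))) (suc p ℕ.+ 0)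
        ≡⟨ at-+ (lins (α 0) a ⊛ lins β b) (suc p) _ 0 ⟩
      (lins (α 0) a ⊛ lins β b) (α 0 ℕ.+ (β ℕ.+ 1 ℕ.+ 0))
        ≈⟨ coef-lins-0 (α 0) a (lins β b) (β ℕ.+ 1)
             (λ t → trans (reflexive (≡.cong (lins β b) (ℕ.+-assoc β 1 t))) (coef-lins-> β b t)) 0 ⟩
      0# ∎
      where
      index : ∀ α β p → α ℕ.+ suc (β ℕ.+ suc p) ≡ suc p ℕ.+ (α ℕ.+ (β ℕ.+ 1 ℕ.+ 0))
      index = solve-∀

    module _ (p q e : ℕ) (α : ℕ → ℕ) (X Y : ℕ → Carrier) where
      n = p ℕ.+ e
      ny = q ℕ.+ e
      F = generating (suc n) ny X Y

      -- The numerator of φ F at its pole xₖ; the rest of the residue, 1 / Π (xₖ - xᵢ), is supplied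
      -- by `weight`.
      coefficient : ℕ → Carrier
      coefficient k = φ (α 0) (X k) * ∏ ny (λ j → X k + Y j)

      -- Once F is in partial fractions, each term is a geometric series in xₖ times polynomials,
      -- and beyond their degrees its coefficients are the values of the polynomials at xₖ times
      -- powers of xₖ.
      first-row-F : ∀ l → V (suc n) X * column (suc p) α F (suc (q ℕ.+ l)) 0 ≈
        ∑ (suc n) (λ k → (weight n X k * coefficient k) * geo (X k) l)
      first-row-F l = begin
        V (suc n) X * at (Q ⊛ F) (α 0 ℕ.+ suc (q ℕ.+ l)) (suc p)
          ≈⟨ *-congˡ (at-z^ n (Q ⊛ F) (α 0 ℕ.+ suc (q ℕ.+ l)) (suc p)) ⟨
        V (suc n) X * at (z^ n ⊛ (Q ⊛ F)) (n ℕ.+ (α 0 ℕ.+ suc (q ℕ.+ l))) (suc p)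
          ≡⟨ ≡.cong (V (suc n) X *_) (≡.trans (≡.cong₂ (at (z^ n ⊛ (Q ⊛ F))) (index p e (α 0) q l)
               (≡.sym (ℕ.+-identityʳ (suc p))))
               (at-+ (z^ n ⊛ (Q ⊛ F)) (suc p) _ 0)) ⟩
        V (suc n) X * (z^ n ⊛ (Q ⊛ F)) K
          ≈⟨ coef-C (V (suc n) X) _ K ⟨
        (C (V (suc n) X) ⊛ (z^ n ⊛ (Q ⊛ F))) K
          ≈⟨ coef-≈ (S.trans (S.*-congˡ (S.trans (z^-cong n (S.*-comm Q F)) (S.sym (z^-*ʳ n F Q))))
               (Sol.solve 3 (λ v f q → v Sol.:* (f Sol.:* q) Sol.:= q Sol.:* (v Sol.:* f)) S.refl _ _ _)) K ⟩
        (Q ⊛ (C (V (suc n) X) ⊛ (z^ n ⊛ F))) K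
          ≈⟨ coef-≈ (S.trans (S.*-congˡ (S.sym (generating-lagrangeˣ n ny X Y))) (Σ.*-∑ (suc n) Q _)) K ⟩
        S.∑ (suc n) (λ k → Q ⊛ (C (weight n X k) ⊛ (L ⊛ geo (X k)))) K
          ≈⟨ coef-∑ (suc n) _ K ⟩
        ∑ (suc n) (λ k → (Q ⊛ (C (weight n X k) ⊛ (L ⊛ geo (X k)))) K)
          ≈⟨ ∑-cong (suc n) term ⟩
        ∑ (suc n) (λ k → (weight n X k * coefficient k) * geo (X k) l) ∎
        where
        Q = lins (α 0) a
        L = lins ny (λ j → - Y j)
        -- The residue, shifted by the n powers of z from `generating-lagrangeˣ`, lies l places past
        -- the total degree α 0 + ny of the numerators.
        K = α 0 ℕ.+ ((ny ℕ.+ 0) ℕ.+ l)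
        index : ∀ p e α q l → (p ℕ.+ e) ℕ.+ (α ℕ.+ suc (q ℕ.+ l)) ≡ suc p ℕ.+ (α ℕ.+ ((q ℕ.+ e ℕ.+ 0) ℕ.+ l))
        index = solve-∀
        inner : ∀ k t → (L ⊛ geo (X k)) ((ny ℕ.+ 0) ℕ.+ t) ≈ (∏ ny (λ j → X k - - Y j) * 1#) * geo (X k) t
        inner k t = trans (reflexive (≡.cong (L ⊛ geo (X k)) (ℕ.+-assoc ny 0 t)))
          (coef-lins ny (λ j → - Y j) (geo (X k)) 0 (X k) 1# (λ t → sym (*-identityˡ _)) t)
        term : ∀ k → (Q ⊛ (C (weight n X k) ⊛ (L ⊛ geo (X k)))) K ≈ (weight n X k * coefficient k) * geo (X k) l
        term k = begin
          (Q ⊛ (C (weight n X k) ⊛ (L ⊛ geo (X k)))) K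
            ≈⟨ coef-≈ (Sol.solve 3 (λ q w g → q Sol.:* (w Sol.:* g) Sol.:= w Sol.:* (q Sol.:* g)) S.refl _ _ _) K ⟩
          (C (weight n X k) ⊛ (Q ⊛ (L ⊛ geo (X k)))) K
            ≈⟨ coef-C (weight n X k) _ K ⟩
          weight n X k * (Q ⊛ (L ⊛ geo (X k))) K
            ≈⟨ *-congˡ (coef-lins (α 0) a (L ⊛ geo (X k)) (ny ℕ.+ 0) (X k) _ (inner k) l) ⟩
          weight n X k * (φ (α 0) (X k) * (∏ ny (λ j → X k - - Y j) * 1#) * geo (X k) l)
            ≈⟨ *-congˡ (*-congʳ (*-congˡ (trans (*-identityʳ _)
                 (∏-cong ny (λ j → solve 2 (λ x y → x :- (:- y) := x :+ y) refl (X k) (Y j)))))) ⟩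
          weight n X k * (coefficient k * geo (X k) l)
            ≈⟨ *-assoc _ _ _ ⟨
          (weight n X k * coefficient k) * geo (X k) l ∎

      first-row : ∀ β j → V (suc n) X * columns (suc p) q α β F j 0 ≈
        ∑ (suc n) (λ k → (weight n X k * coefficient k) * evaluation q (X k) j)
      first-row β j = trans (*-congˡ (reflexive (glue-map {A = ℕ → Carrier} (λ u → u 0) q
          (χ-columns (suc p) α β) (F-columns (suc p) α F (suc q)) j)))
        (glue-elim (λ j u → V (suc n) X * u ≈ ∑ (suc n) (λ k → w k * evaluation q (X k) j)) q
          (λ j → χ-columns (suc p) α β j 0) (λ l → F-columns (suc p) α F (suc q) l 0) χ-part F-part j)
        where
        w : ℕ → Carrier
        w k = weight n X k * coefficient k
        χ-part : ∀ j → j ℕ.< q → V (suc n) X * column (suc p) α (lins (β j) b) (suc (β j ℕ.+ suc p)) 0 ≈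
          ∑ (suc n) (λ k → w k * evaluation q (X k) j)
        χ-part j j<q = trans (trans (*-congˡ (first-row-χ p α (β j))) (zeroʳ _))
          (sym (∑-zero (suc n) (λ k _ → trans (*-congˡ (reflexive (glue-< q (λ _ → 0#) (geo (X k)) j j<q)))
              (zeroʳ _))))
        F-part : ∀ l → V (suc n) X * column (suc p) α F (suc (q ℕ.+ l)) 0 ≈
          ∑ (suc n) (λ k → w k * evaluation q (X k) (q ℕ.+ l))
        F-part l = trans (first-row-F l) (∑-cong (suc n)
            (λ k → *-congˡ (sym (reflexive (glue-+ q (λ _ → 0#) (geo (X k)) l)))))

  column-suc : ∀ p α P k i → column (suc p) α P (suc k) (suc i) ≈ column p (α ∘ suc) P k i
  column-suc p α P k i = trans (reflexive (≡.cong (λ ρ → pairing ρ P (suc k)) (rows-suc p α i)))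
      (pairing-bump (rows p (α ∘ suc) i) P k)

  -- The row of φ₀ is a residue at infinity, hence a sum of evaluations at the xₖ.
  Gram-remove-row : ∀ m p q e α β X Y → q ℕ.≤ m →
    V (suc (p ℕ.+ e)) X * Gram (suc m) (suc p) q α β (generating (suc (p ℕ.+ e)) (q ℕ.+ e) X Y) ≈
    sg q * ∑ (suc (p ℕ.+ e)) (λ k → (weight (p ℕ.+ e) X k * (φ (α 0) (X k) * ∏ (q ℕ.+ e) (λ j → X k + Y j))) *
      Gram m p q (α ∘ suc) β (generating (p ℕ.+ e) (q ℕ.+ e) (X ∘ skip k) Y))
  Gram-remove-row m p q e α β X Y q≤m = begin
    V (suc n′) X * Det (suc m) A
      ≈⟨ *-congˡ (Det-transpose (suc m) A) ⟩
    V (suc n′) X * Det (suc m) (λ i j → A j i)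
      ≈⟨ Det-*ˡ m (V (suc n′) X) (λ j → A j 0) rest ⟨
    Det (suc m) ((λ j → V (suc n′) X * A j 0) ◂ rest)
      ≈⟨ Det-minors m ((λ j → V (suc n′) X * A j 0) ◂ rest)
           ((λ j → ∑ (suc n′) (λ k → w k * evaluation q (X k) j)) ◂ rest)
           (first-row p q e α X Y β) (λ _ → refl) ⟩
    Det (suc m) ((λ j → ∑ (suc n′) (λ k → w k * evaluation q (X k) j)) ◂ rest)
      ≈⟨ Det-∑ m (suc n′) w (λ k → evaluation q (X k)) rest ⟩
    ∑ (suc n′) (λ k → w k * Det (suc m) (evaluation q (X k) ◂ rest))
      ≈⟨ ∑-cong< (suc n′) (λ { k (s≤s k≤n) → trans (*-congˡ (evaluate k k≤n))
           (solve 3 (λ w s m → w :* (s :* m) := s :* (w :* m)) refl _ _ _) }) ⟩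
    ∑ (suc n′) (λ k → sg q * (w k * Gram m p q (α ∘ suc) β (F′ k)))
      ≈⟨ *-∑ (suc n′) (sg q) _ ⟨
    sg q * ∑ (suc n′) (λ k → w k * Gram m p q (α ∘ suc) β (F′ k)) ∎
    where
    n′ = p ℕ.+ e
    F₀ = generating (suc n′) (q ℕ.+ e) X Y
    F′ : ℕ → Series
    F′ k = generating n′ (q ℕ.+ e) (X ∘ skip k) Y
    A = columns (suc p) q α β F₀
    rest : ℕ → ℕ → Carrier
    rest i j = A j (suc i)
    w : ℕ → Carrier
    w k = weight n′ X k * coefficient p q e α X Y k
    f g : ℕ → ℕ → Carrier
    f j i = column (suc p) α (lins (β j) b) (suc (β j ℕ.+ suc p)) (suc i)
    g l i = column (suc p) α F₀ (suc (q ℕ.+ l)) (suc i)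
    evaluate : ∀ k → k ℕ.≤ n′ → Det (suc m) (evaluation q (X k) ◂ rest) ≈ sg q * Gram m p q (α ∘ suc) β (F′ k)
    evaluate k k≤n = begin
      Det (suc m) (evaluation q (X k) ◂ rest)
        ≈⟨ Det-cong (suc m) {evaluation q (X k) ◂ rest} {evaluation q (X k) ◂ (λ i j → glue q f g j i)}
             (λ { zero _ j → refl ; (suc i) _ j → reflexive
                 (≡.cong (λ u → u i) (glue-map {A = ℕ → Carrier} {B = ℕ → Carrier} (λ u → u ∘ suc) q
               (χ-columns (suc p) α β) (F-columns (suc p) α F₀ (suc q)) j)) }) ⟩
      Det (suc m) (evaluation q (X k) ◂ (λ i j → glue q f g j i))
        ≈⟨ Det-evaluation m q (X k) f g q≤m ⟩
      sg q * Det m (glue q f (λ l i → g (suc l) i - X k * g l i))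
        ≈⟨ *-congˡ (Det-cong m (λ j _ i → glue-cong q χ-part F-part j i)) ⟩
      sg q * Gram m p q (α ∘ suc) β (F′ k) ∎
      where
      χ-part : ∀ j i → f j i ≈ column p (α ∘ suc) (lins (β j) b) (suc (β j ℕ.+ p)) i
      χ-part j i = trans (reflexive (≡.cong (λ k → column (suc p) α (lins (β j) b) (suc k) (suc i))
          (ℕ.+-suc (β j) p)))
        (column-suc p α (lins (β j) b) (suc (β j ℕ.+ p)) i)
      F-part : ∀ l i → g (suc l) i - X k * g l i ≈ column p (α ∘ suc) (F′ k) (suc (q ℕ.+ l)) i
      F-part l i = begin
        column (suc p) α F₀ (suc (q ℕ.+ suc l)) (suc i) - X k * g l i
          ≡⟨ ≡.cong (λ t → column (suc p) α F₀ (suc t) (suc i) - X k * g l i) (ℕ.+-suc q l) ⟩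
        column (suc p) α F₀ (2 ℕ.+ (q ℕ.+ l)) (suc i) - X k * g l i
          ≈⟨ pairing-lin (rows (suc p) α (suc i)) (X k) F₀ (suc (q ℕ.+ l)) ⟨
        column (suc p) α (lin (X k) ⊛ F₀) (2 ℕ.+ (q ℕ.+ l)) (suc i)
          ≈⟨ pairing-cong (rows (suc p) α (suc i)) (2 ℕ.+ (q ℕ.+ l)) (generating-dropˣ n′ (q ℕ.+ e) X Y k k≤n) ⟨
        column (suc p) α (F′ k) (2 ℕ.+ (q ℕ.+ l)) (suc i)
          ≈⟨ column-suc p α (F′ k) (suc (q ℕ.+ l)) i ⟩
        column p (α ∘ suc) (F′ k) (suc (q ℕ.+ l)) i ∎

-- Removal of a leg column

module ColumnRemoval {c ℓ} (R : CommutativeRing c ℓ) (a b : ℕ → CommutativeRing.Carrier R) where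
  open CommutativeRing R
  open RingTactic R
  open FiniteSums R
  open Determinants R
  open PowerSeries R
  open Vandermonde R
  open GeneratingFunctions R
  open GramMatrix R a b
  private
    module Σ = FiniteSums seriesRing
    module Sol = RingTactic seriesRing
    open import Relation.Binary.Reasoning.Setoid setoid
    import Relation.Binary.Reasoning.Setoid S.setoid as SR

  module Columns (m p q : ℕ) (α β : ℕ → ℕ) (q≤m : q ℕ.≤ m) (F : Series) where

    -- These columns serve two determinants. They stand beside χ at index q when F comes with q + 1
    -- legs; and if F is u + y times G up to normalisation, they stand beside G when G comes with q
    -- legs. This is how a leg is traded for a factor u + y of F.
    others : ℕ → ℕ → Carrier
    others = glue q (χ-columns p α β) (F-columns p α F (2 ℕ.+ q))

    -- The determinant whose column q is P, paired at exponent k.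
    L : ℕ → Series → Carrier
    L k P = Det (suc m) (column p α P k ◂ others)

    L-cong : ∀ k {P P′} → P ≋ P′ → L k P ≈ L k P′
    L-cong k {P} {P′} P≋ = Det-minors m (column p α P k ◂ others) (column p α P′ k ◂ others)
      (λ i → pairing-cong (rows p α i) k P≋) (λ _ → refl)

    L-C : ∀ k x P → L k (C x ⊛ P) ≈ x * L k P
    L-C k x P = trans (Det-minors m (column p α (C x ⊛ P) k ◂ others) ((λ i → x * column p α P k i) ◂ others)
      (λ i → pairing-C (rows p α i) x P k) (λ _ → refl)) (Det-*ˡ m x (column p α P k) others)

    L-⊕C : ∀ k x P P′ → L k ((C x ⊛ P) ⊕ P′) ≈ x * L k P + L k P′
    L-⊕C k x P P′ = trans (Det-minors m (column p α ((C x ⊛ P) ⊕ P′) k ◂ others)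
        ((λ i → x * column p α P k i + column p α P′ k i) ◂ others)
      (λ i → trans (pairing-⊕ (rows p α i) (C x ⊛ P) P′ k) (+-congʳ (pairing-C (rows p α i) x P k))) (λ _ → refl))
      (Det-linear m x (column p α P k) (column p α P′ k) others)

    L-∑ : ∀ k n (w : ℕ → Carrier) (f : ℕ → Series) → L k (S.∑ n (λ i → C (w i) ⊛ f i)) ≈ ∑ n (λ i → w i * L k (f i))
    L-∑ k n w f = trans (Det-minors m (column p α (S.∑ n (λ i → C (w i) ⊛ f i)) k ◂ others)
        ((λ i → ∑ n (λ j → w j * column p α (f j) k i)) ◂ others)
      (λ i → trans (pairing-∑ (rows p α i) n _ k) (∑-cong n (λ j → pairing-C (rows p α i) (w j) (f j) k)))
          (λ _ → refl))
      (Det-∑ m n w (λ j → column p α (f j) k) others)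

    L-z^ : ∀ n P k → L (n ℕ.+ k) (z^ n ⊛ P) ≈ L k P
    L-z^ n P k = Det-minors m (column p α (z^ n ⊛ P) (n ℕ.+ k) ◂ others) (column p α P k ◂ others)
      (λ i → pairing-z^ (rows p α i) n P k) (λ _ → refl)

    L-lin : ∀ x P k → L (suc k) (lin x ⊛ P) ≈ L (suc k) P - x * L k P
    L-lin x P k = begin
      L (suc k) (lin x ⊛ P)
        ≈⟨ L-cong (suc k) (S.trans (Sol.solve 3 (λ x z p → (Sol.:1 Sol.:- x Sol.:* z) Sol.:* p Sol.:= (Sol.:- x)
             Sol.:* (z Sol.:* p) Sol.:+ p) S.refl (C x) z P)
             (S.+-congʳ (S.*-congʳ (S.sym (C-neg x))))) ⟩
      L (suc k) ((C (- x) ⊛ (z ⊛ P)) ⊕ P)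
        ≈⟨ L-⊕C (suc k) (- x) (z ⊛ P) P ⟩
      - x * L (suc k) (z ⊛ P) + L (suc k) P
        ≈⟨ +-congʳ (*-congˡ (L-z^ 1 P k)) ⟩
      - x * L k P + L (suc k) P
        ≈⟨ solve 3 (λ x l l′ → (:- x) :* l :+ l′ := l′ :- x :* l) refl _ _ _ ⟩
      L (suc k) P - x * L k P ∎

    -- F times a polynomial is a combination of the columns F, F u, F u², .... The bound by m
    -- ensures that all of those needed occur among `others`.
    L-F : ∀ s l d → q ℕ.+ (s ℕ.+ l) ℕ.< m → L (2 ℕ.+ (q ℕ.+ (s ℕ.+ l))) (lins s d ⊛ F) ≈ 0#
    L-F zero l d ql<m = trans (L-cong _ (S.trans (S.*-congʳ (Σ.∏-empty _)) (S.*-identityˡ F)))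
      (Det-repeated m (q ℕ.+ l) (column p α F (2 ℕ.+ (q ℕ.+ l))) others ql<m
        (λ i → reflexive (≡.cong (λ u → u i) (glue-+ q (χ-columns p α β) (F-columns p α F (2 ℕ.+ q)) l))))
    L-F (suc s) l d sl<m = begin
      L (2 ℕ.+ (q ℕ.+ suc (s ℕ.+ l))) (lins (suc s) d ⊛ F)
        ≈⟨ L-cong _ (S.trans (S.*-congʳ (Σ.∏-suc s _)) (S.*-assoc _ _ _)) ⟩
      L (2 ℕ.+ (q ℕ.+ suc (s ℕ.+ l))) (lin (d 0) ⊛ P)
        ≡⟨ ≡.cong (λ k → L (2 ℕ.+ k) (lin (d 0) ⊛ P)) (ℕ.+-suc q (s ℕ.+ l)) ⟩
      L (3 ℕ.+ (q ℕ.+ (s ℕ.+ l))) (lin (d 0) ⊛ P)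
        ≈⟨ L-lin (d 0) P (2 ℕ.+ (q ℕ.+ (s ℕ.+ l))) ⟩
      L (3 ℕ.+ (q ℕ.+ (s ℕ.+ l))) P - d 0 * L (2 ℕ.+ (q ℕ.+ (s ℕ.+ l))) P
        ≡⟨ ≡.cong (λ k → L (2 ℕ.+ k) P - d 0 * L (2 ℕ.+ (q ℕ.+ (s ℕ.+ l))) P)
             (≡.trans (≡.cong (q ℕ.+_) (ℕ.+-suc s l)) (ℕ.+-suc q (s ℕ.+ l))) ⟨
      L (2 ℕ.+ (q ℕ.+ (s ℕ.+ suc l))) P - d 0 * L (2 ℕ.+ (q ℕ.+ (s ℕ.+ l))) P
        ≈⟨ +-cong (L-F s (suc l) (d ∘ suc) (≡.subst (λ k → q ℕ.+ k ℕ.< m) (≡.sym (ℕ.+-suc s l)) sl<m))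
             (-‿cong (*-congˡ (L-F s l (d ∘ suc) (ℕ.<⇒≤ (≡.subst (ℕ._< m) (ℕ.+-suc q (s ℕ.+ l)) sl<m))))) ⟩
      0# - d 0 * 0#
        ≈⟨ solve 1 (λ c → :0 :- c :* :0 := :0) refl (d 0) ⟩
      0# ∎
      where P = lins s (d ∘ suc) ⊛ F

    -- Column operations replace all F-columns of the factor G but the first by those of F.
    Gram-factor : ∀ y G → F ≋ lin (- y) ⊛ G → Gram (suc m) p q α β G ≈ sg q * L (suc q) G
    Gram-factor y G F≋ = begin
      Det (suc m) (glue q χs (F-columns p α G (suc q)))
        ≈⟨ Det-chain-glue (suc m) q (- y) χs (F-columns p α G (suc q)) g (λ _ → refl) step ⟨
      Det (suc m) (glue q χs g)
        ≈⟨ Det-move m q (glue q χs g) q≤m ⟩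
      sg q * Det (suc m) (glue q χs g q ◂ (glue q χs g ∘ skip q))
        ≈⟨ *-congˡ (Det-cong (suc m) {glue q χs g q ◂ (glue q χs g ∘ skip q)} {column p α G (suc q) ◂ others}
             (λ { zero _ i → reflexive (≡.cong (λ u → u i)
                 (≡.trans (glue-at q χs g) (≡.cong (λ k → column p α G (suc k)) (ℕ.+-identityʳ q))))
                ; (suc j) _ i → reflexive (≡.cong (λ u → u i) (glue-skip q χs g j)) })) ⟩
      sg q * L (suc q) G ∎
      where
      χs = χ-columns p α β
      g : ℕ → ℕ → Carrier
      g = F-columns p α G (suc q) 0 ◂ F-columns p α F (2 ℕ.+ q)
      step : ∀ l i → column p α F (2 ℕ.+ (q ℕ.+ l)) i ≈ F-columns p α G (suc q) (suc l) i - - y * F-columns p α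
          G (suc q) l i
      step l i = trans (pairing-cong (rows p α i) (2 ℕ.+ (q ℕ.+ l)) F≋)
        (trans (pairing-lin (rows p α i) (- y) G (suc (q ℕ.+ l)))
          (+-congʳ (reflexive (≡.cong (λ k → column p α G (suc k) i) (≡.sym (ℕ.+-suc q l))))))

    Gram-χ : Gram (suc m) p (suc q) α β F ≈ sg q * L (suc (β q ℕ.+ p)) (lins (β q) b)
    Gram-χ = begin
      Det (suc m) (glue (suc q) χs g)
        ≈⟨ Det-move m q (glue (suc q) χs g) q≤m ⟩
      sg q * Det (suc m) (glue (suc q) χs g q ◂ (glue (suc q) χs g ∘ skip q))
        ≈⟨ *-congˡ (Det-cong (suc m) {glue (suc q) χs g q ◂ (glue (suc q) χs g ∘ skip q)} {χs q ◂ others}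
             (λ { zero _ i → reflexive (≡.cong (λ u → u i) (glue-suc-at q χs g))
                ; (suc j) _ i → reflexive (≡.cong (λ u → u i) (glue-suc-skip q χs g j)) })) ⟩
      sg q * L (suc (β q ℕ.+ p)) (lins (β q) b) ∎
      where
      χs = χ-columns p α β
      g = F-columns p α F (2 ℕ.+ q)

  module _ (m p q e : ℕ) (α β : ℕ → ℕ) (X Y : ℕ → Carrier) (q≤m : q ℕ.≤ m) (β+p≤m : β q ℕ.+ p ℕ.≤ m) where
    private
      n nx T : ℕ
      n  = q ℕ.+ e
      nx = p ℕ.+ e
      T  = β q ℕ.+ nx
      F : Series
      F = generating nx (suc n) X Y
      open Columns m p q α β q≤m F

      -- `cs` lists the roots of Q = χ Π (u - xᵢ), which has degree T. Since χ = F Q / Π (u + yⱼ),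
      -- dividing Q by Π (u + yⱼ) writes χ as F times a polynomial plus multiples of the F / (u +
      -- yₖ) with numerators Q(-yₖ), up to sign the products in `u`.
      cs w : ℕ → Carrier
      cs = glue (β q) b X
      w = weight n Y

      Fs : ℕ → Series
      Fs k = generating nx n X (Y ∘ skip k)

      u : ℕ → ℕ → Carrier
      u τ k = w k * ∏ τ (λ i → Y k + cs i)

      P : ℕ → Series
      P τ = S.∑ (suc n) (λ k → C (u τ k) ⊛ Fs k)

      -- One step of the division: z (yₖ + c) = (1 + yₖ z) - (1 - c z), and 1 + yₖ z turns `Fs k`
      -- into F, independently of k.
      P-suc : ∀ τ → z ⊛ P (suc τ) ≋ (C (∑ (suc n) (u τ)) ⊛ F) ⊕ neg (lin (cs τ) ⊛ P τ)
      P-suc τ = SR.begin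
        z ⊛ P (suc τ)
          SR.≈⟨ Σ.*-∑ (suc n) z _ ⟩
        S.∑ (suc n) (λ k → z ⊛ (C (u (suc τ) k) ⊛ Fs k))
          SR.≈⟨ Σ.∑-cong< (suc n) (λ { k (s≤s k≤n) → term k k≤n }) ⟩
        S.∑ (suc n) (λ k → (F ⊛ C (u τ k)) ⊕ (neg (lin (cs τ)) ⊛ (C (u τ k) ⊛ Fs k)))
          SR.≈⟨ S.trans (Σ.∑-+ (suc n) _ _) (S.+-cong (S.sym (Σ.*-∑ (suc n) F _))
               (S.sym (Σ.*-∑ (suc n) (neg (lin (cs τ))) _))) ⟩
        (F ⊛ S.∑ (suc n) (λ k → C (u τ k))) ⊕ (neg (lin (cs τ)) ⊛ P τ)
          SR.≈⟨ S.+-cong (S.trans (S.*-comm _ _) (S.*-congʳ (C-∑ (suc n) (u τ))))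
               (Sol.solve 2 (λ a b → (Sol.:- a) Sol.:* b Sol.:= Sol.:- (a Sol.:* b)) S.refl _ _) ⟩
        (C (∑ (suc n) (u τ)) ⊛ F) ⊕ neg (lin (cs τ) ⊛ P τ) SR.∎
        where
        term : ∀ k → k ℕ.≤ n → z ⊛ (C (u (suc τ) k) ⊛ Fs k) ≋ (F ⊛ C (u τ k)) ⊕
            (neg (lin (cs τ)) ⊛ (C (u τ k) ⊛ Fs k))
        term k k≤n = SR.begin
          z ⊛ (C (u (suc τ) k) ⊛ Fs k)
            SR.≈⟨ S.*-congˡ (S.*-congʳ (S.trans (C-cong (trans (*-congˡ (∏-last τ _)) (sym (*-assoc _ _ _))))
                 (S.trans (C-* _ _) (S.*-congˡ (C-+ _ _))))) ⟩
          z ⊛ ((C (u τ k) ⊛ (C (Y k) ⊕ C (cs τ))) ⊛ Fs k)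
            SR.≈⟨ Sol.solve 5 (λ z u y c f → z Sol.:* ((u Sol.:* (y Sol.:+ c)) Sol.:* f) Sol.:=
                 ((Sol.:1 Sol.:- (Sol.:- y) Sol.:* z) Sol.:* f) Sol.:* u Sol.:+
                     (Sol.:- (Sol.:1 Sol.:- c Sol.:* z)) Sol.:* (u Sol.:* f))
                 S.refl z (C (u τ k)) (C (Y k)) (C (cs τ)) (Fs k) ⟩
          (((S.1# S.- (neg (C (Y k)) ⊛ z)) ⊛ Fs k) ⊛ C (u τ k)) ⊕ (neg (lin (cs τ)) ⊛ (C (u τ k) ⊛ Fs k))
            SR.≈⟨ S.+-congʳ (S.*-congʳ (S.*-congʳ (S.+-congˡ (S.-‿cong (S.*-congʳ (S.sym (C-neg (Y k)))))))) ⟩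
          ((lin (- Y k) ⊛ Fs k) ⊛ C (u τ k)) ⊕ (neg (lin (cs τ)) ⊛ (C (u τ k) ⊛ Fs k))
            SR.≈⟨ S.+-congʳ (S.*-congʳ (S.sym (generating-dropʸ nx n X Y k k≤n))) ⟩
          (F ⊛ C (u τ k)) ⊕ (neg (lin (cs τ)) ⊛ (C (u τ k) ⊛ Fs k)) SR.∎

      -- If τ < n, the scalar is an interpolation sum of too low a degree. If n ≤ τ, then s is so
      -- small that, because of β q + p ≤ m, the column depends on `others`.
      negligible : ∀ s τ d → s ℕ.+ suc τ ℕ.≤ T → ∑ (suc n) (u τ) * L (2 ℕ.+ (q ℕ.+ s)) (lins s d ⊛ F) ≈ 0#
      negligible s τ d s+τ<T with τ ℕ.<? n
      ... | yes τ<n = trans (*-congʳ (trans (∑-cong (suc n) (λ k → *-congˡ (sym (*-identityʳ _))))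
              (∑-weights-small n Y τ cs 0 (≡.subst (ℕ._< n) (≡.sym (ℕ.+-identityʳ τ)) τ<n)))) (zeroˡ _)
      ... | no τ≮n = trans (*-congˡ (trans (reflexive (≡.cong (λ k → L (2 ℕ.+ (q ℕ.+ k)) (lins s d ⊛ F))
          (≡.sym (ℕ.+-identityʳ s))))
              (L-F s 0 d bound))) (zeroʳ _)
        where
        bound : q ℕ.+ (s ℕ.+ 0) ℕ.< m
        bound = ℕ.≤-trans (ℕ.+-cancelʳ-≤ e (suc (q ℕ.+ (s ℕ.+ 0))) (β q ℕ.+ p)
            (ℕ.≤-trans (ℕ.≤-reflexive (index₁ q s e))
          (ℕ.≤-trans (ℕ.+-monoʳ-≤ s (s≤s (ℕ.≮⇒≥ τ≮n))) (ℕ.≤-trans s+τ<T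
              (ℕ.≤-reflexive (≡.sym (ℕ.+-assoc (β q) p e))))))) β+p≤m
          where
          index₁ : ∀ q s e → suc (q ℕ.+ (s ℕ.+ 0)) ℕ.+ e ≡ s ℕ.+ suc (q ℕ.+ e)
          index₁ = solve-∀

      -- Each step exchanges a factor yₖ + c of the coefficients for a common factor 1 - c z and a
      -- sign; the multiple of F that splits off is negligible. The factors `d` are those already
      -- extracted, so the induction needs them arbitrary.
      descend : ∀ τ s d → s ℕ.+ τ ℕ.≤ T →
        L (suc (q ℕ.+ s)) (lins s d ⊛ P τ) ≈ sg τ * L (suc (q ℕ.+ (s ℕ.+ τ))) (lins s d ⊛ (lins τ cs ⊛ P 0))
      descend zero s d _ = begin
        L (suc (q ℕ.+ s)) (lins s d ⊛ P 0)
          ≡⟨ ≡.cong (λ k → L (suc (q ℕ.+ k)) (lins s d ⊛ P 0)) (ℕ.+-identityʳ s) ⟨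
        L (suc (q ℕ.+ (s ℕ.+ 0))) (lins s d ⊛ P 0)
          ≈⟨ L-cong _ (S.*-congˡ (S.sym (S.trans (S.*-congʳ (Σ.∏-empty _)) (S.*-identityˡ _)))) ⟩
        L (suc (q ℕ.+ (s ℕ.+ 0))) (lins s d ⊛ (lins 0 cs ⊛ P 0))
          ≈⟨ *-identityˡ _ ⟨
        1# * L (suc (q ℕ.+ (s ℕ.+ 0))) (lins s d ⊛ (lins 0 cs ⊛ P 0)) ∎
      descend (suc τ) s d s+τ<T = begin
        L (suc (q ℕ.+ s)) (lins s d ⊛ P (suc τ))
          ≈⟨ L-z^ 1 (lins s d ⊛ P (suc τ)) (suc (q ℕ.+ s)) ⟨
        L (2 ℕ.+ (q ℕ.+ s)) (z ⊛ (lins s d ⊛ P (suc τ)))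
          ≈⟨ L-cong _ (S.trans (Sol.solve 3 (λ z l p → z Sol.:* (l Sol.:* p) Sol.:= l Sol.:* (z Sol.:* p))
               S.refl _ _ _) (S.trans (S.*-congˡ (P-suc τ))
               (S.trans (Sol.solve 5 (λ g c f l p → g Sol.:* (c Sol.:* f Sol.:+ Sol.:- (l Sol.:* p)) Sol.:=
                 c Sol.:* (g Sol.:* f) Sol.:+ (Sol.:- Sol.:1) Sol.:* ((l Sol.:* g) Sol.:* p)) S.refl _ _ _ _ _)
                 (S.+-congˡ (S.*-cong (S.sym (C-neg 1#)) (S.*-congʳ (S.sym (Σ.∏-suc s _)))))))) ⟩
        L (2 ℕ.+ (q ℕ.+ s)) ((C (∑ (suc n) (u τ)) ⊛ (lins s d ⊛ F)) ⊕ (C (- 1#) ⊛ (lins (suc s) (cs τ ◂ d) ⊛ P τ)))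
          ≈⟨ L-⊕C _ _ _ _ ⟩
        ∑ (suc n) (u τ) * L (2 ℕ.+ (q ℕ.+ s)) (lins s d ⊛ F) + L (2 ℕ.+ (q ℕ.+ s))
            (C (- 1#) ⊛ (lins (suc s) (cs τ ◂ d) ⊛ P τ))
          ≈⟨ +-cong (negligible s τ d s+τ<T) (trans (L-C _ (- 1#) _)
               (*-congˡ (reflexive (≡.cong (λ k → L (suc k) (lins (suc s) (cs τ ◂ d) ⊛ P τ))
               (≡.sym (ℕ.+-suc q s)))))) ⟩
        0# + - 1# * L (suc (q ℕ.+ suc s)) (lins (suc s) (cs τ ◂ d) ⊛ P τ)
          ≈⟨ +-congˡ (*-congˡ (descend τ (suc s) (cs τ ◂ d) (≡.subst (ℕ._≤ T) (ℕ.+-suc s τ) s+τ<T))) ⟩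
        0# + - 1# * (sg τ * L (suc (q ℕ.+ suc (s ℕ.+ τ))) (lins (suc s) (cs τ ◂ d) ⊛ (lins τ cs ⊛ P 0)))
          ≈⟨ solve 2 (λ s l → :0 :+ (:- :1) :* (s :* l) := (:- s) :* l) refl _ _ ⟩
        sg (suc τ) * L (suc (q ℕ.+ suc (s ℕ.+ τ))) (lins (suc s) (cs τ ◂ d) ⊛ (lins τ cs ⊛ P 0))
          ≈⟨ *-congˡ (trans (reflexive (≡.cong (λ k → L (suc (q ℕ.+ k))
               (lins (suc s) (cs τ ◂ d) ⊛ (lins τ cs ⊛ P 0))) (≡.sym (ℕ.+-suc s τ))))
               (L-cong _ (S.trans (S.*-congʳ (Σ.∏-suc s _)) (S.trans
                 (Sol.solve 4 (λ c d l p → (c Sol.:* d) Sol.:* (l Sol.:* p) Sol.:= d Sol.:*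
                     ((l Sol.:* c) Sol.:* p)) S.refl _ _ _ _)
                 (S.*-congˡ (S.*-congʳ (S.sym (Σ.∏-last τ (λ i → lin (cs i)))))))))) ⟩
        sg (suc τ) * L (suc (q ℕ.+ (s ℕ.+ suc τ))) (lins s d ⊛ (lins (suc τ) cs ⊛ P 0)) ∎

      -- By `generating-lagrangeʸ`, P 0 is a multiple of Π 1 / (1 - xᵢ z), and the roots xᵢ in `cs`
      -- cancel this product. Only the column χ is left.
      lins-P₀ : lins T cs ⊛ P 0 ≋ C (V (suc n) Y * sg n) ⊛ (z^ n ⊛ lins (β q) b)
      lins-P₀ = SR.begin
        lins T cs ⊛ P 0
          SR.≈⟨ S.*-cong (S.trans (Σ.∏-cong T (λ i → S.reflexive (glue-map lin (β q) b X i)))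
               (Σ.∏-glue (β q) nx (λ i → lin (b i)) (λ i → lin (X i))))
               (S.trans (Σ.∑-cong (suc n) (λ k → S.*-congʳ
                   (C-cong (trans (*-congˡ (∏-empty _)) (*-identityʳ _))))) (generating-lagrangeʸ nx n X Y)) ⟩
        (lins (β q) b ⊛ lins nx X) ⊛ (C (V (suc n) Y * sg n) ⊛ (z^ n ⊛ geos nx X))
          SR.≈⟨ Sol.solve 4 (λ g l v x → (g Sol.:* l) Sol.:* (v Sol.:* x) Sol.:= v Sol.:*
               (x Sol.:* (l Sol.:* g))) S.refl _ _ _ _ ⟩
        C (V (suc n) Y * sg n) ⊛ ((z^ n ⊛ geos nx X) ⊛ (lins nx X ⊛ lins (β q) b))
          SR.≈⟨ S.*-congˡ (S.trans (z^-*ʳ n _ _) (z^-cong n (S.trans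
               (Sol.solve 3 (λ g l b → g Sol.:* (l Sol.:* b) Sol.:= (l Sol.:* g) Sol.:* b) S.refl _ _ _)
               (S.trans (S.*-congʳ (lins-geos nx X)) (S.*-identityˡ _))))) ⟩
        C (V (suc n) Y * sg n) ⊛ (z^ n ⊛ lins (β q) b) SR.∎

    private
      index : ∀ q β p e → suc (q ℕ.+ (β ℕ.+ (p ℕ.+ e))) ≡ (q ℕ.+ e) ℕ.+ suc (β ℕ.+ p)
      index = solve-∀

      -- The descent contributes (-1) to the power T, the interpolation (-1)ⁿ, and T + n = β q + p +
      -- q + 2e.
      signs : sg (β q ℕ.+ p ℕ.+ q) * (sg T * sg n) ≈ 1#
      signs = begin
        sg (β q ℕ.+ p ℕ.+ q) * (sg T * sg n)            ≈⟨ *-congˡ (sg-+ T n) ⟨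
        sg (β q ℕ.+ p ℕ.+ q) * sg (T ℕ.+ n)             ≡⟨ ≡.cong (λ k → sg (β q ℕ.+ p ℕ.+ q) * sg k)
            (index₂ (β q) p q e) ⟩
        sg (β q ℕ.+ p ℕ.+ q) * sg ((β q ℕ.+ p ℕ.+ q) ℕ.+ (e ℕ.+ e))
          ≈⟨ *-congˡ (trans (sg-+ (β q ℕ.+ p ℕ.+ q) (e ℕ.+ e)) (*-congˡ (trans (sg-+ e e) (sg-square e)))) ⟩
        sg (β q ℕ.+ p ℕ.+ q) * (sg (β q ℕ.+ p ℕ.+ q) * 1#)
          ≈⟨ trans (*-congˡ (*-identityʳ _)) (sg-square (β q ℕ.+ p ℕ.+ q)) ⟩
        1# ∎
        where
        index₂ : ∀ β p q e → (β ℕ.+ (p ℕ.+ e)) ℕ.+ (q ℕ.+ e) ≡ (β ℕ.+ p ℕ.+ q) ℕ.+ (e ℕ.+ e)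
        index₂ = solve-∀

    -- Interpolation at the -yₖ writes the column χ as a combination of the F / (u + yₖ) and of the other columns.
    Gram-remove-column :
      V (suc (q ℕ.+ e)) Y * Gram (suc m) p (suc q) α β (generating (p ℕ.+ e) (suc (q ℕ.+ e)) X Y) ≈
      sg (β q ℕ.+ p ℕ.+ q) * ∑ (suc (q ℕ.+ e)) (λ k →
        (weight (q ℕ.+ e) Y k * (χ (β q) (Y k) * ∏ (p ℕ.+ e) (λ i → X i + Y k))) *
        Gram (suc m) p q α β (generating (p ℕ.+ e) (q ℕ.+ e) X (Y ∘ skip k)))
    Gram-remove-column = sym (begin
      sg (β q ℕ.+ p ℕ.+ q) * ∑ (suc n) (λ k → (w k * (χ (β q) (Y k) * ∏ nx (λ i → X i + Y k))) * Gram (suc m) p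
          q α β (Fs k))
        ≈⟨ *-congˡ (∑-cong< (suc n) (λ { k (s≤s k≤n) → *-cong (*-congˡ (coefficient k))
             (Gram-factor (Y k) (Fs k) (generating-dropʸ nx n X Y k k≤n)) })) ⟩
      sg (β q ℕ.+ p ℕ.+ q) * ∑ (suc n) (λ k → u T k * (sg q * L (suc q) (Fs k)))
        ≈⟨ *-congˡ (trans (∑-cong (suc n) (λ k → solve 3 (λ u s l → u :* (s :* l) := s :* (u :* l)) refl _ _ _))
             (sym (*-∑ (suc n) (sg q) _))) ⟩
      sg (β q ℕ.+ p ℕ.+ q) * (sg q * ∑ (suc n) (λ k → u T k * L (suc q) (Fs k)))
        ≈⟨ *-congˡ (*-congˡ (L-∑ (suc q) (suc n) (u T) Fs)) ⟨
      sg (β q ℕ.+ p ℕ.+ q) * (sg q * L (suc q) (P T))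
        ≈⟨ *-congˡ (*-congˡ (trans (reflexive (≡.cong (λ k → L (suc k) (P T)) (≡.sym (ℕ.+-identityʳ q))))
             (trans (L-cong _ (S.sym (S.trans (S.*-congʳ (Σ.∏-empty _)) (S.*-identityˡ _))))
                 (descend T 0 b ℕ.≤-refl)))) ⟩
      sg (β q ℕ.+ p ℕ.+ q) * (sg q * (sg T * L (suc (q ℕ.+ T)) (lins 0 b ⊛ (lins T cs ⊛ P 0))))
        ≈⟨ *-congˡ (*-congˡ (*-congˡ (trans (L-cong _ (S.trans (S.*-congʳ (Σ.∏-empty _))
             (S.trans (S.*-identityˡ _) lins-P₀)))
             (trans (L-C _ _ _) (*-congˡ (trans (reflexive
                 (≡.cong (λ k → L k (z^ n ⊛ lins (β q) b)) (index q (β q) p e)))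
                 (L-z^ n (lins (β q) b) (suc (β q ℕ.+ p))))))))) ⟩
      sg (β q ℕ.+ p ℕ.+ q) * (sg q * (sg T * ((V (suc n) Y * sg n) * L (suc (β q ℕ.+ p)) (lins (β q) b))))
        ≈⟨ solve 6 (λ s r t v n l → s :* (r :* (t :* ((v :* n) :* l))) := (s :* (t :* n)) :* (v :* (r :* l)))
             refl _ _ _ _ _ _ ⟩
      (sg (β q ℕ.+ p ℕ.+ q) * (sg T * sg n)) * (V (suc n) Y * (sg q * L (suc (β q ℕ.+ p)) (lins (β q) b)))
        ≈⟨ trans (*-congʳ signs) (*-identityˡ _) ⟩
      V (suc n) Y * (sg q * L (suc (β q ℕ.+ p)) (lins (β q) b))
        ≈⟨ *-congˡ Gram-χ ⟨
      V (suc n) Y * Gram (suc m) p (suc q) α β F ∎)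
      where
      coefficient : ∀ k → χ (β q) (Y k) * ∏ nx (λ i → X i + Y k) ≈ ∏ T (λ i → Y k + cs i)
      coefficient k = sym (trans (∏-cong T (λ i → reflexive (glue-map (λ x → Y k + x) (β q) b X i)))
        (trans (∏-glue (β q) nx (λ i → Y k + b i) (λ i → Y k + X i)) (*-congˡ (∏-cong nx (λ i → +-comm _ _)))))

-- Removal of the last x or y

module PointRemoval {c ℓ} (R : CommutativeRing c ℓ) (a b : ℕ → CommutativeRing.Carrier R) where
  open CommutativeRing R
  open RingTactic R
  open FiniteSums R
  open Determinants R
  open PowerSeries R
  open Vandermonde R
  open GeneratingFunctions R
  open GramMatrix R a b
  open ColumnRemoval R a b
  private
    module Σ = FiniteSums seriesRing
    module Sol = RingTactic seriesRing
    open import Relation.Binary.Reasoning.Setoid setoid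
    import Relation.Binary.Reasoning.Setoid S.setoid as SR

  pairing-small : ∀ (Q : Series) A B n G k → A ℕ.+ k ℕ.< n ℕ.+ B → pairing (Q , A , B) (z^ n ⊛ G) k ≈ 0#
  pairing-small Q A B n G k small = trans
    (at-cong (S.trans (S.*-comm Q _) (z^-*ʳ n G Q)) (A ℕ.+ k) B) (at-z^-< n (G ⊛ Q) small)

  module _ (p q n nx : ℕ) (α β : ℕ → ℕ) (X Y : ℕ → Carrier)
    (α-small : ∀ i → i ℕ.< p → α i ℕ.+ suc q ℕ.< suc n ℕ.+ p) (q≤n : q ℕ.≤ n) where
    private
      F : Series
      F = generating nx (suc n) X Y
      Fs : ℕ → Series
      Fs k = generating nx n X (Y ∘ skip k)
      w u : ℕ → Carrier
      w = weight n Y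
      u k = w k * ∏ n (Y ∘ skip k)
      V′ Π : Carrier
      V′ = V (suc n) Y
      Π = ∏ (suc n) Y

      -- From 1 / (1 + yₖ z) = 1 - yₖ z / (1 + yₖ z): the first parts sum to a multiple of F by
      -- `∑-weights-top`, and in the second ones yₖ completes the product of all y's, so
      -- `generating-lagrangeʸ` makes their sum divisible by the power n + 1 of z.
      ∑-Fs : S.∑ (suc n) (λ k → C (u k) ⊛ Fs k) ≋ (C (sg n * V′) ⊛ F) ⊕
          (C (- Π * (V′ * sg n)) ⊛ (z^ suc n ⊛ geos nx X))
      ∑-Fs = SR.begin
        S.∑ (suc n) (λ k → C (u k) ⊛ Fs k)
          SR.≈⟨ Σ.∑-cong< (suc n) (λ { k (s≤s k≤n) → term k k≤n }) ⟩
        S.∑ (suc n) (λ k → (F ⊛ C (u k)) ⊕ ((C (- Π) ⊛ z) ⊛ (C (w k) ⊛ Fs k)))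
          SR.≈⟨ S.trans (Σ.∑-+ (suc n) _ _) (S.+-cong (S.sym (Σ.*-∑ (suc n) F _))
               (S.sym (Σ.*-∑ (suc n) (C (- Π) ⊛ z) _))) ⟩
        (F ⊛ S.∑ (suc n) (λ k → C (u k))) ⊕ ((C (- Π) ⊛ z) ⊛ S.∑ (suc n) (λ k → C (w k) ⊛ Fs k))
          SR.≈⟨ S.+-cong (S.trans (S.*-comm _ _) (S.*-congʳ (S.trans (C-∑ (suc n) u) (C-cong (∑-weights-top n Y)))))
               (S.*-congˡ (generating-lagrangeʸ nx n X Y)) ⟩
        (C (sg n * V′) ⊛ F) ⊕ ((C (- Π) ⊛ z) ⊛ (C (V′ * sg n) ⊛ (z^ n ⊛ geos nx X)))
          SR.≈⟨ S.+-congˡ (S.trans (Sol.solve 4 (λ p z v g → (p Sol.:* z) Sol.:* (v Sol.:* g) Sol.:=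
               (p Sol.:* v) Sol.:* (z Sol.:* g)) S.refl _ _ _ _)
               (S.*-congʳ (S.sym (C-* _ _)))) ⟩
        (C (sg n * V′) ⊛ F) ⊕ (C (- Π * (V′ * sg n)) ⊛ (z^ suc n ⊛ geos nx X)) SR.∎
        where
        term : ∀ k → k ℕ.≤ n → C (u k) ⊛ Fs k ≋ (F ⊛ C (u k)) ⊕ ((C (- Π) ⊛ z) ⊛ (C (w k) ⊛ Fs k))
        term k k≤n = SR.begin
          C (u k) ⊛ Fs k
            SR.≈⟨ Sol.solve 4 (λ u y z f → u Sol.:* f Sol.:= ((Sol.:1 Sol.:- (Sol.:- y) Sol.:* z) Sol.:* f)
                 Sol.:* u Sol.:+ ((Sol.:- (u Sol.:* y)) Sol.:* z) Sol.:* f)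
                 S.refl (C (u k)) (C (Y k)) z (Fs k) ⟩
          (((S.1# S.- (neg (C (Y k)) ⊛ z)) ⊛ Fs k) ⊛ C (u k)) ⊕ ((neg (C (u k) ⊛ C (Y k)) ⊛ z) ⊛ Fs k)
            SR.≈⟨ S.+-cong (S.*-congʳ (S.trans (S.*-congʳ
                 (S.+-congˡ (S.-‿cong (S.*-congʳ (S.sym (C-neg (Y k)))))))
                 (S.sym (generating-dropʸ nx n X Y k k≤n))))
                 (S.*-congʳ (S.*-congʳ (S.trans (S.-‿cong (S.sym (C-* (u k) (Y k))))
                     (S.trans (S.sym (C-neg _)) (S.trans (C-cong coefficient) (C-* _ _)))))) ⟩
          (F ⊛ C (u k)) ⊕ (((C (- Π) ⊛ C (w k)) ⊛ z) ⊛ Fs k)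
            SR.≈⟨ S.+-congˡ (Sol.solve 4 (λ p w z f → ((p Sol.:* w) Sol.:* z) Sol.:* f Sol.:= (p Sol.:* z)
                 Sol.:* (w Sol.:* f)) S.refl _ _ _ _) ⟩
          (F ⊛ C (u k)) ⊕ ((C (- Π) ⊛ z) ⊛ (C (w k) ⊛ Fs k)) SR.∎
          where
          coefficient : - (u k * Y k) ≈ - Π * w k
          coefficient = trans (solve 3 (λ w p y → :- ((w :* p) :* y) := (:- (y :* p)) :* w) refl _ _ _)
            (*-congʳ (-‿cong (sym (∏-skip n k Y k≤n))))

      -- The remainder in `∑-Fs` decays too fast at infinity to have a residue with any row:
      -- `α-small` says so for the polynomial rows, and q ≤ n suffices for the rows of negative
      -- degree.
      column-small : ∀ G i → column p α (z^ suc n ⊛ G) (suc q) i ≈ 0#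
      column-small G i = glue-elim (λ _ ρ → pairing ρ (z^ suc n ⊛ G) (suc q) ≈ 0#) p _ _
        (λ i i<p → pairing-small (lins (α i) a) (α i) p (suc n) G (suc q) (α-small i i<p))
        (λ r → pairing-small (H r) 0 (suc (p ℕ.+ r)) (suc n) G (suc q)
            (s≤s (ℕ.≤-trans (s≤s (ℕ.≤-trans q≤n (ℕ.m≤m+n n (p ℕ.+ r))))
            (ℕ.≤-reflexive (≡.sym (ℕ.+-suc n (p ℕ.+ r))))))) i

    -- Interpolation at 0 of the polynomial t ↦ Gram (F u / (u + t)), whose degree is below the number of y's.
    Gram-removeʸ : ∀ m → sg n * (V (suc n) Y * Gram m p q α β (generating nx (suc n) X Y)) ≈
      ∑ (suc n) (λ k → (weight n Y k * ∏ n (Y ∘ skip k)) * Gram m p q α β (generating nx n X (Y ∘ skip k)))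
    Gram-removeʸ m with q ℕ.<? m
    -- If m ≤ q, the matrix consists of legs only and does not involve the y's; only the sum of the
    -- weights is at stake.
    ... | no q≮m = begin
      sg n * (V′ * Gram m p q α β F)             ≈⟨ *-assoc _ _ _ ⟨
      (sg n * V′) * Gram m p q α β F             ≈⟨ *-congʳ (∑-weights-top n Y) ⟨
      ∑ (suc n) u * Gram m p q α β F             ≈⟨ trans (*-comm _ _) (*-∑ (suc n) _ u) ⟩
      ∑ (suc n) (λ k → Gram m p q α β F * u k)   ≈⟨ ∑-cong (suc n) (λ k → trans (*-comm _ _) (*-congˡ (same k))) ⟩
      ∑ (suc n) (λ k → u k * Gram m p q α β (Fs k)) ∎
      where
      same : ∀ k → Gram m p q α β F ≈ Gram m p q α β (Fs k)
      same k = Det-cong m (λ j j<m i → reflexive (≡.cong (λ v → v i) (≡.trans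
        (glue-< q (χ-columns p α β) (F-columns p α F (suc q)) j (ℕ.<-≤-trans j<m (ℕ.≮⇒≥ q≮m)))
        (≡.sym (glue-< q (χ-columns p α β) (F-columns p α (Fs k) (suc q)) j (ℕ.<-≤-trans j<m (ℕ.≮⇒≥ q≮m)))))))
    Gram-removeʸ (suc m) | yes (s≤s q≤m) = sym (begin
      ∑ (suc n) (λ k → u k * Gram (suc m) p q α β (Fs k))
        ≈⟨ ∑-cong< (suc n) (λ { k (s≤s k≤n) → trans (*-congˡ
             (Gram-factor (Y k) (Fs k) (generating-dropʸ nx n X Y k k≤n)))
             (solve 3 (λ u s l → u :* (s :* l) := s :* (u :* l)) refl _ _ _) }) ⟩
      ∑ (suc n) (λ k → sg q * (u k * L (suc q) (Fs k)))
        ≈⟨ trans (sym (*-∑ (suc n) (sg q) _)) (*-congˡ (sym (L-∑ (suc q) (suc n) u Fs))) ⟩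
      sg q * L (suc q) (S.∑ (suc n) (λ k → C (u k) ⊛ Fs k))
        ≈⟨ *-congˡ (trans (L-cong (suc q) ∑-Fs) (L-⊕C (suc q) _ F _)) ⟩
      sg q * ((sg n * V′) * L (suc q) F + L (suc q) (C (- Π * (V′ * sg n)) ⊛ (z^ suc n ⊛ geos nx X)))
        ≈⟨ *-congˡ (+-congˡ (trans (L-C (suc q) _ (z^ suc n ⊛ geos nx X)) (trans (*-congˡ
             (∑-zero (suc m) (λ i _ → trans (*-congˡ (trans (*-congʳ (column-small (geos nx X) i)) (zeroˡ _)))
                 (zeroʳ _)))) (zeroʳ _)))) ⟩
      sg q * ((sg n * V′) * L (suc q) F + 0#)
        ≈⟨ solve 4 (λ r s v l → r :* ((s :* v) :* l :+ :0) := s :* (v :* (r :* l))) refl _ _ _ _ ⟩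
      sg n * (V′ * (sg q * L (suc q) F))
        ≈⟨ *-congˡ (*-congˡ (Gram-factor 0# F F≋)) ⟨
      sg n * (V′ * Gram (suc m) p q α β F) ∎)
      where
      open Columns m p q α β q≤m F
      -- With y = 0 the factor in `Gram-factor` is F itself, which expresses the determinant of F
      -- through `L`.
      F≋ : F ≋ lin (- 0#) ⊛ F
      F≋ = S.sym (S.trans (S.*-congʳ (S.+-congˡ (S.-‿cong
          (S.*-congʳ (S.trans (C-cong (solve 0 (:- :0 := :0) refl)) C-0)))))
        (Sol.solve 2 (λ z f → (Sol.:1 Sol.:- Sol.:0 Sol.:* z) Sol.:* f Sol.:= f) S.refl z F))

  module _ (p q e ny : ℕ) (α β : ℕ → ℕ) (X Y : ℕ → Carrier) (β-small : ∀ j → j ℕ.< q → β j ℕ.< q ℕ.+ e) where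
    private
      n : ℕ
      n = p ℕ.+ e
      F : Series
      F = generating (suc n) ny X Y
      Fs : ℕ → Series
      Fs k = generating n ny (X ∘ skip k) Y
      w u : ℕ → Carrier
      w = weight n X
      u k = w k * ∏ n (X ∘ skip k)
      V′ Π : Carrier
      V′ = V (suc n) X
      Π = ∏ (suc n) X

      -- The F-columns begin one power of u lower than in `Gram`. An additional row then removes the
      -- surplus: a unit row deletes the lowest column, and evaluation at xₖ combines neighbours
      -- into columns for F (1 - xₖ z).
      χs Fc A : ℕ → ℕ → Carrier
      χs = χ-columns p α β
      Fc = F-columns p α F q
      A = glue q χs Fc

      -- A row with an arbitrary series ψ in place of `H r` at degree -(r + 1). Its entries at the
      -- legs are set to 0, which is their value as soon as β j < r.
      tail : ℕ → Series → ℕ → Carrier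
      tail r ψ = glue q (λ _ → 0#) (λ l → at (ψ ⊛ F) (q ℕ.+ l) (suc (p ℕ.+ r)))

      tail-zero : ∀ m r ψ → m ℕ.≤ p ℕ.+ r → Det (suc m) (tail r ψ ◂ (λ i j → A j i)) ≈ 0#
      tail-zero m r ψ m≤pr = ∑-zero (suc m) (λ j j≤m → trans (*-congˡ (trans (*-congʳ
        (glue-elim (λ j v → j ℕ.< suc m → v ≈ 0#) q _ _ (λ _ _ _ → refl)
          (λ l ql≤m → at-< (ψ ⊛ F) (ℕ.<-≤-trans ql≤m (s≤s m≤pr))) j j≤m)) (zeroˡ _))) (zeroʳ _))

      -- Gaussian elimination against the rows p + r, p + r + 1, … of the matrix.
      tail-negligible : ∀ m d r ψ → (∀ j → j ℕ.< q → β j ℕ.< r) → m ℕ.≤ p ℕ.+ r ℕ.+ d →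
        Det (suc m) (tail r ψ ◂ (λ i j → A j i)) ≈ 0#
      tail-negligible m zero    r ψ β<r m≤ = tail-zero m r ψ (≡.subst (m ℕ.≤_) (ℕ.+-identityʳ _) m≤)
      tail-negligible m (suc d) r ψ β<r m≤ with p ℕ.+ r ℕ.<? m
      ... | no pr≮m = tail-zero m r ψ (ℕ.≮⇒≥ pr≮m)
      ... | yes pr<m = begin
        Det (suc m) (tail r ψ ◂ (λ i j → A j i))
          ≈⟨ Det-minors m (tail r ψ ◂ (λ i j → A j i)) ((λ j → ψ 0 * A j (p ℕ.+ r) + tail (suc r) ψ′ j) ◂
               (λ i j → A j i)) eliminate (λ _ → refl) ⟩
        Det (suc m) ((λ j → ψ 0 * A j (p ℕ.+ r) + tail (suc r) ψ′ j) ◂ (λ i j → A j i))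
          ≈⟨ Det-linear m (ψ 0) (λ j → A j (p ℕ.+ r)) (tail (suc r) ψ′) (λ i j → A j i) ⟩
        ψ 0 * Det (suc m) ((λ j → A j (p ℕ.+ r)) ◂ (λ i j → A j i)) + Det (suc m)
            (tail (suc r) ψ′ ◂ (λ i j → A j i))
          ≈⟨ +-cong (*-congˡ (Det-repeated m (p ℕ.+ r) (λ j → A j (p ℕ.+ r)) (λ i j → A j i) pr<m (λ _ → refl)))
               (tail-negligible m d (suc r) ψ′ (λ j j<q → ℕ.m≤n⇒m≤1+n (β<r j j<q))
                 (≡.subst (m ℕ.≤_) (≡.trans (ℕ.+-suc (p ℕ.+ r) d) (≡.cong (ℕ._+ d) (≡.sym (ℕ.+-suc p r)))) m≤)) ⟩
        ψ 0 * 0# + 0#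
          ≈⟨ solve 1 (λ c → c :* :0 :+ :0 := :0) refl (ψ 0) ⟩
        0# ∎
        where
        -- Since `H r` starts with 1, subtracting ψ 0 times row p + r kills the leading term of ψ;
        -- ψ′ is the difference divided by z, one degree lower.
        ψ′ : Series
        ψ′ t = ψ (suc t) - ψ 0 * H r (suc t)
        ψ-split : ψ ≋ (C (ψ 0) ⊛ H r) ⊕ (z ⊛ ψ′)
        ψ-split = coefficientwise λ
          { zero → sym (trans (+-cong (trans (*-congˡ (geos-zero (suc r) b)) (*-identityʳ _)) (coef-z-zero ψ′))
              (+-identityʳ _))
          ; (suc t) → sym (trans (+-cong (coef-C (ψ 0) (H r) (suc t)) (coef-z-suc ψ′ t))
              (solve 2 (λ a b → a :+ (b :- a) := b) refl _ _)) }
        row-r : ∀ P k → column p α P k (p ℕ.+ r) ≈ at (H r ⊛ P) k (suc (p ℕ.+ r))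
        row-r P k = reflexive (≡.cong (λ ρ → pairing ρ P k) (glue-+ p _ _ r))
        eliminate : ∀ j → tail r ψ j ≈ ψ 0 * A j (p ℕ.+ r) + tail (suc r) ψ′ j
        eliminate j with position q j
        ... | inj₁ j<q = begin
          tail r ψ j
            ≡⟨ glue-< q _ _ j j<q ⟩
          0#
            ≈⟨ solve 1 (λ c → c :* :0 :+ :0 := :0) refl (ψ 0) ⟨
          ψ 0 * 0# + 0#
            ≈⟨ +-cong (*-congˡ (trans (sym (trans (row-r _ _)
                 (at-< (H r ⊛ lins (β j) b) (s≤s (ℕ.<-≤-trans (ℕ.+-monoˡ-< p (β<r j j<q))
                 (ℕ.≤-reflexive (ℕ.+-comm r p)))))))
                 (reflexive (≡.cong (λ v → v (p ℕ.+ r)) (≡.sym (glue-< q χs Fc j j<q))))))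
                     (reflexive (≡.sym (glue-< q _ _ j j<q))) ⟩
          ψ 0 * A j (p ℕ.+ r) + tail (suc r) ψ′ j ∎
        ... | inj₂ (l , ≡.refl) = begin
          tail r ψ (q ℕ.+ l)
            ≡⟨ glue-+ q _ _ l ⟩
          at (ψ ⊛ F) (q ℕ.+ l) (suc (p ℕ.+ r))
            ≈⟨ at-cong (S.trans (S.*-congʳ ψ-split) (Sol.solve 5
                 (λ c h z p f → (c Sol.:* h Sol.:+ z Sol.:* p) Sol.:* f Sol.:= c Sol.:* (h Sol.:* f) Sol.:+ z
                 Sol.:* (p Sol.:* f))
                 S.refl _ _ _ _ _)) (q ℕ.+ l) (suc (p ℕ.+ r)) ⟩
          at ((C (ψ 0) ⊛ (H r ⊛ F)) ⊕ (z ⊛ (ψ′ ⊛ F))) (q ℕ.+ l) (suc (p ℕ.+ r))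
            ≈⟨ trans (at-⊕ _ _ (q ℕ.+ l) (suc (p ℕ.+ r)))
                 (+-cong (at-C (ψ 0) (H r ⊛ F) (q ℕ.+ l) (suc (p ℕ.+ r)))
                 (at-z-suc (ψ′ ⊛ F) (q ℕ.+ l) (suc (p ℕ.+ r)))) ⟩
          ψ 0 * at (H r ⊛ F) (q ℕ.+ l) (suc (p ℕ.+ r)) + at (ψ′ ⊛ F) (q ℕ.+ l) (suc (suc (p ℕ.+ r)))
            ≈⟨ +-cong (*-congˡ (trans (sym (row-r F (q ℕ.+ l)))
                 (reflexive (≡.cong (λ v → v (p ℕ.+ r)) (≡.sym (glue-+ q χs Fc l))))))
                 (reflexive (≡.trans (≡.cong (λ k → at (ψ′ ⊛ F) (q ℕ.+ l) (suc k)) (≡.sym (ℕ.+-suc p r)))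
                     (≡.sym (glue-+ q _ _ l)))) ⟩
          ψ 0 * A (q ℕ.+ l) (p ℕ.+ r) + tail (suc r) ψ′ (q ℕ.+ l) ∎

      t : Series
      t = z^ suc n ⊛ geos (suc n) X

      -- Interpolation at 0 through the xₖ is exact on 1 and gives 0 on the powers of u from the
      -- first to the n-th. The row `t` collects the errors on higher powers, which are complete
      -- homogeneous functions of the x's.
      ∑-evaluations : ∀ j → ∑ (suc n) (λ k → u k * evaluation q (X k) j) ≈
        (sg n * V′) * unit q j + (Π * V′) * glue q (λ _ → 0#) t j
      ∑-evaluations j with position q j
      ... | inj₁ j<q = begin
        ∑ (suc n) (λ k → u k * evaluation q (X k) j)
          ≈⟨ ∑-zero (suc n) (λ k _ → trans (*-congˡ (reflexive (glue-< q _ _ j j<q))) (zeroʳ _)) ⟩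
        0#
          ≈⟨ solve 2 (λ a b → a :* :0 :+ b :* :0 := :0) refl _ _ ⟨
        (sg n * V′) * 0# + (Π * V′) * 0#
          ≡⟨ ≡.cong₂ (λ v v′ → (sg n * V′) * v + (Π * V′) * v′) (glue-< q _ _ j j<q) (glue-< q _ _ j j<q) ⟨
        (sg n * V′) * unit q j + (Π * V′) * glue q (λ _ → 0#) t j ∎
      ... | inj₂ (l , ≡.refl) = begin
        ∑ (suc n) (λ k → u k * evaluation q (X k) (q ℕ.+ l))
          ≈⟨ ∑-cong (suc n) (λ k → *-congˡ (reflexive (glue-+ q _ _ l))) ⟩
        ∑ (suc n) (λ k → u k * geo (X k) l)
          ≈⟨ powers l ⟩
        (sg n * V′) * (1# ◂ (λ _ → 0#)) l + (Π * V′) * t l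
          ≡⟨ ≡.cong₂ (λ v v′ → (sg n * V′) * v + (Π * V′) * v′) (glue-+ q _ _ l) (glue-+ q _ _ l) ⟨
        (sg n * V′) * unit q (q ℕ.+ l) + (Π * V′) * glue q (λ _ → 0#) t (q ℕ.+ l) ∎
        where
        powers : ∀ l → ∑ (suc n) (λ k → u k * geo (X k) l) ≈ (sg n * V′) * (1# ◂ (λ _ → 0#)) l + (Π * V′) * t l
        powers zero = begin
          ∑ (suc n) (λ k → u k * 1#)          ≈⟨ trans (∑-cong (suc n) (λ k → *-identityʳ _)) (∑-weights-top n X) ⟩
          sg n * V′                           ≈⟨ solve 2 (λ a b → a :* :1 :+ b :* :0 := a) refl _ _ ⟨
          (sg n * V′) * 1# + (Π * V′) * 0#    ≈⟨ +-congˡ (*-congˡ (coef-z-zero (z^ n ⊛ geos (suc n) X))) ⟨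
          (sg n * V′) * 1# + (Π * V′) * t 0   ∎
        powers (suc l) = begin
          ∑ (suc n) (λ k → u k * (X k * geo (X k) l))
            ≈⟨ ∑-cong< (suc n) (λ { k (s≤s k≤n) → trans
                 (solve 4 (λ w p x g → (w :* p) :* (x :* g) := (x :* p) :* (w :* g)) refl _ _ _ _)
                 (*-cong (sym (∏-skip n k X k≤n)) (sym (coef-C (w k) (geo (X k)) l))) }) ⟩
          ∑ (suc n) (λ k → Π * (C (w k) ⊛ geo (X k)) l)
            ≈⟨ trans (sym (*-∑ (suc n) Π _)) (*-congˡ (trans (sym (coef-∑ (suc n) _ l))
                 (coef-≈ (lagrange₁ n X) l))) ⟩
          Π * (C V′ ⊛ (z^ n ⊛ geos (suc n) X)) l
            ≈⟨ *-congˡ (trans (coef-C V′ _ l) (*-congˡ (sym (coef-z-suc (z^ n ⊛ geos (suc n) X) l)))) ⟩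
          Π * (V′ * t (suc l))
            ≈⟨ solve 4 (λ p v t c → p :* (v :* t) := c :* :0 :+ (p :* v) :* t) refl _ _ _ _ ⟩
          (sg n * V′) * 0# + (Π * V′) * t (suc l) ∎

      -- Π 1 / (1 - xᵢ z) equals F times Π 1 / (1 + yⱼ z), so the error row is of the kind treated
      -- by Gaussian elimination, starting at r = q + e, beyond all the legs.
      t-tail : ∀ j → glue q (λ _ → 0#) t j ≈ tail (q ℕ.+ e) (geos ny (λ j → - Y j)) j
      t-tail j with position q j
      ... | inj₁ j<q = reflexive (≡.trans (glue-< q _ _ j j<q) (≡.sym (glue-< q _ _ j j<q)))
      ... | inj₂ (l , ≡.refl) = begin
        glue q (λ _ → 0#) t (q ℕ.+ l)
          ≡⟨ glue-+ q _ _ l ⟩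
        at t l 0
          ≈⟨ z^-shift (suc n) (geos (suc n) X) l 0 ⟩
        at (geos (suc n) X) l (suc n ℕ.+ 0)
          ≈⟨ at-cong (S.sym (S.trans (Sol.solve 3 (λ g l x → g Sol.:* (l Sol.:* x) Sol.:= (l Sol.:* g) Sol.:* x)
               S.refl _ _ _)
               (S.trans (S.*-congʳ (lins-geos ny _)) (S.*-identityˡ _)))) l (suc n ℕ.+ 0) ⟩
        at (geos ny (λ j → - Y j) ⊛ F) l (suc n ℕ.+ 0)
          ≡⟨ at-+ (geos ny (λ j → - Y j) ⊛ F) q l (suc n ℕ.+ 0) ⟨
        at (geos ny (λ j → - Y j) ⊛ F) (q ℕ.+ l) (q ℕ.+ (suc n ℕ.+ 0))
          ≡⟨ ≡.cong (at (geos ny (λ j → - Y j) ⊛ F) (q ℕ.+ l)) (index p q e) ⟩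
        at (geos ny (λ j → - Y j) ⊛ F) (q ℕ.+ l) (suc (p ℕ.+ (q ℕ.+ e)))
          ≡⟨ glue-+ q _ _ l ⟨
        tail (q ℕ.+ e) (geos ny (λ j → - Y j)) (q ℕ.+ l) ∎
        where
        index : ∀ p q e → q ℕ.+ (suc (p ℕ.+ e) ℕ.+ 0) ≡ suc (p ℕ.+ (q ℕ.+ e))
        index = solve-∀
        z^-shift : ∀ k f i j → at (z^ k ⊛ f) i j ≈ at f i (k ℕ.+ j)
        z^-shift zero    f i j = refl
        z^-shift (suc k) f i j = trans (at-z-suc (z^ k ⊛ f) i j)
            (trans (z^-shift k f i (suc j)) (reflexive (≡.cong (at f i) (ℕ.+-suc k j))))

      Det-Fs : ∀ m → q ℕ.≤ m → ∀ k → k ℕ.≤ n →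
        Det (suc m) (evaluation q (X k) ◂ (λ i j → A j i)) ≈ sg q * Gram m p q α β (Fs k)
      Det-Fs m q≤m k k≤n = trans (Det-evaluation m q (X k) χs Fc q≤m) (*-congˡ (Det-cong m (λ j _ i →
        glue-cong q (λ _ _ → refl) step j i)))
        where
        step : ∀ l i → column p α F (q ℕ.+ suc l) i - X k * column p α F (q ℕ.+ l) i ≈ column p α (Fs k)
            (suc q ℕ.+ l) i
        step l i = trans (+-congʳ (reflexive (≡.cong (λ k → column p α F k i) (ℕ.+-suc q l))))
          (trans (sym (pairing-lin (rows p α i) (X k) F (q ℕ.+ l)))
            (sym (pairing-cong (rows p α i) (suc (q ℕ.+ l)) (generating-dropˣ n ny X Y k k≤n))))

    -- The dual of `Gram-removeʸ`: the evaluation rows at the xₖ combine to a multiple of the unit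
    -- row, which yields the determinant of F, and a multiple of the error row, which is dependent
    -- on the others.
    Gram-removeˣ : ∀ m → q ℕ.≤ m → sg (p ℕ.+ e) * (V (suc (p ℕ.+ e)) X * Gram m p q α β
        (generating (suc (p ℕ.+ e)) ny X Y)) ≈
      ∑ (suc (p ℕ.+ e)) (λ k → (weight (p ℕ.+ e) X k * ∏ (p ℕ.+ e) (X ∘ skip k)) * Gram m p q α β
          (generating (p ℕ.+ e) ny (X ∘ skip k) Y))
    Gram-removeˣ m q≤m = begin
      sg n * (V′ * Gram m p q α β F)
        ≈⟨ trans (sym (*-identityˡ _)) (*-congʳ (sym (sg-square q))) ⟩
      (sg q * sg q) * (sg n * (V′ * Gram m p q α β F))
        ≈⟨ solve 5 (λ q n v g c → (q :* q) :* (n :* (v :* g)) := q :* ((n :* v) :* (q :* g) :+ c :* :0)) refl _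
             _ _ _ (Π * V′) ⟩
      sg q * ((sg n * V′) * (sg q * Gram m p q α β F) + (Π * V′) * 0#)
        ≈⟨ *-congˡ (+-cong (*-congˡ (sym unit-row)) (*-congˡ (sym tail-row))) ⟩
      sg q * ((sg n * V′) * Det (suc m) (unit q ◂ At) + (Π * V′) * Det (suc m) (glue q (λ _ → 0#) t ◂ At))
        ≈⟨ *-congˡ (trans (+-congˡ (sym (Det-*ˡ m (Π * V′) (glue q (λ _ → 0#) t) At)))
             (sym (Det-linear m (sg n * V′) (unit q) _ At))) ⟩
      sg q * Det (suc m) ((λ j → (sg n * V′) * unit q j + (Π * V′) * glue q (λ _ → 0#) t j) ◂ At)
        ≈⟨ *-congˡ (Det-minors m ((λ j → (sg n * V′) * unit q j + (Π * V′) * glue q (λ _ → 0#) t j) ◂ At)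
             ((λ j → ∑ (suc n) (λ k → u k * evaluation q (X k) j)) ◂ At) (λ j → sym (∑-evaluations j))
                 (λ _ → refl)) ⟩
      sg q * Det (suc m) ((λ j → ∑ (suc n) (λ k → u k * evaluation q (X k) j)) ◂ At)
        ≈⟨ *-congˡ (Det-∑ m (suc n) u (λ k → evaluation q (X k)) At) ⟩
      sg q * ∑ (suc n) (λ k → u k * Det (suc m) (evaluation q (X k) ◂ At))
        ≈⟨ *-∑ (suc n) (sg q) _ ⟩
      ∑ (suc n) (λ k → sg q * (u k * Det (suc m) (evaluation q (X k) ◂ At)))
        ≈⟨ ∑-cong< (suc n) (λ { k (s≤s k≤n) → trans (*-congˡ (*-congˡ (Det-Fs m q≤m k k≤n)))
             (trans (solve 3 (λ s u g → s :* (u :* (s :* g)) := (s :* s) :* (u :* g)) refl _ _ _)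
                 (trans (*-congʳ (sg-square q)) (*-identityˡ _))) }) ⟩
      ∑ (suc n) (λ k → u k * Gram m p q α β (Fs k)) ∎
      where
      At : ℕ → ℕ → Carrier
      At i j = A j i
      unit-row : Det (suc m) (unit q ◂ At) ≈ sg q * Gram m p q α β F
      unit-row = trans (Det-unit-row m q A q≤m) (*-congˡ
          (Det-cong m (λ j _ i → trans (reflexive (≡.cong (λ v → v i) (glue-skip q χs Fc j)))
        (glue-cong q (λ _ _ → refl) (λ l i → reflexive (≡.cong (λ k → column p α F k i) (ℕ.+-suc q l))) j i))))
      tail-row : Det (suc m) (glue q (λ _ → 0#) t ◂ At) ≈ 0#
      tail-row = trans (Det-minors m (glue q (λ _ → 0#) t ◂ At) (tail (q ℕ.+ e) (geos ny (λ j → - Y j)) ◂ At)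
          t-tail (λ _ → refl))
        (tail-negligible m m (q ℕ.+ e) (geos ny (λ j → - Y j)) β-small (ℕ.m≤n+m m (p ℕ.+ (q ℕ.+ e))))

  -- Without polynomial rows and legs the entry in column j and row i is the coefficient of order j
  -- - i of a series with constant term 1.
  Gram-empty : ∀ m α β F → F 0 ≈ 1# → Gram m 0 0 α β F ≈ 1#
  Gram-empty m α β F F≈1 = unitriangular m H (λ r → geos-zero (suc r) b)
    where
    unitriangular : ∀ m (G : ℕ → Series) → (∀ r → G r 0 ≈ 1#) → Det m (λ j i → at (G i ⊛ F) j i) ≈ 1#
    unitriangular zero    G G≈1 = refl
    unitriangular (suc m) G G≈1 = begin
      Det (suc m) (λ j i → at (G i ⊛ F) j i)
        ≈⟨ Det-unit m 0 (λ i → at (G i ⊛ F) 0 i) (λ j i → at (G i ⊛ F) (suc j) i) z≤n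
             (trans (*-cong (G≈1 0) F≈1) (*-identityˡ _))
             (λ { zero 0≢0 → contradiction ≡.refl 0≢0 ; (suc i) _ → refl }) ⟩
      1# * Det m (λ j i → at (G (suc i) ⊛ F) (suc j) (suc i))
        ≈⟨ trans (*-identityˡ _) (unitriangular m (G ∘ suc) (λ r → G≈1 (suc r))) ⟩
      1# ∎

-- Alternating sums over permutations

module Alternants {c ℓ} (R : CommutativeRing c ℓ) where
  open CommutativeRing R
  open RingTactic R
  open FiniteSums R
  open import Relation.Binary.Reasoning.Setoid setoid

  -- Σ_w sgn(w) f (X ∘ w) over the permutations w of the first n entries of X.
  Alt : ℕ → ((ℕ → Carrier) → Carrier) → (ℕ → Carrier) → Carrier
  Alt zero    f X = f X
  Alt (suc n) f X = ∑ (suc n) (λ k → sg k * Alt n (λ v → f (X k ◂ v)) (X ∘ skip k))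

  Alt-cong : ∀ n {f g} → (∀ v → f v ≈ g v) → ∀ X → Alt n f X ≈ Alt n g X
  Alt-cong zero    f≈g X = f≈g X
  Alt-cong (suc n) f≈g X = ∑-cong (suc n) (λ k → *-congˡ (Alt-cong n (λ v → f≈g (X k ◂ v)) (X ∘ skip k)))

  -- Arguments are infinite sequences, and what follows the first n entries varies with the order in
  -- which entries were deleted.
  DependsOn : ℕ → ((ℕ → Carrier) → Carrier) → Set _
  DependsOn n f = ∀ u v → (∀ i → i ℕ.< n → u i ≈ v i) → f u ≈ f v

  ◂-cong : ∀ {n x y} {u v : ℕ → Carrier} → x ≈ y → (∀ i → i ℕ.< n → u i ≈ v i) → ∀ i → i ℕ.< suc n → (x ◂ u) i ≈
      (y ◂ v) i
  ◂-cong x≈y u≈v zero    _         = x≈y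
  ◂-cong x≈y u≈v (suc i) (s≤s i<n) = u≈v i i<n

  Alt-congˣ : ∀ n {f} → DependsOn n f → ∀ {X Y} → (∀ i → X i ≈ Y i) → Alt n f X ≈ Alt n f Y
  Alt-congˣ zero    dep {X} {Y} X≈Y = dep X Y (λ _ ())
  Alt-congˣ (suc n) {f} dep {X} {Y} X≈Y = ∑-cong (suc n) (λ k → *-congˡ (trans
    (Alt-cong n (λ v → dep (X k ◂ v) (Y k ◂ v) (◂-cong (X≈Y k) (λ _ _ → refl))) (X ∘ skip k))
    (Alt-congˣ n (λ u v u≈v → dep (Y k ◂ u) (Y k ◂ v) (◂-cong refl u≈v)) (λ i → X≈Y (skip k i)))))

  Alt-* : ∀ n x f X → Alt n (λ v → x * f v) X ≈ x * Alt n f X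
  Alt-* zero    x f X = refl
  Alt-* (suc n) x f X = trans
    (∑-cong (suc n) (λ k → trans (*-congˡ (Alt-* n x _ (X ∘ skip k)))
        (solve 3 (λ s x a → s :* (x :* a) := x :* (s :* a)) refl _ _ _)))
    (sym (*-∑ (suc n) x _))

  Alt-∑ : ∀ n m (F : ℕ → (ℕ → Carrier) → Carrier) X → Alt n (λ v → ∑ m (λ k → F k v)) X ≈ ∑ m (λ k → Alt n (F k) X)
  Alt-∑ zero    m F X = refl
  Alt-∑ (suc n) m F X = trans
    (∑-cong (suc n) (λ l → trans (*-congˡ (Alt-∑ n m (λ k v → F k (X l ◂ v)) (X ∘ skip l))) (*-∑ m (sg l) _)))
    (∑-swap (suc n) m _)

  Alt-symmetric : ∀ n (h : Carrier → Carrier) f X → Alt n (λ v → ∏ n (h ∘ v) * f v) X ≈ ∏ n (h ∘ X) * Alt n f X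
  Alt-symmetric zero    h f X = refl
  Alt-symmetric (suc n) h f X = begin
    ∑ (suc n) (λ k → sg k * Alt n (λ v → ∏ (suc n) (h ∘ (X k ◂ v)) * f (X k ◂ v)) (X ∘ skip k))
      ≈⟨ ∑-cong< (suc n) (λ { k (s≤s k≤n) → trans (*-congˡ (term k k≤n))
           (solve 3 (λ s p a → s :* (p :* a) := p :* (s :* a)) refl _ _ _) }) ⟩
    ∑ (suc n) (λ k → ∏ (suc n) (h ∘ X) * (sg k * Alt n (λ v → f (X k ◂ v)) (X ∘ skip k)))
      ≈⟨ *-∑ (suc n) _ _ ⟨
    ∏ (suc n) (h ∘ X) * Alt (suc n) f X ∎
    where
    term : ∀ k → k ℕ.≤ n → Alt n (λ v → ∏ (suc n) (h ∘ (X k ◂ v)) * f (X k ◂ v)) (X ∘ skip k) ≈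
      ∏ (suc n) (h ∘ X) * Alt n (λ v → f (X k ◂ v)) (X ∘ skip k)
    term k k≤n = begin
      Alt n (λ v → ∏ (suc n) (h ∘ (X k ◂ v)) * f (X k ◂ v)) (X ∘ skip k)
        ≈⟨ Alt-cong n (λ v → trans (*-congʳ (∏-suc n (h ∘ (X k ◂ v)))) (*-assoc _ _ _)) (X ∘ skip k) ⟩
      Alt n (λ v → h (X k) * (∏ n (h ∘ v) * f (X k ◂ v))) (X ∘ skip k)
        ≈⟨ Alt-* n (h (X k)) _ (X ∘ skip k) ⟩
      h (X k) * Alt n (λ v → ∏ n (h ∘ v) * f (X k ◂ v)) (X ∘ skip k)
        ≈⟨ *-congˡ (Alt-symmetric n h (λ v → f (X k ◂ v)) (X ∘ skip k)) ⟩
      h (X k) * (∏ n (h ∘ X ∘ skip k) * Alt n (λ v → f (X k ◂ v)) (X ∘ skip k))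
        ≈⟨ trans (sym (*-assoc _ _ _)) (*-congʳ (sym (∏-skip n k (h ∘ X) k≤n))) ⟩
      ∏ (suc n) (h ∘ X) * Alt n (λ v → f (X k ◂ v)) (X ∘ skip k) ∎

  -- `Alt` chooses the first argument first. Recursion singles out the last argument among the rest,
  -- and the ordered pairs (first, last) are then exchanged by `∑-pairs`; `sg n` is the sign of
  -- moving the last place to the front.
  Alt-last : ∀ n f → DependsOn (suc n) f → ∀ X →
    Alt (suc n) f X ≈ sg n * ∑ (suc n) (λ k → sg k * Alt n (λ v → f (glue n v (λ _ → X k))) (X ∘ skip k))
  Alt-last zero f dep X = trans (∑-cong< 1 (λ { zero _ → *-congˡ
      (dep (X 0 ◂ (X ∘ suc)) (λ _ → X 0) (λ { zero _ → refl ; (suc i) (s≤s ()) })) ; (suc k) (s≤s ()) }))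
    (sym (*-identityˡ _))
  Alt-last (suc n) f dep X = begin
    ∑ (2 ℕ.+ n) (λ k → sg k * Alt (suc n) (λ v → f (X k ◂ v)) (X ∘ skip k))
      ≈⟨ ∑-cong (2 ℕ.+ n) (λ k → trans (*-congˡ (trans (Alt-last n (λ v → f (X k ◂ v))
           (λ u v u≈v → dep (X k ◂ u) (X k ◂ v) (◂-cong refl u≈v)) (X ∘ skip k))
           (*-∑ (suc n) (sg n) _))) (trans (*-∑ (suc n) (sg k) _)
               (trans (∑-cong (suc n) (λ l → exchange k l)) (sym (*-∑ (suc n) (- sg n) _))))) ⟩
    ∑ (2 ℕ.+ n) (λ k → - sg n * ∑ (suc n) (λ l → T (skip k l) (pre k l)))
      ≈⟨ trans (sym (*-∑ (2 ℕ.+ n) (- sg n) _)) (*-congˡ (∑-pairs (suc n) T)) ⟩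
    - sg n * ∑ (2 ℕ.+ n) (λ l → ∑ (suc n) (T l))
      ≈⟨ *-congˡ (∑-cong (2 ℕ.+ n) (λ l → sym (*-∑ (suc n) (sg l) _))) ⟩
    sg (suc n) * ∑ (2 ℕ.+ n) (λ l → sg l * Alt (suc n) (λ v → f (glue (suc n) v (λ _ → X l))) (X ∘ skip l)) ∎
    where
    T : ℕ → ℕ → Carrier
    T l k = sg l * (sg k * Alt n (λ v → f (X (skip l k) ◂ glue n v (λ _ → X l))) (X ∘ skip l ∘ skip k))
    exchange : ∀ k l → sg k * (sg n * (sg l * Alt n (λ v → f (X k ◂ glue n v (λ _ → X (skip k l))))
        (X ∘ skip k ∘ skip l))) ≈
      - sg n * T (skip k l) (pre k l)
    exchange k l = begin
      sg k * (sg n * (sg l * A))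
        ≈⟨ solve 4 (λ k n l a → k :* (n :* (l :* a)) := (:- n) :* ((:- (k :* l)) :* a)) refl _ _ _ _ ⟩
      - sg n * (- (sg k * sg l) * A)
        ≈⟨ *-congˡ (*-cong (sym (sg-skip-pre k l)) (trans
             (Alt-congˣ n (λ u v u≈v → dep _ _ (◂-cong refl (glue-dep n u v u≈v)))
                 (λ i → reflexive (≡.cong X (≡.sym (skip-skip k l i)))))
             (Alt-cong n (λ v → reflexive (≡.cong (λ i → f (X i ◂ glue n v (λ _ → X (skip k l))))
                 (≡.sym (skip-pre k l)))) _))) ⟩
      - sg n * ((sg (skip k l) * sg (pre k l)) * A′)
        ≈⟨ *-congˡ (*-assoc _ _ _) ⟩
      - sg n * T (skip k l) (pre k l) ∎
      where
      A A′ : Carrier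
      A = Alt n (λ v → f (X k ◂ glue n v (λ _ → X (skip k l)))) (X ∘ skip k ∘ skip l)
      A′ = Alt n (λ v → f (X (skip (skip k l) (pre k l)) ◂ glue n v (λ _ → X (skip k l))))
          (X ∘ skip (skip k l) ∘ skip (pre k l))
      glue-dep : ∀ n (u v : ℕ → Carrier) → (∀ i → i ℕ.< n → u i ≈ v i) → ∀ {x} i → i ℕ.< suc n → glue n u
          (λ _ → x) i ≈ glue n v (λ _ → x) i
      glue-dep zero    u v u≈v i       _         = refl
      glue-dep (suc n) u v u≈v zero    _         = u≈v 0 (s≤s z≤n)
      glue-dep (suc n) u v u≈v (suc i) (s≤s i<n) = glue-dep n (u ∘ suc) (v ∘ suc)
          (λ i i<n → u≈v (suc i) (s≤s i<n)) i i<n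

-- Gram determinants as double alternants

-- An order in which the Gram matrix is reduced to the empty one: a row, a column,
-- or the last x together with the last y is removed at each step.
data Path : (p q e : ℕ) (α β : ℕ → ℕ) → Set where
  done          : ∀ {α β} → Path 0 0 0 α β
  remove-row    : ∀ {p q e α β} → Path p q e (α ∘ suc) β → Path (suc p) q e α β
  remove-column : ∀ {p q e α β} → Path p q e α β → Path p (suc q) e α β
  remove-corner : ∀ {p q e α β} → (∀ i → i ℕ.< p → α i ℕ.< p ℕ.+ e) → (∀ j → j ℕ.< q → β j ℕ.< q ℕ.+ e) →
    Path p q e α β → Path p q (suc e) α β

module GramAlternant {c ℓ} (R : CommutativeRing c ℓ) (a b : ℕ → CommutativeRing.Carrier R) where
  open CommutativeRing R
  open RingTactic R
  open FiniteSums R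
  open PowerSeries R
  open Vandermonde R
  open GeneratingFunctions R
  open GramMatrix R a b
  open RowRemoval R a b
  open ColumnRemoval R a b
  open PointRemoval R a b
  open Alternants R
  open import Relation.Binary.Reasoning.Setoid setoid

  -- A row takes the first x and a column the first y. A corner takes the last of both, which
  -- themselves contribute 1, and leaves the interpolation weight, the product of the variables that
  -- remain.
  summand : ∀ {p q e α β} → Path p q e α β → (ℕ → Carrier) → (ℕ → Carrier) → Carrier
  summand done u v = 1#
  summand (remove-row {p} {q} {e} {α} P) u v = (φ (α 0) (u 0) * ∏ (q ℕ.+ e) (λ j → u 0 + v j)) * summand P
      (u ∘ suc) v
  summand (remove-column {p} {q} {e} {α} {β} P) u v = (χ (β q) (v 0) * ∏ (p ℕ.+ e) (λ i → u i + v 0)) * summand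
      P u (v ∘ suc)
  summand (remove-corner {p} {q} {e} _ _ P) u v = (∏ (p ℕ.+ e) u * ∏ (q ℕ.+ e) v) * summand P u v

  private
    +-suc-bound : ∀ {m n i} → i ℕ.< m ℕ.+ n → i ℕ.< m ℕ.+ suc n
    +-suc-bound {m} {n} {i} i<mn = ≡.subst (i ℕ.<_) (≡.sym (ℕ.+-suc m n)) (ℕ.m≤n⇒m≤1+n i<mn)

  summand-cong : ∀ {p q e α β} (P : Path p q e α β) {u u′ v v′} →
    (∀ i → i ℕ.< p ℕ.+ e → u i ≈ u′ i) → (∀ j → j ℕ.< q ℕ.+ e → v j ≈ v′ j) → summand P u v ≈ summand P u′ v′
  summand-cong done u≈ v≈ = refl
  summand-cong (remove-row {p} {q} {e} {α} P) u≈ v≈ = *-cong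
    (*-cong (∏-cong (α 0) (λ t → +-congʳ (u≈ 0 (s≤s z≤n))))
        (∏-cong< (q ℕ.+ e) (λ j j<n → +-cong (u≈ 0 (s≤s z≤n)) (v≈ j j<n))))
    (summand-cong P (λ i i<n → u≈ (suc i) (s≤s i<n)) v≈)
  summand-cong (remove-column {p} {q} {e} {α} {β} P) u≈ v≈ = *-cong
    (*-cong (∏-cong (β q) (λ t → +-congʳ (v≈ 0 (s≤s z≤n))))
        (∏-cong< (p ℕ.+ e) (λ i i<n → +-cong (u≈ i i<n) (v≈ 0 (s≤s z≤n)))))
    (summand-cong P u≈ (λ j j<n → v≈ (suc j) (s≤s j<n)))
  summand-cong (remove-corner {p} {q} {e} _ _ P) u≈ v≈ = *-cong
    (*-cong (∏-cong< (p ℕ.+ e) (λ i i<n → u≈ i (+-suc-bound {p} i<n)))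
        (∏-cong< (q ℕ.+ e) (λ j j<n → v≈ j (+-suc-bound {q} j<n))))
    (summand-cong P (λ i i<n → u≈ i (+-suc-bound {p} i<n)) (λ j j<n → v≈ j (+-suc-bound {q} j<n)))

  -- The signs of the column removals. The sign `sg q` of a row removal is hidden in the dependence
  -- on p, by `Sg-suc`.
  Sg : ℕ → ℕ → (ℕ → ℕ) → Carrier
  Sg p zero    β = 1#
  Sg p (suc q) β = sg (β q ℕ.+ p ℕ.+ q) * Sg p q β

  Sg-suc : ∀ p q β → Sg (suc p) q β ≈ sg q * Sg p q β
  Sg-suc p zero    β = sym (*-identityˡ _)
  Sg-suc p (suc q) β = trans (*-cong (reflexive (≡.cong sg (index (β q) p q))) (Sg-suc p q β))
    (solve 3 (λ s q r → (:- s) :* (q :* r) := (:- q) :* (s :* r)) refl _ _ _)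
    where
    index : ∀ β p q → β ℕ.+ suc p ℕ.+ q ≡ suc (β ℕ.+ p ℕ.+ q)
    index = solve-∀

  private
    Alternant : ∀ {p q e α β} → Path p q e α β → (nx ny : ℕ) → (ℕ → Carrier) → (ℕ → Carrier) → Carrier
    Alternant P nx ny X Y = Alt nx (λ u → Alt ny (λ v → summand P u v) Y) X

  -- Only the removal of a row lowers the size m, and it lowers p as well, so both bounds persist.
  -- The second one is what `Gram-remove-column` requires of the current leg.
  V-V-Gram : ∀ {p q e α β} (P : Path p q e α β) m → p ℕ.+ q ℕ.≤ m → (∀ j → j ℕ.< q → β j ℕ.+ p ℕ.< m) → ∀ X Y →
    V (p ℕ.+ e) X * (V (q ℕ.+ e) Y * Gram m p q α β (generating (p ℕ.+ e) (q ℕ.+ e) X Y)) ≈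
    Sg p q β * Alt (p ℕ.+ e) (λ u → Alt (q ℕ.+ e) (λ v → summand P u v) Y) X
  V-V-Gram {α = α} {β} done m _ _ X Y = trans (*-identityˡ _) (*-congˡ (Gram-empty m α β (generating 0 0 X Y)
    (trans (*-cong (lins-zero 0 (λ j → - Y j)) (geos-zero 0 X)) (*-identityˡ _))))
  V-V-Gram {q = q} {e} {α} {β} (remove-row {p} P) (suc m) (s≤s pq≤m) bound X Y = begin
    V (suc n) X * (V ny Y * Gram (suc m) (suc p) q α β (generating (suc n) ny X Y))
      ≈⟨ solve 3 (λ x y g → x :* (y :* g) := y :* (x :* g)) refl _ _ _ ⟩
    V ny Y * (V (suc n) X * Gram (suc m) (suc p) q α β (generating (suc n) ny X Y))
      ≈⟨ *-congˡ (Gram-remove-row m p q e α β X Y (ℕ.≤-trans (ℕ.m≤n+m q p) pq≤m)) ⟩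
    V ny Y * (sg q * ∑ (suc n) (λ k → (weight n X k * A k) * G k))
      ≈⟨ solve 3 (λ v s x → v :* (s :* x) := s :* (v :* x)) refl _ _ _ ⟩
    sg q * (V ny Y * ∑ (suc n) (λ k → (weight n X k * A k) * G k))
      ≈⟨ *-congˡ (trans (*-∑ (suc n) (V ny Y) _) (∑-cong (suc n) (λ k → trans
           (solve 5 (λ y s x a g → y :* (((s :* x) :* a) :* g) := (s :* a) :* (x :* (y :* g))) refl _ _ _ _ _)
           (trans (*-congˡ (V-V-Gram P m pq≤m bound′ (X ∘ skip k) Y))
               (solve 4 (λ s a r t → (s :* a) :* (r :* t) := r :* (s :* (a :* t))) refl _ _ _ _))))) ⟩
    sg q * ∑ (suc n) (λ k → Sg p q β * (sg k * (A k * Alternant P n ny (X ∘ skip k) Y)))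
      ≈⟨ trans (*-congˡ (sym (*-∑ (suc n) (Sg p q β) _)))
           (trans (sym (*-assoc _ _ _)) (*-congʳ (sym (Sg-suc p q β)))) ⟩
    Sg (suc p) q β * ∑ (suc n) (λ k → sg k * (A k * Alternant P n ny (X ∘ skip k) Y))
      ≈⟨ *-congˡ (∑-cong (suc n) (λ k → *-congˡ (trans (sym (Alt-* n (A k) _ (X ∘ skip k)))
           (Alt-cong n {λ u → A k * Alt ny (λ v → summand P u v) Y}
           {λ u → Alt ny (λ v → (φ (α 0) (X k) * ∏ ny (λ j → X k + v j)) * summand P u v) Y}
               (λ u → sym (inner k u)) (X ∘ skip k))))) ⟩
    Sg (suc p) q β * Alternant (remove-row {α = α} P) (suc n) ny X Y ∎
    where
    n = p ℕ.+ e
    ny = q ℕ.+ e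
    bound′ : ∀ j → j ℕ.< q → β j ℕ.+ p ℕ.< m
    bound′ j j<q = ℕ.≤-pred (≡.subst (ℕ._≤ suc m) (≡.cong suc (ℕ.+-suc (β j) p)) (bound j j<q))
    A G : ℕ → Carrier
    A k = φ (α 0) (X k) * ∏ ny (λ j → X k + Y j)
    G k = Gram m p q (α ∘ suc) β (generating n ny (X ∘ skip k) Y)
    inner : ∀ k u → Alt ny (λ v → (φ (α 0) (X k) * ∏ ny (λ j → X k + v j)) * summand P u v) Y ≈ A k * Alt ny
        (λ v → summand P u v) Y
    inner k u = begin
      Alt ny (λ v → (φ (α 0) (X k) * ∏ ny (λ j → X k + v j)) * summand P u v) Y
        ≈⟨ Alt-cong ny (λ v → *-assoc _ _ _) Y ⟩
      Alt ny (λ v → φ (α 0) (X k) * (∏ ny (λ j → X k + v j) * summand P u v)) Y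
        ≈⟨ Alt-* ny (φ (α 0) (X k)) _ Y ⟩
      φ (α 0) (X k) * Alt ny (λ v → ∏ ny (λ j → X k + v j) * summand P u v) Y
        ≈⟨ *-congˡ (Alt-symmetric ny (λ y → X k + y) (summand P u) Y) ⟩
      φ (α 0) (X k) * (∏ ny (λ j → X k + Y j) * Alt ny (λ v → summand P u v) Y)
        ≈⟨ *-assoc _ _ _ ⟨
      A k * Alt ny (λ v → summand P u v) Y ∎
  V-V-Gram {p = p} {e = e} {α} {β} (remove-column {q = q} P) m pq<m bound X Y with m
  ... | zero = contra (≡.subst (ℕ._≤ 0) (ℕ.+-suc p q) pq<m)
    where
    contra : ∀ {A : Set _} → suc (p ℕ.+ q) ℕ.≤ 0 → A
    contra ()
  ... | suc m = begin
    V nx X * (V (suc n) Y * Gram (suc m) p (suc q) α β (generating nx (suc n) X Y))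
      ≈⟨ *-congˡ (Gram-remove-column m p q e α β X Y (ℕ.≤-trans (ℕ.m≤n+m q p) pq≤m)
           (ℕ.≤-pred (bound q ℕ.≤-refl))) ⟩
    V nx X * (sg (β q ℕ.+ p ℕ.+ q) * ∑ (suc n) (λ k → (weight n Y k * A k) * G k))
      ≈⟨ solve 3 (λ v s x → v :* (s :* x) := s :* (v :* x)) refl _ _ _ ⟩
    sg (β q ℕ.+ p ℕ.+ q) * (V nx X * ∑ (suc n) (λ k → (weight n Y k * A k) * G k))
      ≈⟨ *-congˡ (trans (*-∑ (suc n) (V nx X) _) (∑-cong (suc n) (λ k → trans
           (solve 5 (λ x s y a g → x :* (((s :* y) :* a) :* g) := (s :* a) :* (x :* (y :* g))) refl _ _ _ _ _)
           (trans (*-congˡ (V-V-Gram P (suc m) (ℕ.m≤n⇒m≤1+n pq≤m) (λ j j<q → bound j (ℕ.m≤n⇒m≤1+n j<q)) X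
               (Y ∘ skip k)))
             (solve 4 (λ s a r t → (s :* a) :* (r :* t) := r :* (s :* (a :* t))) refl _ _ _ _))))) ⟩
    sg (β q ℕ.+ p ℕ.+ q) * ∑ (suc n) (λ k → Sg p q β * (sg k * (A k * Alternant P nx n X (Y ∘ skip k))))
      ≈⟨ trans (*-congˡ (sym (*-∑ (suc n) (Sg p q β) _))) (sym (*-assoc _ _ _)) ⟩
    Sg p (suc q) β * ∑ (suc n) (λ k → sg k * (A k * Alternant P nx n X (Y ∘ skip k)))
      ≈⟨ *-congˡ (sym outer) ⟩
    Sg p (suc q) β * Alternant (remove-column P) nx (suc n) X Y ∎
    where
    n = q ℕ.+ e
    nx = p ℕ.+ e
    pq≤m : p ℕ.+ q ℕ.≤ m
    pq≤m = ℕ.≤-pred (≡.subst (ℕ._≤ suc m) (ℕ.+-suc p q) pq<m)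
    A G : ℕ → Carrier
    A k = χ (β q) (Y k) * ∏ nx (λ i → X i + Y k)
    G k = Gram (suc m) p q α β (generating nx n X (Y ∘ skip k))
    outer : Alternant (remove-column P) nx (suc n) X Y ≈ ∑ (suc n)
        (λ k → sg k * (A k * Alternant P nx n X (Y ∘ skip k)))
    outer = begin
      Alt nx (λ u → ∑ (suc n) (λ k → sg k * Alt n (λ v → (χ (β q) (Y k) * ∏ nx (λ i → u i + Y k)) * summand P u
          v) (Y ∘ skip k))) X
        ≈⟨ Alt-∑ nx (suc n) _ X ⟩
      ∑ (suc n) (λ k → Alt nx (λ u → sg k * Alt n (λ v → (χ (β q) (Y k) * ∏ nx (λ i → u i + Y k)) * summand P u
          v) (Y ∘ skip k)) X)
        ≈⟨ ∑-cong (suc n) (λ k → trans (Alt-* nx (sg k) _ X) (*-congˡ (begin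
             Alt nx (λ u → Alt n (λ v → (χ (β q) (Y k) * ∏ nx (λ i → u i + Y k)) * summand P u v) (Y ∘ skip k)) X
               ≈⟨ Alt-cong nx (λ u → trans (Alt-* n _ _ (Y ∘ skip k)) (*-assoc _ _ _)) X ⟩
             Alt nx (λ u → χ (β q) (Y k) * (∏ nx (λ i → u i + Y k) * Alt n (λ v → summand P u v) (Y ∘ skip k))) X
               ≈⟨ Alt-* nx (χ (β q) (Y k)) _ X ⟩
             χ (β q) (Y k) * Alt nx (λ u → ∏ nx (λ i → u i + Y k) * Alt n (λ v → summand P u v) (Y ∘ skip k)) X
               ≈⟨ *-congˡ (Alt-symmetric nx (λ x → x + Y k) (λ u → Alt n (λ v → summand P u v) (Y ∘ skip k)) X) ⟩
             χ (β q) (Y k) * (∏ nx (λ i → X i + Y k) * Alternant P nx n X (Y ∘ skip k))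
               ≈⟨ *-assoc _ _ _ ⟨
             A k * Alternant P nx n X (Y ∘ skip k) ∎))) ⟩
      ∑ (suc n) (λ k → sg k * (A k * Alternant P nx n X (Y ∘ skip k))) ∎
  V-V-Gram {p = p} {q} {α = α} {β} P′@(remove-corner {e = e} α-small β-small P) m pq≤m bound X Y
    rewrite ℕ.+-suc p e | ℕ.+-suc q e = begin
    V (suc nx) X * (V (suc ny) Y * G₀)
      -- Each of the two point removals needs its sign in front of the determinant; both are
      -- inserted as squares.
      ≈⟨ unsigned (V (suc nx) X) (V (suc ny) Y * G₀) ⟩
    (sg ny * sg nx) * (V (suc nx) X * (sg ny * (V (suc ny) Y * G₀)) * sg nx)
      ≈⟨ *-congˡ (*-congʳ (*-congˡ (Gram-removeʸ p q ny (suc nx) α β X Y α-small′ (ℕ.m≤m+n q e) m))) ⟩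
    (sg ny * sg nx) * (V (suc nx) X * ∑ (suc ny) (λ k → (weight ny Y k * ∏ ny (Y ∘ skip k)) * G₁ k) * sg nx)
      ≈⟨ *-congˡ (trans (*-comm _ _) (trans (sym (*-assoc _ _ _))
           (trans (*-∑ (suc ny) _ _) (∑-cong (suc ny) step)))) ⟩
    (sg ny * sg nx) * ∑ (suc ny) (λ k → ∑ (suc nx) (λ l → Sg p q β * t l k))
      ≈⟨ *-congˡ (trans (∑-swap (suc ny) (suc nx) _) (trans
           (∑-cong (suc nx) (λ l → sym (*-∑ (suc ny) (Sg p q β) _))) (sym (*-∑ (suc nx) (Sg p q β) _)))) ⟩
    (sg ny * sg nx) * (Sg p q β * ∑ (suc nx) (λ l → ∑ (suc ny) (t l)))
      ≈⟨ solve 4 (λ a b s t → (a :* b) :* (s :* t) := s :* (b :* (a :* t))) refl _ _ _ _ ⟩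
    Sg p q β * (sg nx * (sg ny * ∑ (suc nx) (λ l → ∑ (suc ny) (t l))))
      ≈⟨ *-congˡ (sym outer) ⟩
    Sg p q β * Alternant P′ (suc nx) (suc ny) X Y ∎
    where
    nx = p ℕ.+ e
    ny = q ℕ.+ e
    G₀ : Carrier
    G₀ = Gram m p q α β (generating (suc nx) (suc ny) X Y)
    G₁ : ℕ → Carrier
    G₁ k = Gram m p q α β (generating (suc nx) ny X (Y ∘ skip k))
    t : ℕ → ℕ → Carrier
    t l k = (sg l * sg k) * ((∏ nx (X ∘ skip l) * ∏ ny (Y ∘ skip k)) * Alternant P nx ny (X ∘ skip l) (Y ∘ skip k))
    α-small′ : ∀ i → i ℕ.< p → α i ℕ.+ suc q ℕ.< suc ny ℕ.+ p
    α-small′ i i<p = ℕ.≤-trans (ℕ.+-monoˡ-≤ (suc q) (α-small i i<p)) (ℕ.≤-reflexive (index p q e))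
      where
      index : ∀ p q e → (p ℕ.+ e) ℕ.+ suc q ≡ suc (q ℕ.+ e) ℕ.+ p
      index = solve-∀
    unsigned : ∀ x y → x * y ≈ (sg ny * sg nx) * (x * (sg ny * y) * sg nx)
    unsigned x y = sym (trans (solve 4 (λ a b x y → (a :* b) :* (x :* (a :* y) :* b) := (a :* a) :*
        ((b :* b) :* (x :* y))) refl _ _ _ _)
      (trans (*-congʳ (sg-square ny)) (trans (*-identityˡ _) (trans (*-congʳ (sg-square nx)) (*-identityˡ _)))))
    step : ∀ k → (sg nx * V (suc nx) X) * ((weight ny Y k * ∏ ny (Y ∘ skip k)) * G₁ k) ≈ ∑ (suc nx)
        (λ l → Sg p q β * t l k)
    step k = begin
      (sg nx * V (suc nx) X) * ((weight ny Y k * ∏ ny (Y ∘ skip k)) * G₁ k)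
        ≈⟨ solve 4 (λ s v w g → (s :* v) :* (w :* g) := w :* (s :* (v :* g))) refl _ _ _ _ ⟩
      (weight ny Y k * ∏ ny (Y ∘ skip k)) * (sg nx * (V (suc nx) X * G₁ k))
        ≈⟨ *-congˡ (Gram-removeˣ p q e ny α β X (Y ∘ skip k) β-small m (ℕ.≤-trans (ℕ.m≤n+m q p) pq≤m)) ⟩
      (weight ny Y k * ∏ ny (Y ∘ skip k)) * ∑ (suc nx) (λ l → (weight nx X l * ∏ nx (X ∘ skip l)) * Gram m p q α
          β (generating nx ny (X ∘ skip l) (Y ∘ skip k)))
        ≈⟨ *-∑ (suc nx) _ _ ⟩
      ∑ (suc nx) (λ l → (weight ny Y k * ∏ ny (Y ∘ skip k)) *
          ((weight nx X l * ∏ nx (X ∘ skip l)) * Gram m p q α β (generating nx ny (X ∘ skip l) (Y ∘ skip k))))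
        ≈⟨ ∑-cong (suc nx) (λ l → trans
             (solve 7 (λ s v p s′ v′ p′ g → ((s :* v) :* p) :* (((s′ :* v′) :* p′) :* g) :=
                 ((s′ :* s) :* (p′ :* p)) :* (v′ :* (v :* g))) refl _ _ _ _ _ _ _)
             (trans (*-congˡ (V-V-Gram P m pq≤m bound (X ∘ skip l) (Y ∘ skip k)))
               (solve 4 (λ s a r t → (s :* a) :* (r :* t) := r :* (s :* (a :* t))) refl _ _ _ _))) ⟩
      ∑ (suc nx) (λ l → Sg p q β * t l k) ∎
    K : (ℕ → Carrier) → Carrier
    K u = ∑ (suc ny) (λ k → sg k * (∏ ny (Y ∘ skip k) * Alt ny (λ v → summand P u v) (Y ∘ skip k)))
    K-depends : DependsOn nx K
    K-depends u u′ u≈ = ∑-cong (suc ny) (λ k → *-congˡ (*-congˡ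
        (Alt-cong ny (λ v → summand-cong P u≈ (λ _ _ → refl)) (Y ∘ skip k))))
    inner : ∀ u → Alt (suc ny) (λ v → summand P′ u v) Y ≈ sg ny * (∏ nx u * K u)
    inner u = begin
      Alt (suc ny) (λ v → summand P′ u v) Y
        ≈⟨ Alt-last ny (summand P′ u) (λ v v′ v≈ → summand-cong P′ {u} {u} {v} {v′} (λ _ _ → refl)
             (λ j j<n → v≈ j (≡.subst (j ℕ.<_) (ℕ.+-suc q e) j<n))) Y ⟩
      sg ny * ∑ (suc ny) (λ k → sg k * Alt ny (λ v → summand P′ u (glue ny v (λ _ → Y k))) (Y ∘ skip k))
        ≈⟨ *-congˡ (∑-cong (suc ny) (λ k → trans (*-congˡ (term k))
             (solve 3 (λ s p x → s :* (p :* x) := p :* (s :* x)) refl _ _ _))) ⟩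
      sg ny * ∑ (suc ny) (λ k → ∏ nx u * (sg k * (∏ ny (Y ∘ skip k) * Alt ny (λ v → summand P u v) (Y ∘ skip k))))
        ≈⟨ *-congˡ (*-∑ (suc ny) (∏ nx u) _) ⟨
      sg ny * (∏ nx u * K u) ∎
      where
      term : ∀ k → Alt ny (λ v → summand P′ u (glue ny v (λ _ → Y k))) (Y ∘ skip k) ≈
        ∏ nx u * (∏ ny (Y ∘ skip k) * Alt ny (λ v → summand P u v) (Y ∘ skip k))
      term k = begin
        Alt ny (λ v → (∏ nx u * ∏ ny (glue ny v (λ _ → Y k))) * summand P u (glue ny v (λ _ → Y k))) (Y ∘ skip k)
          ≈⟨ Alt-cong ny (λ v → trans (*-cong (*-congˡ (∏-cong< ny (λ j j<n → reflexive (glue-< ny v _ j j<n))))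
               (summand-cong P (λ _ _ → refl) (λ j j<n → reflexive (glue-< ny v _ j j<n)))) (*-assoc _ _ _))
                   (Y ∘ skip k) ⟩
        Alt ny (λ v → ∏ nx u * (∏ ny v * summand P u v)) (Y ∘ skip k)
          ≈⟨ Alt-* ny (∏ nx u) _ (Y ∘ skip k) ⟩
        ∏ nx u * Alt ny (λ v → ∏ ny v * summand P u v) (Y ∘ skip k)
          ≈⟨ *-congˡ (Alt-symmetric ny (λ y → y) (summand P u) (Y ∘ skip k)) ⟩
        ∏ nx u * (∏ ny (Y ∘ skip k) * Alt ny (λ v → summand P u v) (Y ∘ skip k)) ∎
    outer : Alternant P′ (suc nx) (suc ny) X Y ≈ sg nx * (sg ny * ∑ (suc nx) (λ l → ∑ (suc ny) (t l)))
    outer = begin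
      Alt (suc nx) (λ u → Alt (suc ny) (λ v → summand P′ u v) Y) X
        ≈⟨ trans (Alt-cong (suc nx) inner X) (Alt-* (suc nx) (sg ny) (λ u → ∏ nx u * K u) X) ⟩
      sg ny * Alt (suc nx) (λ u → ∏ nx u * K u) X
        ≈⟨ *-congˡ (Alt-last nx (λ u → ∏ nx u * K u) (λ u u′ u≈ → *-cong
             (∏-cong< nx (λ i i<n → u≈ i (ℕ.m≤n⇒m≤1+n i<n)))
             (K-depends u u′ (λ i i<n → u≈ i (ℕ.m≤n⇒m≤1+n i<n)))) X) ⟩
      sg ny * (sg nx * ∑ (suc nx) (λ l → sg l * Alt nx (λ u → ∏ nx (glue nx u (λ _ → X l)) * K
          (glue nx u (λ _ → X l))) (X ∘ skip l)))
        ≈⟨ solve 3 (λ a b c → a :* (b :* c) := b :* (a :* c)) refl _ _ _ ⟩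
      sg nx * (sg ny * ∑ (suc nx) (λ l → sg l * Alt nx (λ u → ∏ nx (glue nx u (λ _ → X l)) * K
          (glue nx u (λ _ → X l))) (X ∘ skip l)))
        ≈⟨ *-congˡ (*-congˡ (∑-cong (suc nx) term)) ⟩
      sg nx * (sg ny * ∑ (suc nx) (λ l → ∑ (suc ny) (t l))) ∎
      where
      term : ∀ l → sg l * Alt nx (λ u → ∏ nx (glue nx u (λ _ → X l)) * K (glue nx u (λ _ → X l))) (X ∘ skip l) ≈
          ∑ (suc ny) (t l)
      term l = begin
        sg l * Alt nx (λ u → ∏ nx (glue nx u (λ _ → X l)) * K (glue nx u (λ _ → X l))) (X ∘ skip l)
          ≈⟨ *-congˡ (Alt-cong nx (λ u → *-cong (∏-cong< nx (λ i i<n → reflexive (glue-< nx u _ i i<n)))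
               (K-depends _ u (λ i i<n → reflexive (glue-< nx u _ i i<n)))) (X ∘ skip l)) ⟩
        sg l * Alt nx (λ u → ∏ nx u * K u) (X ∘ skip l)
          ≈⟨ *-congˡ (Alt-symmetric nx (λ x → x) K (X ∘ skip l)) ⟩
        sg l * (∏ nx (X ∘ skip l) * Alt nx K (X ∘ skip l))
          ≈⟨ *-congˡ (*-congˡ (trans (Alt-∑ nx (suc ny) _ (X ∘ skip l))
               (∑-cong (suc ny) (λ k → trans (Alt-* nx (sg k) _ (X ∘ skip l))
               (*-congˡ (Alt-* nx (∏ ny (Y ∘ skip k)) _ (X ∘ skip l))))))) ⟩
        sg l * (∏ nx (X ∘ skip l) * ∑ (suc ny) (λ k → sg k *
            (∏ ny (Y ∘ skip k) * Alternant P nx ny (X ∘ skip l) (Y ∘ skip k))))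
          ≈⟨ trans (sym (*-assoc _ _ _)) (trans (*-∑ (suc ny) _ _) (∑-cong (suc ny) (λ k →
               solve 5 (λ s p r q a → (s :* p) :* (r :* (q :* a)) := (s :* r) :* ((p :* q) :* a)) refl _ _ _ _
                   _))) ⟩
        ∑ (suc ny) (t l) ∎

-- From the Gram determinant to the Jacobi-Trudi determinant

-- For increasing c this enumerates the naturals outside {c 0, ..., c (q - 1)} in increasing order.
skips : (ℕ → ℕ) → ℕ → ℕ → ℕ
skips c zero    i = i
skips c (suc q) i = skip (c q) (skips c q i)

module GramJacobiTrudi {c ℓ} (R : CommutativeRing c ℓ) (a b : ℕ → CommutativeRing.Carrier R) where
  open CommutativeRing R
  open RingTactic R
  open FiniteSums R
  open Determinants R
  open PowerSeries R
  open GramMatrix R a b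
  open GramAlternant R a b
  private
    module Σ = FiniteSums seriesRing
    module Sol = RingTactic seriesRing
  open import Relation.Binary.Reasoning.Setoid setoid

  private
    glue-cong< : ∀ q {f f′ g : ℕ → ℕ → Carrier} → (∀ j → j ℕ.< q → ∀ i → f j i ≈ f′ j i) →
      ∀ j i → glue q f g j i ≈ glue q f′ g j i
    glue-cong< zero    f≈ j       i = refl
    glue-cong< (suc q) f≈ zero    i = f≈ 0 (s≤s z≤n) i
    glue-cong< (suc q) f≈ (suc j) i = glue-cong< q (λ j j<q → f≈ (suc j) (s≤s j<q)) j i

    skip-≢ : ∀ x i → skip x i ≢ x
    skip-≢ zero    i       ()
    skip-≢ (suc x) zero    ()
    skip-≢ (suc x) (suc i) eq = skip-≢ x i (ℕ.suc-injective eq)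

    unit-skip : ∀ x y k → x ℕ.< y → unit x (skip y k) ≈ unit x k
    unit-skip zero    (suc y) zero    _         = refl
    unit-skip zero    (suc y) (suc k) _         = refl
    unit-skip (suc x) (suc y) zero    _         = refl
    unit-skip (suc x) (suc y) (suc k) (s≤s x<y) = unit-skip x y k x<y

  sign : (ℕ → ℕ) → ℕ → Carrier
  sign cs zero    = 1#
  sign cs (suc q) = sg (cs q ℕ.+ q) * sign cs q

  -- The unit column with the lowest row goes first: deleting row `cs q` does not move the ones of
  -- the other unit columns, which lie above it.
  Det-strip : ∀ q N cs g → (∀ i j → i ℕ.< j → j ℕ.< q → cs i ℕ.< cs j) → (∀ j → j ℕ.< q → cs j ℕ.≤ j ℕ.+ N) →
    Det (q ℕ.+ N) (glue q (λ j → unit (cs j)) g) ≈ sign cs q * Det N (λ l i → g l (skips cs q i))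
  Det-strip zero    N cs g incr bound = sym (*-identityˡ _)
  Det-strip (suc q) N cs g incr bound = begin
    Det (suc (q ℕ.+ N)) A
      ≈⟨ Det-move (q ℕ.+ N) q A (ℕ.m≤m+n q N) ⟩
    sg q * Det (suc (q ℕ.+ N)) (A q ◂ (A ∘ skip q))
      ≈⟨ *-congˡ (Det-cong (suc (q ℕ.+ N)) {A q ◂ (A ∘ skip q)} {unit (cs q) ◂ glue q us g}
           (λ { zero _ i → reflexive (≡.cong (λ u → u i) (glue-suc-at q us g))
              ; (suc j) _ i → reflexive (≡.cong (λ u → u i) (glue-suc-skip q us g j)) })) ⟩
    sg q * Det (suc (q ℕ.+ N)) (unit (cs q) ◂ glue q us g)
      ≈⟨ *-congˡ (Det-unit (q ℕ.+ N) (cs q) (unit (cs q)) (glue q us g) (bound q ℕ.≤-refl) (unit-at (cs q))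
           (unit-≢ (cs q))) ⟩
    sg q * (sg (cs q) * Det (q ℕ.+ N) (λ j k → glue q us g j (skip (cs q) k)))
      ≈⟨ *-congˡ (*-congˡ (Det-cong (q ℕ.+ N) (λ j _ k → trans
           (reflexive (≡.cong (λ u → u k) (glue-map {A = ℕ → Carrier} {B = ℕ → Carrier} (λ u → u ∘ skip (cs q))
               q us g j)))
           (glue-cong< q {λ j → us j ∘ skip (cs q)} {us}
               (λ j j<q k → unit-skip (cs j) (cs q) k (incr j q j<q ℕ.≤-refl)) j k)))) ⟩
    sg q * (sg (cs q) * Det (q ℕ.+ N) (glue q us (λ l → g l ∘ skip (cs q))))
      ≈⟨ *-congˡ (*-congˡ (Det-strip q N cs (λ l → g l ∘ skip (cs q))
           (λ i j i<j j<q → incr i j i<j (ℕ.m≤n⇒m≤1+n j<q))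
           (λ j j<q → bound j (ℕ.m≤n⇒m≤1+n j<q)))) ⟩
    sg q * (sg (cs q) * (sign cs q * Det N (λ l i → g l (skips cs (suc q) i))))
      ≈⟨ solve 4 (λ q c s d → q :* (c :* (s :* d)) := ((c :* q) :* s) :* d) refl _ _ _ _ ⟩
    ((sg (cs q) * sg q) * sign cs q) * Det N (λ l i → g l (skips cs (suc q) i))
      ≈⟨ *-congʳ (*-congʳ (sg-+ (cs q) q)) ⟨
    sign cs (suc q) * Det N (λ l i → g l (skips cs (suc q) i)) ∎
    where
    us : ℕ → ℕ → Carrier
    us j = unit (cs j)
    A = glue (suc q) us g

  Sg-square : ∀ p q β → Sg p q β * Sg p q β ≈ 1#
  Sg-square p zero    β = *-identityˡ _
  Sg-square p (suc q) β = trans (solve 2 (λ a b → (a :* b) :* (a :* b) := (a :* a) :* (b :* b)) refl _ _)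
    (trans (*-cong (sg-square (β q ℕ.+ p ℕ.+ q)) (Sg-square p q β)) (*-identityˡ _))

  sign-Sg : ∀ d q β → sign (λ j → d ℕ.+ β j) q ≈ Sg d q β
  sign-Sg d zero    β = refl
  sign-Sg d (suc q) β = *-cong (reflexive (≡.cong (λ k → sg (k ℕ.+ q)) (ℕ.+-comm d (β q)))) (sign-Sg d q β)

  lins-+ : ∀ m n f → lins (m ℕ.+ n) f ≋ lins m f ⊛ lins n (λ i → f (m ℕ.+ i))
  lins-+ m n f = Σ.∏-+ m n (λ i → lin (f i))

  H-lins : ∀ r k → H r ⊛ lins (suc r ℕ.+ k) b ≋ lins k (λ i → b (suc r ℕ.+ i))
  H-lins r k = S.trans (S.*-congˡ (lins-+ (suc r) k b)) (S.trans
    (Sol.solve 3 (λ g l x → g Sol.:* (l Sol.:* x) Sol.:= (l Sol.:* g) Sol.:* x) S.refl _ _ _)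
    (S.trans (S.*-congʳ (lins-geos (suc r) b)) (S.*-identityˡ _)))

  private
    at-shift : ∀ f k α p → at f (α ℕ.+ suc (k ℕ.+ p)) p ≈ f (α ℕ.+ suc k)
    at-shift f k α p = reflexive (≡.trans (≡.cong₂ (at f) (index k α p) (≡.sym (ℕ.+-identityʳ p)))
        (at-+ f p (α ℕ.+ suc k) 0))
      where
      index : ∀ k α p → α ℕ.+ suc (k ℕ.+ p) ≡ p ℕ.+ (α ℕ.+ suc k)
      index = solve-∀

    χ-row : ∀ α β → (lins α a ⊛ lins β b) (α ℕ.+ suc β) ≈ 0#
    χ-row α β = trans (reflexive (≡.cong (λ k → (lins α a ⊛ lins β b) (α ℕ.+ k)) (index β)))
      (coef-lins-0 α a (lins β b) (β ℕ.+ 1) (λ t → trans (reflexive (≡.cong (lins β b) (ℕ.+-assoc β 1 t)))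
          (coef-lins-> β b t)) 0)
      where
      index : ∀ β → suc β ≡ β ℕ.+ 1 ℕ.+ 0
      index = solve-∀

    -- Residue of χ / ((u - b₀) ⋯ (u - bᵣ)): the quotient is a polynomial for r < β, equals 1 / (u -
    -- bᵣ) for r = β, and decays at least like the inverse square of u for r > β.
    χ-negative : ∀ β r → at (H r ⊛ lins β b) β r ≈ unit β r
    χ-negative β r with ℕ.<-cmp r β
    ... | tri> _ r≢β r>β = trans (at-< (H r ⊛ lins β b) r>β) (sym (unit-≢ β r r≢β))
    ... | tri≈ _ ≡.refl _ = trans (reflexive (at-diagonal (H r ⊛ lins r b) r))
      (trans (*-cong (geos-zero (suc r) b) (lins-zero r b)) (trans (*-identityˡ _) (sym (unit-at r))))
    ... | tri< r<β r≢β _ with ℕ.m≤n⇒∃[o]m+o≡n r<β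
    ...   | k , ≡.refl = begin
      at (H r ⊛ lins (suc r ℕ.+ k) b) (suc r ℕ.+ k) r
        ≈⟨ at-cong (H-lins r k) (suc r ℕ.+ k) r ⟩
      at (lins k (λ i → b (suc r ℕ.+ i))) (suc r ℕ.+ k) r
        ≡⟨ ≡.trans (≡.cong₂ (at (lins k (λ i → b (suc r ℕ.+ i)))) (index r k) (≡.sym (ℕ.+-identityʳ r)))
             (at-+ _ r (k ℕ.+ 1) 0) ⟩
      lins k (λ i → b (suc r ℕ.+ i)) (k ℕ.+ 1)
        ≈⟨ coef-lins-> k (λ i → b (suc r ℕ.+ i)) 0 ⟩
      0#
        ≈⟨ unit-≢ (suc r ℕ.+ k) r r≢β ⟨
      unit (suc r ℕ.+ k) r ∎
      where
      index : ∀ r k → suc r ℕ.+ k ≡ r ℕ.+ (k ℕ.+ 1)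
      index = solve-∀

    unit-+ : ∀ d β r → unit (d ℕ.+ β) (d ℕ.+ r) ≈ unit β r
    unit-+ zero    β r = refl
    unit-+ (suc d) β r = unit-+ d β r

  -- With a polynomial row the product is a polynomial and has no residue; with the other rows
  -- `χ-negative` applies. Each leg thus singles out the row that the Jacobi-Trudi matrix omits.
  column-χ : ∀ d α β i → column d α (lins β b) (suc (β ℕ.+ d)) i ≈ unit (d ℕ.+ β) i
  column-χ d α β = glue-elim (λ i ρ → pairing ρ (lins β b) (suc (β ℕ.+ d)) ≈ unit (d ℕ.+ β) i) d _ _
    (λ i i<d → trans (trans (at-shift (lins (α i) a ⊛ lins β b) β (α i) d) (χ-row (α i) β))
      (sym (unit-≢ (d ℕ.+ β) i (λ { ≡.refl → ℕ.m+n≮m d β i<d }))))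
    (λ r → trans (reflexive (≡.trans (≡.cong (λ k → at (H r ⊛ lins β b) k (d ℕ.+ r)) (ℕ.+-comm β d))
        (at-+ (H r ⊛ lins β b) d β r)))
      (trans (χ-negative β r) (sym (unit-+ d β r))))

  private
    module _ (d : ℕ) (α β : ℕ → ℕ) (F : Series) where
      -- Column l after min(l, t) of its l factors u have been replaced by u - b₀, u - b₁, ....
      -- Stage 0 has the columns of the Gram matrix, and t ≥ l gives the Jacobi-Trudi column F (u -
      -- b₀) ⋯ (u - b₍ₗ₋₁₎).
      stage : ℕ → ℕ → ℕ → Carrier
      stage t l = column d α (lins (l ℕ.⊓ t) b ⊛ F) (suc d ℕ.+ l)

      stage-suc : ∀ m t → Det m (glue d (χ-columns d α β) (stage (suc t))) ≈ Det m
          (glue d (χ-columns d α β) (stage t))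
      stage-suc m t = Det-chain m (d ℕ.+ t) (b t) same step
        where
        χs = χ-columns d α β
        same : ∀ j → j ℕ.≤ d ℕ.+ t → ∀ i → glue d χs (stage (suc t)) j i ≈ glue d χs (stage t) j i
        same j j≤ i with position d j
        ... | inj₁ j<d = reflexive (≡.cong (λ u → u i) (≡.trans (glue-< d χs (stage (suc t)) j j<d)
            (≡.sym (glue-< d χs (stage t) j j<d))))
        ... | inj₂ (l , ≡.refl) = reflexive (≡.cong (λ u → u i) (≡.trans (glue-+ d χs (stage (suc t)) l)
          (≡.trans (≡.cong (λ k → column d α (lins k b ⊛ F) (suc d ℕ.+ l))
              (≡.trans (ℕ.m≤n⇒m⊓n≡m (ℕ.m≤n⇒m≤1+n l≤t)) (≡.sym (ℕ.m≤n⇒m⊓n≡m l≤t))))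
            (≡.sym (glue-+ d χs (stage t) l)))))
          where
          l≤t : l ℕ.≤ t
          l≤t = ℕ.+-cancelˡ-≤ d l t j≤
        step : ∀ j → d ℕ.+ t ℕ.≤ j → ∀ i → glue d χs (stage (suc t)) (suc j) i ≈ glue d χs (stage t) (suc j) i -
            b t * glue d χs (stage t) j i
        step j ≤j i with position d j
        ... | inj₁ j<d = contradiction (ℕ.≤-trans (ℕ.m≤m+n d t) ≤j) (ℕ.<⇒≱ j<d)
        ... | inj₂ (l , ≡.refl) = begin
          glue d χs (stage (suc t)) (suc (d ℕ.+ l)) i
            ≡⟨ at-suc (stage (suc t)) ⟩
          column d α (lins (suc (l ℕ.⊓ t)) b ⊛ F) (suc d ℕ.+ suc l) i
            ≡⟨ ≡.cong₂ (λ k k′ → column d α (lins (suc k) b ⊛ F) k′ i) l⊓t (≡.cong suc (ℕ.+-suc d l)) ⟩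
          column d α (lins (suc t) b ⊛ F) (2 ℕ.+ (d ℕ.+ l)) i
            ≈⟨ pairing-cong (rows d α i) (2 ℕ.+ (d ℕ.+ l))
                 (S.trans (S.*-congʳ (S.trans (Σ.∏-last t (λ i → lin (b i))) (S.*-comm _ _))) (S.*-assoc _ _ _)) ⟩
          column d α (lin (b t) ⊛ (lins t b ⊛ F)) (2 ℕ.+ (d ℕ.+ l)) i
            ≈⟨ pairing-lin (rows d α i) (b t) (lins t b ⊛ F) (suc d ℕ.+ l) ⟩
          column d α (lins t b ⊛ F) (2 ℕ.+ (d ℕ.+ l)) i - b t * column d α (lins t b ⊛ F) (suc d ℕ.+ l) i
            ≡⟨ ≡.cong₂ (λ k k′ → column d α (lins k b ⊛ F) k′ i - b t * column d α (lins t b ⊛ F) (suc d ℕ.+ l)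
                 i) (≡.sym (ℕ.m≥n⇒m⊓n≡n (ℕ.m≤n⇒m≤1+n t≤l))) (≡.cong suc (≡.sym (ℕ.+-suc d l))) ⟩
          stage t (suc l) i - b t * column d α (lins t b ⊛ F) (suc d ℕ.+ l) i
            ≡⟨ ≡.cong (λ k → stage t (suc l) i - b t * column d α (lins k b ⊛ F) (suc d ℕ.+ l) i) (≡.sym l⊓t) ⟩
          stage t (suc l) i - b t * stage t l i
            ≡⟨ ≡.cong₂ (λ x y → x - b t * y) (at-suc (stage t)) (≡.cong (λ u → u i) (glue-+ d χs (stage t) l)) ⟨
          glue d χs (stage t) (suc (d ℕ.+ l)) i - b t * glue d χs (stage t) (d ℕ.+ l) i ∎
          where
          t≤l : t ℕ.≤ l
          t≤l = ℕ.+-cancelˡ-≤ d t l ≤j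
          l⊓t : l ℕ.⊓ t ≡ t
          l⊓t = ℕ.m≥n⇒m⊓n≡n t≤l
          at-suc : ∀ g → glue d χs g (suc (d ℕ.+ l)) i ≡ g (suc l) i
          at-suc g = ≡.trans (≡.cong (λ k → glue d χs g k i) (≡.sym (ℕ.+-suc d l)))
              (≡.cong (λ u → u i) (glue-+ d χs g (suc l)))

      stage-all : ∀ m t → Det m (glue d (χ-columns d α β) (stage t)) ≈ Gram m d d α β F
      stage-all m zero    = Det-cong m (λ j _ i → glue-cong d (λ _ _ → refl) (λ l i → trans
        (reflexive (≡.cong (λ k → column d α (lins k b ⊛ F) (suc d ℕ.+ l) i) (ℕ.⊓-zeroʳ l)))
        (pairing-cong (rows d α i) (suc d ℕ.+ l) (S.trans (S.*-congʳ (Σ.∏-empty _)) (S.*-identityˡ F)))) j i)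
      stage-all m (suc t) = trans (stage-suc m t) (stage-all m t)

  -- Column operations bring in the shifted powers; then the legs, being unit vectors, are stripped
  -- together with their rows. The strict increase of β is needed to strip them in order.
  Gram-Jacobi-Trudi : ∀ d N α β F → (∀ i j → i ℕ.< j → j ℕ.< d → β i ℕ.< β j) →
      (∀ j → j ℕ.< d → d ℕ.+ β j ℕ.≤ j ℕ.+ N) →
    Sg d d β * Gram (d ℕ.+ N) d d α β F ≈
    Det N (λ l i → column d α (lins l b ⊛ F) (suc d ℕ.+ l) (skips (λ j → d ℕ.+ β j) d i))
  Gram-Jacobi-Trudi d N α β F incr bound = begin
    Sg d d β * Gram (d ℕ.+ N) d d α β F
      ≈⟨ *-congˡ (stage-all d α β F (d ℕ.+ N) N) ⟨
    Sg d d β * Det (d ℕ.+ N) (glue d (χ-columns d α β) (stage d α β F N))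
      ≈⟨ *-congˡ (Det-cong (d ℕ.+ N) (λ j _ i → glue-cong d {g = stage d α β F N} (λ j i → column-χ d α (β j) i)
           (λ _ _ → refl) j i)) ⟩
    Sg d d β * Det (d ℕ.+ N) (glue d (λ j → unit (d ℕ.+ β j)) (stage d α β F N))
      ≈⟨ *-congˡ (Det-strip d N (λ j → d ℕ.+ β j) (stage d α β F N)
           (λ i j i<j j<d → ℕ.+-monoʳ-< d (incr i j i<j j<d)) bound) ⟩
    Sg d d β * (sign (λ j → d ℕ.+ β j) d * Det N (λ l i → stage d α β F N l (skips (λ j → d ℕ.+ β j) d i)))
      ≈⟨ trans (sym (*-assoc _ _ _)) (trans (*-congʳ (trans (*-congˡ (sign-Sg d d β)) (Sg-square d d β)))
           (*-identityˡ _)) ⟩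
    Det N (λ l i → stage d α β F N l (skips (λ j → d ℕ.+ β j) d i))
      ≈⟨ Det-cong N (λ l l<N i → reflexive (≡.cong (λ k → column d α (lins k b ⊛ F) (suc d ℕ.+ l)
           (skips (λ j → d ℕ.+ β j) d i))
           (ℕ.m≤n⇒m⊓n≡m (ℕ.<⇒≤ l<N)))) ⟩
    Det N (λ l i → column d α (lins l b ⊛ F) (suc d ℕ.+ l) (skips (λ j → d ℕ.+ β j) d i)) ∎

  positive-row : ∀ d α F l i → i ℕ.< d → column d α (lins l b ⊛ F) (suc d ℕ.+ l) i ≈
      (lins (α i) a ⊛ (lins l b ⊛ F)) (α i ℕ.+ suc l)
  positive-row d α F l i i<d = trans (reflexive (≡.cong (λ ρ → pairing ρ (lins l b ⊛ F) (suc d ℕ.+ l))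
      (glue-< d _ _ i i<d)))
    (trans (reflexive (≡.cong (λ k → at (lins (α i) a ⊛ (lins l b ⊛ F)) (α i ℕ.+ suc k) d) (ℕ.+-comm d l)))
      (at-shift (lins (α i) a ⊛ (lins l b ⊛ F)) l (α i) d))

  negative-row : ∀ d α F l r → column d α (lins l b ⊛ F) (suc d ℕ.+ l) (d ℕ.+ r) ≈ at (H r ⊛ (lins l b ⊛ F)) l r
  negative-row d α F l r = trans (reflexive (≡.cong (λ ρ → pairing ρ (lins l b ⊛ F) (suc d ℕ.+ l))
      (glue-+ d _ _ r)))
    (reflexive (at-+ (H r ⊛ (lins l b ⊛ F)) d l r))

-- Passage from finite index types to sequences

toℕ-punchIn : ∀ {n} (j : Fin (suc n)) k → toℕ (punchIn j k) ≡ skip (toℕ j) (toℕ k)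
toℕ-punchIn zero    k       = ≡.refl
toℕ-punchIn (suc j) zero    = ≡.refl
toℕ-punchIn (suc j) (suc k) = ≡.cong suc (toℕ-punchIn j k)

module FiniteIndices {c ℓ} (R : CommutativeRing c ℓ) where
  open CommutativeRing R hiding (zero)
  open RingTactic R
  open FiniteSums R
  open Determinants R
  open Vandermonde R
  open Alternants R
  module O = RingOperations R
  private
    module Π = CommutativeMonoidSum *-commutativeMonoid
    module +-Sum = CommutativeMonoidSum +-commutativeMonoid
  open import Relation.Binary.Reasoning.Setoid setoid

  sum-cong : ∀ n {f g : Fin n → Carrier} → (∀ i → f i ≈ g i) → O.sum f ≈ O.sum g
  sum-cong n = +-Sum.sum-cong-≋ {n}

  sum-toℕ : ∀ n {f : Fin n → Carrier} (g : ℕ → Carrier) → (∀ i → f i ≈ g (toℕ i)) → O.sum f ≈ ∑ n g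
  sum-toℕ zero    g f≈g = sym (∑-empty g)
  sum-toℕ (suc n) g f≈g = trans (+-cong (f≈g zero) (sum-toℕ n (g ∘ suc) (f≈g ∘ suc))) (sym (∑-suc n g))

  product-toℕ : ∀ n {f : Fin n → Carrier} (g : ℕ → Carrier) → (∀ i → f i ≈ g (toℕ i)) → O.product f ≈ ∏ n g
  product-toℕ zero    g f≈g = sym (∏-empty g)
  product-toℕ (suc n) g f≈g = trans (*-cong (f≈g zero) (product-toℕ n (g ∘ suc) (f≈g ∘ suc))) (sym (∏-suc n g))

  V-toℕ : ∀ n {x : Fin n → Carrier} (X : ℕ → Carrier) → (∀ i → x i ≈ X (toℕ i)) → O.V x ≈ V n X
  V-toℕ zero    X x≈X = refl
  V-toℕ (suc n) {x} X x≈X = *-cong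
    (trans (*-identityˡ _) (product-toℕ n (λ i → X 0 - X (suc i)) (λ i → +-cong (x≈X zero) (-‿cong (x≈X (suc i))))))
    (trans (Π.sum-cong-≋ {n} (λ i → *-identityˡ _)) (V-toℕ n (X ∘ suc) (x≈X ∘ suc)))

  ∑-list-cong : ∀ {A : Set} (as : List A) {f g : A → Carrier} → (∀ a → f a ≈ g a) → O.∑-list as f ≈ O.∑-list as g
  ∑-list-cong []       f≈g = refl
  ∑-list-cong (a ∷ as) f≈g = +-cong (f≈g a) (∑-list-cong as f≈g)

  ∑-list-++ : ∀ {A : Set} (as bs : List A) f → O.∑-list (as List.++ bs) f ≈ O.∑-list as f + O.∑-list bs f
  ∑-list-++ []       bs f = sym (+-identityˡ _)
  ∑-list-++ (a ∷ as) bs f = trans (+-congˡ (∑-list-++ as bs f)) (sym (+-assoc _ _ _))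

  ∑-list-map : ∀ {A B : Set} (h : A → B) as f → O.∑-list (List.map h as) f ≈ O.∑-list as (f ∘ h)
  ∑-list-map h []       f = refl
  ∑-list-map h (a ∷ as) f = +-congˡ (∑-list-map h as f)

  ∑-list-product : ∀ {A B D : Set} (h : A → B → D) as bs f →
    O.∑-list (cartesianProductWith h as bs) f ≈ O.∑-list as (λ a → O.∑-list bs (λ b → f (h a b)))
  ∑-list-product h []       bs f = refl
  ∑-list-product h (a ∷ as) bs f = trans (∑-list-++ (List.map (h a) bs) _ f)
    (+-cong (∑-list-map (h a) bs f) (∑-list-product h as bs f))

  *-∑-list : ∀ {A : Set} x (as : List A) f → x * O.∑-list as f ≈ O.∑-list as (λ a → x * f a)
  *-∑-list x []       f = zeroʳ x
  *-∑-list x (a ∷ as) f = trans (distribˡ _ _ _) (+-congˡ (*-∑-list x as f))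

  ∑-list-tabulate : ∀ {A : Set} n (h : Fin n → A) f → O.∑-list (List.tabulate h) f ≈ O.sum (f ∘ h)
  ∑-list-tabulate zero    h f = refl
  ∑-list-tabulate (suc n) h f = +-congˡ (∑-list-tabulate n (h ∘ suc) f)

  private
    inverted : Bool → Carrier
    inverted t = if t then - 1# else 1#

    insert-suc : ∀ {n} (j : Fin (suc n)) (ρ : Permutation′ n) k → insert zero j ρ ⟨$⟩ʳ suc k ≡ punchIn j (ρ ⟨$⟩ʳ k)
    insert-suc j ρ k = insert-punchIn zero j ρ k

    punchIn-<? : ∀ {n} (j : Fin (suc n)) a b → does (punchIn j a Fin.<? punchIn j b) ≡ does (a Fin.<? b)
    punchIn-<? zero    a       b       = ≡.refl
    punchIn-<? (suc j) zero    zero    = ≡.refl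
    punchIn-<? (suc j) zero    (suc b) = ≡.refl
    punchIn-<? (suc j) (suc a) zero    = ≡.refl
    punchIn-<? (suc j) (suc a) (suc b) = punchIn-<? j a b

    inversions-0 : ∀ n (j : Fin (suc n)) → O.product (λ l → inverted (does (punchIn j l Fin.<? j))) ≈ sg (toℕ j)
    inversions-0 n       zero    = trans (product-toℕ n (λ _ → 1#) (λ _ → refl)) (∏-1 n (λ _ _ → refl))
    inversions-0 (suc n) (suc j) = trans (*-congˡ (inversions-0 n j))
        (solve 1 (λ s → (:- :1) :* s := :- s) refl (sg (toℕ j)))

  -- The inversions with position 0 are the values below j, and reordering by ρ does not change
  -- their number. The others are those of ρ, because `punchIn j` is monotone.
  sgn-insert : ∀ {n} (j : Fin (suc n)) (ρ : Permutation′ n) → O.sgn (insert zero j ρ) ≈ sg (toℕ j) * O.sgn ρ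
  sgn-insert {n} j ρ = *-cong
    (begin
      1# * O.product (λ l → inverted (does ((insert zero j ρ ⟨$⟩ʳ suc l) Fin.<? j)))
        ≈⟨ *-identityˡ _ ⟩
      O.product (λ l → inverted (does ((insert zero j ρ ⟨$⟩ʳ suc l) Fin.<? j)))
        ≈⟨ Π.sum-cong-≋ {n} (λ l → reflexive (≡.cong (λ k → inverted (does (k Fin.<? j))) (insert-suc j ρ l))) ⟩
      O.product (λ l → inverted (does (punchIn j (ρ ⟨$⟩ʳ l) Fin.<? j)))
        ≈⟨ Π.sum-permute (λ l → inverted (does (punchIn j l Fin.<? j))) ρ ⟨
      O.product (λ l → inverted (does (punchIn j l Fin.<? j)))
        ≈⟨ inversions-0 n j ⟩
      sg (toℕ j) ∎)
    (Π.sum-cong-≋ {n} (λ i → trans (*-identityˡ _) (Π.sum-cong-≋ {n}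
        (λ k → reflexive (≡.cong (λ t → inverted (does (i Fin.<? k) ∧ t))
      (≡.trans (≡.cong₂ (λ x y → does (x Fin.<? y)) (insert-suc j ρ k) (insert-suc j ρ i))
          (punchIn-<? j (ρ ⟨$⟩ʳ k) (ρ ⟨$⟩ʳ i))))))))

  𝔖-suc : ∀ n (F : Permutation′ (suc n) → Carrier) (G : ℕ → Carrier) →
    (∀ j → O.∑-list (𝔖 n) (λ ρ → O.sgn ρ * F (insert zero j ρ)) ≈ G (toℕ j)) →
    O.∑-list (𝔖 (suc n)) (λ π → O.sgn π * F π) ≈ ∑ (suc n) (λ k → sg k * G k)
  𝔖-suc n F G F≈G = begin
    O.∑-list (𝔖 (suc n)) (λ π → O.sgn π * F π)
      ≈⟨ ∑-list-product (insert zero) (allFin (suc n)) (𝔖 n) _ ⟩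
    O.∑-list (allFin (suc n)) (λ j → O.∑-list (𝔖 n) (λ ρ → O.sgn (insert zero j ρ) * F (insert zero j ρ)))
      ≈⟨ ∑-list-tabulate (suc n) (λ j → j) _ ⟩
    O.sum (λ j → O.∑-list (𝔖 n) (λ ρ → O.sgn (insert zero j ρ) * F (insert zero j ρ)))
      ≈⟨ sum-toℕ (suc n) (λ k → sg k * G k) (λ j → trans
           (∑-list-cong (𝔖 n) (λ ρ → trans (*-congʳ (sgn-insert j ρ)) (*-assoc _ _ _)))
           (trans (sym (*-∑-list (sg (toℕ j)) (𝔖 n) _)) (*-congˡ (F≈G j)))) ⟩
    ∑ (suc n) (λ k → sg k * G k) ∎

  -- Splitting permutations by the image of 0 is an expansion along the first row, which `Det` reads
  -- as its first column.
  det-toℕ : ∀ n {A : Fin n → Fin n → Carrier} (B : ℕ → ℕ → Carrier) → (∀ i j → A i j ≈ B (toℕ i) (toℕ j)) →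
      O.det A ≈ Det n B
  det-toℕ zero    B A≈B = trans (+-identityʳ _) (*-identityˡ _)
  det-toℕ (suc n) {A} B A≈B = 𝔖-suc n (λ π → O.product (λ i → A i (π ⟨$⟩ʳ i)))
    (λ l → B 0 l * Det n (λ i k → B (suc i) (skip l k))) (λ j → begin
    O.∑-list (𝔖 n) (λ ρ → O.sgn ρ * (A zero j * O.product (λ i → A (suc i) (insert zero j ρ ⟨$⟩ʳ suc i))))
      ≈⟨ ∑-list-cong (𝔖 n) (λ ρ → trans (solve 3 (λ s a p → s :* (a :* p) := a :* (s :* p)) refl _ _ _)
           (*-congˡ (*-congˡ (Π.sum-cong-≋ {n} (λ i → reflexive (≡.cong (A (suc i)) (insert-suc j ρ i))))))) ⟩
    O.∑-list (𝔖 n) (λ ρ → A zero j * (O.sgn ρ * O.product (λ i → A (suc i) (punchIn j (ρ ⟨$⟩ʳ i)))))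
      ≈⟨ *-∑-list (A zero j) (𝔖 n) _ ⟨
    A zero j * O.det (λ i k → A (suc i) (punchIn j k))
      ≈⟨ *-cong (A≈B zero j) (det-toℕ n (λ i k → B (suc i) (skip (toℕ j) k))
           (λ i k → trans (A≈B (suc i) (punchIn j k))
           (reflexive (≡.cong (B (suc (toℕ i))) (toℕ-punchIn j k))))) ⟩
    B 0 (toℕ j) * Det n (λ i k → B (suc i) (skip (toℕ j) k)) ∎)

  -- The hypothesis admits every v with the right first n entries, because the rest of the sequence
  -- that `Alt` arrives at is left over from its deletions.
  Alt-toℕ : ∀ n f X (F : Permutation′ n → Carrier) → DependsOn n f →
    (∀ (π : Permutation′ n) v → (∀ i → v (toℕ i) ≈ X (toℕ (π ⟨$⟩ʳ i))) → F π ≈ f v) →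
    O.∑-list (𝔖 n) (λ π → O.sgn π * F π) ≈ Alt n f X
  Alt-toℕ zero    f X F dep F≈f = trans (+-identityʳ _) (trans (*-identityˡ _) (F≈f _ X (λ ())))
  Alt-toℕ (suc n) f X F dep F≈f = 𝔖-suc n F (λ k → Alt n (λ v → f (X k ◂ v)) (X ∘ skip k)) (λ j →
    Alt-toℕ n (λ v → f (X (toℕ j) ◂ v)) (X ∘ skip (toℕ j)) (λ ρ → F (insert zero j ρ))
      (λ u v u≈v → dep _ _ (◂-cong refl u≈v))
      (λ ρ v v≈ → F≈f (insert zero j ρ) (X (toℕ j) ◂ v) (λ
        { zero → refl
        ; (suc i) → trans (v≈ i) (reflexive (≡.cong X (≡.sym
            (≡.trans (≡.cong toℕ (insert-suc j ρ i)) (toℕ-punchIn j (ρ ⟨$⟩ʳ i)))))) })))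

-- Newton's identities for the generating function

module Newton {c ℓ} (R : CommutativeRing c ℓ) where
  open CommutativeRing R hiding (zero)
  open RingTactic R
  open FiniteSums R
  open PowerSeries R
  open FiniteIndices R
  open GeneratingFunctions R using (generating)
  open SemiringMult semiring using () renaming (_×_ to _·_; ×-congʳ to ·-congʳ; ×-comm-* to ·-comm-*; ×-assoc-*
      to ·-assoc-*)
  open CommutativeMonoidMult +-commutativeMonoid using () renaming (×-distrib-+ to ·-distrib-+)
  private
    module Σ = FiniteSums seriesRing
    module Sol = RingTactic seriesRing
  open import Relation.Binary.Reasoning.Setoid setoid
  import Relation.Binary.Reasoning.Setoid S.setoid as SR

  -- The derivation z d/dz.
  θ : Series → Series
  θ f n = n · f n

  private
    ·-zeroʳ : ∀ n → n · 0# ≈ 0#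
    ·-zeroʳ zero    = refl
    ·-zeroʳ (suc n) = trans (+-identityˡ _) (·-zeroʳ n)

    ·-neg : ∀ n x → n · (- x) ≈ - (n · x)
    ·-neg zero    x = solve 0 (:0 := :- :0) refl
    ·-neg (suc n) x = trans (+-congˡ (·-neg n x)) (solve 2 (λ x y → :- x :+ :- y := :- (x :+ y)) refl _ _)

    ⊛-+ˡ : ∀ f g h n → ((λ i → f i + g i) ⊛ h) n ≈ (f ⊛ h) n + (g ⊛ h) n
    ⊛-+ˡ f g h n = coef-≈ (S.distribʳ h f g) n

  leibniz : ∀ f g n → θ (f ⊛ g) n ≈ (θ f ⊛ g) n + (f ⊛ θ g) n
  leibniz f g zero    = solve 2 (λ f g → :0 := :0 :* g :+ f :* :0) refl (f 0) (g 0)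
  leibniz f g (suc n) = begin
    suc n · (f 0 * g (suc n) + ((f ∘ suc) ⊛ g) n)
      ≈⟨ ·-distrib-+ _ _ (suc n) ⟩
    suc n · (f 0 * g (suc n)) + (((f ∘ suc) ⊛ g) n + n · ((f ∘ suc) ⊛ g) n)
      ≈⟨ +-cong (sym (·-comm-* (suc n) (f 0) (g (suc n)))) (+-congˡ (leibniz (f ∘ suc) g n)) ⟩
    f 0 * θ g (suc n) + (((f ∘ suc) ⊛ g) n + ((θ (f ∘ suc) ⊛ g) n + ((f ∘ suc) ⊛ θ g) n))
      ≈⟨ solve 5 (λ a x y w g → a :+ (x :+ (y :+ w)) := (:0 :* g :+ (x :+ y)) :+ (a :+ w)) refl _ _ _ _
           (g (suc n)) ⟩
    (0# * g (suc n) + (((f ∘ suc) ⊛ g) n + (θ (f ∘ suc) ⊛ g) n)) + (f 0 * θ g (suc n) + ((f ∘ suc) ⊛ θ g) n)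
      ≈⟨ +-congʳ (+-congˡ (⊛-+ˡ (f ∘ suc) (θ (f ∘ suc)) g n)) ⟨
    (θ f ⊛ g) (suc n) + (f ⊛ θ g) (suc n) ∎

  -- P is the logarithmic derivative z f′ / f, in a form that avoids division; products of series
  -- correspond to sums.
  record LogDerivative (f P : Series) : Set ℓ where
    constructor logDerivative
    field
      θ≋ : θ f ≋ P ⊛ f

  open LogDerivative

  private
    θ-cong : ∀ {f g} → f ≋ g → θ f ≋ θ g
    θ-cong f≋g = coefficientwise (λ n → ·-congʳ n (coef-≈ f≋g n))

    θ-one : θ S.1# ≋ S.0#
    θ-one = coefficientwise λ { zero → refl ; (suc n) → ·-zeroʳ (suc n) }

    θ-lin : ∀ x → θ (lin x) ≋ neg (C x ⊛ z)
    θ-lin x = coefficientwise λ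
      { zero → solve 1 (λ x → :0 := :- (x :* :0)) refl x
      ; (suc zero) → trans (+-identityʳ _) (trans (+-identityˡ _) refl)
      ; (suc (suc n)) → trans (·-congʳ (2 ℕ.+ n) (+-identityˡ _)) (trans (·-neg (2 ℕ.+ n) _)
          (-‿cong (trans (·-congʳ (2 ℕ.+ n) (trans (coef-C x z (2 ℕ.+ n)) (zeroʳ x))) (trans (·-zeroʳ (2 ℕ.+ n))
            (sym (trans (coef-C x z (2 ℕ.+ n)) (zeroʳ x)))))))
      }

  log-⊛ : ∀ {f g P Q} → LogDerivative f P → LogDerivative g Q → LogDerivative (f ⊛ g) (P ⊕ Q)
  log-⊛ {f} {g} {P} {Q} (logDerivative θf) (logDerivative θg) = logDerivative (SR.begin
    θ (f ⊛ g)                       SR.≈⟨ coefficientwise (leibniz f g) ⟩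
    (θ f ⊛ g) ⊕ (f ⊛ θ g)           SR.≈⟨ S.+-cong (S.*-congʳ θf) (S.*-congˡ θg) ⟩
    ((P ⊛ f) ⊛ g) ⊕ (f ⊛ (Q ⊛ g))   SR.≈⟨ Sol.solve 4 (λ p f g q → (p Sol.:* f) Sol.:* g Sol.:+ f Sol.:*
        (q Sol.:* g) Sol.:= (p Sol.:+ q) Sol.:* (f Sol.:* g)) S.refl P f g Q ⟩
    (P ⊕ Q) ⊛ (f ⊛ g)               SR.∎)

  log-lin : ∀ x → LogDerivative (lin x) (neg (C x ⊛ (z ⊛ geo x)))
  log-lin x = logDerivative (S.trans (θ-lin x) (S.sym (SR.begin
    neg (C x ⊛ (z ⊛ geo x)) ⊛ lin x
      SR.≈⟨ Sol.solve 4 (λ x z g l → (Sol.:- (x Sol.:* (z Sol.:* g))) Sol.:* l Sol.:= (Sol.:- (x Sol.:* z))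
           Sol.:* (l Sol.:* g)) S.refl _ _ _ _ ⟩
    neg (C x ⊛ z) ⊛ (lin x ⊛ geo x)
      SR.≈⟨ S.trans (S.*-congˡ (lin-geo x)) (S.*-identityʳ _) ⟩
    neg (C x ⊛ z) SR.∎)))

  -- The derivation kills `lin x ⊛ geo x`, so the Leibniz rule gives `geo x` the opposite
  -- logarithmic derivative of `lin x`.
  log-geo : ∀ x → LogDerivative (geo x) (C x ⊛ (z ⊛ geo x))
  log-geo x = logDerivative (SR.begin
    θ (geo x)
      SR.≈⟨ S.trans (S.sym (S.*-identityˡ _)) (S.*-congʳ (S.sym (lin-geo x))) ⟩
    (lin x ⊛ geo x) ⊛ θ (geo x)
      SR.≈⟨ Sol.solve 5 (λ l g t xz u → (l Sol.:* g) Sol.:* t Sol.:= g Sol.:* (u Sol.:* g Sol.:+ l Sol.:* t)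
           Sol.:- g Sol.:* (u Sol.:* g)) S.refl (lin x) (geo x) (θ (geo x)) z (θ (lin x)) ⟩
    (geo x ⊛ ((θ (lin x) ⊛ geo x) ⊕ (lin x ⊛ θ (geo x)))) S.- (geo x ⊛ (θ (lin x) ⊛ geo x))
      SR.≈⟨ S.+-cong (S.*-congˡ (S.trans (S.sym (coefficientwise (leibniz (lin x) (geo x))))
           (S.trans (θ-cong (lin-geo x)) θ-one)))
           (S.-‿cong (S.*-congˡ (S.*-congʳ (θ-lin x)))) ⟩
    (geo x ⊛ S.0#) S.- (geo x ⊛ (neg (C x ⊛ z) ⊛ geo x))
      SR.≈⟨ Sol.solve 3 (λ g x z → g Sol.:* Sol.:0 Sol.:- g Sol.:* ((Sol.:- (x Sol.:* z)) Sol.:* g) Sol.:=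
           (x Sol.:* (z Sol.:* g)) Sol.:* g) S.refl (geo x) (C x) z ⟩
    (C x ⊛ (z ⊛ geo x)) ⊛ geo x SR.∎)

  log-∏ : ∀ n (f P : ℕ → Series) → (∀ i → LogDerivative (f i) (P i)) → LogDerivative (S.∏ n f) (S.∑ n P)
  log-∏ zero    f P logs = logDerivative (S.trans (θ-cong (Σ.∏-empty f))
      (S.trans θ-one (S.sym (S.trans (S.*-congʳ (Σ.∑-empty P)) (S.zeroˡ _)))))
  log-∏ (suc n) f P logs = logDerivative (S.trans (θ-cong (Σ.∏-suc n f))
      (S.trans (θ≋ (log-⊛ (logs 0) (log-∏ n (f ∘ suc) (P ∘ suc) (logs ∘ suc))))
    (S.*-cong (S.sym (Σ.∑-suc n P)) (S.sym (Σ.∏-suc n f)))))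

  -- Index k carries the power sum of degree k + 1, hence the sign (-1)ᵏ at the y's.
  power-sum : ℕ → ℕ → (ℕ → Carrier) → (ℕ → Carrier) → ℕ → Carrier
  power-sum nx ny X Y k = ∑ nx (λ i → geo (X i) (suc k)) + sg k * ∑ ny (λ j → geo (Y j) (suc k))

  private
    convolution : ∀ f g k → (f ⊛ g) k ≈ O.sum {suc k} (λ i → f (toℕ i) * g (k ∸ toℕ i))
    convolution f g zero    = sym (+-identityʳ _)
    convolution f g (suc k) = +-congˡ (convolution (f ∘ suc) g k)

  -- The logarithmic derivative of F has constant term 0 and the power sums as its further
  -- coefficients; compare coefficients of order k + 1.
  newton-generating : ∀ nx ny X Y k → suc k · generating nx ny X Y (suc k) ≈
    O.sum {suc k} (λ i → power-sum nx ny X Y (toℕ i) * generating nx ny X Y (k ∸ toℕ i))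
  newton-generating nx ny X Y k = begin
    suc k · F (suc k)
      ≈⟨ coef-≈ (θ≋ (log-⊛ (log-∏ ny (λ j → lin (- Y j)) _ (λ j → log-lin (- Y j)))
           (log-∏ nx (λ i → geo (X i)) _ (λ i → log-geo (X i))))) (suc k) ⟩
    P 0 * F (suc k) + ((P ∘ suc) ⊛ F) k
      ≈⟨ +-cong (trans (*-congʳ P₀) (zeroˡ _)) (coef-≈ (S.*-congʳ (coefficientwise P-suc)) k) ⟩
    0# + (power-sum nx ny X Y ⊛ F) k
      ≈⟨ trans (+-identityˡ _) (convolution (power-sum nx ny X Y) F k) ⟩
    O.sum {suc k} (λ i → power-sum nx ny X Y (toℕ i) * F (k ∸ toℕ i)) ∎
    where
    F = generating nx ny X Y
    Ps : ℕ → Series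
    Ps j = neg (C (- Y j) ⊛ (z ⊛ geo (- Y j)))
    Qs : ℕ → Series
    Qs i = C (X i) ⊛ (z ⊛ geo (X i))
    P : Series
    P = S.∑ ny Ps ⊕ S.∑ nx Qs
    Q₀ : ∀ x → (C x ⊛ (z ⊛ geo x)) 0 ≈ 0#
    Q₀ x = trans (*-congˡ (coef-z-zero (geo x))) (zeroʳ x)
    Q-suc : ∀ x k → (C x ⊛ (z ⊛ geo x)) (suc k) ≈ geo x (suc k)
    Q-suc x k = trans (coef-C x (z ⊛ geo x) (suc k)) (*-congˡ (coef-z-suc (geo x) k))
    P₀ : P 0 ≈ 0#
    P₀ = trans (+-cong (trans (coef-∑ ny Ps 0) (∑-zero ny
        (λ j _ → trans (-‿cong (Q₀ (- Y j))) (solve 0 (:- :0 := :0) refl))))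
      (trans (coef-∑ nx Qs 0) (∑-zero nx (λ i _ → Q₀ (X i))))) (+-identityˡ _)
    P-suc : ∀ k → P (suc k) ≈ power-sum nx ny X Y k
    P-suc k = trans (+-comm _ _) (+-cong
      (trans (coef-∑ nx Qs (suc k)) (∑-cong nx (λ i → Q-suc (X i) k)))
      (trans (coef-∑ ny Ps (suc k)) (trans (∑-cong ny (λ j → trans
          (-‿cong (trans (Q-suc (- Y j) k) (geo-neg (Y j) (suc k))))
        (solve 2 (λ s g → :- ((:- s) :* g) := s :* g) refl _ _))) (sym (*-∑ ny (sg k) _)))))

  -- The term with F 0 drops out because the polynomial has degree k only; accordingly the sum
  -- defining the shifted complete functions starts at i = 1.
  coef-lins-⊛ : ∀ k (A : ℕ → Carrier) F → (lins k A ⊛ F) (suc k) ≈ O.sum {suc k}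
      (λ i → lins k A (k ∸ toℕ i) * F (suc (toℕ i)))
  coef-lins-⊛ k A F = begin
    (lins k A ⊛ F) (suc k)
      ≈⟨ coef-≈ (S.*-comm (lins k A) F) (suc k) ⟩
    F 0 * lins k A (suc k) + ((F ∘ suc) ⊛ lins k A) k
      ≈⟨ +-cong (trans (*-congˡ (trans (reflexive (≡.cong (lins k A) (≡.sym (ℕ.+-comm k 1))))
           (coef-lins-> k A 0))) (zeroʳ _))
           (convolution (F ∘ suc) (lins k A) k) ⟩
    0# + O.sum {suc k} (λ i → F (suc (toℕ i)) * lins k A (k ∸ toℕ i))
      ≈⟨ trans (+-identityˡ _) (sum-cong (suc k) (λ i → *-comm (F (suc (toℕ i))) (lins k A (k ∸ toℕ i)))) ⟩
    O.sum {suc k} (λ i → lins k A (k ∸ toℕ i) * F (suc (toℕ i))) ∎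

-- Evaluation of the Jacobi-Trudi entries

difference : ∀ m i j → + m ℤ.- + i ℤ.+ + j ≡ (m ℕ.+ j) ⊖ i
difference m i j = ≡.trans (rearrange (+ m) (+ i) (+ j)) (ℤ.m-n≡m⊖n (m ℕ.+ j) i)
  where
  rearrange : ∀ m i j → m ℤ.- i ℤ.+ j ≡ m ℤ.+ j ℤ.- i
  rearrange = ℤSolver.solve-∀

module Evaluation {c r} (K : CommutativeRing c r) (1/1+_ : ℕ → CommutativeRing.Carrier K)
  (1/1+-inverse : ∀ k → CommutativeRing._≈_ K
    (SemiringMult._×_ (CommutativeRing.semiring K) (suc k) (1/1+ k)) (CommutativeRing.1# K)) where
  private
    module K where
      open CommutativeRing K public
      open RingOperations K public
    module KM = SemiringMult K.semiring
    module KSol = RingTactic K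
  module SF = SymmetricFunctions K 1/1+_ 1/1+-inverse

  module Homomorphism {U W : Set} (σ : U → SF.Poly W) where
    private
      module RU = RingOperations (SF.polynomialRing U)
      module RW = RingOperations (SF.polynomialRing W)

    ⟪_⟫ : SF.Poly U → SF.Poly W
    ⟪_⟫ = SF.substitute σ

    hom-sum : ∀ n (f : Fin n → SF.Poly U) → ⟪ RU.sum f ⟫ ≡ RW.sum (⟪_⟫ ∘ f)
    hom-sum zero    f = ≡.refl
    hom-sum (suc n) f = ≡.cong (⟪ f zero ⟫ SF.+_) (hom-sum n (f ∘ suc))

    hom-product : ∀ n (f : Fin n → SF.Poly U) → ⟪ RU.product f ⟫ ≡ RW.product (⟪_⟫ ∘ f)
    hom-product zero    f = ≡.refl
    hom-product (suc n) f = ≡.cong (⟪ f zero ⟫ SF.*_) (hom-product n (f ∘ suc))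

    hom-∑-list : ∀ {A : Set} (as : List A) f → ⟪ RU.∑-list as f ⟫ ≡ RW.∑-list as (⟪_⟫ ∘ f)
    hom-∑-list []       f = ≡.refl
    hom-∑-list (a ∷ as) f = ≡.cong (⟪ f a ⟫ SF.+_) (hom-∑-list as f)

    hom-^ : ∀ f k → ⟪ f RU.^ k ⟫ ≡ ⟪ f ⟫ RW.^ k
    hom-^ f zero    = ≡.refl
    hom-^ f (suc k) = ≡.cong (⟪ f ⟫ SF.*_) (hom-^ f k)

    hom-if : ∀ b {f g} → ⟪ if b then f else g ⟫ ≡ (if b then ⟪ f ⟫ else ⟪ g ⟫)
    hom-if true  = ≡.refl
    hom-if false = ≡.refl

  module _ {W : Set} where
    R : CommutativeRing _ _
    R = SF.polynomialRing W
    open CommutativeRing R hiding (zero)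
    open import Algebra.Properties.AbelianGroup +-abelianGroup using (inverseˡ-unique)
    open PowerSeries R
    open FiniteIndices R
    open SemiringMult semiring using () renaming (_×_ to _·_; ×-comm-* to ·-comm-*; ×-assoc-* to ·-assoc-*)
    open import Relation.Binary.Reasoning.Setoid setoid

    con-neg : ∀ x → SF.con (K.- x) ≈ - SF.con x
    con-neg x = inverseˡ-unique _ _ (trans (sym (SF.con-+ (K.- x) x)) (SF.con-cong (K.-‿inverseˡ x)))

    ^-geo : ∀ {x y} → x ≈ y → ∀ k → x O.^ k ≈ geo y k
    ^-geo x≈y zero    = refl
    ^-geo x≈y (suc k) = *-cong x≈y (^-geo x≈y k)

    divide : ∀ k u → SF.con (1/1+ k) * (suc k · u) ≈ u
    divide k u = begin
      SF.con (1/1+ k) * (suc k · u)      ≈⟨ ·-comm-* (suc k) (SF.con (1/1+ k)) u ⟩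
      suc k · (SF.con (1/1+ k) * u)      ≈⟨ ·-assoc-* (suc k) (SF.con (1/1+ k)) u ⟨
      (suc k · SF.con (1/1+ k)) * u      ≈⟨ *-congʳ (con-· (suc k) (1/1+ k)) ⟩
      SF.con (suc k KM.× (1/1+ k)) * u   ≈⟨ *-congʳ (SF.con-cong (1/1+-inverse k)) ⟩
      1# * u                             ≈⟨ *-identityˡ u ⟩
      u                                  ∎
      where
      con-· : ∀ m a → m · SF.con a ≈ SF.con (m KM.× a)
      con-· zero    a = refl
      con-· (suc m) a = trans (+-congˡ (con-· m a)) (sym (SF.con-+ a (m KM.× a)))

    -- The signed elementary functions are the coefficients of Π (1 - vⱼ z), and the recursion of
    -- `e` on its head variable is multiplication by 1 - v₀ z.
    lins-e : ∀ n k (v : Fin n → K.Carrier) A → (∀ j → SF.con (v j) ≈ A (toℕ j)) →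
      SF.con (((K.- K.1#) K.^ k) K.* K.e k v) ≈ lins n A k
    lins-e n zero v A v≈A = trans (SF.con-cong (K.*-identityˡ _)) (sym (lins-zero n A))
    lins-e zero (suc k) v A v≈A = trans (SF.con-cong (K.zeroʳ _)) (sym (coef-lins-> 0 A k))
    lins-e (suc n) (suc k) v A v≈A = sym (begin
      lins (suc n) A (suc k)
        ≈⟨ coef-≈ (S-∏-suc n _) (suc k) ⟩
      (lin (A 0) ⊛ lins n (A ∘ suc)) (suc k)
        ≈⟨ coef-lin-suc (A 0) _ k ⟩
      lins n (A ∘ suc) (suc k) - A 0 * lins n (A ∘ suc) k
        ≈⟨ +-cong (sym (lins-e n (suc k) (v ∘ suc) (A ∘ suc) (v≈A ∘ suc)))
             (-‿cong (*-cong (sym (v≈A zero)) (sym (lins-e n k (v ∘ suc) (A ∘ suc) (v≈A ∘ suc))))) ⟩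
      SF.con (s′ K.* e₁) - SF.con (v zero) * SF.con (s K.* e₀)
        ≈⟨ +-congˡ (trans (-‿cong (sym (SF.con-* _ _))) (sym (con-neg _))) ⟩
      SF.con (s′ K.* e₁) + SF.con (K.- (v zero K.* (s K.* e₀)))
        ≈⟨ SF.con-+ _ _ ⟨
      SF.con (s′ K.* e₁ K.+ K.- (v zero K.* (s K.* e₀)))
        ≈⟨ SF.con-cong (KSol.solve 4 (λ s e x f → ((KSol.:- KSol.:1) KSol.:* s) KSol.:* e KSol.:+ KSol.:-
             (x KSol.:* (s KSol.:* f)) KSol.:=
             ((KSol.:- KSol.:1) KSol.:* s) KSol.:* (e KSol.:+ x KSol.:* f)) K.refl s e₁ (v zero) e₀) ⟩
      SF.con (s′ K.* K.e (suc k) v) ∎)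
      where
      s = (K.- K.1#) K.^ k
      s′ = (K.- K.1#) K.^ suc k
      e₁ = K.e (suc k) (v ∘ suc)
      e₀ = K.e k (v ∘ suc)

  module Finite (n : ℕ) where
    open CommutativeRing (R {Fin n ⊎ Fin n}) hiding (zero)
    open RingTactic (R {Fin n ⊎ Fin n})
    open FiniteSums (R {Fin n ⊎ Fin n})
    open PowerSeries (R {Fin n ⊎ Fin n})
    open FiniteIndices (R {Fin n ⊎ Fin n})
    open Newton (R {Fin n ⊎ Fin n})
    open GeneratingFunctions (R {Fin n ⊎ Fin n}) using (generating)
    open import Relation.Binary.Reasoning.Setoid setoid
    extend : ∀ {n} → (Fin n → Carrier) → ℕ → Carrier
    extend {zero}  x i       = 0#
    extend {suc n} x zero    = x zero
    extend {suc n} x (suc i) = extend (x ∘ suc) i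

    extend-toℕ : ∀ {n} (x : Fin n → Carrier) i → extend x (toℕ i) ≡ x i
    extend-toℕ x zero    = ≡.refl
    extend-toℕ x (suc i) = extend-toℕ (x ∘ suc) i

    X Y : ℕ → Carrier
    X = extend (SF.x {n})
    Y = extend (SF.y {n})

    F : Series
    F = generating n n X Y

    ev : SF.Λ → Carrier
    ev = SF.evaluate n

    private
      module Hom = Homomorphism (λ k → SF.p (suc k) (SF.x {n}) SF.+ (SF.- SF.con K.1#) SF.^ k SF.* SF.p (suc k)
          (SF.y {n}))

      signs : ∀ k → (- SF.con K.1#) O.^ k ≈ sg k
      signs zero    = refl
      signs (suc k) = trans (*-congˡ (signs k)) (solve 1 (λ s → (:- :1) :* s := :- s) refl (sg k))

      ev-p : ∀ k → SF.p (suc k) (SF.x {n}) SF.+ (SF.- SF.con K.1#) SF.^ k SF.* SF.p (suc k) (SF.y {n}) ≈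
          power-sum n n X Y k
      ev-p k = +-cong (sum-toℕ n (λ i → geo (X i) (suc k))
          (λ i → ^-geo (reflexive (≡.sym (extend-toℕ (SF.x {n}) i))) (suc k)))
        (*-cong (signs k) (sum-toℕ n (λ i → geo (Y i) (suc k))
            (λ i → ^-geo (reflexive (≡.sym (extend-toℕ (SF.y {n}) i))) (suc k))))

    F-zero : F 0 ≈ 1#
    F-zero = trans (*-cong (lins-zero n (λ j → - Y j)) (geos-zero n X)) (*-identityˡ _)

    -- The coefficients of F satisfy, by `newton-generating`, the recursion that defines `𝐡s`.
    ev-𝐡s : ∀ k (i : Fin (suc k)) → ev (lookup (SF.𝐡s k) i) ≈ F (k ∸ toℕ i)
    ev-𝐡s zero    zero    = sym F-zero
    ev-𝐡s (suc k) (suc i) = ev-𝐡s k i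
    ev-𝐡s (suc k) zero    = begin
      SF.con (1/1+ k) * ev (O′.sum {suc k} (λ i → SF.var (toℕ i) SF.* lookup (SF.𝐡s k) i))
        ≡⟨ ≡.cong (SF.con (1/1+ k) *_) (Hom.hom-sum (suc k) (λ i → SF.var (toℕ i) SF.* lookup (SF.𝐡s k) i)) ⟩
      SF.con (1/1+ k) * O.sum {suc k} (λ i → ev (SF.var (toℕ i)) * ev (lookup (SF.𝐡s k) i))
        ≈⟨ *-congˡ (sum-cong (suc k) (λ i → *-cong (ev-p (toℕ i)) (ev-𝐡s k i))) ⟩
      SF.con (1/1+ k) * O.sum {suc k} (λ i → power-sum n n X Y (toℕ i) * F (k ∸ toℕ i))
        ≈⟨ *-congˡ (newton-generating n n X Y k) ⟨
      SF.con (1/1+ k) * (suc k · F (suc k))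
        ≈⟨ divide k (F (suc k)) ⟩
      F (suc k) ∎
      where
      module O′ = RingOperations (SF.polynomialRing ℕ)
      open SemiringMult semiring using () renaming (_×_ to _·_)

    -- In other words, the shifted complete function of degree k + 1 is the residue of F (u - a₁) ⋯
    -- (u - aₖ), F having degree 0 in u.
    ev-h : ∀ k (a : ℤ → K.Carrier) → ev SF.h⟨ + suc k , a ⟩ ≈ (lins k (λ t → SF.con (a (+ suc t))) ⊛ F) (suc k)
    ev-h k a = begin
      ev SF.h⟨ + suc k , a ⟩
        ≡⟨ Hom.hom-sum (suc k) (λ i → SF.con (coefficient i) SF.* SF.𝐡 (suc (toℕ i))) ⟩
      O.sum {suc k} (λ i → SF.con (coefficient i) * ev (SF.𝐡 (suc (toℕ i))))
        ≈⟨ sum-cong (suc k) (λ i → *-cong (lins-e k (k ∸ toℕ i) (λ j → a (+ suc (toℕ j))) A (λ _ → refl))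
             (ev-𝐡 (toℕ i))) ⟩
      O.sum {suc k} (λ i → lins k A (k ∸ toℕ i) * F (suc (toℕ i)))
        ≈⟨ coef-lins-⊛ k A F ⟨
      (lins k A ⊛ F) (suc k) ∎
      where
      A : ℕ → Carrier
      A t = SF.con (a (+ suc t))
      coefficient : Fin (suc k) → K.Carrier
      coefficient i = ((K.- K.1#) K.^ (k ∸ toℕ i)) K.* K.e (k ∸ toℕ i) (λ (j : Fin k) → a (+ suc (toℕ j)))
      ev-𝐡 : ∀ k → ev (SF.𝐡 (suc k)) ≈ F (suc k)
      ev-𝐡 k = ev-𝐡s (suc k) zero

    ev-det : ∀ m (A : Fin m → Fin m → SF.Λ) → ev (SF.det A) ≡ O.det (λ i j → ev (A i j))
    ev-det m A = ≡.trans (Hom.hom-∑-list (𝔖 m) _) (∑-list-≡ (𝔖 m) (λ π → ≡.cong₂ SF._*_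
        (≡.trans (Hom.hom-product m _) (product-≡ m (λ i → ≡.trans (Hom.hom-product m _) (product-≡ m (λ j →
          Hom.hom-if (does (i Fin.<? j) ∧ does ((π ⟨$⟩ʳ j) Fin.<? (π ⟨$⟩ʳ i))) {SF.- SF.con K.1#} {SF.con K.1#})))))
        (Hom.hom-product m (λ i → A i (π ⟨$⟩ʳ i)))))
      where
      ∑-list-≡ : ∀ {B : Set} (bs : List B) {f g : B → Carrier} → (∀ b → f b ≡ g b) → O.∑-list bs f ≡ O.∑-list bs g
      ∑-list-≡ []       f≡g = ≡.refl
      ∑-list-≡ (b ∷ bs) f≡g = ≡.cong₂ SF._+_ (f≡g b) (∑-list-≡ bs f≡g)
      product-≡ : ∀ m {f g : Fin m → Carrier} → (∀ i → f i ≡ g i) → O.product f ≡ O.product g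
      product-≡ zero    f≡g = ≡.refl
      product-≡ (suc m) f≡g = ≡.cong₂ SF._*_ (f≡g zero) (product-≡ m (f≡g ∘ suc))

    module Shifted (a : ℤ → K.Carrier) where
      -- The sequence a read outwards from its middle: a₁, a₂, ... and a₀, a₍₋₁₎, ....
      a⁺ b : ℕ → Carrier
      a⁺ t = SF.con (a (+ suc t))
      b t = SF.con (a (ℤ.- (+ t)))

      open GramMatrix (R {Fin n ⊎ Fin n}) a⁺ b using (H)
      open GramJacobiTrudi (R {Fin n ⊎ Fin n}) a⁺ b using (H-lins)

      -- The shifted sequence of column j + 1 of the matrix: b₍ⱼ₋₁₎, ..., b₀ followed by a₁, a₂,
      -- .... Its first j + α terms thus split into the shift of the column and the polynomial of
      -- the row.
      A : ℕ → ℕ → Carrier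
      A j t = SF.con (SF.τ (+ 1 ℤ.- + suc j) a (+ suc t))

      A-zero : ∀ t → A 0 t ≡ a⁺ t
      A-zero t = ≡.cong (SF.con ∘ a) (ℤ.+-identityʳ (+ suc t))

      A-suc-zero : ∀ j → A (suc j) 0 ≡ b j
      A-suc-zero j = ≡.cong (SF.con ∘ a) (index (+ j))
        where
        index : ∀ j → + 1 ℤ.+ (+ 1 ℤ.- (+ 2 ℤ.+ j)) ≡ ℤ.- j
        index = ℤSolver.solve-∀

      A-suc-suc : ∀ j t → A (suc j) (suc t) ≡ A j t
      A-suc-suc j t = ≡.cong (SF.con ∘ a) (index (+ j) (+ t))
        where
        index : ∀ j t → (+ 2 ℤ.+ t) ℤ.+ (+ 1 ℤ.- (+ 2 ℤ.+ j)) ≡ (+ 1 ℤ.+ t) ℤ.+ (+ 1 ℤ.- (+ 1 ℤ.+ j))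
        index = ℤSolver.solve-∀

      lins-A-suc : ∀ k j → lins (suc k) (A (suc j)) ≋ lin (b j) ⊛ lins k (A j)
      lins-A-suc k j = S.trans (S-∏-suc k _) (S.*-cong (S.reflexive (≡.cong lin (A-suc-zero j)))
        (S-∏-cong k (λ t → S.reflexive (≡.cong lin (A-suc-suc j t)))))

      lins-A : ∀ α j → lins (j ℕ.+ α) (A j) ≋ lins α a⁺ ⊛ lins j b
      lins-A α zero    = S.trans (S-∏-cong α (λ t → S.reflexive (≡.cong lin (A-zero t))))
        (S.sym (S.trans (S.*-congˡ (S-∏-empty _)) (S.*-identityʳ _)))
      lins-A α (suc j) = S.trans (lins-A-suc (j ℕ.+ α) j) (S.trans (S.*-congˡ (lins-A α j))
        (S.trans (Sol.solve 3 (λ l x y → l Sol.:* (x Sol.:* y) Sol.:= x Sol.:* (y Sol.:* l)) S.refl _ _ _)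
          (S.*-congˡ (S.sym (S-∏-last j (λ t → lin (b t)))))))
        where module Sol = RingTactic seriesRing

      lins-A-tail : ∀ k r → lins k (A (suc r ℕ.+ k)) ≋ lins k (λ i → b (suc r ℕ.+ i))
      lins-A-tail zero    r = S.trans (S-∏-empty _) (S.sym (S-∏-empty _))
      lins-A-tail (suc k) r = S.trans (S.reflexive (≡.cong (λ j → lins (suc k) (A j)) (ℕ.+-suc (suc r) k)))
        (S.trans (lins-A-suc k (suc r ℕ.+ k)) (S.trans (S.*-congˡ (lins-A-tail k r))
          (S.trans (S.*-comm _ _) (S.sym (S-∏-last k (λ i → lin (b (suc r ℕ.+ i))))))))

      jt-entry : ℕ → ℕ → ℕ → Carrier
      jt-entry m i j = ev SF.h⟨ + m ℤ.- + suc i ℤ.+ + suc j , SF.τ (+ 1 ℤ.- + suc j) a ⟩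

      entry-positive : ∀ α i j → jt-entry (α ℕ.+ suc i) i j ≈ (lins α a⁺ ⊛ (lins j b ⊛ F)) (α ℕ.+ suc j)
      entry-positive α i j = begin
        jt-entry (α ℕ.+ suc i) i j
          ≡⟨ ≡.cong (λ k → ev SF.h⟨ k , SF.τ (+ 1 ℤ.- + suc j) a ⟩)
               (≡.trans (difference (α ℕ.+ suc i) (suc i) (suc j))
               (≡.trans (≡.cong₂ _⊖_ (index α i j) (≡.sym (ℕ.+-identityʳ (suc i))))
                   (ℤ.+-cancelˡ-⊖ (suc i) (suc (j ℕ.+ α)) 0))) ⟩
        ev SF.h⟨ + suc (j ℕ.+ α) , SF.τ (+ 1 ℤ.- + suc j) a ⟩
          ≈⟨ ev-h (j ℕ.+ α) (SF.τ (+ 1 ℤ.- + suc j) a) ⟩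
        (lins (j ℕ.+ α) (A j) ⊛ F) (suc (j ℕ.+ α))
          ≈⟨ coef-≈ (S.trans (S.*-congʳ (lins-A α j)) (S.*-assoc _ _ _)) (suc (j ℕ.+ α)) ⟩
        (lins α a⁺ ⊛ (lins j b ⊛ F)) (suc (j ℕ.+ α))
          ≡⟨ ≡.cong (lins α a⁺ ⊛ (lins j b ⊛ F)) (ℕ.+-comm (suc j) α) ⟩
        (lins α a⁺ ⊛ (lins j b ⊛ F)) (α ℕ.+ suc j) ∎
        where
        index : ∀ α i j → α ℕ.+ suc i ℕ.+ suc j ≡ suc i ℕ.+ suc (j ℕ.+ α)
        index = solve-∀

      -- Row number r + m + 1 of length m has degree -(r + 1), and the index of the entry is j - r:
      -- it is 0 above the diagonal j = r, 1 on it, and for j > r the denominator of `H r` cancels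
      -- all but k of the factors u - bₛ.
      entry-negative : ∀ m r j → jt-entry m (r ℕ.+ m) j ≈ at (H r ⊛ (lins j b ⊛ F)) j r
      entry-negative m r j with ℕ.<-cmp j r
      ... | tri< j<r _ _ with ℕ.m≤n⇒∃[o]m+o≡n j<r
      ...   | k , ≡.refl = trans (reflexive (≡.cong (λ k → ev SF.h⟨ k , SF.τ (+ 1 ℤ.- + suc j) a ⟩)
          (≡.trans (difference m (suc (suc j ℕ.+ k ℕ.+ m)) (suc j))
               (≡.trans (≡.cong₂ _⊖_ (index₁ m j) (index₂ m j k)) (ℤ.+-cancelˡ-⊖ (suc j ℕ.+ m) 0 (suc k))))))
             (sym (at-< (H r ⊛ (lins j b ⊛ F)) j<r))
        where
        index₁ : ∀ m j → m ℕ.+ suc j ≡ suc j ℕ.+ m ℕ.+ 0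
        index₁ = solve-∀
        index₂ : ∀ m j k → suc (suc j ℕ.+ k ℕ.+ m) ≡ suc j ℕ.+ m ℕ.+ suc k
        index₂ = solve-∀
      entry-negative m r j | tri≈ _ ≡.refl _ = trans (reflexive
          (≡.cong (λ k → ev SF.h⟨ k , SF.τ (+ 1 ℤ.- + suc j) a ⟩) (≡.trans (difference m (suc (j ℕ.+ m)) (suc j))
               (≡.trans (≡.cong (_⊖ suc (j ℕ.+ m)) (index m j)) (ℤ.n⊖n≡0 (suc (j ℕ.+ m)))))))
             (sym (trans (reflexive (at-diagonal (H j ⊛ (lins j b ⊛ F)) j))
                 (trans (*-cong (geos-zero (suc j) b) (trans (*-cong (lins-zero j b) F-zero) (*-identityˡ _)))
                 (*-identityˡ _))))
        where
        index : ∀ m j → m ℕ.+ suc j ≡ suc (j ℕ.+ m)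
        index = solve-∀
      entry-negative m r j | tri> _ _ r<j with ℕ.m≤n⇒∃[o]m+o≡n r<j
      ... | k , ≡.refl = begin
        jt-entry m (r ℕ.+ m) (suc r ℕ.+ k)
          ≡⟨ ≡.cong (λ k′ → ev SF.h⟨ k′ , SF.τ (+ 1 ℤ.- + suc (suc r ℕ.+ k)) a ⟩)
               (≡.trans (difference m (suc (r ℕ.+ m)) (suc (suc r ℕ.+ k)))
               (≡.trans (≡.cong₂ _⊖_ (index₁ m r k) (≡.sym (ℕ.+-identityʳ (suc (r ℕ.+ m)))))
                   (ℤ.+-cancelˡ-⊖ (suc (r ℕ.+ m)) (suc k) 0))) ⟩
        ev SF.h⟨ + suc k , SF.τ (+ 1 ℤ.- + suc (suc r ℕ.+ k)) a ⟩
          ≈⟨ ev-h k (SF.τ (+ 1 ℤ.- + suc (suc r ℕ.+ k)) a) ⟩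
        (lins k (A (suc r ℕ.+ k)) ⊛ F) (suc k)
          ≈⟨ coef-≈ (S.*-congʳ (S.trans (lins-A-tail k r) (S.sym (H-lins r k)))) (suc k) ⟩
        ((H r ⊛ lins (suc r ℕ.+ k) b) ⊛ F) (suc k)
          ≈⟨ coef-≈ (S.*-assoc (H r) (lins (suc r ℕ.+ k) b) F) (suc k) ⟩
        (H r ⊛ (lins (suc r ℕ.+ k) b ⊛ F)) (suc k)
          ≡⟨ ≡.trans (≡.cong₂ (at (H r ⊛ (lins (suc r ℕ.+ k) b ⊛ F))) (≡.sym (ℕ.+-suc r k))
               (≡.sym (ℕ.+-identityʳ r))) (at-+ (H r ⊛ (lins (suc r ℕ.+ k) b ⊛ F)) r (suc k) 0) ⟨
        at (H r ⊛ (lins (suc r ℕ.+ k) b ⊛ F)) (suc r ℕ.+ k) r ∎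
        where
        index₁ : ∀ m r k → m ℕ.+ suc (suc r ℕ.+ k) ≡ suc (r ℕ.+ m) ℕ.+ suc k
        index₁ = solve-∀

-- Young diagrams and Frobenius coordinates

module _ {A : Set} {P : Pred A 0ℓ} (P? : Decidable P) where

  -- A predicate inherited by smaller indices selects an initial segment, so the number of selected
  -- entries is a threshold.
  filter-applyUpTo⁻ : ∀ n (g : ℕ → A) → (∀ i → P (g (suc i)) → P (g i)) →
    ∀ i → i ℕ.< length (filter P? (applyUpTo g n)) → i ℕ.< n × P (g i)
  filter-applyUpTo⁻ (suc n) g anti i i<l with P? (g 0)
  filter-applyUpTo⁻ (suc n) g anti zero    i<l       | yes p = s≤s z≤n , p
  filter-applyUpTo⁻ (suc n) g anti (suc i) (s≤s i<l) | yes p =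
    let (i<n , q) = filter-applyUpTo⁻ n (g ∘ suc) (anti ∘ suc) i i<l in s≤s i<n , q
  ... | no ¬p = contradiction (anti 0 (proj₂ (filter-applyUpTo⁻ n (g ∘ suc) (anti ∘ suc) 0
      (ℕ.≤-<-trans z≤n i<l)))) ¬p

  filter-applyUpTo⁺ : ∀ n (g : ℕ → A) → (∀ i → P (g (suc i)) → P (g i)) →
    ∀ i → i ℕ.< n → P (g i) → i ℕ.< length (filter P? (applyUpTo g n))
  filter-applyUpTo⁺ (suc n) g anti i i<n q with P? (g 0)
  filter-applyUpTo⁺ (suc n) g anti zero    _         q | yes p = s≤s z≤n
  filter-applyUpTo⁺ (suc n) g anti (suc i) (s≤s i<n) q | yes p = s≤s
      (filter-applyUpTo⁺ n (g ∘ suc) (anti ∘ suc) i i<n q)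
  ... | no ¬p = contradiction (first i q) ¬p
    where
    first : ∀ i → P (g i) → P (g 0)
    first zero    q = q
    first (suc i) q = first i (anti i q)

module Young (μ : YoungDiagram) where
  open YoungDiagram μ using (rows; decreasing)

  private
    entry-suc : ∀ {ms} → Linked ℕ._≥_ ms → ∀ i → entry ms (suc i) ℕ.≤ entry ms i
    entry-suc []        i       = z≤n
    entry-suc [-]       i       = z≤n
    entry-suc (m≥ ∷ ms) zero    = m≥
    entry-suc (m≥ ∷ ms) (suc i) = entry-suc ms i

    entry-beyond : ∀ ms i → length ms ℕ.≤ i → entry ms i ≡ 0
    entry-beyond []       i       _        = ≡.refl
    entry-beyond (m ∷ ms) (suc i) (s≤s le) = entry-beyond ms i le

    applyUpTo-entry : ∀ ms → applyUpTo (entry ms) (length ms) ≡ ms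
    applyUpTo-entry []       = ≡.refl
    applyUpTo-entry (m ∷ ms) = ≡.cong (m ∷_) (applyUpTo-entry ms)

    positive⇒inside : ∀ {k} i → suc k ℕ.≤ row μ (suc i) → i ℕ.< ℓ μ
    positive⇒inside i k<row with i ℕ.<? ℓ μ
    ... | yes i<ℓ = i<ℓ
    ... | no i≮ℓ  = contradiction (≡.subst (_ ℕ.<_) (entry-beyond rows i (ℕ.≮⇒≥ i≮ℓ)) k<row) (λ ())

  row-antitone : ∀ {i j} → i ℕ.≤ j → row μ (suc j) ℕ.≤ row μ (suc i)
  row-antitone {i} {j} i≤j with ℕ.m≤n⇒∃[o]m+o≡n i≤j
  ... | k , ≡.refl = go k
    where
    go : ∀ k → row μ (suc (i ℕ.+ k)) ℕ.≤ row μ (suc i)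
    go zero    = ℕ.≤-reflexive (≡.cong (row μ ∘ suc) (ℕ.+-identityʳ i))
    go (suc k) = ℕ.≤-trans (ℕ.≤-reflexive (≡.cong (row μ ∘ suc) (ℕ.+-suc i k)))
        (ℕ.≤-trans (entry-suc decreasing (i ℕ.+ k)) (go k))

  private
    col-applyUpTo : ∀ j → col μ j ≡ length (filter (j ℕ.≤?_) (applyUpTo (entry rows) (ℓ μ)))
    col-applyUpTo j = ≡.cong (length ∘ filter (j ℕ.≤?_)) (≡.sym (applyUpTo-entry rows))

    d-applyUpTo : d μ ≡ length (filter (λ i → i ℕ.≤? row μ i) (applyUpTo suc (ℓ μ)))
    d-applyUpTo = ≡.cong (length ∘ filter (λ i → i ℕ.≤? row μ i)) (List.map-upTo suc (ℓ μ))

    col-anti : ∀ {j} i → j ℕ.≤ entry rows (suc i) → j ℕ.≤ entry rows i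
    col-anti i j≤ = ℕ.≤-trans j≤ (entry-suc decreasing i)

    d-anti : ∀ i → suc (suc i) ℕ.≤ row μ (suc (suc i)) → suc i ℕ.≤ row μ (suc i)
    d-anti i le = ℕ.≤-trans (ℕ.n≤1+n (suc i)) (ℕ.≤-trans le (entry-suc decreasing i))

  <col⇒≤row : ∀ {i j} → i ℕ.< col μ j → j ℕ.≤ row μ (suc i)
  <col⇒≤row {i} {j} i<col = proj₂ (filter-applyUpTo⁻ (j ℕ.≤?_) (ℓ μ) (entry rows) col-anti i
      (≡.subst (i ℕ.<_) (col-applyUpTo j) i<col))

  ≤row⇒<col : ∀ {i j} → suc j ℕ.≤ row μ (suc i) → i ℕ.< col μ (suc j)
  ≤row⇒<col {i} {j} j<row = ≡.subst (i ℕ.<_) (≡.sym (col-applyUpTo (suc j)))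
    (filter-applyUpTo⁺ (suc j ℕ.≤?_) (ℓ μ) (entry rows) col-anti i (positive⇒inside i j<row) j<row)

  <d⇒≤row : ∀ {i} → i ℕ.< d μ → suc i ℕ.≤ row μ (suc i)
  <d⇒≤row {i} i<d = proj₂ (filter-applyUpTo⁻ (λ i → i ℕ.≤? row μ i) (ℓ μ) suc d-anti i
      (≡.subst (i ℕ.<_) d-applyUpTo i<d))

  ≤row⇒<d : ∀ {i} → suc i ℕ.≤ row μ (suc i) → i ℕ.< d μ
  ≤row⇒<d {i} le = ≡.subst (i ℕ.<_) (≡.sym d-applyUpTo)
    (filter-applyUpTo⁺ (λ i → i ℕ.≤? row μ i) (ℓ μ) suc d-anti i (positive⇒inside i le) le)

  d≤ℓ : d μ ℕ.≤ ℓ μ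
  d≤ℓ = ≡.subst (ℕ._≤ ℓ μ) (≡.sym d-applyUpTo)
    (ℕ.≤-trans (List.length-filter (λ i → i ℕ.≤? row μ i) (applyUpTo suc (ℓ μ)))
        (ℕ.≤-reflexive (List.length-applyUpTo suc (ℓ μ))))

  col≤ℓ : ∀ j → col μ j ℕ.≤ ℓ μ
  col≤ℓ j = List.length-filter (j ℕ.≤?_) rows

  row≤d : ∀ i → d μ ℕ.≤ i → row μ (suc i) ℕ.≤ d μ
  row≤d i d≤i = ℕ.≤-trans (row-antitone d≤i) (ℕ.≮⇒≥ (λ d<row → ℕ.<-irrefl ≡.refl (≤row⇒<d d<row)))

  d≤row : ∀ i → i ℕ.< d μ → d μ ℕ.≤ row μ (suc i)
  d≤row i i<d with d μ in eq | i<d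
  ... | suc k | s≤s i≤k = ℕ.≤-trans (<d⇒≤row (≡.subst (k ℕ.<_) (≡.sym eq) ℕ.≤-refl)) (row-antitone i≤k)

  col-antitone : ∀ {i j} → i ℕ.≤ j → col μ (suc j) ℕ.≤ col μ (suc i)
  col-antitone {i} {j} i≤j = ℕ.≮⇒≥ (λ lt → ℕ.<-irrefl ≡.refl (≤row⇒<col (ℕ.≤-trans (s≤s i≤j) (<col⇒≤row lt))))

  col≤d : ∀ j → d μ ℕ.≤ j → col μ (suc j) ℕ.≤ d μ
  col≤d j d≤j = ℕ.≮⇒≥ (λ d<col → ℕ.<⇒≱ (ℕ.≤-trans (s≤s d≤j) (<col⇒≤row d<col)) (row≤d (d μ) ℕ.≤-refl))

  d≤col : ∀ j → j ℕ.< d μ → d μ ℕ.≤ col μ (suc j)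
  d≤col j j<d with d μ in eq | j<d
  ... | suc k | s≤s j≤k = ≤row⇒<col (ℕ.≤-trans (s≤s j≤k) (<d⇒≤row (≡.subst (k ℕ.<_) (≡.sym eq) ℕ.≤-refl)))

  -- The Frobenius coordinates: the legs are listed from the innermost hook outwards.
  arm leg : ℕ → ℕ
  arm i = row μ (suc i) ∸ suc i
  leg j = col μ (d μ ∸ j) ∸ (d μ ∸ j)

  arm-+ : ∀ {i} → i ℕ.< d μ → arm i ℕ.+ suc i ≡ row μ (suc i)
  arm-+ i<d = ℕ.m∸n+n≡m (<d⇒≤row i<d)

  private
    column-index : ∀ {j} → j ℕ.< d μ → suc (d μ ∸ suc j) ≡ d μ ∸ j
    column-index {j} j<d = ≡.sym (ℕ.+-∸-assoc 1 j<d)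

  leg-+ : ∀ {j} → j ℕ.< d μ → leg j ℕ.+ (d μ ∸ j) ≡ col μ (d μ ∸ j)
  leg-+ {j} j<d = ℕ.m∸n+n≡m (≡.subst (λ k → k ℕ.≤ col μ k) (column-index j<d)
    (ℕ.≤-trans (ℕ.≤-trans (ℕ.≤-reflexive (column-index j<d)) (ℕ.m∸n≤m (d μ) j))
      (d≤col (d μ ∸ suc j) (ℕ.≤-trans (ℕ.≤-reflexive (column-index j<d)) (ℕ.m∸n≤m (d μ) j)))))

  leg-increasing : ∀ i j → i ℕ.< j → j ℕ.< d μ → leg i ℕ.< leg j
  leg-increasing i j i<j j<d = ℕ.+-cancelʳ-≤ (d μ ∸ j) (suc (leg i)) (leg j) (ℕ.≤-trans
    (ℕ.≤-trans (ℕ.≤-reflexive (≡.sym (ℕ.+-suc (leg i) (d μ ∸ j))))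
        (ℕ.+-monoʳ-≤ (leg i) (ℕ.∸-monoʳ-< i<j (ℕ.<⇒≤ j<d))))
    (ℕ.≤-trans (ℕ.≤-reflexive (leg-+ (ℕ.<-trans i<j j<d)))
      (ℕ.≤-trans (≡.subst₂ (λ x y → col μ x ℕ.≤ col μ y) (column-index (ℕ.<-trans i<j j<d)) (column-index j<d)
          (col-antitone (ℕ.∸-monoʳ-≤ (d μ) (s≤s (ℕ.<⇒≤ i<j)))))
        (ℕ.≤-reflexive (≡.sym (leg-+ j<d))))))

  -- d + leg j is j plus the length of column d - j.
  leg-bound : ∀ {N} → ℓ μ ℕ.≤ N → ∀ j → j ℕ.< d μ → d μ ℕ.+ leg j ℕ.≤ j ℕ.+ N
  leg-bound {N} ℓ≤N j j<d = ℕ.≤-trans (ℕ.≤-reflexive (≡.trans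
      (≡.cong (ℕ._+ leg j) (≡.sym (ℕ.m+[n∸m]≡n (ℕ.<⇒≤ j<d))))
      (≡.trans (ℕ.+-assoc j (d μ ∸ j) (leg j)) (≡.cong (j ℕ.+_)
          (≡.trans (ℕ.+-comm (d μ ∸ j) (leg j)) (leg-+ j<d))))))
    (ℕ.+-monoʳ-≤ j (ℕ.≤-trans (col≤ℓ (d μ ∸ j)) ℓ≤N))

  private
    skip-+ : ∀ m x i → skip (m ℕ.+ x) (m ℕ.+ i) ≡ m ℕ.+ skip x i
    skip-+ zero    x i = ≡.refl
    skip-+ (suc m) x i = ≡.cong suc (skip-+ m x i)

    cut : ℕ → ℕ
    cut j = d μ ℕ.+ leg j

  skips-inside : ∀ q i → i ℕ.< d μ → skips cut q i ≡ i
  skips-inside zero    i i<d = ≡.refl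
  skips-inside (suc q) i i<d = ≡.trans (≡.cong (skip (cut q)) (skips-inside q i i<d))
    (skip-< (cut q) i (ℕ.<-≤-trans i<d (ℕ.m≤m+n (d μ) (leg q))))

  -- Below the diagonal, the rows of the Jacobi–Trudi matrix avoid the legs.
  skips-outside : ∀ i q → q ℕ.≤ d μ →
    skips cut q (d μ ℕ.+ i) ≡ d μ ℕ.+ (i ℕ.+ (q ℕ.⊓ (d μ ∸ row μ (suc (d μ ℕ.+ i)))))
  skips-outside i zero    _   = ≡.cong (d μ ℕ.+_) (≡.sym (ℕ.+-identityʳ i))
  skips-outside i (suc q) q<d = ≡.trans (≡.cong (skip (cut q)) (skips-outside i q (ℕ.<⇒≤ q<d)))
    (≡.trans (skip-+ (d μ) (leg q) _) (≡.cong (d μ ℕ.+_) step))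
    where
    ρ = row μ (suc (d μ ℕ.+ i))
    J = d μ ∸ suc q
    d∸ρ+ρ : d μ ∸ ρ ℕ.+ ρ ≡ d μ
    d∸ρ+ρ = ℕ.m∸n+n≡m (row≤d _ (ℕ.m≤m+n (d μ) i))
    leg-col : leg q ℕ.+ suc J ≡ col μ (suc J)
    leg-col = ≡.subst (λ k → leg q ℕ.+ k ≡ col μ k) (≡.sym (column-index q<d)) (leg-+ q<d)
    d≡ : q ℕ.+ suc J ≡ d μ
    d≡ = ≡.trans (≡.cong (q ℕ.+_) (column-index q<d)) (ℕ.m+[n∸m]≡n (ℕ.<⇒≤ q<d))
    index : d μ ℕ.+ i ≡ (i ℕ.+ q) ℕ.+ suc J
    index = ≡.trans (≡.cong (ℕ._+ i) (≡.sym d≡)) (shuffle q (suc J) i)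
      where
      shuffle : ∀ q J i → q ℕ.+ J ℕ.+ i ≡ (i ℕ.+ q) ℕ.+ J
      shuffle = solve-∀
    step : skip (leg q) (i ℕ.+ (q ℕ.⊓ (d μ ∸ ρ))) ≡ i ℕ.+ (suc q ℕ.⊓ (d μ ∸ ρ))
    -- The case q < d - ρ says that the box in row d + i + 1 and column d - q lies outside the
    -- diagram; then leg q is at most i + q and the index must jump over it. Otherwise the leg is
    -- larger.
    step with q ℕ.<? d μ ∸ ρ
    ... | yes q<d∸ρ = ≡.trans (≡.cong (λ k → skip (leg q) (i ℕ.+ k)) (ℕ.m≤n⇒m⊓n≡m (ℕ.<⇒≤ q<d∸ρ)))
        (≡.trans (skip-≥ (leg q) (i ℕ.+ q) small) (≡.trans (≡.sym (ℕ.+-suc i q))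
            (≡.cong (i ℕ.+_) (≡.sym (ℕ.m≤n⇒m⊓n≡m q<d∸ρ)))))
      where
      ρ<J : ρ ℕ.< suc J
      ρ<J = ℕ.+-cancelˡ-< q ρ (suc J) (ℕ.≤-trans (ℕ.+-monoˡ-≤ ρ q<d∸ρ) (ℕ.≤-reflexive (≡.trans d∸ρ+ρ (≡.sym d≡))))
      small : leg q ℕ.≤ i ℕ.+ q
      small = ℕ.+-cancelʳ-≤ (suc J) (leg q) (i ℕ.+ q) (ℕ.≤-trans (ℕ.≤-reflexive leg-col)
        (ℕ.≤-trans (ℕ.≮⇒≥ (λ lt → ℕ.<⇒≱ ρ<J (<col⇒≤row lt))) (ℕ.≤-reflexive index)))
    ... | no q≮d∸ρ = ≡.trans (≡.cong (λ k → skip (leg q) (i ℕ.+ k)) (ℕ.m≥n⇒m⊓n≡n (ℕ.≮⇒≥ q≮d∸ρ)))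
        (≡.trans (skip-< (leg q) _ (ℕ.≤-<-trans (ℕ.+-monoʳ-≤ i (ℕ.≮⇒≥ q≮d∸ρ)) large))
            (≡.cong (i ℕ.+_) (≡.sym (ℕ.m≥n⇒m⊓n≡n (ℕ.≤-trans (ℕ.≮⇒≥ q≮d∸ρ) (ℕ.n≤1+n q))))))
      where
      J<ρ : suc J ℕ.≤ ρ
      J<ρ = ℕ.+-cancelˡ-≤ q (suc J) ρ (ℕ.≤-trans (ℕ.≤-reflexive d≡)
          (ℕ.≤-trans (ℕ.≤-reflexive (≡.sym d∸ρ+ρ)) (ℕ.+-monoˡ-≤ ρ (ℕ.≮⇒≥ q≮d∸ρ))))
      large : i ℕ.+ q ℕ.< leg q
      large = ℕ.+-cancelʳ-< (suc J) (i ℕ.+ q) (leg q) (ℕ.≤-trans (s≤s (ℕ.≤-reflexive (≡.sym index)))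
        (ℕ.≤-trans (≤row⇒<col J<ρ) (ℕ.≤-reflexive (≡.sym leg-col))))

-- The order of reduction given by the diagram

module FrobeniusPath {r s} (R : CommutativeRing r s) (a b : ℕ → CommutativeRing.Carrier R) (μ : YoungDiagram) where
  open CommutativeRing R hiding (zero)
  open RingTactic R
  open FiniteSums R
  open PowerSeries R using (geo)
  open GramMatrix R a b using (φ; χ)
  open GramAlternant R a b using (summand)
  open Young μ
  open import Relation.Binary.Reasoning.Setoid setoid

  private
    D : ℕ
    D = d μ

  factor : (ℕ → Carrier → Carrier) → (ℕ → ℕ) → ℕ → ℕ → Carrier → Carrier
  factor ψ len n k x = if does (suc k ℕ.≤? D) then ψ (len (suc k) ∸ suc k) x * geo x (n ∸ len (suc k)) else geo
      x (n ∸ suc k)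

  x-factor y-factor : ℕ → ℕ → Carrier → Carrier
  x-factor = factor φ (row μ)
  y-factor = factor χ (col μ)

  box-factor : ℕ → ℕ → Carrier → Carrier → Carrier
  box-factor i j x y = if does (suc j ℕ.≤? row μ (suc i)) then x + y else 1#

  -- The part of g that belongs to rows from r + 1 and columns from c + 1 on, with n as the n of g
  -- and the variables renumbered from 0.
  explicit : ℕ → ℕ → ℕ → ℕ → ℕ → (ℕ → Carrier) → (ℕ → Carrier) → Carrier
  explicit r c nx ny n u v = ∏ nx (λ i → x-factor n (r ℕ.+ i) (u i)) * (∏ ny (λ j → y-factor n (c ℕ.+ j) (v j)) *
    ∏ nx (λ i → ∏ ny (λ j → box-factor (r ℕ.+ i) (c ℕ.+ j) (u i) (v j))))

  private
    if-true : ∀ {m n} {x y : Carrier} → m ℕ.≤ n → (if does (m ℕ.≤? n) then x else y) ≡ x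
    if-true {m} {n} m≤n = ≡.cong (λ t → if t then _ else _) (dec-true (m ℕ.≤? n) m≤n)

    if-false : ∀ {m n} {x y : Carrier} → n ℕ.< m → (if does (m ℕ.≤? n) then x else y) ≡ y
    if-false {m} {n} n<m = ≡.cong (λ t → if t then _ else _) (dec-false (m ℕ.≤? n) (ℕ.<⇒≱ n<m))

    ∏-shift : ∀ n k (f : ℕ → Carrier → Carrier) (u : ℕ → Carrier) →
      ∏ (suc n) (λ i → f (k ℕ.+ i) (u i)) ≈ f k (u 0) * ∏ n (λ i → f (suc k ℕ.+ i) (u (suc i)))
    ∏-shift n k f u = trans (∏-suc n _) (*-cong (reflexive (≡.cong (λ i → f i (u 0)) (ℕ.+-identityʳ k)))
      (∏-cong n (λ i → reflexive (≡.cong (λ i′ → f i′ (u (suc i))) (ℕ.+-suc k i)))))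

    factor-full : ∀ ψ len n k x → k ℕ.< D → n ℕ.≤ len (suc k) → factor ψ len n k x ≈ ψ (len (suc k) ∸ suc k) x
    factor-full ψ len n k x k<D n≤len = trans (reflexive (if-true k<D))
      (trans (*-congˡ (reflexive (≡.cong (geo x) (ℕ.m≤n⇒m∸n≡0 n≤len)))) (*-identityʳ _))

    -- A corner raises n by one, and every row not longer than the old n gains a power of its
    -- variable; this is how the exponents n - μᵢ and n - i of g build up.
    factor-suc : ∀ ψ len n k x → k ℕ.< n → len (suc k) ℕ.≤ n → factor ψ len (suc n) k x ≈ x * factor ψ len n k x
    factor-suc ψ len n k x k<n len≤n with k ℕ.<? D
    ... | yes k<D = trans (reflexive (if-true k<D)) (trans
        (*-congˡ (reflexive (≡.cong (geo x) (ℕ.+-∸-assoc 1 len≤n))))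
      (trans (solve 3 (λ p x g → p :* (x :* g) := x :* (p :* g)) refl _ _ _)
          (*-congˡ (reflexive (≡.sym (if-true k<D))))))
    ... | no k≮D = trans (reflexive (if-false (s≤s (ℕ.≮⇒≥ k≮D))))
        (trans (reflexive (≡.cong (geo x) (ℕ.+-∸-assoc 1 k<n)))
      (*-congˡ (reflexive (≡.sym (if-false (s≤s (ℕ.≮⇒≥ k≮D)))))))

    -- The new last variable has number n + 1 > d, hence exponent (n + 1) - (n + 1) = 0.
    factors-suc : ∀ ψ len k m n (u : ℕ → Carrier) → D ℕ.≤ n → k ℕ.+ m ≡ n → (∀ i → len (suc (k ℕ.+ i)) ℕ.≤ n) →
      ∏ m u * ∏ m (λ i → factor ψ len n (k ℕ.+ i) (u i)) ≈ ∏ (suc m) (λ i → factor ψ len (suc n) (k ℕ.+ i) (u i))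
    factors-suc ψ len k m n u D≤n k+m≡n len≤n = sym (trans (∏-last m _) (trans (*-cong
      (trans (∏-cong< m (λ i i<m → factor-suc ψ len n (k ℕ.+ i) (u i)
          (ℕ.<-≤-trans (ℕ.+-monoʳ-< k i<m) (ℕ.≤-reflexive k+m≡n)) (len≤n i))) (∏-* m u _))
      (reflexive (≡.trans (≡.cong (λ k → factor ψ len (suc n) k (u m)) k+m≡n)
          (≡.trans (if-false (s≤s D≤n)) (≡.cong (geo (u m)) (ℕ.n∸n≡0 (suc n)))))))
      (*-identityʳ _)))

    -- A row of length at least n carries no extra power of x, and all its boxes in the first n
    -- columns lie in μ, which accounts for the full product of the x + yⱼ.
    explicit-row : ∀ r c nx ny n u v → r ℕ.< D → n ℕ.≤ row μ (suc r) → c ℕ.+ ny ≡ n →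
      (φ (arm r) (u 0) * ∏ ny (λ j → u 0 + v j)) * explicit (suc r) c nx ny n (u ∘ suc) v ≈ explicit r c
          (suc nx) ny n u v
    explicit-row r c nx ny n u v r<D n≤row ≡.refl = begin
      (φ (arm r) (u 0) * ∏ ny (λ j → u 0 + v j)) * explicit (suc r) c nx ny n (u ∘ suc) v
        ≈⟨ solve 5 (λ p b x y z → (p :* b) :* (x :* (y :* z)) := (p :* x) :* (y :* (b :* z))) refl _ _ _ _ _ ⟩
      _ ≈⟨ *-cong
             (trans (*-congʳ (sym (factor-full φ (row μ) n r (u 0) r<D n≤row))) (sym (∏-shift nx r (x-factor n) u)))
             (*-congˡ (trans (*-congʳ (∏-cong< ny (λ j j<ny → reflexive
                 (≡.sym (if-true (ℕ.≤-trans (ℕ.+-monoʳ-< c j<ny) n≤row))))))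
               (sym (trans (∏-suc nx _) (*-cong
                 (∏-cong ny (λ j → reflexive (≡.cong (λ i → box-factor i (c ℕ.+ j) (u 0) (v j)) (ℕ.+-identityʳ r))))
                 (∏-cong nx (λ i → ∏-cong ny (λ j → reflexive
                     (≡.cong (λ i′ → box-factor i′ (c ℕ.+ j) (u (suc i)) (v j)) (ℕ.+-suc r i)))))))))) ⟩
      explicit r c (suc nx) ny n u v ∎

    explicit-column : ∀ r c nx ny n u v → c ℕ.< D → n ℕ.≤ col μ (suc c) → r ℕ.+ nx ≡ n →
      (χ (col μ (suc c) ∸ suc c) (v 0) * ∏ nx (λ i → u i + v 0)) * explicit r (suc c) nx ny n u (v ∘ suc) ≈
          explicit r c nx (suc ny) n u v
    explicit-column r c nx ny n u v c<D n≤col ≡.refl = begin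
      (χ (col μ (suc c) ∸ suc c) (v 0) * ∏ nx (λ i → u i + v 0)) * explicit r (suc c) nx ny n u (v ∘ suc)
        ≈⟨ solve 5 (λ p b x y z → (p :* b) :* (x :* (y :* z)) := x :* ((p :* y) :* (b :* z))) refl _ _ _ _ _ ⟩
      _ ≈⟨ *-congˡ (*-cong
             (trans (*-congʳ (sym (factor-full χ (col μ) n c (v 0) c<D n≤col))) (sym (∏-shift ny c (y-factor n) v)))
             (trans (*-congʳ (∏-cong< nx (λ i i<nx → reflexive
                 (≡.sym (if-true (<col⇒≤row (ℕ.≤-trans (ℕ.+-monoʳ-< r i<nx) n≤col)))))))
               (trans (sym (∏-* nx _ _)) (∏-cong nx (λ i → sym
                   (∏-shift ny c (λ j y → box-factor (r ℕ.+ i) j (u i) y) v)))))) ⟩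
      explicit r c nx (suc ny) n u v ∎

    -- The remaining rows and columns have length at most n, so the new row and column n + 1
    -- contribute no box.
    explicit-corner : ∀ r c nx ny n u v → D ℕ.≤ n → r ℕ.+ nx ≡ n → c ℕ.+ ny ≡ n → row μ (suc r) ℕ.≤ n → col μ
        (suc c) ℕ.≤ n →
      (∏ nx u * ∏ ny v) * explicit r c nx ny n u v ≈ explicit r c (suc nx) (suc ny) (suc n) u v
    explicit-corner r c nx ny n u v D≤n r+nx c+ny row≤n col≤n = begin
      (∏ nx u * ∏ ny v) * explicit r c nx ny n u v
        ≈⟨ solve 5 (λ p q x y z → (p :* q) :* (x :* (y :* z)) := (p :* x) :* ((q :* y) :* z)) refl _ _ _ _ _ ⟩
      _ ≈⟨ *-cong xs (*-cong ys boxes) ⟩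
      explicit r c (suc nx) (suc ny) (suc n) u v ∎
      where
      xs = factors-suc φ (row μ) r nx n u D≤n r+nx (λ i → ℕ.≤-trans (row-antitone (ℕ.m≤m+n r i)) row≤n)
      ys = factors-suc χ (col μ) c ny n v D≤n c+ny (λ j → ℕ.≤-trans (col-antitone (ℕ.m≤m+n c j)) col≤n)
      boxes : ∏ nx (λ i → ∏ ny (λ j → box-factor (r ℕ.+ i) (c ℕ.+ j) (u i) (v j))) ≈
        ∏ (suc nx) (λ i → ∏ (suc ny) (λ j → box-factor (r ℕ.+ i) (c ℕ.+ j) (u i) (v j)))
      boxes = sym (trans (∏-last nx _) (trans (*-cong
        (∏-cong nx (λ i → trans (∏-last ny _) (trans (*-congˡ (reflexive (if-false
          (ℕ.≤-trans (s≤s (ℕ.≤-trans (row-antitone (ℕ.m≤m+n r i)) row≤n))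
              (ℕ.≤-reflexive (≡.cong suc (≡.sym c+ny))))))) (*-identityʳ _))))
        (∏-1 (suc ny) (λ j _ → reflexive (if-false (ℕ.≰⇒> (λ le → ℕ.<⇒≱ (≤row⇒<col le)
          (ℕ.≤-trans (col-antitone (ℕ.m≤m+n c j)) (ℕ.≤-trans col≤n (ℕ.≤-reflexive (≡.sym r+nx))))))))))
        (*-identityʳ _)))

  Reduction : (p q e : ℕ) (α : ℕ → ℕ) (r c : ℕ) → Set _
  Reduction p q e α r c = Σ[ P ∈ Path p q e α leg ] (∀ u v → summand P u v ≈ explicit r c (p ℕ.+ e) (q ℕ.+ e)
      (D ℕ.+ e) u v)

  private
    offset : ∀ r p → r ℕ.+ suc p ≡ D → suc r ℕ.+ p ≡ D
    offset r p eq = ≡.trans (≡.sym (ℕ.+-suc r p)) eq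

    total : ∀ r p e → r ℕ.+ p ≡ D → r ℕ.+ (p ℕ.+ e) ≡ D ℕ.+ e
    total r p e r+p = ≡.trans (≡.sym (ℕ.+-assoc r p e)) (≡.cong (ℕ._+ e) r+p)

    offset-< : ∀ r p → r ℕ.+ suc p ≡ D → r ℕ.< D
    offset-< r p eq = ℕ.≤-trans (ℕ.m≤m+n (suc r) p) (ℕ.≤-reflexive (offset r p eq))

    -- Legs are numbered from the diagonal outwards, so the outermost remaining column c + 1 is that
    -- of leg q.
    offset-column : ∀ {c} q → c ℕ.+ suc q ≡ D → D ∸ q ≡ suc c
    offset-column {c} q eq = ≡.trans (≡.cong (_∸ q) (≡.sym (offset c q eq))) (ℕ.m+n∸n≡m (suc c) q)

    mutual
      -- The next row goes if it reaches n = D + e, else the next column if it does, else a corner.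
      -- In the last case the rows and columns still present are no longer than these two, which
      -- bounds all remaining arms and legs.
      reduce : ∀ p q e α r c → r ℕ.+ p ≡ D → c ℕ.+ q ≡ D → (∀ i → i ℕ.< p → α i ≡ arm (r ℕ.+ i)) → Reduction p q
          e α r c
      reduce zero    q e α r c r+p c+q α≡ = reduce-column zero q e α r c r+p c+q α≡ (inj₂ ≡.refl)
      reduce (suc p) q e α r c r+p c+q α≡ with D ℕ.+ e ℕ.≤? row μ (suc r)
      ... | no  row<n = reduce-column (suc p) q e α r c r+p c+q α≡ (inj₁ (ℕ.≰⇒> row<n))
      ... | yes n≤row with reduce p q e (α ∘ suc) (suc r) c (offset r p r+p) c+q
               (λ i i<p → ≡.trans (α≡ (suc i) (s≤s i<p)) (≡.cong arm (ℕ.+-suc r i)))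
      ...   | P , P≈ = remove-row P , λ u v → trans
                (*-cong (*-congʳ (reflexive (≡.cong (λ k → φ k (u 0))
                    (≡.trans (α≡ 0 (s≤s z≤n)) (≡.cong arm (ℕ.+-identityʳ r)))))) (P≈ (u ∘ suc) v))
                (explicit-row r c (p ℕ.+ e) (q ℕ.+ e) (D ℕ.+ e) u v (offset-< r p r+p) n≤row (total c q e c+q))

      reduce-column : ∀ p q e α r c → r ℕ.+ p ≡ D → c ℕ.+ q ≡ D → (∀ i → i ℕ.< p → α i ≡ arm (r ℕ.+ i)) →
        row μ (suc r) ℕ.< D ℕ.+ e ⊎ p ≡ 0 → Reduction p q e α r c
      reduce-column p zero    e α r c r+p c+q α≡ small = reduce-corner p zero e α r c r+p c+q α≡ small (inj₂ ≡.refl)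
      reduce-column p (suc q) e α r c r+p c+q α≡ small with D ℕ.+ e ℕ.≤? col μ (suc c)
      ... | no  col<n = reduce-corner p (suc q) e α r c r+p c+q α≡ small (inj₁ (ℕ.≰⇒> col<n))
      ... | yes n≤col with reduce p q e α r (suc c) r+p (offset c q c+q) α≡
      ...   | P , P≈ = remove-column P , λ u v → trans
                (*-cong (*-congʳ (reflexive (≡.cong (λ k → χ (col μ k ∸ k) (v 0)) (offset-column q c+q))))
                    (P≈ u (v ∘ suc)))
                (explicit-column r c (p ℕ.+ e) (q ℕ.+ e) (D ℕ.+ e) u v (offset-< c q c+q) n≤col (total r p e r+p))

      reduce-corner : ∀ p q e α r c → r ℕ.+ p ≡ D → c ℕ.+ q ≡ D → (∀ i → i ℕ.< p → α i ≡ arm (r ℕ.+ i)) →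
        row μ (suc r) ℕ.< D ℕ.+ e ⊎ p ≡ 0 → col μ (suc c) ℕ.< D ℕ.+ e ⊎ q ≡ 0 → Reduction p q e α r c
      reduce-corner zero    zero    zero α r c r+p c+q α≡ _ _ = done , λ u v → sym
          (trans (*-cong (∏-empty _) (*-cong (∏-empty _) (∏-empty _)))
        (trans (*-identityˡ _) (*-identityˡ _)))
      -- For e = 0 a remaining row lies within the first D and so has length at least D = n; it
      -- would have been removed before. The same holds for columns.
      reduce-corner (suc p) q       zero α r c r+p c+q α≡ (inj₁ row<D) _ = contradiction
          (d≤row r (offset-< r p r+p))
        (ℕ.<⇒≱ (≡.subst (row μ (suc r) ℕ.<_) (ℕ.+-identityʳ D) row<D))
      reduce-corner zero    (suc q) zero α r c r+p c+q α≡ _ (inj₁ col<D) = contradiction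
          (d≤col c (offset-< c q c+q))
        (ℕ.<⇒≱ (≡.subst (col μ (suc c) ℕ.<_) (ℕ.+-identityʳ D) col<D))
      reduce-corner p q (suc e) α r c r+p c+q α≡ row-small col-small with reduce p q e α r c r+p c+q α≡
      ... | P , P≈ = remove-corner α-small β-small P , λ u v → trans (*-congˡ (P≈ u v)) (trans
          (explicit-corner r c (p ℕ.+ e) (q ℕ.+ e) (D ℕ.+ e) u v (ℕ.m≤m+n D e) (total r p e r+p)
              (total c q e c+q) row≤n col≤n)
          (reflexive (≡.trans (≡.cong₂ (λ k l → explicit r c k l (suc (D ℕ.+ e)) u v) (≡.sym (ℕ.+-suc p e))
              (≡.sym (ℕ.+-suc q e)))
            (≡.cong (λ k → explicit r c (p ℕ.+ suc e) (q ℕ.+ suc e) k u v) (≡.sym (ℕ.+-suc D e))))))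
        where
        at-end : ∀ {k m} → k ℕ.+ m ≡ D → m ≡ 0 → D ℕ.≤ k
        at-end {k} k+m ≡.refl = ℕ.≤-reflexive (≡.trans (≡.sym k+m) (ℕ.+-identityʳ k))
        row-bound : row μ (suc r) ℕ.< D ℕ.+ suc e ⊎ p ≡ 0 → row μ (suc r) ℕ.≤ D ℕ.+ e
        row-bound (inj₁ row<n) = ℕ.≤-pred (≡.subst (row μ (suc r) ℕ.<_) (ℕ.+-suc D e) row<n)
        row-bound (inj₂ p≡0)   = ℕ.≤-trans (row≤d r (at-end r+p p≡0)) (ℕ.m≤m+n D e)
        col-bound : col μ (suc c) ℕ.< D ℕ.+ suc e ⊎ q ≡ 0 → col μ (suc c) ℕ.≤ D ℕ.+ e
        col-bound (inj₁ col<n) = ℕ.≤-pred (≡.subst (col μ (suc c) ℕ.<_) (ℕ.+-suc D e) col<n)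
        col-bound (inj₂ q≡0)   = ℕ.≤-trans (col≤d c (at-end c+q q≡0)) (ℕ.m≤m+n D e)
        row≤n : row μ (suc r) ℕ.≤ D ℕ.+ e
        row≤n = row-bound row-small
        col≤n : col μ (suc c) ℕ.≤ D ℕ.+ e
        col≤n = col-bound col-small
        inside : ∀ i → i ℕ.< p → r ℕ.+ i ℕ.< D
        inside i i<p = ℕ.<-≤-trans (ℕ.+-monoʳ-< r i<p) (ℕ.≤-reflexive r+p)
        α-small : ∀ i → i ℕ.< p → α i ℕ.< p ℕ.+ e
        α-small i i<p = ℕ.+-cancelʳ-< r (α i) (p ℕ.+ e) (ℕ.≤-<-trans (ℕ.+-monoʳ-≤ (α i) (ℕ.m≤m+n r i))
          (ℕ.≤-trans (ℕ.≤-reflexive (≡.trans (≡.sym (ℕ.+-suc (α i) (r ℕ.+ i)))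
              (≡.trans (≡.cong (ℕ._+ suc (r ℕ.+ i)) (α≡ i i<p)) (arm-+ (inside i i<p)))))
            (ℕ.≤-trans (row-antitone (ℕ.m≤m+n r i)) (ℕ.≤-trans row≤n
                (ℕ.≤-reflexive (≡.trans (≡.sym (total r p e r+p)) (ℕ.+-comm r (p ℕ.+ e))))))))
        β-small : ∀ j → j ℕ.< q → leg j ℕ.< q ℕ.+ e
        β-small j j<q = ℕ.+-cancelʳ-< c (leg j) (q ℕ.+ e) (ℕ.<-≤-trans (ℕ.+-monoʳ-< (leg j) c<D∸j)
          (ℕ.≤-trans (ℕ.≤-reflexive (leg-+ j<D)) (ℕ.≤-trans
              (≡.subst (λ k → col μ k ℕ.≤ col μ (suc c)) (ℕ.m+[n∸m]≡n {1} {D ∸ j} (ℕ.≤-trans (s≤s z≤n) c<D∸j))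
              (col-antitone (ℕ.∸-monoˡ-≤ 1 c<D∸j)))
            (ℕ.≤-trans col≤n (ℕ.≤-reflexive (≡.trans (≡.sym (total c q e c+q)) (ℕ.+-comm c (q ℕ.+ e))))))))
          where
          j<D : j ℕ.< D
          j<D = ℕ.<-≤-trans j<q (ℕ.≤-trans (ℕ.m≤n+m q c) (ℕ.≤-reflexive c+q))
          c<D∸j : c ℕ.< D ∸ j
          c<D∸j = ℕ.≤-trans (ℕ.≤-reflexive (≡.sym (ℕ.m+n∸n≡m (suc c) j))) (ℕ.∸-monoˡ-≤ j
            (ℕ.≤-trans (ℕ.+-monoʳ-< c j<q) (ℕ.≤-reflexive c+q)))

  reduction : ∀ e → Reduction D D e arm 0 0
  reduction e = reduce D D e arm 0 0 ≡.refl ≡.refl (λ _ _ → ≡.refl)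

-- Comparison of both sides with the double alternant

module SergeevPragacz {c r} (K : CommutativeRing c r) (1/1+_ : ℕ → CommutativeRing.Carrier K)
  (1/1+-inverse : ∀ k → CommutativeRing._≈_ K
    (SemiringMult._×_ (CommutativeRing.semiring K) (suc k) (1/1+ k)) (CommutativeRing.1# K)) where
  private module K = CommutativeRing K
  open Evaluation K 1/1+_ 1/1+-inverse

  module _ (a : ℤ → K.Carrier) (μ : YoungDiagram) (e : ℕ) where
    private
      D n : ℕ
      D = d μ
      n = D ℕ.+ e

      P : CommutativeRing _ _
      P = R {Fin n ⊎ Fin n}

    open CommutativeRing P hiding (zero)
    open RingTactic P
    open FiniteSums P
    open Determinants P
    open PowerSeries P
    open Vandermonde P
    open Alternants P
    open FiniteIndices P
    open Finite n
    open Shifted a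
    open GramMatrix P a⁺ b using (column; Gram; φ; χ)
    open GramAlternant P a⁺ b
    open GramJacobiTrudi P a⁺ b
    open FrobeniusPath P a⁺ b μ
    open Young μ
    open RingProperties ring using (-‿involutive)
    open import Relation.Binary.Reasoning.Setoid setoid

    private
      -- The first D rows have degrees `arm i`. Row D + l, of length ρ, has degree -(l + (D - ρ) +
      -- 1), and l + (D - ρ) is entry l, counted from 0, in the list of numbers that are not legs.
      jt-entry-column : ∀ i j → jt-entry (row μ (suc i)) i j ≈
        column D arm (lins j b ⊛ F) (suc D ℕ.+ j) (skips (λ j → D ℕ.+ leg j) D i)
      jt-entry-column i j with position D i
      ... | inj₁ i<D = begin
        jt-entry (row μ (suc i)) i j
          ≡⟨ ≡.cong (λ m → jt-entry m i j) (arm-+ i<D) ⟨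
        jt-entry (arm i ℕ.+ suc i) i j
          ≈⟨ entry-positive (arm i) i j ⟩
        (lins (arm i) a⁺ ⊛ (lins j b ⊛ F)) (arm i ℕ.+ suc j)
          ≈⟨ positive-row D arm F j i i<D ⟨
        column D arm (lins j b ⊛ F) (suc D ℕ.+ j) i
          ≡⟨ ≡.cong (column D arm (lins j b ⊛ F) (suc D ℕ.+ j)) (skips-inside D i i<D) ⟨
        column D arm (lins j b ⊛ F) (suc D ℕ.+ j) (skips (λ j → D ℕ.+ leg j) D i) ∎
      ... | inj₂ (l , ≡.refl) = begin
        jt-entry ρ (D ℕ.+ l) j
          ≡⟨ ≡.cong (λ i → jt-entry ρ i j) index ⟩
        jt-entry ρ (l ℕ.+ (D ∸ ρ) ℕ.+ ρ) j
          ≈⟨ entry-negative ρ (l ℕ.+ (D ∸ ρ)) j ⟩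
        at (H (l ℕ.+ (D ∸ ρ)) ⊛ (lins j b ⊛ F)) j (l ℕ.+ (D ∸ ρ))
          ≈⟨ negative-row D arm F j (l ℕ.+ (D ∸ ρ)) ⟨
        column D arm (lins j b ⊛ F) (suc D ℕ.+ j) (D ℕ.+ (l ℕ.+ (D ∸ ρ)))
          ≡⟨ ≡.cong (column D arm (lins j b ⊛ F) (suc D ℕ.+ j)) (≡.trans (skips-outside l D ℕ.≤-refl)
               (≡.cong (λ k → D ℕ.+ (l ℕ.+ k)) (ℕ.m≥n⇒m⊓n≡n (ℕ.m∸n≤m D ρ)))) ⟨
        column D arm (lins j b ⊛ F) (suc D ℕ.+ j) (skips (λ j → D ℕ.+ leg j) D (D ℕ.+ l)) ∎
        where
        open GramMatrix P a⁺ b using (H)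
        ρ = row μ (suc (D ℕ.+ l))
        index : D ℕ.+ l ≡ l ℕ.+ (D ∸ ρ) ℕ.+ ρ
        index = ≡.trans (ℕ.+-comm D l) (≡.trans (≡.cong (l ℕ.+_) (≡.sym (ℕ.m∸n+n≡m (row≤d _ (ℕ.m≤m+n D l)))))
            (≡.sym (ℕ.+-assoc l (D ∸ ρ) ρ)))

      path : Path D D e arm leg
      path = proj₁ (reduction e)

      E : (ℕ → Carrier) → (ℕ → Carrier) → Carrier
      E = explicit 0 0 n n n

      path-E : ∀ u v → summand path u v ≈ E u v
      path-E = proj₂ (reduction e)

      E-cong : ∀ {u u′ v v′} → (∀ i → i ℕ.< n → u i ≈ u′ i) → (∀ j → j ℕ.< n → v j ≈ v′ j) → E u v ≈ E u′ v′
      E-cong u≈ v≈ = trans (sym (path-E _ _)) (trans (summand-cong path u≈ v≈) (path-E _ _))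

      left : ∀ N → ℓ μ ℕ.≤ N → ev (SF.s N μ a) * (O.V (SF.x {n}) * O.V (SF.y {n})) ≈ Alt n
          (λ u → Alt n (λ v → E u v) Y) X
      left N ℓ≤N = begin
        ev (SF.s N μ a) * (O.V (SF.x {n}) * O.V (SF.y {n}))
          ≈⟨ *-cong (reflexive (ev-det N (λ i j →
               SF.h⟨ + row μ (suc (toℕ i)) ℤ.- + suc (toℕ i) ℤ.+ + suc (toℕ j) , SF.τ (+ 1 ℤ.- + suc (toℕ j)) a
                   ⟩))) (*-cong (V-toℕ n X (λ i → reflexive (≡.sym (extend-toℕ (SF.x {n}) i))))
               (V-toℕ n Y (λ i → reflexive (≡.sym (extend-toℕ (SF.y {n}) i))))) ⟩
        O.det {N} (λ i j → jt-entry (row μ (suc (toℕ i))) (toℕ i) (toℕ j)) * (V n X * V n Y)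
          ≈⟨ *-congʳ (trans (det-toℕ N B (λ i j → jt-entry-column (toℕ i) (toℕ j))) (Det-transpose N B)) ⟩
        Det N (λ j i → B i j) * (V n X * V n Y)
          ≈⟨ *-congʳ (Gram-Jacobi-Trudi D N arm leg F leg-increasing (leg-bound ℓ≤N)) ⟨
        (Sg D D leg * G) * (V n X * V n Y)
          ≈⟨ solve 4 (λ s g x y → (s :* g) :* (x :* y) := s :* (x :* (y :* g))) refl _ _ _ _ ⟩
        Sg D D leg * (V n X * (V n Y * G))
          ≈⟨ *-congˡ (V-V-Gram path (D ℕ.+ N) (ℕ.+-monoʳ-≤ D (ℕ.≤-trans d≤ℓ ℓ≤N)) bound X Y) ⟩
        Sg D D leg * (Sg D D leg * Alt n (λ u → Alt n (λ v → summand path u v) Y) X)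
          -- Stripping the legs and removing the columns produce the same sign, which squares to 1.
          ≈⟨ trans (sym (*-assoc _ _ _)) (trans (*-congʳ (Sg-square D D leg)) (*-identityˡ _)) ⟩
        Alt n (λ u → Alt n (λ v → summand path u v) Y) X
          ≈⟨ Alt-cong n (λ u → Alt-cong n (λ v → path-E u v) Y) X ⟩
        Alt n (λ u → Alt n (λ v → E u v) Y) X ∎
        where
        B : ℕ → ℕ → Carrier
        B i j = column D arm (lins j b ⊛ F) (suc D ℕ.+ j) (skips (λ j → D ℕ.+ leg j) D i)
        G = Gram (D ℕ.+ N) D D arm leg F
        bound : ∀ j → j ℕ.< D → leg j ℕ.+ D ℕ.< D ℕ.+ N
        bound j j<D = ℕ.≤-<-trans (ℕ.≤-reflexive (ℕ.+-comm (leg j) D))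
            (ℕ.≤-<-trans (leg-bound ℓ≤N j j<D) (ℕ.+-monoˡ-< N j<D))

      module _ (σ : Fin n ⊎ Fin n → Carrier) (u v : ℕ → Carrier)
        (σ-x : ∀ i → σ (inj₁ i) ≈ u (toℕ i)) (σ-y : ∀ i → σ (inj₂ i) ≈ v (toℕ i)) where
        open Homomorphism σ

        if-* : ∀ t {f f′ g g′ F F′ G G′} → f ≈ F → f′ ≈ F′ → g ≈ G → g′ ≈ G′ →
          (if t then f * f′ else g * g′) ≈ (if t then F else G) * (if t then F′ else G′)
        if-* true  f f′ g g′ = *-cong f f′
        if-* false f f′ g g′ = *-cong g g′

        if-cong : ∀ t {f g F G} → f ≈ F → g ≈ G → (if t then f else g) ≈ (if t then F else G)
        if-cong true  f g = f
        if-cong false f g = g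

        power : ∀ {f x} → ⟪ f ⟫ ≈ x → ∀ k → ⟪ f SF.^ k ⟫ ≈ geo x k
        power f≈x k = trans (reflexive (hom-^ _ k)) (^-geo f≈x k)

        x-powers : ∀ k m → ⟪ SF.x k SF.∣ a ^∣ m ⟫ ≈ φ m (u (toℕ k))
        x-powers k m = trans (reflexive (hom-product m _))
            (product-toℕ m (λ t → u (toℕ k) - a⁺ t) (λ t → +-congʳ (σ-x k)))

        y-powers : ∀ k m → ⟪ SF.y k SF.∣ SF.dual a ^∣ m ⟫ ≈ χ m (v (toℕ k))
        y-powers k m = trans (reflexive (hom-product m _))
            (product-toℕ m (λ t → v (toℕ k) + b t) (λ t → +-cong (σ-y k)
          (trans (-‿cong (con-neg _)) (trans (-‿involutive _)
              (reflexive (≡.cong (SF.con ∘ a) (index (+ toℕ t))))))))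
          where
          index : ∀ t → + 1 ℤ.- (+ 1 ℤ.+ t) ≡ ℤ.- t
          index = ℤSolver.solve-∀

        -- Proved for an arbitrary substitution of the variables, so that one computation covers all
        -- w.
        g-E : ⟪ SF.g n μ a ⟫ ≈ E u v
        g-E = begin
          ⟪ SF.g n μ a ⟫
            ≈⟨ *-cong
                 (trans (reflexive (hom-product n _)) (product-toℕ n
                     (λ i → x-factor n i (u i) * y-factor n i (v i)) (λ k → trans
                   (reflexive (hom-if (does (suc (toℕ k) ℕ.≤? D))))
                   (if-* (does (suc (toℕ k) ℕ.≤? D))
                     (*-cong (x-powers k (arm (toℕ k))) (power {SF.x k} (σ-x k) (n ∸ row μ (suc (toℕ k)))))
                     (*-cong (y-powers k (col μ (suc (toℕ k)) ∸ suc (toℕ k)))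
                         (power {SF.y k} (σ-y k) (n ∸ col μ (suc (toℕ k)))))
                     (power {SF.x k} (σ-x k) (n ∸ suc (toℕ k))) (power {SF.y k} (σ-y k) (n ∸ suc (toℕ k)))))))
                 (trans (reflexive (hom-product n _)) (product-toℕ n
                     (λ i → ∏ n (λ j → box-factor i j (u i) (v j))) (λ k →
                   trans (reflexive (hom-product n _)) (product-toℕ n
                       (λ j → box-factor (toℕ k) j (u (toℕ k)) (v j)) (λ l → trans
                     (reflexive (hom-if (does (suc (toℕ l) ℕ.≤? row μ (suc (toℕ k))))))
                     (if-cong (does (suc (toℕ l) ℕ.≤? row μ (suc (toℕ k)))) (+-cong (σ-x k) (σ-y l)) refl)))))) ⟩
          ∏ n (λ i → x-factor n i (u i) * y-factor n i (v i)) * ∏ n (λ i → ∏ n (λ j → box-factor i j (u i) (v j)))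
            ≈⟨ trans (*-congʳ (∏-* n _ _)) (*-assoc _ _ _) ⟩
          E u v ∎

      right : O.∑-list (cartesianProduct (𝔖 n) (𝔖 n)) (λ w → SF.ε w * (w SF.∙ SF.g n μ a)) ≈ Alt n
          (λ u → Alt n (λ v → E u v) Y) X
      right = begin
        O.∑-list (cartesianProduct (𝔖 n) (𝔖 n)) (λ w → SF.ε w * (w SF.∙ SF.g n μ a))
          ≈⟨ ∑-list-product _,_ (𝔖 n) (𝔖 n) _ ⟩
        O.∑-list (𝔖 n) (λ w₁ → O.∑-list (𝔖 n) (λ w₂ → (O.sgn w₁ * O.sgn w₂) * ((w₁ , w₂) SF.∙ SF.g n μ a)))
          ≈⟨ ∑-list-cong (𝔖 n) (λ w₁ → trans (∑-list-cong (𝔖 n) (λ w₂ → *-assoc _ _ _))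
               (sym (*-∑-list (O.sgn w₁) (𝔖 n) _))) ⟩
        O.∑-list (𝔖 n) (λ w₁ → O.sgn w₁ * O.∑-list (𝔖 n) (λ w₂ → O.sgn w₂ * ((w₁ , w₂) SF.∙ SF.g n μ a)))
          ≈⟨ Alt-toℕ n (λ u → Alt n (λ v → E u v) Y) X _ (λ u u′ u≈ → Alt-cong n (λ v → E-cong u≈ (λ _ _ → refl)) Y)
               (λ w₁ u u≈ → Alt-toℕ n (λ v → E u v) Y _ (λ v v′ v≈ → E-cong (λ _ _ → refl) v≈)
                 (λ w₂ v v≈ → g-E (SF.var ∘ Sum.map (w₁ ⟨$⟩ʳ_) (w₂ ⟨$⟩ʳ_)) u v
                   (λ i → trans (reflexive (≡.sym (extend-toℕ (SF.x {n}) (w₁ ⟨$⟩ʳ i)))) (sym (u≈ i)))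
                   (λ i → trans (reflexive (≡.sym (extend-toℕ (SF.y {n}) (w₂ ⟨$⟩ʳ i)))) (sym (v≈ i))))) ⟩
        Alt n (λ u → Alt n (λ v → E u v) Y) X ∎

    theorem-+ : ∀ N → ℓ μ ℕ.≤ N → ev (SF.s N μ a) * (O.V (SF.x {n}) * O.V (SF.y {n})) ≈
      O.∑-list (cartesianProduct (𝔖 n) (𝔖 n)) (λ w → SF.ε w * (w SF.∙ SF.g n μ a))
    theorem-+ N ℓ≤N = trans (left N ℓ≤N) (sym right)

  theorem : (a : ℤ → K.Carrier) (n : ℕ) (μ : YoungDiagram) → d μ ℕ.≤ n → (N : ℕ) → ℓ μ ℕ.≤ N →
    SF._≈_ (SF.evaluate n (SF.s N μ a) SF.* (SF.V (SF.x {n}) SF.* SF.V (SF.y {n})))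
      (SF.∑-list (cartesianProduct (𝔖 n) (𝔖 n)) (λ w → SF.ε w SF.* (w SF.∙ SF.g n μ a)))
  theorem a n μ d≤n N ℓ≤N with ℕ.m≤n⇒∃[o]m+o≡n d≤n
  ... | e , ≡.refl = theorem-+ a μ e N ℓ≤N

open SymmetricFunctions ℂ-commutativeRing 1/1+_ 1/1+-inverse

theorem15 : (a : ℤ → ℂ) (n : ℕ) → 1 ≤ n →
    (μ : YoungDiagram) → d μ ≤ n →
    (N : ℕ) → ℓ μ ≤ N →
    evaluate n (s N μ a) * (V (x {n}) * V (y {n}))
    ≈ ∑-list (cartesianProduct (𝔖 n) (𝔖 n)) (λ w → ε w * (w ∙ g n μ a))
theorem15 a n _ = SergeevPragacz.theorem ℂ-commutativeRing 1/1+_ 1/1+-inverse a n
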